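{- Let $p$ be a prime, let $\alpha,\beta,\gamma\in\overline{\mathbb F}_p$ be the roots (with multiplicity) of $T(X)=X^3-X-1\in\mathbb F_p[X]$, let $R_p=\mathbb F_p(\alpha,\beta,\gamma)$ and $r_p=[R_p:\mathbb F_p]\in\{1,2,3\}$. Let $a,b,c$ be the multiplicative orders of $\alpha,\beta,\gamma$ in $R_p^\times$, and let $t_p,\Omega_p,\omega_p,A_p$ be the period, divisibility set, first-occurrence index and truncated divisibility set of the Padovan sequence modulo $p$ (defined in the context). Then: 1) For all $p$: $t_p-3,\ t_p-2,\ t_p\in A_p$; hence $\omega_p\le t_p-3$. 2) $\Omega_p=A_p+\mathbb N t_p=\{x+kt_p : x\in A_p,\ k\in\mathbb N\}$, where $\mathbb N=\{0,1,2,\dots\}$. 3) If $p\ne 23$, then $t_p=\operatorname{lcm}(a,b,c)$, and $t_p$ divides $p^{r_p}-1$. 4) If $p=23$, then $t_{23}=506=p(p-1)$ and $r_p=1$. 5) Moreover: (i) $r_p=1$ if and only if there exist integers $x,y$ with $p=x^2+23y^2$. (ii) If $r_p=2$, then $T$ has a root in $\mathbb F_p$ and, naming the roots so that $\alpha\in\mathbb F_p$, one has: $t_p=b=c$; $b$ divides $(p+1)a$; and $\omega_p\le (p+1)\,o(\alpha^3)-3$, where $o(\alpha^3)$ is the multiplicative order of $\alpha^3$. (iii) If $r_p=3$, then $t_p=a=b=c$, and this number divides $\frac{p^3-1}{p-1}=p^2+p+1$.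
   Context: The Padovan sequence $(T_n)_{n\ge 0}$ is the integer sequence defined by $T_0=0$, $T_1=1$, $T_2=1$ and $T_{n+3}=T_{n+1}+T_n$ for all $n\ge 0$. For a prime $p$: - $t_p=\min\{n\ge 1 : T_n\equiv 0,\ T_{n+1}\equiv 1,\ T_{n+2}\equiv 1 \pmod p\}$ is the period of $(T_n)_{n\ge0}$ modulo $p$; - $\Omega_p=\{n\ge 1 : p \mid T_n\}$; - $\omega_p=\min\Omega_p$; - $A_p=\Omega_p\cap\{1,2,\dots,t_p\}$. $R_p$ is the splitting field over $\mathbb F_p$ of $X^3-X-1$. -}

module Defs where

open import Algebra.Apartness using (HeytingField; HeytingCommutativeRing)
open import Algebra.Bundles using (CommutativeRing; Semiring)
import Algebra.Definitions.RawSemiring as RawSemiringDefs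
open import Algebra.Morphism.Structures using (module RingMorphisms)
open import Data.Fin.Base using (Fin)
open import Data.Integer.Base as ℤ using (ℤ; +_; 0ℤ; 1ℤ)
import Data.Integer.Divisibility.Signed as ℤ∣
import Data.Integer.Properties as ℤ
open import Data.Integer.Tactic.RingSolver using (solve-∀)
open import Data.List.Base using (List; []; _∷_; map; foldr)
open import Data.Nat.Base as ℕ using (ℕ; zero; suc)
open import Data.Product.Base using (_×_; _,_; ∃-syntax)
open import Data.Sum.Base using (_⊎_)
open import Level using (Level; _⊔_; 0ℓ) renaming (suc to lsuc)
open import Relation.Binary.Definitions using (Decidable)
open import Relation.Binary.PropositionalEquality.Core
  using (_≡_; refl; sym; subst)
open import Relation.Unary using (Pred; _∈_)

private
  variable
    c ℓ ℓ₁ ℓ₂ : Level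

IsLeast : Pred ℕ ℓ → Pred ℕ ℓ
IsLeast P m = m ∈ P × (∀ n → n ∈ P → m ℕ.≤ n)

infix 4 _≋_[mod_]

-- A record, so that x and y can be inferred from a proof.
record _≋_[mod_] (x y : ℤ) (n : ℕ) : Set where
  constructor congruent
  field
    divides-difference : + n ℤ∣.∣ x ℤ.- y

private
  module Congruence (n : ℕ) where

    along : ∀ {x y z} → x ≡ y ℤ.- z → + n ℤ∣.∣ x → y ≋ z [mod n ]
    along eq d = congruent (subst (+ n ℤ∣.∣_) eq d)

    ≈-reflexive : ∀ {x y} → x ≡ y → x ≋ y [mod n ]
    ≈-reflexive {x} refl =
      along (sym (ℤ.+-inverseʳ x)) (ℤ∣.divides 0ℤ refl)

    ≈-sym : ∀ {x y} → x ≋ y [mod n ] → y ≋ x [mod n ]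
    ≈-sym {x} {y} (congruent d) = along (lemma x y) (ℤ∣.∣m⇒∣-m d)
      where
      lemma : ∀ x y → ℤ.- (x ℤ.- y) ≡ y ℤ.- x
      lemma = solve-∀

    ≈-trans : ∀ {x y z} →
              x ≋ y [mod n ] → y ≋ z [mod n ] → x ≋ z [mod n ]
    ≈-trans {x} {y} {z} (congruent d) (congruent e) =
      along (lemma x y z) (ℤ∣.∣m∣n⇒∣m+n d e)
      where
      lemma : ∀ x y z → (x ℤ.- y) ℤ.+ (y ℤ.- z) ≡ x ℤ.- z
      lemma = solve-∀

    +-cong : ∀ {x y u v} → x ≋ y [mod n ] → u ≋ v [mod n ] →
             x ℤ.+ u ≋ y ℤ.+ v [mod n ]
    +-cong {x} {y} {u} {v} (congruent d) (congruent e) =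
      along (lemma x y u v) (ℤ∣.∣m∣n⇒∣m+n d e)
      where
      lemma : ∀ x y u v →
              (x ℤ.- y) ℤ.+ (u ℤ.- v) ≡ (x ℤ.+ u) ℤ.- (y ℤ.+ v)
      lemma = solve-∀

    *-cong : ∀ {x y u v} → x ≋ y [mod n ] → u ≋ v [mod n ] →
             x ℤ.* u ≋ y ℤ.* v [mod n ]
    *-cong {x} {y} {u} {v} (congruent d) (congruent e) =
      along (lemma x y u v)
        (ℤ∣.∣m∣n⇒∣m+n (ℤ∣.∣n⇒∣m*n u d) (ℤ∣.∣n⇒∣m*n y e))
      where
      lemma : ∀ x y u v →
              u ℤ.* (x ℤ.- y) ℤ.+ y ℤ.* (u ℤ.- v) ≡ x ℤ.* u ℤ.- y ℤ.* v
      lemma = solve-∀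

    -‿cong : ∀ {x y} → x ≋ y [mod n ] → ℤ.- x ≋ ℤ.- y [mod n ]
    -‿cong {x} {y} (congruent d) = along (lemma x y) (ℤ∣.∣m⇒∣-m d)
      where
      lemma : ∀ x y → ℤ.- (x ℤ.- y) ≡ (ℤ.- x) ℤ.- (ℤ.- y)
      lemma = solve-∀

-- The quotient is ℤ itself with congruence as its equality; for prime n
-- it is the field 𝔽ₙ.
ℤ/_ : ℕ → CommutativeRing 0ℓ 0ℓ
ℤ/ n = record
  { Carrier = ℤ
  ; _≈_     = _≋_[mod n ]
  ; _+_     = ℤ._+_
  ; _*_     = ℤ._*_
  ; -_      = ℤ.-_
  ; 0#      = 0ℤ
  ; 1#      = 1ℤ
  ; isCommutativeRing = record
    { isRing = record
      { +-isAbelianGroup = record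
        { isGroup = record
          { isMonoid = record
            { isSemigroup = record
              { isMagma = record
                { isEquivalence = record
                  { refl  = ≈-reflexive refl
                  ; sym   = ≈-sym
                  ; trans = ≈-trans
                  }
                ; ∙-cong = +-cong
                }
              ; assoc = λ x y z → ≈-reflexive (ℤ.+-assoc x y z)
              }
            ; identity = (λ x → ≈-reflexive (ℤ.+-identityˡ x))
                       , (λ x → ≈-reflexive (ℤ.+-identityʳ x))
            }
          ; inverse = (λ x → ≈-reflexive (ℤ.+-inverseˡ x))
                    , (λ x → ≈-reflexive (ℤ.+-inverseʳ x))
          ; ⁻¹-cong = -‿cong
          }
        ; comm = λ x y → ≈-reflexive (ℤ.+-comm x y)
        }
      ; *-cong     = *-cong
      ; *-assoc    = λ x y z → ≈-reflexive (ℤ.*-assoc x y z)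
      ; *-identity = (λ x → ≈-reflexive (ℤ.*-identityˡ x))
                   , (λ x → ≈-reflexive (ℤ.*-identityʳ x))
      ; distrib    = (λ x y z → ≈-reflexive (ℤ.*-distribˡ-+ x y z))
                   , (λ x y z → ≈-reflexive (ℤ.*-distribʳ-+ x y z))
      }
    ; *-comm = λ x y → ≈-reflexive (ℤ.*-comm x y)
    }
  }
  where open Congruence n

padovan : ℕ → ℤ
padovan 0 = 0ℤ
padovan 1 = 1ℤ
padovan 2 = 1ℤ
padovan (suc (suc (suc n))) = padovan (suc n) ℤ.+ padovan n

Period : ℕ → Pred ℕ 0ℓ
Period p n = 1 ℕ.≤ n
           × padovan n ≋ 0ℤ [mod p ]
           × padovan (1 ℕ.+ n) ≋ 1ℤ [mod p ]
           × padovan (2 ℕ.+ n) ≋ 1ℤ [mod p ]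

Ω : ℕ → Pred ℕ 0ℓ
Ω p n = 1 ℕ.≤ n × + p ℤ∣.∣ padovan n

-- Aₚ, with the period t = tₚ passed explicitly.
A : (p t : ℕ) → Pred ℕ 0ℓ
A p t n = n ∈ Ω p × n ℕ.≤ t

infixl 6 _+ℕ·_

_+ℕ·_ : Pred ℕ 0ℓ → ℕ → Pred ℕ 0ℓ
(S +ℕ· t) n = ∃[ x ] ∃[ k ] (x ∈ S × n ≡ x ℕ.+ k ℕ.* t)

-- Polynomials are lists of coefficients starting with the constant term;
-- trailing zeros are allowed and are invisible to _≈ₚ_.
module Polynomial (R : CommutativeRing c ℓ) where
  open CommutativeRing R

  Poly : Set c
  Poly = List Carrier

  coeff : Poly → ℕ → Carrier
  coeff []      _       = 0#
  coeff (a ∷ _) zero    = a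
  coeff (_ ∷ f) (suc i) = coeff f i

  infix  4 _≈ₚ_
  infixl 6 _+ₚ_
  infixl 7 _*ₚ_

  _≈ₚ_ : Poly → Poly → Set ℓ
  f ≈ₚ g = ∀ i → coeff f i ≈ coeff g i

  _+ₚ_ : Poly → Poly → Poly
  []      +ₚ g       = g
  (a ∷ f) +ₚ []      = a ∷ f
  (a ∷ f) +ₚ (b ∷ g) = a + b ∷ f +ₚ g

  _*ₚ_ : Poly → Poly → Poly
  []      *ₚ g = []
  (a ∷ f) *ₚ g = map (a *_) g +ₚ (0# ∷ f *ₚ g)

  eval : Poly → Carrier → Carrier
  eval f x = foldr (λ a v → a + x * v) 0# f

  X-_ : Carrier → Poly
  X- a = - a ∷ 1# ∷ []

  X³-X-1 : Poly
  X³-X-1 = - 1# ∷ - 1# ∷ 0# ∷ 1# ∷ []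

-- A Heyting field with decidable apartness is a field in the classical
-- sense: equality is decidable, apartness is its negation, and the
-- nonzero elements are invertible.
record Extension (p : ℕ) c ℓ₁ ℓ₂ : Set (lsuc (c ⊔ ℓ₁ ⊔ ℓ₂)) where
  field
    heytingField : HeytingField c ℓ₁ ℓ₂

  open HeytingField heytingField using (_#_; heytingCommutativeRing)

  commutativeRing : CommutativeRing c ℓ₁
  commutativeRing =
    HeytingCommutativeRing.commutativeRing heytingCommutativeRing

  open CommutativeRing commutativeRing public
  open RawSemiringDefs (Semiring.rawSemiring semiring) public using (_^_; sum)
  open RingMorphisms (CommutativeRing.rawRing (ℤ/ p)) rawRing
    using (IsRingHomomorphism)

  field
    _#?_ : Decidable _#_
    ι    : ℤ → Carrier
    ι-isRingHomomorphism : IsRingHomomorphism ι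

  In𝔽ₚ : Pred Carrier ℓ₁
  In𝔽ₚ x = ∃[ k ] ι k ≈ x

  HasOrder : Carrier → Pred ℕ ℓ₁
  HasOrder x = IsLeast (λ n → 1 ℕ.≤ n × x ^ n ≈ 1#)

  HasDegree : Pred ℕ (c ⊔ ℓ₁)
  HasDegree r = ∃[ e ] Spans e × Independent e
    where
    combination : (Fin r → ℤ) → (Fin r → Carrier) → Carrier
    combination k e = sum (λ i → ι (k i) * e i)

    Spans : (Fin r → Carrier) → Set (c ⊔ ℓ₁)
    Spans e = ∀ x → ∃[ k ] combination k e ≈ x

    Independent : (Fin r → Carrier) → Set ℓ₁
    Independent e = ∀ k → combination k e ≈ 0# → ∀ i → k i ≋ 0ℤ [mod p ]

module _ {p : ℕ} (E : Extension p c ℓ₁ ℓ₂) where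
  open Extension E

  data 𝔽ₚ⟮_⟯ {s} (S : Pred Carrier s) : Pred Carrier (c ⊔ ℓ₁ ⊔ s) where
    gen∈  : ∀ {x} → x ∈ S → 𝔽ₚ⟮ S ⟯ x
    base∈ : ∀ k → 𝔽ₚ⟮ S ⟯ (ι k)
    add∈  : ∀ {x y} → 𝔽ₚ⟮ S ⟯ x → 𝔽ₚ⟮ S ⟯ y → 𝔽ₚ⟮ S ⟯ (x + y)
    neg∈  : ∀ {x} → 𝔽ₚ⟮ S ⟯ x → 𝔽ₚ⟮ S ⟯ (- x)
    mul∈  : ∀ {x y} → 𝔽ₚ⟮ S ⟯ x → 𝔽ₚ⟮ S ⟯ y → 𝔽ₚ⟮ S ⟯ (x * y)
    inv∈  : ∀ {x y} → 𝔽ₚ⟮ S ⟯ x → x * y ≈ 1# → 𝔽ₚ⟮ S ⟯ y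
    resp∈ : ∀ {x y} → x ≈ y → 𝔽ₚ⟮ S ⟯ x → 𝔽ₚ⟮ S ⟯ y

-- The record includes a choice of ordering of the roots, which occur with
-- multiplicity since the factorisation is an identity of polynomials.
record SplittingField (p : ℕ) c ℓ₁ ℓ₂ : Set (lsuc (c ⊔ ℓ₁ ⊔ ℓ₂)) where
  field
    extension : Extension p c ℓ₁ ℓ₂

  open Extension extension public
  open Polynomial commutativeRing
  open Polynomial (ℤ/ p) using () renaming (X³-X-1 to T)

  field
    α β γ     : Carrier
    splits    : map ι T ≈ₚ (X- α) *ₚ (X- β) *ₚ (X- γ)
    generated : ∀ x → 𝔽ₚ⟮_⟯ extension (λ y → y ≈ α ⊎ y ≈ β ⊎ y ≈ γ) x

-- A root ρ of X³ − X − 1 satisfies ρⁿ⁺³ = (Tₙ₊₂ − Tₙ) + Tₙ₊₁ρ + Tₙρ².  As the discriminant is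
-- −23, for p ≠ 23 the roots are distinct, the period is the lcm of their orders, and Frobenius
-- permutes them trivially, by a transposition or by a 3-cycle according as r = 1, 2 or 3; this
-- gives all parts except the criterion p = x² + 23y².
--
-- For the latter let δ = (α − β)(β − γ)(γ − α), so δ² = −23, and L = α + ωβ + ω²γ.  When δ lies in
-- 𝔽ₚ, Frobenius fixes the roots exactly if the unit (L/L̄)³ = (25 − 3√−3 δ)/2 has trivial cubic
-- residue symbol modulo p.  If δ ≡ −X/Y (swap β and γ otherwise), the unit is u/Y for the
-- Eisenstein integer u = (25Y + 3X√−3)/2, and cubic reciprocity with rational modulus turns the
-- symbol (u/p) into a character value Χ(p) modulo N(u).  Writing X² + 23Y² = 4Mp gives
-- N(u) = 27Mp + Y², whence Χ(M)Χ(p) = Χ(Y)² = 1.  When p = x² + 23y² one can take M to be a cube;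
-- otherwise reduction of forms of discriminant −23 gives p = 2x² + xy + 3y², where M is 2 up to
-- cubes and Χ(2) ≠ 1.
--
-- The reciprocity law is read off the Gauss sum g = Σ χ(a)[a] in the group ring of ℤ/l over the
-- Eisenstein integers modulo q: g⁴ = lJg for the Jacobi sum J, while g^q = Σ χ(a)^q [qa].

module Submission where

open import Defs
open import Algebra.Apartness using (HeytingField)
open import Algebra.Bundles using (CommutativeRing)
open import Algebra.Morphism.Structures using (module RingMorphisms)
import Algebra.Properties.AbelianGroup as AbelianGroupProperties
import Algebra.Properties.CommutativeSemiring.Binomial as Binomial
import Algebra.Properties.CommutativeSemiring.Exp as Exp
import Algebra.Properties.Ring as RingProperties
import Algebra.Properties.Semiring.Mult as Mult
import Algebra.Properties.Semiring.Mult.TCOptimised as MultTCO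
import Algebra.Properties.Semiring.Sum as Sum
import Algebra.Solver.Ring as RingSolver
open import Algebra.Solver.Ring.AlmostCommutativeRing
  using (fromCommutativeRing; _-Raw-AlmostCommutative⟶_)
open import Data.Bool.Base using (Bool; true; not; _∧_)
open import Data.Empty using (⊥; ⊥-elim)
open import Data.Fin.Base as Fin using (Fin; zero; suc; toℕ)
open import Data.Fin.Permutation using (Permutation; permutation)
import Data.Fin.Properties as Fin
open import Data.Integer.Base as ℤ using (ℤ; +_; -[1+_]; 0ℤ; 1ℤ)
import Data.Integer.Divisibility.Signed as ℤ∣
import Data.Integer.DivMod as ℤ
import Data.Integer.Properties as ℤ
import Data.Integer.Tactic.RingSolver as ℤ-Solver
open import Data.List.Base as List using (List; []; _∷_)
open import Data.List.Membership.Propositional using () renaming (_∈_ to _∈ₗ_)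
import Data.List.Properties as List
open import Data.List.Relation.Unary.All using (All; _∷_)
open import Data.List.Relation.Unary.Any using (here; there)
open import Data.Maybe.Base using (Maybe; just; nothing)
open import Data.Nat.Base as ℕ using (ℕ; zero; suc; _!)
open import Data.Nat.Combinatorics
  using (nCn≡1; nCk≡n!/k![n-k]!; k![n∸k]!∣n!) renaming (_C_ to _choose_)
import Data.Nat.Divisibility as ℕ∣
import Data.Nat.DivMod as ℕ
import Data.Nat.Induction as ℕ
open import Data.Nat.LCM using (lcm; lcm-least; m∣lcm[m,n]; n∣lcm[m,n])
open import Data.Nat.ListAction using (product)
open import Data.Nat.ListAction.Properties using (∈⇒∣product)
open import Data.Nat.Primality
  using ( Prime; prime?; euclidsLemma; ¬prime[0]; ¬prime[1]; prime⇒nonZero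
        ; prime⇒nonTrivial; prime⇒irreducible)
open import Data.Nat.Primality.Factorisation using (PrimeFactorisation; factorise)
import Data.Nat.Properties as ℕ
open import Data.Nat.Properties using (_!*_!≢0)
import Data.Nat.Tactic.RingSolver as ℕ-Solver
open import Data.Product.Base using (_×_; _,_; proj₁; proj₂; ∃-syntax)
open import Data.Sum.Base using (_⊎_; inj₁; inj₂; [_,_]′; map)
open import Function.Base using (_∘_; id)
open import Function.Bundles using (_⇔_; mk⇔; Equivalence)
open import Level using (Level; _⊔_)
open import Relation.Binary.PropositionalEquality as ≡ using (_≡_; _≢_)
import Relation.Binary.Reasoning.Setoid as SetoidReasoning
open import Relation.Nullary using (¬_; Dec; yes; no; contradiction; ¬?)
open import Relation.Nullary.Decidable using (decidable-stable; from-yes; from-no)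
open import Relation.Unary using (Pred)

private
  variable
    c ℓ : Level

module IntegerCoefficients (R : CommutativeRing c ℓ) where
  open CommutativeRing R
  open RingProperties ring
  open AbelianGroupProperties +-abelianGroup
  open MultTCO semiring using (×-homo-+; ×1-homo-*; 1+×)
    renaming (_×_ to _·_) public
  open SetoidReasoning setoid

  fromℤ : ℤ → Carrier
  fromℤ (+ n)    = n · 1#
  fromℤ -[1+ n ] = - (suc n · 1#)

  private
    cancel-1 : ∀ x y → x - y ≈ (1# + x) - (1# + y)
    cancel-1 x y = begin
      x - y                       ≈⟨ +-congʳ (+-identityʳ x) ⟨
      (x + 0#) - y                ≈⟨ +-congʳ (+-congˡ (-‿inverseʳ 1#)) ⟨
      (x + (1# - 1#)) - y         ≈⟨ +-congʳ (+-assoc x 1# (- 1#)) ⟨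
      ((x + 1#) - 1#) - y         ≈⟨ +-congʳ (+-congʳ (+-comm x 1#)) ⟩
      ((1# + x) - 1#) - y         ≈⟨ +-assoc _ _ _ ⟩
      (1# + x) + (- 1# - y)       ≈⟨ +-congˡ (⁻¹-∙-comm 1# y) ⟩
      (1# + x) - (1# + y)         ∎

    ⊖-homo : ∀ m n → fromℤ (m ℤ.⊖ n) ≈ m · 1# - n · 1#
    ⊖-homo zero    zero    = sym (-‿inverseʳ 0#)
    ⊖-homo (suc m) zero    = begin
      suc m · 1#        ≈⟨ +-identityʳ _ ⟨
      suc m · 1# + 0#   ≈⟨ +-congˡ ε⁻¹≈ε ⟨
      suc m · 1# - 0#   ∎
    ⊖-homo zero    (suc n) = sym (+-identityˡ _)
    ⊖-homo (suc m) (suc n) = begin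
      fromℤ (suc m ℤ.⊖ suc n)   ≡⟨ ≡.cong fromℤ (ℤ.[1+m]⊖[1+n]≡m⊖n m n) ⟩
      fromℤ (m ℤ.⊖ n)           ≈⟨ ⊖-homo m n ⟩
      m · 1# - n · 1#           ≈⟨ cancel-1 _ _ ⟩
      (1# + m · 1#) - (1# + n · 1#)   ≈⟨ +-cong (1+× m 1#) (-‿cong (1+× n 1#)) ⟨
      suc m · 1# - suc n · 1#   ∎

  fromℤ-+ : ∀ i j → fromℤ (i ℤ.+ j) ≈ fromℤ i + fromℤ j
  fromℤ-+ (+ m)    (+ n)    = ×-homo-+ 1# m n
  fromℤ-+ (+ m)    -[1+ n ] = ⊖-homo m (suc n)
  fromℤ-+ -[1+ m ] (+ n)    = trans (⊖-homo n (suc m)) (+-comm _ _)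
  fromℤ-+ -[1+ m ] -[1+ n ] = begin
    - (suc (suc (m ℕ.+ n)) · 1#)       ≡⟨ ≡.cong (λ k → - (suc k · 1#)) (ℕ.+-suc m n) ⟨
    - ((suc m ℕ.+ suc n) · 1#)         ≈⟨ -‿cong (×-homo-+ 1# (suc m) (suc n)) ⟩
    - (suc m · 1# + suc n · 1#)        ≈⟨ ⁻¹-∙-comm _ _ ⟨
    - (suc m · 1#) - suc n · 1#        ∎

  fromℤ-neg : ∀ i → fromℤ (ℤ.- i) ≈ - fromℤ i
  fromℤ-neg (+ zero)  = sym ε⁻¹≈ε
  fromℤ-neg (+ suc n) = refl
  fromℤ-neg -[1+ n ]  = sym (⁻¹-involutive _)

  private
    fromℕ-* : ∀ m j → fromℤ (+ m ℤ.* j) ≈ m · 1# * fromℤ j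
    fromℕ-* m (+ n) = begin
      fromℤ (+ m ℤ.* + n)     ≡⟨ ≡.cong fromℤ (ℤ.pos-* m n) ⟨
      (m ℕ.* n) · 1#          ≈⟨ ×1-homo-* m n ⟩
      m · 1# * n · 1#         ∎
    fromℕ-* m -[1+ n ] = begin
      fromℤ (+ m ℤ.* ℤ.- + suc n)     ≡⟨ ≡.cong fromℤ (ℤ.neg-distribʳ-* (+ m) (+ suc n)) ⟨
      fromℤ (ℤ.- (+ m ℤ.* + suc n))   ≈⟨ fromℤ-neg (+ m ℤ.* + suc n) ⟩
      - fromℤ (+ m ℤ.* + suc n)       ≈⟨ -‿cong (fromℕ-* m (+ suc n)) ⟩
      - (m · 1# * suc n · 1#)         ≈⟨ -‿distribʳ-* _ _ ⟩
      m · 1# * - (suc n · 1#)         ∎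

  fromℤ-* : ∀ i j → fromℤ (i ℤ.* j) ≈ fromℤ i * fromℤ j
  fromℤ-* (+ m)    j = fromℕ-* m j
  fromℤ-* -[1+ m ] j = begin
    fromℤ (ℤ.- + suc m ℤ.* j)     ≡⟨ ≡.cong fromℤ (ℤ.neg-distribˡ-* (+ suc m) j) ⟨
    fromℤ (ℤ.- (+ suc m ℤ.* j))   ≈⟨ fromℤ-neg (+ suc m ℤ.* j) ⟩
    - fromℤ (+ suc m ℤ.* j)       ≈⟨ -‿cong (fromℕ-* (suc m) j) ⟩
    - (suc m · 1# * fromℤ j)      ≈⟨ -‿distribˡ-* _ _ ⟩
    - (suc m · 1#) * fromℤ j      ∎

  private
    morphism : CommutativeRing.rawRing ℤ.+-*-commutativeRing
               -Raw-AlmostCommutative⟶ fromCommutativeRing R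
    morphism = record
      { ⟦_⟧    = fromℤ
      ; +-homo = fromℤ-+
      ; *-homo = fromℤ-*
      ; -‿homo = fromℤ-neg
      ; 0-homo = refl
      ; 1-homo = refl
      }

    _coeff≟_ : ∀ i j → Maybe (fromℤ i ≈ fromℤ j)
    i coeff≟ j with i ℤ.≟ j
    ... | yes ≡.refl = just refl
    ... | no _     = nothing

  open RingSolver (CommutativeRing.rawRing ℤ.+-*-commutativeRing)
    (fromCommutativeRing R) morphism _coeff≟_ public
    using (solve; _:=_; con; _:+_; _:*_; _:-_; :-_; _:^_)

prime∤! : ∀ {p} → Prime p → ∀ {k} → k ℕ.< p → ¬ p ℕ∣.∣ k !
prime∤! p-prime {zero}  _   d = ¬prime[1] (≡.subst Prime (ℕ∣.∣1⇒≡1 d) p-prime)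
prime∤! p-prime {suc k} k<p d with euclidsLemma (suc k) (k !) p-prime d
... | inj₁ p∣1+k = ℕ∣.>⇒∤ k<p p∣1+k
... | inj₂ p∣k!  = prime∤! p-prime (ℕ.<-trans (ℕ.n<1+n k) k<p) p∣k!

prime∣C : ∀ {p} → Prime p → ∀ {k} → 1 ℕ.≤ k → k ℕ.< p → p ℕ∣.∣ p choose k
prime∣C {suc p} p-prime {k} 1≤k k<p
  with euclidsLemma (suc p choose k) (k ! ℕ.* (suc p ℕ.∸ k) !) p-prime p∣product
  where
  instance
    nonZero : ℕ.NonZero (k ! ℕ.* (suc p ℕ.∸ k) !)
    nonZero = k !* (suc p ℕ.∸ k) !≢0
  k≤p = ℕ.<⇒≤ k<p
  p∣product : suc p ℕ∣.∣ (suc p choose k) ℕ.* (k ! ℕ.* (suc p ℕ.∸ k) !)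
  p∣product = ≡.subst (suc p ℕ∣.∣_)
    (≡.sym (≡.trans
      (≡.cong (ℕ._* (k ! ℕ.* (suc p ℕ.∸ k) !)) (nCk≡n!/k![n-k]! k≤p))
      (ℕ.m/n*n≡m (k![n∸k]!∣n! k≤p))))
    (ℕ∣.m∣m*n (p !))
... | inj₁ d = d
... | inj₂ d with euclidsLemma (k !) ((suc p ℕ.∸ k) !) p-prime d
...   | inj₁ d′ = contradiction d′ (prime∤! p-prime k<p)
...   | inj₂ d′ = contradiction d′ (prime∤! p-prime (ℕ.∸-monoʳ-< 1≤k (ℕ.<⇒≤ k<p)))

prime⇒suc : ∀ {p} → Prime p → ∃[ q ] p ≡ suc q
prime⇒suc {zero}  p-prime = contradiction p-prime ¬prime[0]
prime⇒suc {suc q} _       = q , ≡.refl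

module _ (R : CommutativeRing c ℓ) where
  open CommutativeRing R hiding (zero)
  open Exp commutativeSemiring

  ^-cube : ∀ x m → x ^ m * (x ^ m * x ^ m) ≈ x ^ (3 ℕ.* m)
  ^-cube x m = sym (trans (^-homo-* x m (m ℕ.+ (m ℕ.+ 0))) (*-congˡ (trans (^-homo-* x m (m ℕ.+ 0))
    (*-congˡ (^-congʳ x (ℕ.+-identityʳ m))))))

  0^suc : ∀ {x} k → x ≈ 0# → x ^ suc k ≈ 0#
  0^suc {x} k x≈0 = trans (*-congʳ x≈0) (zeroˡ (x ^ k))

  1^≈1 : ∀ n → 1# ^ n ≈ 1#
  1^≈1 zero    = refl
  1^≈1 (suc n) = trans (*-identityˡ _) (1^≈1 n)

module Frobenius (R : CommutativeRing c ℓ)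
  {p : ℕ} (p-prime : Prime p)
  (char-p : CommutativeRing._≈_ R (IntegerCoefficients.fromℤ R (+ p))
                                  (CommutativeRing.0# R)) where
  open CommutativeRing R hiding (zero)
  open IntegerCoefficients R using (fromℤ; 1+×)
  open Mult semiring using () renaming (_×_ to _·_)
  open Mult semiring using (×-assocˡ; ×-congʳ; ×-assoc-*; ×-homo-1)
  open Exp commutativeSemiring
  open Binomial commutativeSemiring
  open Sum semiring using (sum; sum-init-last; sum-cong-≋; sum-replicate-zero)
  open SetoidReasoning setoid

  ·-zero : ∀ {n} → p ℕ∣.∣ n → ∀ x → n · x ≈ 0#
  ·-zero (ℕ∣.divides k ≡.refl) x = begin
    (k ℕ.* p) · x        ≈⟨ ×-congʳ (k ℕ.* p) (*-identityˡ x) ⟨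
    (k ℕ.* p) · (1# * x) ≈⟨ ×-assoc-* (k ℕ.* p) 1# x ⟨
    (k ℕ.* p) · 1# * x   ≈⟨ *-congʳ (×-assocˡ 1# k p) ⟨
    k · (p · 1#) * x     ≈⟨ *-congʳ (×-congʳ k (trans (MultTCO.×ᵤ≈× semiring p 1#) char-p)) ⟩
    k · 0# * x           ≈⟨ ×-assoc-* k 0# x ⟩
    k · (0# * x)         ≈⟨ ×-congʳ k (trans (zeroˡ x) (sym (zeroʳ 0#))) ⟩
    k · (0# * 0#)        ≈⟨ ×-comm-0 k ⟩
    0#                   ∎
    where
    ×-comm-0 : ∀ k → k · (0# * 0#) ≈ 0#
    ×-comm-0 zero    = refl
    ×-comm-0 (suc k) = trans (+-cong (zeroʳ 0#) (×-comm-0 k)) (+-identityˡ 0#)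

  frobenius-+ : ∀ x y → (x + y) ^ p ≈ x ^ p + y ^ p
  frobenius-+ x y = ≡.subst (λ n → (x + y) ^ n ≈ x ^ n + y ^ n) (≡.sym p≡) (begin
    (x + y) ^ suc q                           ≈⟨ theorem (suc q) x y ⟩
    t zero + sum (t ∘ suc)                    ≈⟨ +-congˡ (sum-init-last (t ∘ suc)) ⟩
    t zero + (sum (t ∘ suc ∘ Fin.inject₁) + t (suc (Fin.fromℕ q)))
      ≈⟨ +-cong first (+-cong (trans (sum-cong-≋ middle) (sum-replicate-zero q)) final) ⟩
    y ^ suc q + (0# + x ^ suc q)              ≈⟨ +-congˡ (+-identityˡ _) ⟩
    y ^ suc q + x ^ suc q                     ≈⟨ +-comm _ _ ⟩
    x ^ suc q + y ^ suc q                     ∎)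
    where
    q = proj₁ (prime⇒suc p-prime)
    p≡ = proj₂ (prime⇒suc p-prime)
    t = binomialTerm x y (suc q)
    first : t zero ≈ y ^ suc q
    first = trans (×-homo-1 _) (*-identityˡ _)
    final : t (suc (Fin.fromℕ q)) ≈ x ^ suc q
    final = begin
      t (suc (Fin.fromℕ q))
        ≡⟨ ≡.cong (λ k → (suc q choose suc k) · (x ^ suc k * y ^ (q ℕ.∸ k))) (Fin.toℕ-fromℕ q) ⟩
      (suc q choose suc q) · (x ^ suc q * y ^ (q ℕ.∸ q))
        ≡⟨ ≡.cong₂ (λ m n → m · (x ^ suc q * y ^ n)) (nCn≡1 (suc q)) (ℕ.n∸n≡0 q) ⟩
      1 · (x ^ suc q * 1#)   ≈⟨ ×-homo-1 _ ⟩
      x ^ suc q * 1#         ≈⟨ *-identityʳ _ ⟩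
      x ^ suc q              ∎
    middle : ∀ i → t (suc (Fin.inject₁ i)) ≈ 0#
    middle i rewrite Fin.toℕ-inject₁ i =
      ·-zero (≡.subst (ℕ∣._∣ (suc q choose suc (toℕ i))) (≡.sym p≡)
               (prime∣C (≡.subst Prime p≡ p-prime) (ℕ.s≤s ℕ.z≤n) (ℕ.s≤s (Fin.toℕ<n i))))
             (x ^ suc (toℕ i) * y ^ (q ℕ.∸ toℕ i))

  0^p≈0 : 0# ^ p ≈ 0#
  0^p≈0 = ≡.subst (λ n → 0# ^ n ≈ 0#) (≡.sym (proj₂ (prime⇒suc p-prime))) (zeroˡ _)

  frobenius-sum : ∀ {n} (f : Fin n → Carrier) → sum f ^ p ≈ sum (λ i → f i ^ p)
  frobenius-sum {zero}  f = 0^p≈0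
  frobenius-sum {suc n} f =
    trans (frobenius-+ _ _) (+-congˡ (frobenius-sum (f ∘ suc)))

  frobenius-neg : ∀ x → (- x) ^ p ≈ - (x ^ p)
  frobenius-neg x = inverseʳ-unique _ _ (begin
    x ^ p + (- x) ^ p   ≈⟨ frobenius-+ x (- x) ⟨
    (x - x) ^ p         ≈⟨ ^-congˡ p (-‿inverseʳ x) ⟩
    0# ^ p              ≈⟨ 0^p≈0 ⟩
    0#                  ∎)
    where open AbelianGroupProperties +-abelianGroup

  frobenius-ℕ : ∀ n → fromℤ (+ n) ^ p ≈ fromℤ (+ n)
  frobenius-ℕ zero    = 0^p≈0
  frobenius-ℕ (suc n) = begin
    fromℤ (+ suc n) ^ p       ≈⟨ ^-congˡ p (1+× n 1#) ⟩
    (1# + fromℤ (+ n)) ^ p    ≈⟨ frobenius-+ _ _ ⟩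
    1# ^ p + fromℤ (+ n) ^ p  ≈⟨ +-cong (1^≈1 R p) (frobenius-ℕ n) ⟩
    1# + fromℤ (+ n)          ≈⟨ 1+× n 1# ⟨
    fromℤ (+ suc n)           ∎

  frobenius-ℤ : ∀ i → fromℤ i ^ p ≈ fromℤ i
  frobenius-ℤ (+ n)    = frobenius-ℕ n
  frobenius-ℤ -[1+ n ] = trans (frobenius-neg _) (-‿cong (frobenius-ℕ (suc n)))

module _ {n : ℕ} where
  open CommutativeRing (ℤ/ n) renaming (refl to ≋-refl; sym to ≋-sym; trans to ≋-trans)

  ∣⇒≋0 : ∀ {i} → + n ℤ∣.∣ i → i ≋ 0ℤ [mod n ]
  ∣⇒≋0 {i} d = congruent (≡.subst (+ n ℤ∣.∣_) (≡.sym (ℤ.+-identityʳ i)) d)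

  ≋0⇒∣ : ∀ {i} → i ≋ 0ℤ [mod n ] → + n ℤ∣.∣ i
  ≋0⇒∣ {i} (congruent d) = ≡.subst (+ n ℤ∣.∣_) (ℤ.+-identityʳ i) d

  +-multiple : ∀ i k → i ≋ i ℤ.+ k ℤ.* + n [mod n ]
  +-multiple i k = congruent (ℤ∣.divides (ℤ.- k) (lemma i k (+ n)))
    where
    lemma : ∀ i k n → i ℤ.- (i ℤ.+ k ℤ.* n) ≡ ℤ.- k ℤ.* n
    lemma = ℤ-Solver.solve-∀

  _≋?_ : ∀ i j → Dec (i ≋ j [mod n ])
  i ≋? j with + n ℤ∣.∣? i ℤ.- j
  ... | yes d = yes (congruent d)
  ... | no ¬d = no λ { (congruent d) → ¬d d }

  ≋-weaken : ∀ {m i j} → + n ℤ∣.∣ + m → i ≋ j [mod m ] → i ≋ j [mod n ]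
  ≋-weaken d (congruent e) = congruent (ℤ∣.∣-trans d e)

  module _ .{{_ : ℕ.NonZero n}} where
    ≋-% : ∀ i → i ≋ + (i ℤ.%ℕ n) [mod n ]
    ≋-% i = ≋-trans (reflexive (ℤ.a≡a%ℕn+[a/ℕn]*n i n)) (≋-sym (+-multiple _ (i ℤ./ℕ n)))

    residue : ℤ → Fin n
    residue i = Fin.fromℕ< (ℤ.n%ℕd<d i n)

    residue-≋ : ∀ i → + toℕ (residue i) ≋ i [mod n ]
    residue-≋ i = ≋-trans (reflexive (≡.cong +_ (Fin.toℕ-fromℕ< (ℤ.n%ℕd<d i n)))) (≋-sym (≋-% i))

  private
    ≋⇒≡ℕ′ : ∀ {a b} → a ℕ.≤ b → b ℕ.< n → + a ≋ + b [mod n ] → a ≡ b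
    ≋⇒≡ℕ′ {a} {b} a≤b b<n a≋b with ≋-sym a≋b
    ... | congruent d with b ℕ.∸ a in b∸a
    ...   | zero  = ℕ.≤-antisym a≤b (ℕ.m∸n≡0⇒m≤n b∸a)
    ...   | suc k = contradiction
      (≡.subst (n ℕ∣.∣_) (≡.trans (≡.cong ℤ.∣_∣ (≡.trans (ℤ.m-n≡m⊖n b a) (ℤ.⊖-≥ a≤b))) b∸a) (ℤ∣.∣⇒∣ᵤ d))
      (ℕ∣.>⇒∤ (ℕ.≤-<-trans (≡.subst (ℕ._≤ b) b∸a (ℕ.m∸n≤m b a)) b<n))

  ≋⇒≡ℕ : ∀ {a b} → a ℕ.< n → b ℕ.< n → + a ≋ + b [mod n ] → a ≡ b
  ≋⇒≡ℕ {a} {b} a<n b<n a≋b with ℕ.≤-total a b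
  ... | inj₁ a≤b = ≋⇒≡ℕ′ a≤b b<n a≋b
  ... | inj₂ b≤a = ≡.sym (≋⇒≡ℕ′ b≤a a<n (≋-sym a≋b))

  ≋⇒≡Fin : ∀ {i j : Fin n} → + toℕ i ≋ + toℕ j [mod n ] → i ≡ j
  ≋⇒≡Fin {i} {j} = Fin.toℕ-injective ∘ ≋⇒≡ℕ (Fin.toℕ<n i) (Fin.toℕ<n j)

fromℤ≡id : ∀ {n} i → IntegerCoefficients.fromℤ (ℤ/ n) i ≡ i
fromℤ≡id {n} (+ k)    = nat k
  where
  open IntegerCoefficients (ℤ/ n)
  nat : ∀ k → k · 1ℤ ≡ + k
  nat zero          = ≡.refl
  nat (suc zero)    = ≡.refl
  nat (suc (suc k)) = ≡.trans (≡.cong (ℤ._+ 1ℤ) (nat (suc k))) (≡.cong +_ (ℕ.+-comm (suc k) 1))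
fromℤ≡id {n} -[1+ k ] = ≡.cong ℤ.-_ (fromℤ≡id {n} (+ suc k))

prime∣* : ∀ {p} → Prime p → ∀ {i j} → + p ℤ∣.∣ i ℤ.* j → + p ℤ∣.∣ i ⊎ + p ℤ∣.∣ j
prime∣* p-prime {i} {j} d
  with euclidsLemma ℤ.∣ i ∣ ℤ.∣ j ∣ p-prime (≡.subst (_ ℕ∣.∣_) (ℤ.abs-* i j) (ℤ∣.∣⇒∣ᵤ d))
... | inj₁ e = inj₁ (ℤ∣.∣ᵤ⇒∣ e)
... | inj₂ e = inj₂ (ℤ∣.∣ᵤ⇒∣ e)

module RootBound (R : CommutativeRing c ℓ)
  (0≉1 : ¬ CommutativeRing._≈_ R (CommutativeRing.0# R) (CommutativeRing.1# R))
  (x*y≈0⇒ : ∀ {x y} → CommutativeRing._≈_ R (CommutativeRing._*_ R x y) (CommutativeRing.0# R) →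
             CommutativeRing._≈_ R x (CommutativeRing.0# R) ⊎
             CommutativeRing._≈_ R y (CommutativeRing.0# R)) where
  open CommutativeRing R hiding (zero)
  open IntegerCoefficients R
  open Exp commutativeSemiring using (_^_)
  open AbelianGroupProperties +-abelianGroup using (x∙y⁻¹≈ε⇒x≈y; x≈y⇒x∙y⁻¹≈ε)
  open SetoidReasoning setoid

  -- The list holds the coefficients of a monic polynomial without the leading one.
  monic : List Carrier → Carrier → Carrier
  monic []      x = 1#
  monic (a ∷ f) x = a + x * monic f x

  quotient : List Carrier → Carrier → List Carrier
  quotient []      r = []
  quotient (a ∷ f) r = monic (a ∷ f) r ∷ quotient f r

  length-quotient : ∀ f r → List.length (quotient f r) ≡ List.length f
  length-quotient []      r = ≡.refl
  length-quotient (_ ∷ f) r = ≡.cong suc (length-quotient f r)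

  factor : ∀ a f r x → monic (a ∷ f) x - monic (a ∷ f) r ≈ (x - r) * monic (quotient f r) x
  factor a []      r x =
    solve 4 (λ a x r o → (a :+ x :* o) :- (a :+ r :* o) := (x :- r) :* o) refl a x r 1#
  factor a (b ∷ f) r x = begin
    (a + x * F x) - (a + r * F r)
      ≈⟨ solve 5 (λ a x r u v → (a :+ x :* u) :- (a :+ r :* v) := x :* (u :- v) :+ (x :- r) :* v)
           refl a x r (F x) (F r) ⟩
    x * (F x - F r) + (x - r) * F r
      ≈⟨ +-congʳ (*-congˡ (factor b f r x)) ⟩
    x * ((x - r) * Q) + (x - r) * F r
      ≈⟨ solve 4 (λ x r q v → x :* ((x :- r) :* q) :+ (x :- r) :* v := (x :- r) :* (v :+ x :* q))
           refl x r Q (F r) ⟩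
    (x - r) * (F r + x * Q)  ∎
    where
    F = monic (b ∷ f)
    Q = monic (quotient f r) x

  roots≤degree : ∀ {m} f (r : Fin m → Carrier) → (∀ {i j} → r i ≈ r j → i ≡ j) →
                 (∀ i → monic f (r i) ≈ 0#) → m ℕ.≤ List.length f
  roots≤degree {zero}  f       r inj root = ℕ.z≤n
  roots≤degree {suc m} []      r inj root = contradiction (sym (root zero)) 0≉1
  roots≤degree {suc m} (a ∷ f) r inj root = ℕ.s≤s
    (≡.subst (m ℕ.≤_) (length-quotient f (r zero))
      (roots≤degree (quotient f (r zero)) (r ∘ suc) (Fin.suc-injective ∘ inj) root′))
    where
    root′ : ∀ i → monic (quotient f (r zero)) (r (suc i)) ≈ 0#
    root′ i with x*y≈0⇒ (begin
      (r (suc i) - r zero) * monic (quotient f (r zero)) (r (suc i)) ≈⟨ factor a f (r zero) (r (suc i)) ⟨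
      monic (a ∷ f) (r (suc i)) - monic (a ∷ f) (r zero)           ≈⟨ +-cong (root (suc i)) (-‿cong (root zero)) ⟩
      0# - 0#                                                      ≈⟨ -‿inverseʳ 0# ⟩
      0#                                                           ∎)
    ... | inj₁ eq = contradiction (inj (x∙y⁻¹≈ε⇒x≈y _ _ eq)) λ ()
    ... | inj₂ eq = eq

  monic-replicate : ∀ k x → monic (List.replicate k 0#) x ≈ x ^ k
  monic-replicate zero    x = refl
  monic-replicate (suc k) x = trans (+-identityˡ _) (*-congˡ (monic-replicate k x))

  roots-of-unity≤ : ∀ {m} k (r : Fin m → Carrier) → (∀ {i j} → r i ≈ r j → i ≡ j) →
                    (∀ i → r i ^ suc k ≈ 1#) → m ℕ.≤ suc k
  roots-of-unity≤ {m} k r inj root =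
    ≡.subst (m ℕ.≤_) (≡.cong suc (List.length-replicate k))
      (roots≤degree (- 1# ∷ List.replicate k 0#) r inj λ i → begin
        - 1# + r i * monic (List.replicate k 0#) (r i)   ≈⟨ +-congˡ (*-congˡ (monic-replicate k (r i))) ⟩
        - 1# + r i ^ suc k                               ≈⟨ +-congˡ (root i) ⟩
        - 1# + 1#                                        ≈⟨ -‿inverseˡ 1# ⟩
        0#                                               ∎)

  fixed-by-power≤ : ∀ {m} k (r : Fin m → Carrier) → (∀ {i j} → r i ≈ r j → i ≡ j) →
                    (∀ i → r i ^ suc (suc k) ≈ r i) → m ℕ.≤ suc (suc k)
  fixed-by-power≤ {m} k r inj root =
    ≡.subst (m ℕ.≤_) (≡.cong (2 ℕ.+_) (List.length-replicate k))
      (roots≤degree (0# ∷ - 1# ∷ List.replicate k 0#) r inj λ i → begin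
        0# + r i * (- 1# + r i * monic (List.replicate k 0#) (r i))
          ≈⟨ +-congˡ (*-congˡ (+-congˡ (*-congˡ (monic-replicate k (r i))))) ⟩
        0# + r i * (- 1# + r i ^ suc k)
          ≈⟨ solve 2 (λ x y → con 0ℤ :+ x :* (:- con 1ℤ :+ y) := x :* y :- x) refl (r i) (r i ^ suc k) ⟩
        r i ^ suc (suc k) - r i    ≈⟨ x≈y⇒x∙y⁻¹≈ε (root i) ⟩
        0#                         ∎)

module PrimeField {p : ℕ} (p-prime : Prime p) where
  open CommutativeRing (ℤ/ p) hiding (zero) renaming (refl to ≋-refl; sym to ≋-sym; trans to ≋-trans)
  open Exp commutativeSemiring using (_^_)
  open SetoidReasoning setoid

  instance
    p-nonZero : ℕ.NonZero p
    p-nonZero = prime⇒nonZero p-prime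

  0≉1 : ¬ 0ℤ ≋ 1ℤ [mod p ]
  0≉1 0≋1 = ¬prime[1] (≡.subst Prime (ℕ∣.∣1⇒≡1 (ℤ∣.∣⇒∣ᵤ (≋0⇒∣ (≋-sym 0≋1)))) p-prime)

  x*y≋0⇒ : ∀ {x y} → x ℤ.* y ≋ 0ℤ [mod p ] → x ≋ 0ℤ [mod p ] ⊎ y ≋ 0ℤ [mod p ]
  x*y≋0⇒ {x} {y} eq with prime∣* p-prime {x} {y} (≋0⇒∣ eq)
  ... | inj₁ d = inj₁ (∣⇒≋0 d)
  ... | inj₂ d = inj₂ (∣⇒≋0 d)

  p≋0 : + p ≋ 0ℤ [mod p ]
  p≋0 = ∣⇒≋0 ℤ∣.∣-refl

  open RootBound (ℤ/ p) 0≉1 x*y≋0⇒ public using (roots-of-unity≤)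

  *-cancelˡ : ∀ {x y z} → ¬ x ≋ 0ℤ [mod p ] → x ℤ.* y ≋ x ℤ.* z [mod p ] → y ≋ z [mod p ]
  *-cancelˡ {x} {y} {z} x≢0 (congruent d) =
    [ (λ e → contradiction (∣⇒≋0 e) x≢0) , congruent ]′
      (prime∣* p-prime {x} {y ℤ.- z}
        (≡.subst (+ p ℤ∣.∣_) (≡.sym (distrib-minus x y z)) d))
    where
    distrib-minus : ∀ x y z → x ℤ.* (y ℤ.- z) ≡ x ℤ.* y ℤ.- x ℤ.* z
    distrib-minus = ℤ-Solver.solve-∀

  fermat : ∀ x → x ^ p ≋ x [mod p ]
  fermat x = ≡.subst (λ y → y ^ p ≋ y [mod p ]) (fromℤ≡id x) (frobenius-ℤ x)
    where
    open Frobenius (ℤ/ p) p-prime (≋-trans (reflexive (fromℤ≡id (+ p))) p≋0)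

  fermat′ : ∀ {q} → p ≡ suc q → ∀ {x} → ¬ x ≋ 0ℤ [mod p ] → x ^ q ≋ 1ℤ [mod p ]
  fermat′ {q} ≡.refl {x} x≢0 = *-cancelˡ x≢0 (≋-trans (fermat x) (≋-sym (*-identityʳ x)))

  inverse : ∀ {x} → ¬ x ≋ 0ℤ [mod p ] → ∃[ y ] x ℤ.* y ≋ 1ℤ [mod p ]
  inverse {x} x≢0 with prime⇒suc p-prime
  ... | suc q , p≡ = x ^ q , fermat′ p≡ x≢0
  ... | zero  , ≡.refl = contradiction p-prime ¬prime[1]

  residue≢0 : ∀ {q} (p≡ : p ≡ suc q) (i : Fin q) → ¬ + suc (toℕ i) ≋ 0ℤ [mod p ]
  residue≢0 ≡.refl i eq =
    contradiction (≋⇒≡ℕ (ℕ.s≤s (Fin.toℕ<n i)) (ℕ.s≤s ℕ.z≤n) eq) λ ()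

  -- Otherwise all p − 1 nonzero residues are roots of X^(k+1) − 1.
  ∃-nontrivial-power : ∀ k → suc (suc k) ℕ.< p →
                       ∃[ x ] ¬ x ≋ 0ℤ [mod p ] × ¬ x ^ suc k ≋ 1ℤ [mod p ]
  ∃-nontrivial-power k k<p with prime⇒suc p-prime
  ... | q , p≡ with Fin.any? {n = q} (λ i → ¬? (_≋?_ {p} ((+ suc (toℕ i)) ^ suc k) 1ℤ))
  ...   | yes (i , i^k≢1) = + suc (toℕ i) , residue≢0 p≡ i , i^k≢1
  ...   | no ¬∃ = contradiction
    (roots-of-unity≤ {q} k (λ i → + suc (toℕ i))
      (λ {i} {j} eq → Fin.toℕ-injective (ℕ.suc-injective (≋⇒≡ℕ (bound i) (bound j) eq)))
      (λ i → decidable-stable (_ ≋? _) λ ne → ¬∃ (i , ne)))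
    (ℕ.<⇒≱ (ℕ.s≤s⁻¹ (≡.subst (suc (suc k) ℕ.<_) p≡ k<p)))
    where
    bound : ∀ (i : Fin q) → suc (toℕ i) ℕ.< p
    bound i = ≡.subst (suc (toℕ i) ℕ.<_) (≡.sym p≡) (ℕ.s≤s (Fin.toℕ<n i))

-- Eisenstein integers

-- R[ω]/(ω² + ω + 1), with (x , y) standing for x + y ω.
module Eisenstein (R : CommutativeRing c ℓ) where
  open CommutativeRing R hiding (zero)
  open IntegerCoefficients R

  private
    infix 4 _≈ₑ_
    _≈ₑ_ : Carrier × Carrier → Carrier × Carrier → Set ℓ
    (a , b) ≈ₑ (a′ , b′) = a ≈ a′ × b ≈ b′

    _*ₑ_ : Carrier × Carrier → Carrier × Carrier → Carrier × Carrier
    (a , b) *ₑ (a′ , b′) = a * a′ - b * b′ , a * b′ + b * a′ - b * b′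

  Eis : CommutativeRing c ℓ
  Eis = record
    { Carrier = Carrier × Carrier
    ; _≈_     = _≈ₑ_
    ; _+_     = λ (a , b) (a′ , b′) → a + a′ , b + b′
    ; _*_     = _*ₑ_
    ; -_      = λ (a , b) → - a , - b
    ; 0#      = 0# , 0#
    ; 1#      = 1# , 0#
    ; isCommutativeRing = record
      { isRing = record
        { +-isAbelianGroup = record
          { isGroup = record
            { isMonoid = record
              { isSemigroup = record
                { isMagma = record
                  { isEquivalence = record
                    { refl  = refl , refl
                    ; sym   = λ (e , f) → sym e , sym f
                    ; trans = λ (e , f) (e′ , f′) → trans e e′ , trans f f′
                    }
                  ; ∙-cong = λ (e , f) (e′ , f′) → +-cong e e′ , +-cong f f′
                  }
                ; assoc = λ (a , b) (a′ , b′) (a″ , b″) → +-assoc a a′ a″ , +-assoc b b′ b″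
                }
              ; identity = (λ (a , b) → +-identityˡ a , +-identityˡ b)
                         , (λ (a , b) → +-identityʳ a , +-identityʳ b)
              }
            ; inverse = (λ (a , b) → -‿inverseˡ a , -‿inverseˡ b)
                      , (λ (a , b) → -‿inverseʳ a , -‿inverseʳ b)
            ; ⁻¹-cong = λ (e , f) → -‿cong e , -‿cong f
            }
          ; comm = λ (a , b) (a′ , b′) → +-comm a a′ , +-comm b b′
          }
        ; *-cong = λ (e , f) (e′ , f′) →
            +-cong (*-cong e e′) (-‿cong (*-cong f f′)) ,
            +-cong (+-cong (*-cong e f′) (*-cong f e′)) (-‿cong (*-cong f f′))
        ; *-assoc = λ (a , b) (c , d) (e , f) →
            solve 6 (λ a b c d e f →
              (a :* c :- b :* d) :* e :- (a :* d :+ b :* c :- b :* d) :* f :=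
              a :* (c :* e :- d :* f) :- b :* (c :* f :+ d :* e :- d :* f)) refl a b c d e f ,
            solve 6 (λ a b c d e f →
              (a :* c :- b :* d) :* f :+ (a :* d :+ b :* c :- b :* d) :* e
                :- (a :* d :+ b :* c :- b :* d) :* f :=
              a :* (c :* f :+ d :* e :- d :* f) :+ b :* (c :* e :- d :* f)
                :- b :* (c :* f :+ d :* e :- d :* f)) refl a b c d e f
        ; *-identity =
            (λ (a , b) →
              solve 2 (λ a b → con 1ℤ :* a :- con 0ℤ :* b := a) refl a b ,
              solve 2 (λ a b → con 1ℤ :* b :+ con 0ℤ :* a :- con 0ℤ :* b := b) refl a b) ,
            (λ (a , b) →
              solve 2 (λ a b → a :* con 1ℤ :- b :* con 0ℤ := a) refl a b ,
              solve 2 (λ a b → a :* con 0ℤ :+ b :* con 1ℤ :- b :* con 0ℤ := b) refl a b)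
        ; distrib =
            (λ (a , b) (c , d) (e , f) →
              solve 6 (λ a b c d e f → a :* (c :+ e) :- b :* (d :+ f) :=
                (a :* c :- b :* d) :+ (a :* e :- b :* f)) refl a b c d e f ,
              solve 6 (λ a b c d e f → a :* (d :+ f) :+ b :* (c :+ e) :- b :* (d :+ f) :=
                (a :* d :+ b :* c :- b :* d) :+ (a :* f :+ b :* e :- b :* f)) refl a b c d e f) ,
            (λ (a , b) (c , d) (e , f) →
              solve 6 (λ a b c d e f → (c :+ e) :* a :- (d :+ f) :* b :=
                (c :* a :- d :* b) :+ (e :* a :- f :* b)) refl a b c d e f ,
              solve 6 (λ a b c d e f → (c :+ e) :* b :+ (d :+ f) :* a :- (d :+ f) :* b :=
                (c :* b :+ d :* a :- d :* b) :+ (e :* b :+ f :* a :- f :* b)) refl a b c d e f)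
        }
      ; *-comm = λ (a , b) (c , d) →
          solve 4 (λ a b c d → a :* c :- b :* d := c :* a :- d :* b) refl a b c d ,
          solve 4 (λ a b c d → a :* d :+ b :* c :- b :* d := c :* b :+ d :* a :- d :* b) refl a b c d
      }
    }

  scalar : Carrier → Carrier × Carrier
  scalar x = x , 0#

  infix 9 _̄
  _̄ : Carrier × Carrier → Carrier × Carrier
  (a , b) ̄ = a - b , - b

  norm : Carrier × Carrier → Carrier
  norm (a , b) = a * a - a * b + b * b

  module E = CommutativeRing Eis
  open Exp E.commutativeSemiring using () renaming (_^_ to _^ₑ_)

  conj-cong : ∀ {x y} → x E.≈ y → x ̄ E.≈ y ̄
  conj-cong (e , f) = +-cong e (-‿cong f) , -‿cong f

  conj-+ : ∀ x y → (x E.+ y) ̄ E.≈ x ̄ E.+ y ̄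
  conj-+ (a , b) (c , d) =
    solve 4 (λ a b c d → (a :+ c) :- (b :+ d) := (a :- b) :+ (c :- d)) refl a b c d ,
    solve 2 (λ b d → :- (b :+ d) := :- b :+ :- d) refl b d

  conj-* : ∀ x y → (x E.* y) ̄ E.≈ x ̄ E.* y ̄
  conj-* (a , b) (c , d) =
    solve 4 (λ a b c d → (a :* c :- b :* d) :- (a :* d :+ b :* c :- b :* d) :=
      (a :- b) :* (c :- d) :- (:- b) :* (:- d)) refl a b c d ,
    solve 4 (λ a b c d → :- (a :* d :+ b :* c :- b :* d) :=
      (a :- b) :* (:- d) :+ (:- b) :* (c :- d) :- (:- b) :* (:- d)) refl a b c d

  conj-involutive : ∀ x → x ̄ ̄ E.≈ x
  conj-involutive (a , b) =
    solve 2 (λ a b → (a :- b) :- (:- b) := a) refl a b ,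
    solve 1 (λ b → :- (:- b) := b) refl b

  conj-1 : E.1# ̄ E.≈ E.1#
  conj-1 = solve 0 (con 1ℤ :- con 0ℤ := con 1ℤ) refl , solve 0 (:- con 0ℤ := con 0ℤ) refl

  conj-^ : ∀ x n → (x ^ₑ n) ̄ E.≈ (x ̄) ^ₑ n
  conj-^ x zero    = conj-1
  conj-^ x (suc n) = E.trans (conj-* x (x ^ₑ n)) (E.*-congˡ (conj-^ x n))

  x*x̄≈norm : ∀ x → x E.* x ̄ E.≈ scalar (norm x)
  x*x̄≈norm (a , b) =
    solve 2 (λ a b → a :* (a :- b) :- b :* (:- b) := a :* a :- a :* b :+ b :* b) refl a b ,
    solve 2 (λ a b → a :* (:- b) :+ b :* (a :- b) :- b :* (:- b) := con 0ℤ) refl a b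

  scalar-cong : ∀ {x y} → x ≈ y → scalar x E.≈ scalar y
  scalar-cong e = e , refl

  scalar-+ : ∀ x y → scalar (x + y) E.≈ scalar x E.+ scalar y
  scalar-+ x y = refl , sym (+-identityˡ 0#)

  scalar-* : ∀ x y → scalar (x * y) E.≈ scalar x E.* scalar y
  scalar-* x y =
    solve 2 (λ x y → x :* y := x :* y :- con 0ℤ :* con 0ℤ) refl x y ,
    solve 2 (λ x y → con 0ℤ := x :* con 0ℤ :+ con 0ℤ :* y :- con 0ℤ :* con 0ℤ) refl x y

  conj-scalar : ∀ x → (scalar x) ̄ E.≈ scalar x
  conj-scalar x = solve 1 (λ x → x :- con 0ℤ := x) refl x , solve 0 (:- con 0ℤ := con 0ℤ) refl

  scalar*-≈ : ∀ s x → scalar s E.* x E.≈ (s * proj₁ x , s * proj₂ x)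
  scalar*-≈ s (a , b) =
    solve 3 (λ s a b → s :* a :- con 0ℤ :* b := s :* a) refl s a b ,
    solve 3 (λ s a b → s :* b :+ con 0ℤ :* a :- con 0ℤ :* b := s :* b) refl s a b

module _ (S : CommutativeRing c ℓ) where
  open CommutativeRing S hiding (zero)
  open Sum semiring
  open SetoidReasoning setoid

  sum-single : ∀ {n} (j : Fin n) (t : Fin n → Carrier) → (∀ i → i ≢ j → t i ≈ 0#) → sum t ≈ t j
  sum-single {suc n} j t t≈0 = begin
    sum t                                 ≈⟨ sum-remove {i = j} t ⟩
    t j + sum (λ i → t (Fin.punchIn j i)) ≈⟨ +-congˡ (sum-cong-≋ λ i → t≈0 _ (Fin.punchInᵢ≢i j i)) ⟩
    t j + sum {n} (λ _ → 0#)              ≈⟨ +-congˡ (sum-replicate-zero n) ⟩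
    t j + 0#                              ≈⟨ +-identityʳ _ ⟩
    t j                                   ∎

record Periodic (S : CommutativeRing c ℓ) (n : ℕ) : Set (c ⊔ ℓ) where
  constructor periodic
  field
    at   : ℤ → CommutativeRing.Carrier S
    cong : ∀ {i j} → i ≋ j [mod n ] → CommutativeRing._≈_ S (at i) (at j)

open Periodic public

-- The group ring S[ℤ/n]: n-periodic functions under convolution.
module GroupRing (S : CommutativeRing c ℓ) (n : ℕ) .{{_ : ℕ.NonZero n}} where
  open CommutativeRing S hiding (zero)
  open Sum semiring
  open SetoidReasoning setoid
  module ℤₙ = CommutativeRing (ℤ/ n)

  private
    F : Set _
    F = Periodic S n

  ∑ : F → Carrier
  ∑ f = sum {n} (λ i → at f (+ toℕ i))

  ∑-cong : ∀ f g → (∀ t → at f t ≈ at g t) → ∑ f ≈ ∑ g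
  ∑-cong f g f≈g = sum-cong-≋ {n} λ i → f≈g _

  infixl 9 _∘ₚ_
  _∘ₚ_ : F → (φ : Periodic (ℤ/ n) n) → F
  f ∘ₚ φ = periodic (at f ∘ at φ) (cong f ∘ cong φ)

  ∑-reindex : ∀ f (φ ψ : Periodic (ℤ/ n) n) →
              (∀ t → at φ (at ψ t) ≋ t [mod n ]) → (∀ t → at ψ (at φ t) ≋ t [mod n ]) →
              ∑ (f ∘ₚ φ) ≈ ∑ f
  ∑-reindex f φ ψ φψ ψφ = sym (trans (sum-permute (λ i → at f (+ toℕ i)) π)
    (sum-cong-≋ {n} λ i → cong f (residue-≋ _)))
    where
    res : Periodic (ℤ/ n) n → Fin n → Fin n
    res φ i = residue (at φ (+ toℕ i))
    inverse-of : ∀ φ ψ → (∀ t → at φ (at ψ t) ≋ t [mod n ]) → ∀ i → res φ (res ψ i) ≡ i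
    inverse-of φ ψ φψ i =
      ≋⇒≡Fin (ℤₙ.trans (residue-≋ _) (ℤₙ.trans (cong φ (residue-≋ _)) (φψ _)))
    π : Permutation n n
    π = permutation (res φ) (res ψ) (inverse-of φ ψ φψ) (inverse-of ψ φ ψφ)

  affine : ℤ → ℤ → Periodic (ℤ/ n) n
  affine a b = periodic (λ i → a ℤ.* i ℤ.+ b) λ e → ℤₙ.+-congʳ (ℤₙ.*-congˡ {a} e)

  ∑-affine : ∀ {a a′} → a ℤ.* a′ ≋ 1ℤ [mod n ] → ∀ b f → ∑ (f ∘ₚ affine a b) ≈ ∑ f
  ∑-affine {a} {a′} aa′ b f = ∑-reindex f (affine a b) (affine a′ (ℤ.- (a′ ℤ.* b)))
    (λ t → ℤₙ.trans (ℤₙ.reflexive (lemma₁ a a′ b t)) (step (t ℤ.- b) b (lemma₃ t b)))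
    (λ t → ℤₙ.trans (ℤₙ.reflexive (lemma₂ a a′ b t)) (step t 0ℤ (ℤ.+-identityʳ t)))
    where
    lemma₁ : ∀ a a′ b t → a ℤ.* (a′ ℤ.* t ℤ.+ ℤ.- (a′ ℤ.* b)) ℤ.+ b ≡ a ℤ.* a′ ℤ.* (t ℤ.- b) ℤ.+ b
    lemma₁ = ℤ-Solver.solve-∀
    lemma₂ : ∀ a a′ b t → a′ ℤ.* (a ℤ.* t ℤ.+ b) ℤ.+ ℤ.- (a′ ℤ.* b) ≡ a ℤ.* a′ ℤ.* t ℤ.+ 0ℤ
    lemma₂ = ℤ-Solver.solve-∀
    lemma₃ : ∀ t b → t ℤ.- b ℤ.+ b ≡ t
    lemma₃ = ℤ-Solver.solve-∀
    step : ∀ s b {t} → s ℤ.+ b ≡ t → a ℤ.* a′ ℤ.* s ℤ.+ b ≋ t [mod n ]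
    step s b ≡.refl = ℤₙ.+-congʳ {b} (ℤₙ.trans (ℤₙ.*-congʳ {s} aa′) (ℤₙ.reflexive (ℤ.*-identityˡ s)))

  ∑-translate : ∀ b f → ∑ (f ∘ₚ affine 1ℤ b) ≈ ∑ f
  ∑-translate b = ∑-affine {1ℤ} {1ℤ} ℤₙ.refl b

  ∑-reflect : ∀ b f → ∑ (f ∘ₚ affine (ℤ.- 1ℤ) b) ≈ ∑ f
  ∑-reflect b = ∑-affine {ℤ.- 1ℤ} {ℤ.- 1ℤ} ℤₙ.refl b

  mono : Carrier → ℤ → F
  mono s a = periodic value value-cong
    where
    value : ℤ → Carrier
    value t with _≋?_ {n} t a
    ... | yes _ = s
    ... | no _  = 0#
    value-cong : ∀ {i j} → i ≋ j [mod n ] → value i ≈ value j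
    value-cong {i} {j} i≋j with _≋?_ {n} i a | _≋?_ {n} j a
    ... | yes _   | yes _   = refl
    ... | no _    | no _    = refl
    ... | yes i≋a | no j≢a  = contradiction (ℤₙ.trans (ℤₙ.sym i≋j) i≋a) j≢a
    ... | no i≢a  | yes j≋a = contradiction (ℤₙ.trans i≋j j≋a) i≢a

  mono-yes : ∀ s a {t} → t ≋ a [mod n ] → at (mono s a) t ≈ s
  mono-yes s a {t} t≋a with _≋?_ {n} t a
  ... | yes _  = refl
  ... | no t≢a = contradiction t≋a t≢a

  mono-no : ∀ s a {t} → ¬ t ≋ a [mod n ] → at (mono s a) t ≈ 0#
  mono-no s a {t} t≢a with _≋?_ {n} t a
  ... | yes t≋a = contradiction t≋a t≢a
  ... | no _    = refl

  ∑-single : ∀ a f → (∀ {t} → ¬ t ≋ a [mod n ] → at f t ≈ 0#) → ∑ f ≈ at f a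
  ∑-single a f f≈0 = trans
    (sum-single S (residue a) _ λ i i≢ → f≈0 λ i≋a → i≢ (≋⇒≡Fin (ℤₙ.trans i≋a (ℤₙ.sym (residue-≋ a)))))
    (cong f (residue-≋ a))

  infixl 7 _⋆ₜ_ _⋆_

  _⋆ₜ_ : F → F → ℤ → F
  (f ⋆ₜ g) t = periodic (λ x → at f x * at g (t ℤ.- x))
    λ e → *-cong (cong f e) (cong g (ℤₙ.+-congˡ {t} (ℤₙ.-‿cong e)))

  _⋆_ : F → F → F
  f ⋆ g = periodic (λ t → ∑ ((f ⋆ₜ g) t))
    λ {i} {j} e → ∑-cong ((f ⋆ₜ g) i) ((f ⋆ₜ g) j) λ x → *-congˡ (cong g (ℤₙ.+-congʳ {ℤ.- x} e))

  private
    infix 4 _≈F_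
    _≈F_ : F → F → Set ℓ
    f ≈F g = ∀ t → at f t ≈ at g t

    ⋆-cong : ∀ {f f′ g g′} → f ≈F f′ → g ≈F g′ → f ⋆ g ≈F f′ ⋆ g′
    ⋆-cong {f} {f′} {g} {g′} e e′ t =
      ∑-cong ((f ⋆ₜ g) t) ((f′ ⋆ₜ g′) t) λ x → *-cong (e x) (e′ _)

    ⋆-comm : ∀ f g → f ⋆ g ≈F g ⋆ f
    ⋆-comm f g t = begin
      ∑ ((f ⋆ₜ g) t)                          ≈⟨ ∑-reflect t ((f ⋆ₜ g) t) ⟨
      ∑ ((f ⋆ₜ g) t ∘ₚ affine (ℤ.- 1ℤ) t)
        ≈⟨ ∑-cong ((f ⋆ₜ g) t ∘ₚ affine (ℤ.- 1ℤ) t) ((g ⋆ₜ f) t) (λ x → trans (*-comm _ _)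
             (*-cong (cong g (ℤₙ.reflexive (lemma₁ t x))) (cong f (ℤₙ.reflexive (lemma₂ t x))))) ⟩
      ∑ ((g ⋆ₜ f) t)                          ∎
      where
      lemma₁ : ∀ t x → t ℤ.- (ℤ.- 1ℤ ℤ.* x ℤ.+ t) ≡ x
      lemma₁ = ℤ-Solver.solve-∀
      lemma₂ : ∀ t x → ℤ.- 1ℤ ℤ.* x ℤ.+ t ≡ t ℤ.- x
      lemma₂ = ℤ-Solver.solve-∀

    ⋆-assoc : ∀ f g h → (f ⋆ g) ⋆ h ≈F f ⋆ (g ⋆ h)
    ⋆-assoc f g h t = begin
      sum {n} (λ x → sum {n} (λ y → term x y) * at h (t ℤ.- val x))
        ≈⟨ sum-cong-≋ {n} (λ x → *-distribʳ-sum (at h (t ℤ.- val x)) (term x)) ⟩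
      sum {n} (λ x → sum {n} (λ y → term x y * at h (t ℤ.- val x)))
        ≈⟨ ∑-comm {n} {n} (λ x y → term x y * at h (t ℤ.- val x)) ⟩
      sum {n} (λ y → sum {n} (λ x → term x y * at h (t ℤ.- val x)))
        ≈⟨ sum-cong-≋ {n} inner ⟩
      sum {n} (λ y → at f (val y) * sum {n} (λ x → at g (val x) * at h (t ℤ.- val y ℤ.- val x))) ∎
      where
      val : Fin n → ℤ
      val i = + toℕ i
      term : Fin n → Fin n → Carrier
      term x y = at f (val y) * at g (val x ℤ.- val y)
      lemma₁ : ∀ x y → 1ℤ ℤ.* x ℤ.+ ℤ.- y ≡ x ℤ.- y
      lemma₁ = ℤ-Solver.solve-∀
      lemma₂ : ∀ t x y → t ℤ.- y ℤ.- (1ℤ ℤ.* x ℤ.+ ℤ.- y) ≡ t ℤ.- x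
      lemma₂ = ℤ-Solver.solve-∀
      inner : ∀ y → sum {n} (λ x → term x y * at h (t ℤ.- val x)) ≈
              at f (val y) * sum {n} (λ x → at g (val x) * at h (t ℤ.- val y ℤ.- val x))
      inner y = begin
        sum {n} (λ x → term x y * at h (t ℤ.- val x))
          ≈⟨ sum-cong-≋ {n} (λ x → *-assoc _ _ _) ⟩
        sum {n} (λ x → at f (val y) * (at g (val x ℤ.- val y) * at h (t ℤ.- val x)))
          ≈⟨ *-distribˡ-sum (at f (val y)) (λ x → at g (val x ℤ.- val y) * at h (t ℤ.- val x)) ⟨
        at f (val y) * sum {n} (λ x → at g (val x ℤ.- val y) * at h (t ℤ.- val x))
          ≈⟨ *-congˡ (sum-cong-≋ {n} λ x → *-cong (cong g (ℤₙ.reflexive (lemma₁ (val x) (val y))))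
               (cong h (ℤₙ.reflexive (lemma₂ t (val x) (val y))))) ⟨
        at f (val y) * ∑ ((g ⋆ₜ h) (t ℤ.- val y) ∘ₚ affine 1ℤ (ℤ.- val y))
          ≈⟨ *-congˡ (∑-translate (ℤ.- val y) ((g ⋆ₜ h) (t ℤ.- val y))) ⟩
        at f (val y) * ∑ ((g ⋆ₜ h) (t ℤ.- val y)) ∎

    ⋆-identityˡ : ∀ f → mono 1# 0ℤ ⋆ f ≈F f
    ⋆-identityˡ f t = begin
      ∑ ((mono 1# 0ℤ ⋆ₜ f) t)
        ≈⟨ ∑-single 0ℤ ((mono 1# 0ℤ ⋆ₜ f) t) (λ x≢0 → trans (*-congʳ (mono-no 1# 0ℤ x≢0)) (zeroˡ _)) ⟩
      at (mono 1# 0ℤ) 0ℤ * at f (t ℤ.- 0ℤ)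
        ≈⟨ *-cong (mono-yes 1# 0ℤ {0ℤ} ℤₙ.refl) (cong f (ℤₙ.reflexive (ℤ.+-identityʳ t))) ⟩
      1# * at f t   ≈⟨ *-identityˡ _ ⟩
      at f t        ∎

    ⋆-distribˡ : ∀ f g h t → ∑ ((f ⋆ₜ periodic (λ t → at g t + at h t) (λ e → +-cong (cong g e) (cong h e))) t)
                             ≈ ∑ ((f ⋆ₜ g) t) + ∑ ((f ⋆ₜ h) t)
    ⋆-distribˡ f g h t = trans (sum-cong-≋ {n} λ x → distribˡ _ _ _) (∑-distrib-+ {n} _ _)

  ring[ℤ/n] : CommutativeRing (c ⊔ ℓ) ℓ
  ring[ℤ/n] = record
    { Carrier = F
    ; _≈_     = _≈F_
    ; _+_     = _+F_
    ; _*_     = _⋆_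
    ; -_      = λ f → periodic (λ t → - at f t) (λ e → -‿cong (cong f e))
    ; 0#      = periodic (λ _ → 0#) (λ _ → refl)
    ; 1#      = mono 1# 0ℤ
    ; isCommutativeRing = record
      { isRing = record
        { +-isAbelianGroup = record
          { isGroup = record
            { isMonoid = record
              { isSemigroup = record
                { isMagma = record
                  { isEquivalence = record
                    { refl  = λ _ → refl
                    ; sym   = λ e t → sym (e t)
                    ; trans = λ e e′ t → trans (e t) (e′ t)
                    }
                  ; ∙-cong = λ e e′ t → +-cong (e t) (e′ t)
                  }
                ; assoc = λ f g h t → +-assoc _ _ _
                }
              ; identity = (λ f t → +-identityˡ _) , (λ f t → +-identityʳ _)
              }
            ; inverse = (λ f t → -‿inverseˡ _) , (λ f t → -‿inverseʳ _)
            ; ⁻¹-cong = λ e t → -‿cong (e t)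
            }
          ; comm = λ f g t → +-comm _ _
          }
        ; *-cong = λ {f} {f′} {g} {g′} → ⋆-cong {f} {f′} {g} {g′}
        ; *-assoc = ⋆-assoc
        ; *-identity = ⋆-identityˡ , λ f t → trans (⋆-comm f (mono 1# 0ℤ) t) (⋆-identityˡ f t)
        ; distrib = ⋆-distribˡ , λ f g h t →
            trans (⋆-comm (g +F h) f t) (trans (⋆-distribˡ f g h t) (+-cong (⋆-comm f g t) (⋆-comm f h t)))
        }
      ; *-comm = ⋆-comm
      }
    }
    where
    _+F_ : F → F → F
    f +F g = periodic (λ t → at f t + at g t) (λ e → +-cong (cong f e) (cong g e))

  module G = CommutativeRing ring[ℤ/n]
  open Exp G.commutativeSemiring using () renaming (_^_ to _^ᴳ_)
  open Exp commutativeSemiring using (_^_)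
  module ∑G = Sum G.semiring

  mono-* : ∀ s a r b → mono s a ⋆ mono r b G.≈ mono (s * r) (a ℤ.+ b)
  mono-* s a r b t = trans
    (∑-single a ((mono s a ⋆ₜ mono r b) t) (λ x≢a → trans (*-congʳ (mono-no s a x≢a)) (zeroˡ _)))
    (trans (*-congʳ (mono-yes s a {a} ℤₙ.refl)) at-t)
    where
    at-t : s * at (mono r b) (t ℤ.- a) ≈ at (mono (s * r) (a ℤ.+ b)) t
    at-t with _≋?_ {n} (t ℤ.- a) b | _≋?_ {n} t (a ℤ.+ b)
    ... | yes _ | yes _ = refl
    ... | no _  | no _  = zeroʳ s
    ... | yes (congruent e) | no ne =
      contradiction (congruent (≡.subst (+ n ℤ∣.∣_) (lemma t a b) e)) ne
      where
      lemma : ∀ t a b → t ℤ.- a ℤ.- b ≡ t ℤ.- (a ℤ.+ b)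
      lemma = ℤ-Solver.solve-∀
    ... | no ne | yes (congruent e) =
      contradiction (congruent (≡.subst (+ n ℤ∣.∣_) (lemma t a b) e)) ne
      where
      lemma : ∀ t a b → t ℤ.- (a ℤ.+ b) ≡ t ℤ.- a ℤ.- b
      lemma = ℤ-Solver.solve-∀

  mono-cong : ∀ {s r a b} → s ≈ r → a ≡ b → mono s a G.≈ mono r b
  mono-cong {a = a} s≈r ≡.refl t with _≋?_ {n} t a
  ... | yes _ = s≈r
  ... | no _  = refl

  mono-^ : ∀ s a k → mono s a ^ᴳ k G.≈ mono (s ^ k) (+ k ℤ.* a)
  mono-^ s a zero    = mono-cong refl (≡.sym (ℤ.*-zeroˡ a))
  mono-^ s a (suc k) t = trans
    (G.*-congˡ {mono s a} {mono s a ^ᴳ k} {mono (s ^ k) (+ k ℤ.* a)} (mono-^ s a k) t)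
    (trans (mono-* s a (s ^ k) (+ k ℤ.* a) t) (mono-cong refl (lemma (+ k) a) t))
    where
    lemma : ∀ k a → a ℤ.+ k ℤ.* a ≡ (1ℤ ℤ.+ k) ℤ.* a
    lemma = ℤ-Solver.solve-∀

  at-sum : ∀ {m} (h : Fin m → F) t → at (∑G.sum h) t ≈ sum (λ i → at (h i) t)
  at-sum {zero}  h t = refl
  at-sum {suc m} h t = +-congˡ (at-sum (h ∘ suc) t)

  decompose : ∀ f → f G.≈ ∑G.sum {n} (λ i → mono (at f (+ toℕ i)) (+ toℕ i))
  decompose f t = sym (begin
    at (∑G.sum {n} (λ i → mono (at f (+ toℕ i)) (+ toℕ i))) t
      ≈⟨ at-sum {n} _ t ⟩
    sum {n} (λ i → at (mono (at f (+ toℕ i)) (+ toℕ i)) t)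
      ≈⟨ sum-single S (residue t) _ (λ i i≢ → mono-no (at f (+ toℕ i)) (+ toℕ i)
           λ t≋i → i≢ (≋⇒≡Fin (ℤₙ.trans (ℤₙ.sym t≋i) (ℤₙ.sym (residue-≋ t))))) ⟩
    at (mono (at f (+ toℕ (residue t))) (+ toℕ (residue t))) t
      ≈⟨ mono-yes _ (+ toℕ (residue t)) {t} (ℤₙ.sym (residue-≋ t)) ⟩
    at f (+ toℕ (residue t))
      ≈⟨ cong f (residue-≋ t) ⟩
    at f t ∎)

  module _ {q : ℕ} (q-prime : Prime q) (char-q : IntegerCoefficients.fromℤ S (+ q) ≈ 0#) where

    char-G : IntegerCoefficients.fromℤ ring[ℤ/n] (+ q) G.≈ G.0#
    char-G t = begin
      at (q ·G G.1#) t           ≈⟨ MultTCO.×ᵤ≈× G.semiring q G.1# t ⟨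
      at (q ·Gᵤ G.1#) t          ≈⟨ at-· q t ⟩
      q ·ᵤ at G.1# t             ≈⟨ Frobenius.·-zero S q-prime char-q ℕ∣.∣-refl (at G.1# t) ⟩
      0#                         ∎
      where
      open MultTCO G.semiring using () renaming (_×_ to _·G_)
      open Mult G.semiring using () renaming (_×_ to _·Gᵤ_)
      open Mult semiring using () renaming (_×_ to _·ᵤ_)
      at-· : ∀ k t → at (k ·Gᵤ G.1#) t ≈ k ·ᵤ at G.1# t
      at-· zero    t = refl
      at-· (suc k) t = +-congˡ (at-· k t)

    -- Freshman's dream: f^q = Σ_a f(a)^q [q a].
    power-at-q : (∀ {i j} → + q ℤ.* i ≋ + q ℤ.* j [mod n ] → i ≋ j [mod n ]) →
                 ∀ f s → at (f ^ᴳ q) (+ q ℤ.* s) ≈ at f s ^ q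
    power-at-q q-cancel f s = begin
      at (f ^ᴳ q) qs
        ≈⟨ ^ᴳ-congˡ q {f} (decompose f) qs ⟩
      at (∑G.sum {n} (λ i → mono (at f (+ toℕ i)) (+ toℕ i)) ^ᴳ q) qs
        ≈⟨ Frobenius.frobenius-sum ring[ℤ/n] q-prime char-G {n} (λ i → mono (at f (+ toℕ i)) (+ toℕ i)) qs ⟩
      at (∑G.sum {n} (λ i → mono (at f (+ toℕ i)) (+ toℕ i) ^ᴳ q)) qs
        ≈⟨ at-sum {n} _ qs ⟩
      sum {n} (λ i → at (mono (at f (+ toℕ i)) (+ toℕ i) ^ᴳ q) qs)
        ≈⟨ sum-cong-≋ {n} (λ i → mono-^ (at f (+ toℕ i)) (+ toℕ i) q qs) ⟩
      sum {n} (λ i → at (mono (at f (+ toℕ i) ^ q) (+ q ℤ.* + toℕ i)) qs)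
        ≈⟨ sum-single S (residue s) _ (λ i i≢ → mono-no _ _ λ qs≋qi →
             i≢ (≋⇒≡Fin (ℤₙ.trans (ℤₙ.sym (q-cancel {s} {+ toℕ i} qs≋qi)) (ℤₙ.sym (residue-≋ s))))) ⟩
      at (mono (at f (+ toℕ (residue s)) ^ q) (+ q ℤ.* + toℕ (residue s))) qs
        ≈⟨ mono-yes (at f (+ toℕ (residue s)) ^ q) (+ q ℤ.* + toℕ (residue s)) {qs} (ℤₙ.*-congˡ {+ q} (ℤₙ.sym (residue-≋ s))) ⟩
      at f (+ toℕ (residue s)) ^ q
        ≈⟨ ^-congˡ q (cong f (residue-≋ s)) ⟩
      at f s ^ q ∎
      where
      open Exp commutativeSemiring using (^-congˡ)
      open Exp G.commutativeSemiring using () renaming (^-congˡ to ^ᴳ-congˡ)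
      qs = + q ℤ.* s

data Value : Set where
  O I W W² : Value

rot : Value → Value
rot O  = O
rot I  = W
rot W  = W²
rot W² = I

infixl 7 _∙_

_∙_ : Value → Value → Value
O  ∙ _ = O
I  ∙ y = y
W  ∙ y = rot y
W² ∙ y = rot (rot y)

infix 9 _*̄

_*̄ : Value → Value
O  *̄ = O
I  *̄ = I
W  *̄ = W²
W² *̄ = W

rot³ : ∀ x → rot (rot (rot x)) ≡ x
rot³ O  = ≡.refl
rot³ I  = ≡.refl
rot³ W  = ≡.refl
rot³ W² = ≡.refl

rot-∙ : ∀ x y → rot x ∙ y ≡ rot (x ∙ y)
rot-∙ O  y = ≡.refl
rot-∙ I  y = ≡.refl
rot-∙ W  y = ≡.refl
rot-∙ W² y = ≡.sym (rot³ y)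

∙-rot : ∀ x y → x ∙ rot y ≡ rot (x ∙ y)
∙-rot O  y = ≡.refl
∙-rot I  y = ≡.refl
∙-rot W  y = ≡.refl
∙-rot W² y = ≡.refl

∙-assoc : ∀ x y z → (x ∙ y) ∙ z ≡ x ∙ (y ∙ z)
∙-assoc O  y z = ≡.refl
∙-assoc I  y z = ≡.refl
∙-assoc W  y z = rot-∙ y z
∙-assoc W² y z = ≡.trans (rot-∙ (rot y) z) (≡.cong rot (rot-∙ y z))

∙-zeroʳ : ∀ x → x ∙ O ≡ O
∙-zeroʳ O  = ≡.refl
∙-zeroʳ I  = ≡.refl
∙-zeroʳ W  = ≡.refl
∙-zeroʳ W² = ≡.refl

∙-identityʳ : ∀ x → x ∙ I ≡ x
∙-identityʳ O  = ≡.refl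
∙-identityʳ I  = ≡.refl
∙-identityʳ W  = ≡.refl
∙-identityʳ W² = ≡.refl

∙-comm : ∀ x y → x ∙ y ≡ y ∙ x
∙-comm O  y = ≡.sym (∙-zeroʳ y)
∙-comm I  y = ≡.sym (∙-identityʳ y)
∙-comm W  y = ≡.sym (≡.trans (∙-rot y I) (≡.cong rot (∙-identityʳ y)))
∙-comm W² y = ≡.sym (≡.trans (∙-rot y W) (≡.cong rot (≡.sym (∙-comm W y))))

∙-interchange : ∀ x y z w → (x ∙ y) ∙ (z ∙ w) ≡ (x ∙ z) ∙ (y ∙ w)
∙-interchange x y z w = ≡.trans (∙-assoc x y (z ∙ w)) (≡.trans
  (≡.cong (x ∙_) (≡.trans (≡.sym (∙-assoc y z w)) (≡.trans (≡.cong (_∙ w) (∙-comm y z)) (∙-assoc z y w))))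
  (≡.sym (∙-assoc x z (y ∙ w))))

x∙x≡x*̄ : ∀ x → x ∙ x ≡ x *̄
x∙x≡x*̄ O  = ≡.refl
x∙x≡x*̄ I  = ≡.refl
x∙x≡x*̄ W  = ≡.refl
x∙x≡x*̄ W² = ≡.refl

*̄-∙ : ∀ x y → (x ∙ y) *̄ ≡ x *̄ ∙ y *̄
*̄-∙ x y = ≡.trans (≡.sym (x∙x≡x*̄ (x ∙ y)))
  (≡.trans (∙-interchange x y x y) (≡.cong₂ _∙_ (x∙x≡x*̄ x) (x∙x≡x*̄ y)))

x*̄∙x≡I : ∀ {x} → x ≢ O → x *̄ ∙ x ≡ I
x*̄∙x≡I {O}  x≢O = contradiction ≡.refl x≢O
x*̄∙x≡I {I}  _   = ≡.refl
x*̄∙x≡I {W}  _   = ≡.refl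
x*̄∙x≡I {W²} _   = ≡.refl

∙-≢O : ∀ {x y} → x ≢ O → y ≢ O → x ∙ y ≢ O
∙-≢O {O}  x≢O _   _    = x≢O ≡.refl
∙-≢O {I}  _   y≢O y≡O  = y≢O y≡O
∙-≢O {W}  _   y≢O eq   = y≢O (≡.trans (≡.sym (rot³ _)) (≡.cong (λ x → rot (rot x)) eq))
∙-≢O {W²} _   y≢O eq   = y≢O (≡.trans (≡.sym (rot³ _)) (≡.cong rot eq))

*̄-≢O : ∀ {x} → x ≢ O → x *̄ ≢ O
*̄-≢O {O}  x≢O _ = x≢O ≡.refl
*̄-≢O {I}  _   ()
*̄-≢O {W}  _   ()
*̄-≢O {W²} _   ()

x∙x≡I⇒ : ∀ {x} → x ∙ x ≡ I → x ≡ I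
x∙x≡I⇒ {I}  _ = ≡.refl

module 𝔼 where
  open Eisenstein ℤ.+-*-commutativeRing public
  open CommutativeRing Eis public

emb : Value → ℤ × ℤ
emb O  = 0ℤ , 0ℤ
emb I  = 1ℤ , 0ℤ
emb W  = 0ℤ , 1ℤ
emb W² = ℤ.- 1ℤ , ℤ.- 1ℤ

emb-∙ : ∀ x y → emb (x ∙ y) 𝔼.≈ emb x 𝔼.* emb y
emb-∙ O  y  = 𝔼.sym (𝔼.zeroˡ (emb y))
emb-∙ I  y  = 𝔼.sym (𝔼.*-identityˡ (emb y))
emb-∙ W  O  = 𝔼.refl
emb-∙ W  I  = 𝔼.refl
emb-∙ W  W  = 𝔼.refl
emb-∙ W  W² = 𝔼.refl
emb-∙ W² O  = 𝔼.refl
emb-∙ W² I  = 𝔼.refl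
emb-∙ W² W  = 𝔼.refl
emb-∙ W² W² = 𝔼.refl

emb-*̄ : ∀ x → emb (x *̄) 𝔼.≈ 𝔼._̄ (emb x)
emb-*̄ O  = 𝔼.refl
emb-*̄ I  = 𝔼.refl
emb-*̄ W  = 𝔼.refl
emb-*̄ W² = 𝔼.refl

-- The values O, I, W, W² of χ at a correspond to 0, 1, w, w² as values of a^(k+1) modulo l.
module CubicCharacter {l : ℕ} (l-prime : Prime l) (k : ℕ) (l≡ : l ≡ suc (3 ℕ.* suc k))
  (w : ℤ) (w-root : w ℤ.* w ℤ.+ w ℤ.+ 1ℤ ≋ 0ℤ [mod l ]) where
  open PrimeField l-prime
  private
    module ℤₗ = CommutativeRing (ℤ/ l)
  open Exp ℤₗ.commutativeSemiring using (_^_; ^-congˡ; ^-distrib-*)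

  private
    val : Value → ℤ
    val O  = 0ℤ
    val I  = 1ℤ
    val W  = w
    val W² = w ℤ.* w

    w³≋1 : w ℤ.* (w ℤ.* w) ≋ 1ℤ [mod l ]
    w³≋1 = congruent (≡.subst (+ l ℤ∣.∣_) (lemma w) (ℤ∣.∣n⇒∣m*n (w ℤ.- 1ℤ) (≋0⇒∣ w-root)))
      where
      lemma : ∀ w → (w ℤ.- 1ℤ) ℤ.* (w ℤ.* w ℤ.+ w ℤ.+ 1ℤ) ≡ w ℤ.* (w ℤ.* w) ℤ.- 1ℤ
      lemma = ℤ-Solver.solve-∀

    1≢w : ¬ 1ℤ ≋ w [mod l ]
    1≢w (congruent d) = ℕ∣.>⇒∤ (≡.subst (3 ℕ.<_) (≡.sym l≡) (ℕ.s≤s (ℕ.m≤m*n 3 (suc k))))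
      (ℤ∣.∣⇒∣ᵤ (≡.subst (+ l ℤ∣.∣_) (lemma w)
        (ℤ∣.∣m∣n⇒∣m+n (≋0⇒∣ w-root) (ℤ∣.∣m⇒∣m*n (w ℤ.+ + 2) d))))
      where
      lemma : ∀ w → (w ℤ.* w ℤ.+ w ℤ.+ 1ℤ) ℤ.+ (1ℤ ℤ.- w) ℤ.* (w ℤ.+ + 2) ≡ + 3
      lemma = ℤ-Solver.solve-∀

    w≢0 : ¬ w ≋ 0ℤ [mod l ]
    w≢0 e = 0≉1 (ℤₗ.trans (ℤₗ.sym (ℤₗ.trans (ℤₗ.*-congʳ {w ℤ.* w} e)
      (ℤₗ.reflexive (ℤ.*-zeroˡ (w ℤ.* w))))) w³≋1)

    w*w≢0 : ¬ w ℤ.* w ≋ 0ℤ [mod l ]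
    w*w≢0 e = [ w≢0 , w≢0 ]′ (x*y≋0⇒ {w} {w} e)

    1≢w*w : ¬ 1ℤ ≋ w ℤ.* w [mod l ]
    1≢w*w e = 1≢w (ℤₗ.sym (ℤₗ.trans (ℤₗ.reflexive (≡.sym (ℤ.*-identityʳ w)))
      (ℤₗ.trans (ℤₗ.*-congˡ {w} e) w³≋1)))

    w≢w*w : ¬ w ≋ w ℤ.* w [mod l ]
    w≢w*w e = 1≢w (*-cancelˡ {w} w≢0 (ℤₗ.trans (ℤₗ.reflexive (ℤ.*-identityʳ w)) e))

    val-injective : ∀ x y → val x ≋ val y [mod l ] → x ≡ y
    val-injective O  O  _ = ≡.refl
    val-injective O  I  e = contradiction e 0≉1
    val-injective O  W  e = contradiction (ℤₗ.sym e) w≢0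
    val-injective O  W² e = contradiction (ℤₗ.sym e) w*w≢0
    val-injective I  O  e = contradiction (ℤₗ.sym e) 0≉1
    val-injective I  I  _ = ≡.refl
    val-injective I  W  e = contradiction e 1≢w
    val-injective I  W² e = contradiction e 1≢w*w
    val-injective W  O  e = contradiction e w≢0
    val-injective W  I  e = contradiction (ℤₗ.sym e) 1≢w
    val-injective W  W  _ = ≡.refl
    val-injective W  W² e = contradiction e w≢w*w
    val-injective W² O  e = contradiction e w*w≢0
    val-injective W² I  e = contradiction (ℤₗ.sym e) 1≢w*w
    val-injective W² W  e = contradiction (ℤₗ.sym e) w≢w*w
    val-injective W² W² _ = ≡.refl

    val-rot : ∀ x → val (rot x) ≋ w ℤ.* val x [mod l ]
    val-rot O  = ℤₗ.reflexive (≡.sym (ℤ.*-zeroʳ w))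
    val-rot I  = ℤₗ.reflexive (≡.sym (ℤ.*-identityʳ w))
    val-rot W  = ℤₗ.refl
    val-rot W² = ℤₗ.sym w³≋1

    val-∙ : ∀ x y → val (x ∙ y) ≋ val x ℤ.* val y [mod l ]
    val-∙ O  y = ℤₗ.reflexive (≡.sym (ℤ.*-zeroˡ (val y)))
    val-∙ I  y = ℤₗ.reflexive (≡.sym (ℤ.*-identityˡ (val y)))
    val-∙ W  y = val-rot y
    val-∙ W² y = ℤₗ.trans (val-rot (rot y)) (ℤₗ.trans (ℤₗ.*-congˡ {w} (val-rot y))
      (ℤₗ.reflexive (≡.sym (ℤ.*-assoc w w (val y)))))

    factored : ∀ y w → (y ℤ.* (y ℤ.* y) ℤ.- 1ℤ) ℤ.+ (w ℤ.* w ℤ.+ w ℤ.+ 1ℤ) ℤ.* ((y ℤ.- 1ℤ) ℤ.* (w ℤ.- 1ℤ ℤ.- y)) ≡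
                       (y ℤ.- 1ℤ) ℤ.* (y ℤ.- w) ℤ.* (y ℤ.- w ℤ.* w)
    factored = ℤ-Solver.solve-∀

    cube-root : ∀ y → y ℤ.* (y ℤ.* y) ≋ 1ℤ [mod l ] → ∃[ x ] y ≋ val x [mod l ] × x ≢ O
    cube-root y (congruent d) =
      [ (λ e → [ (λ e′ → I , congruent e′ , λ ()) , (λ e′ → W , congruent e′ , λ ()) ]′
                 (prime∣* l-prime {y ℤ.- 1ℤ} {y ℤ.- w} e))
      , (λ e → W² , congruent e , λ ())
      ]′ (prime∣* l-prime {(y ℤ.- 1ℤ) ℤ.* (y ℤ.- w)} {y ℤ.- w ℤ.* w}
           (≡.subst (+ l ℤ∣.∣_) (factored y w) (ℤ∣.∣m∣n⇒∣m+n d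
             (ℤ∣.∣m⇒∣m*n ((y ℤ.- 1ℤ) ℤ.* (w ℤ.- 1ℤ ℤ.- y)) (≋0⇒∣ w-root)))))

    power-cubed : ∀ {a} → ¬ a ≋ 0ℤ [mod l ] →
                  a ^ suc k ℤ.* (a ^ suc k ℤ.* a ^ suc k) ≋ 1ℤ [mod l ]
    power-cubed {a} a≢0 = ℤₗ.trans (^-cube (ℤ/ l) a (suc k)) (fermat′ l≡ a≢0)

    χ-spec : ∀ a → ∃[ x ] a ^ suc k ≋ val x [mod l ] × (¬ a ≋ 0ℤ [mod l ] → x ≢ O)
    χ-spec a = by-cases (_≋?_ {l} a 0ℤ)
      where
      from-root : ∃[ x ] a ^ suc k ≋ val x [mod l ] × x ≢ O →
                  ∃[ x ] a ^ suc k ≋ val x [mod l ] × (¬ a ≋ 0ℤ [mod l ] → x ≢ O)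
      from-root (x , e , x≢O) = x , e , λ _ → x≢O
      by-cases : Dec (a ≋ 0ℤ [mod l ]) →
                 ∃[ x ] a ^ suc k ≋ val x [mod l ] × (¬ a ≋ 0ℤ [mod l ] → x ≢ O)
      by-cases (yes a≋0) = O , 0^suc (ℤ/ l) k a≋0 , λ a≢0 → contradiction a≋0 a≢0
      by-cases (no a≢0)  = from-root (cube-root (a ^ suc k) (power-cubed {a} a≢0))

  χ : ℤ → Value
  χ a = proj₁ (χ-spec a)

  χ≢O : ∀ {a} → ¬ a ≋ 0ℤ [mod l ] → χ a ≢ O
  χ≢O {a} = proj₂ (proj₂ (χ-spec a))

  private
    ≋-val-χ : ∀ a → a ^ suc k ≋ val (χ a) [mod l ]
    ≋-val-χ a = proj₁ (proj₂ (χ-spec a))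

    χ-unique : ∀ a x → a ^ suc k ≋ val x [mod l ] → χ a ≡ x
    χ-unique a x e = val-injective (χ a) x (ℤₗ.trans (ℤₗ.sym (≋-val-χ a)) e)

  χ-cong : ∀ {a b} → a ≋ b [mod l ] → χ a ≡ χ b
  χ-cong {a} {b} e = χ-unique a (χ b) (ℤₗ.trans (^-congˡ (suc k) e) (≋-val-χ b))

  χ-* : ∀ a b → χ (a ℤ.* b) ≡ χ a ∙ χ b
  χ-* a b = χ-unique (a ℤ.* b) (χ a ∙ χ b) (ℤₗ.trans (^-distrib-* a b (suc k))
    (ℤₗ.trans (ℤₗ.*-cong (≋-val-χ a) (≋-val-χ b)) (ℤₗ.sym (val-∙ (χ a) (χ b)))))

  χ-0 : ∀ {a} → a ≋ 0ℤ [mod l ] → χ a ≡ O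
  χ-0 {a} e = χ-unique a O (0^suc (ℤ/ l) k e)

  χ-1 : χ 1ℤ ≡ I
  χ-1 = χ-unique 1ℤ I (1^≈1 (ℤ/ l) (suc k))

  χ-[-1] : χ (ℤ.- 1ℤ) ≡ I
  χ-[-1] = x∙x≡I⇒ (≡.trans (≡.sym (χ-* (ℤ.- 1ℤ) (ℤ.- 1ℤ))) χ-1)

  χ-neg : ∀ a → χ (ℤ.- a) ≡ χ a
  χ-neg a = ≡.trans (≡.cong χ (≡.sym (ℤ.-1*i≡-i a)))
    (≡.trans (χ-* (ℤ.- 1ℤ) a) (≡.cong (_∙ χ a) χ-[-1]))

  χ-nontrivial : ∃[ b ] ¬ b ≋ 0ℤ [mod l ] × χ b ≢ I
  χ-nontrivial = nontrivial (∃-nontrivial-power k (≡.subst (suc (suc k) ℕ.<_) (≡.sym l≡)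
    (ℕ.s≤s (ℕ.s≤s (ℕ.≤-trans (ℕ.s≤s (ℕ.m≤m+n k _)) (ℕ.m≤n+m (suc (k ℕ.+ _)) k))))))
    where
    nontrivial : ∃[ b ] ¬ b ≋ 0ℤ [mod l ] × ¬ b ^ suc k ≋ 1ℤ [mod l ] → ∃[ b ] ¬ b ≋ 0ℤ [mod l ] × χ b ≢ I
    nontrivial (b , b≢0 , b^≢1) = b , b≢0 , λ χb≡I → b^≢1
      (≡.subst (λ x → b ^ suc k ≋ val x [mod l ]) χb≡I (≋-val-χ b))

-- Gauss and Jacobi sums

*̄-involutive : ∀ x → x *̄ *̄ ≡ x
*̄-involutive O  = ≡.refl
*̄-involutive I  = ≡.refl
*̄-involutive W  = ≡.refl
*̄-involutive W² = ≡.refl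

record IsCubicCharacter (l : ℕ) (χ : ℤ → Value) : Set where
  field
    χ-cong       : ∀ {a b} → a ≋ b [mod l ] → χ a ≡ χ b
    χ-*          : ∀ a b → χ (a ℤ.* b) ≡ χ a ∙ χ b
    χ-0          : ∀ {a} → a ≋ 0ℤ [mod l ] → χ a ≡ O
    χ≢O          : ∀ {a} → ¬ a ≋ 0ℤ [mod l ] → χ a ≢ O
    χ-1          : χ 1ℤ ≡ I
    χ-neg        : ∀ a → χ (ℤ.- a) ≡ χ a
    χ-nontrivial : ∃[ b ] ¬ b ≋ 0ℤ [mod l ] × χ b ≢ I

conjugate : ∀ {l χ} → IsCubicCharacter l χ → IsCubicCharacter l (λ a → χ a *̄)
conjugate {χ = χ} isχ = record
  { χ-cong = λ e → ≡.cong _*̄ (χ-cong e)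
  ; χ-*    = λ a b → ≡.trans (≡.cong _*̄ (χ-* a b)) (*̄-∙ (χ a) (χ b))
  ; χ-0    = λ e → ≡.cong _*̄ (χ-0 e)
  ; χ≢O    = λ e → *̄-≢O (χ≢O e)
  ; χ-1    = ≡.cong _*̄ χ-1
  ; χ-neg  = λ a → ≡.cong _*̄ (χ-neg a)
  ; χ-nontrivial = proj₁ χ-nontrivial , proj₁ (proj₂ χ-nontrivial) ,
      λ eq → proj₂ (proj₂ χ-nontrivial) (≡.trans (≡.sym (*̄-involutive _)) (≡.cong _*̄ eq))
  }
  where open IsCubicCharacter isχ

record Embedding (S : CommutativeRing c ℓ) : Set (c ⊔ ℓ) where
  open CommutativeRing S
  field
    e   : Value → Carrier
    e-O : e O ≈ 0#
    e-I : e I ≈ 1#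
    e-∙ : ∀ x y → e (x ∙ y) ≈ e x * e y

module GaussSum (S : CommutativeRing c ℓ) (emb : Embedding S)
  {l : ℕ} (l-prime : Prime l) where
  open CommutativeRing S hiding (zero)
  open IntegerCoefficients S using (fromℤ; 1+×; solve; _:=_; _:+_; _:*_; _:-_; :-_; con)
  open Embedding emb
  open SetoidReasoning setoid
  open PrimeField l-prime using (inverse; p-nonZero)
  open GroupRing S l
  open Sum semiring using (sum; sum-cong-≋; ∑-comm; *-distribˡ-sum; ∑-distrib-+)

  gauss : ∀ {χ} → IsCubicCharacter l χ → Periodic S l
  gauss {χ} isχ = periodic (λ a → e (χ a)) λ eq → reflexive (≡.cong e (χ-cong eq))
    where open IsCubicCharacter isχ

  jacobi : ∀ {χ} → IsCubicCharacter l χ → Carrier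
  jacobi isχ = at (gauss isχ ⋆ gauss isχ) 1ℤ

  mono0-⋆ : ∀ s f t → at (mono s 0ℤ ⋆ f) t ≈ s * at f t
  mono0-⋆ s f t = begin
    ∑ ((mono s 0ℤ ⋆ₜ f) t)
      ≈⟨ ∑-single 0ℤ ((mono s 0ℤ ⋆ₜ f) t) (λ x≢0 → trans (*-congʳ (mono-no s 0ℤ x≢0)) (zeroˡ _)) ⟩
    at (mono s 0ℤ) 0ℤ * at f (t ℤ.- 0ℤ)
      ≈⟨ *-cong (mono-yes s 0ℤ {0ℤ} ℤₙ.refl) (cong f (ℤₙ.reflexive (ℤ.+-identityʳ t))) ⟩
    s * at f t ∎

  ∑-const : ∀ n s → sum {n} (λ _ → s) ≈ fromℤ (+ n) * s
  ∑-const zero    s = sym (zeroˡ s)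
  ∑-const (suc n) s = begin
    s + sum {n} (λ _ → s)         ≈⟨ +-cong (sym (*-identityˡ s)) (∑-const n s) ⟩
    1# * s + fromℤ (+ n) * s      ≈⟨ distribʳ s 1# (fromℤ (+ n)) ⟨
    (1# + fromℤ (+ n)) * s        ≈⟨ *-congʳ (1+× n 1#) ⟨
    fromℤ (+ suc n) * s           ∎

  ∑-mono0 : ∀ s → ∑ (mono s 0ℤ) ≈ s
  ∑-mono0 s = trans (∑-single 0ℤ (mono s 0ℤ) (mono-no s 0ℤ)) (mono-yes s 0ℤ {0ℤ} ℤₙ.refl)

  private
    scaled : ∀ t t′ → t ℤ.* t′ ≋ 1ℤ [mod l ] → ∀ f → ∑ (f ∘ₚ affine t 0ℤ) ≈ ∑ f
    scaled t t′ eq f = ∑-affine {t} {t′} eq 0ℤ f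

    mid-lemma : ∀ t y → t ℤ.- (t ℤ.* y ℤ.+ 0ℤ) ≡ t ℤ.* (1ℤ ℤ.- y)
    mid-lemma = ℤ-Solver.solve-∀

  module _ {χ : ℤ → Value} (isχ : IsCubicCharacter l χ) where
    open IsCubicCharacter isχ

    χ-scale : ∀ t y → χ (t ℤ.* y ℤ.+ 0ℤ) ≡ χ t ∙ χ y
    χ-scale t y = ≡.trans (≡.cong χ (ℤ.+-identityʳ (t ℤ.* y))) (χ-* t y)

    χ-scale′ : ∀ t y → χ (t ℤ.- (t ℤ.* y ℤ.+ 0ℤ)) ≡ χ t ∙ χ (1ℤ ℤ.- y)
    χ-scale′ t y = ≡.trans (≡.cong χ (mid-lemma t y)) (χ-* t (1ℤ ℤ.- y))

    ∑-twist : ∃[ x ] x ≢ O × x ≢ I × e x * ∑ (gauss isχ) ≈ ∑ (gauss isχ)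
    ∑-twist with χ-nontrivial
    ... | b , b≢0 , χb≢I with inverse b≢0
    ...   | b′ , bb′ = χ b , χ≢O b≢0 , χb≢I , (begin
      e (χ b) * ∑ (gauss isχ)                  ≈⟨ *-distribˡ-sum {l} (e (χ b)) _ ⟩
      sum {l} (λ i → e (χ b) * e (χ (+ toℕ i)))
        ≈⟨ sum-cong-≋ {l} (λ i → trans (sym (e-∙ (χ b) (χ (+ toℕ i))))
             (reflexive (≡.cong e (≡.sym (χ-scale b (+ toℕ i)))))) ⟩
      ∑ (gauss isχ ∘ₚ affine b 0ℤ)             ≈⟨ scaled b b′ bb′ (gauss isχ) ⟩
      ∑ (gauss isχ)                            ∎)

    module _ (∑χ̄≈0 : ∑ (gauss (conjugate isχ)) ≈ 0#) where

      gauss-square : ∀ t → at (gauss isχ ⋆ gauss isχ) t ≈ jacobi isχ * e (χ t *̄)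
      gauss-square t with _≋?_ {l} t 0ℤ
      ... | yes t≋0 = begin
        ∑ ((gauss isχ ⋆ₜ gauss isχ) t)  ≈⟨ ∑-cong ((gauss isχ ⋆ₜ gauss isχ) t) (gauss (conjugate isχ)) term ⟩
        ∑ (gauss (conjugate isχ))       ≈⟨ ∑χ̄≈0 ⟩
        0#                              ≈⟨ zeroʳ _ ⟨
        jacobi isχ * 0#                 ≈⟨ *-congˡ (trans (reflexive (≡.cong (λ x → e (x *̄)) (χ-0 t≋0))) e-O) ⟨
        jacobi isχ * e (χ t *̄)          ∎
        where
        term : ∀ x → e (χ x) * e (χ (t ℤ.- x)) ≈ e (χ x *̄)
        term x = trans (sym (e-∙ _ _)) (reflexive (≡.cong e
          (≡.trans (≡.cong (χ x ∙_)
            (≡.trans (χ-cong (ℤₙ.trans (ℤₙ.+-congʳ {ℤ.- x} t≋0) (ℤₙ.reflexive (ℤ.+-identityˡ (ℤ.- x))))) (χ-neg x)))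
            (x∙x≡x*̄ (χ x)))))
      ... | no t≢0 with inverse t≢0
      ...   | t′ , tt′ = begin
        ∑ ((gauss isχ ⋆ₜ gauss isχ) t)
          ≈⟨ scaled t t′ tt′ ((gauss isχ ⋆ₜ gauss isχ) t) ⟨
        sum {l} (λ i → e (χ (t ℤ.* + toℕ i ℤ.+ 0ℤ)) * e (χ (t ℤ.- (t ℤ.* + toℕ i ℤ.+ 0ℤ))))
          ≈⟨ sum-cong-≋ {l} (λ i → term (+ toℕ i)) ⟩
        sum {l} (λ i → e (χ t *̄) * (e (χ (+ toℕ i)) * e (χ (1ℤ ℤ.- + toℕ i))))
          ≈⟨ *-distribˡ-sum {l} (e (χ t *̄)) _ ⟨
        e (χ t *̄) * jacobi isχ   ≈⟨ *-comm _ _ ⟩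
        jacobi isχ * e (χ t *̄)   ∎
        where
        term : ∀ y → e (χ (t ℤ.* y ℤ.+ 0ℤ)) * e (χ (t ℤ.- (t ℤ.* y ℤ.+ 0ℤ))) ≈
                     e (χ t *̄) * (e (χ y) * e (χ (1ℤ ℤ.- y)))
        term y = begin
          e (χ (t ℤ.* y ℤ.+ 0ℤ)) * e (χ (t ℤ.- (t ℤ.* y ℤ.+ 0ℤ)))
            ≈⟨ e-∙ _ _ ⟨
          e (χ (t ℤ.* y ℤ.+ 0ℤ) ∙ χ (t ℤ.- (t ℤ.* y ℤ.+ 0ℤ)))
            ≈⟨ reflexive (≡.cong e (≡.trans (≡.cong₂ _∙_ (χ-scale t y) (χ-scale′ t y))
                 (≡.trans (∙-interchange (χ t) (χ y) (χ t) (χ (1ℤ ℤ.- y)))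
                   (≡.cong (_∙ (χ y ∙ χ (1ℤ ℤ.- y))) (x∙x≡x*̄ (χ t)))))) ⟩
          e (χ t *̄ ∙ (χ y ∙ χ (1ℤ ℤ.- y)))
            ≈⟨ trans (e-∙ _ _) (*-congˡ (e-∙ _ _)) ⟩
          e (χ t *̄) * (e (χ y) * e (χ (1ℤ ℤ.- y))) ∎

  module _ {χ : ℤ → Value} (isχ : IsCubicCharacter l χ) where
    open IsCubicCharacter isχ

    private
      g ḡ h : Periodic S l
      g = gauss isχ
      ḡ = gauss (conjugate isχ)
      h = g ⋆ ḡ
      L : Carrier
      L = fromℤ (+ l)

    module _ (∑χ̄≈0 : ∑ (gauss (conjugate isχ)) ≈ 0#)
             (cancel : ∀ x → (L - 1#) * x ≈ 0# → x ≈ 0#) where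

      private
        1-δ : ∀ x → e (χ x) * e (χ x *̄) ≈ 1# + at (mono (- 1#) 0ℤ) x
        1-δ x with _≋?_ {l} x 0ℤ
        ... | yes x≋0 = begin
          e (χ x) * e (χ x *̄)   ≈⟨ *-congʳ (trans (reflexive (≡.cong e (χ-0 x≋0))) e-O) ⟩
          0# * e (χ x *̄)        ≈⟨ zeroˡ _ ⟩
          0#                    ≈⟨ -‿inverseʳ 1# ⟨
          1# - 1#               ∎
        ... | no x≢0 = begin
          e (χ x) * e (χ x *̄)   ≈⟨ e-∙ _ _ ⟨
          e (χ x ∙ χ x *̄)       ≈⟨ reflexive (≡.cong e (≡.trans (∙-comm (χ x) _) (x*̄∙x≡I (χ≢O x≢0)))) ⟩
          e I                   ≈⟨ e-I ⟩
          1#                    ≈⟨ +-identityʳ 1# ⟨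
          1# + 0#               ∎

        h-at-0 : ∀ {t} → t ≋ 0ℤ [mod l ] → at h t ≈ L - 1#
        h-at-0 {t} t≋0 = begin
          at h t
            ≈⟨ sum-cong-≋ {l} (λ i → trans (*-congˡ (reflexive (≡.cong (λ x → e (x *̄)) (neg (+ toℕ i))))) (1-δ (+ toℕ i))) ⟩
          sum {l} (λ i → 1# + at (mono (- 1#) 0ℤ) (+ toℕ i))
            ≈⟨ ∑-distrib-+ {l} (λ _ → 1#) _ ⟩
          sum {l} (λ _ → 1#) + ∑ (mono (- 1#) 0ℤ)
            ≈⟨ +-cong (trans (∑-const l 1#) (*-identityʳ L)) (∑-mono0 (- 1#)) ⟩
          L - 1# ∎
          where
          neg : ∀ x → χ (t ℤ.- x) ≡ χ x
          neg x = ≡.trans (χ-cong (ℤₙ.trans (ℤₙ.+-congʳ {ℤ.- x} t≋0) (ℤₙ.reflexive (ℤ.+-identityˡ (ℤ.- x))))) (χ-neg x)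

        h-const : ∀ {t} → ¬ t ≋ 0ℤ [mod l ] → at h t ≈ at h 1ℤ
        h-const {t} t≢0 with inverse t≢0
        ... | t′ , tt′ = begin
          ∑ ((g ⋆ₜ ḡ) t)
            ≈⟨ scaled t t′ tt′ ((g ⋆ₜ ḡ) t) ⟨
          sum {l} (λ i → e (χ (t ℤ.* + toℕ i ℤ.+ 0ℤ)) * e (χ (t ℤ.- (t ℤ.* + toℕ i ℤ.+ 0ℤ)) *̄))
            ≈⟨ sum-cong-≋ {l} (λ i → term (+ toℕ i)) ⟩
          at h 1ℤ ∎
          where
          term : ∀ y → e (χ (t ℤ.* y ℤ.+ 0ℤ)) * e (χ (t ℤ.- (t ℤ.* y ℤ.+ 0ℤ)) *̄) ≈ e (χ y) * e (χ (1ℤ ℤ.- y) *̄)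
          term y = begin
            e (χ (t ℤ.* y ℤ.+ 0ℤ)) * e (χ (t ℤ.- (t ℤ.* y ℤ.+ 0ℤ)) *̄)
              ≈⟨ e-∙ _ _ ⟨
            e (χ (t ℤ.* y ℤ.+ 0ℤ) ∙ χ (t ℤ.- (t ℤ.* y ℤ.+ 0ℤ)) *̄)
              ≈⟨ reflexive (≡.cong e (≡.trans
                   (≡.cong₂ (λ x z → x ∙ z *̄) (χ-scale isχ t y) (χ-scale′ isχ t y)) (≡.trans
                   (≡.cong (χ t ∙ χ y ∙_) (*̄-∙ (χ t) _)) (≡.trans
                   (∙-interchange (χ t) (χ y) (χ t *̄) (χ (1ℤ ℤ.- y) *̄))
                   (≡.cong (_∙ (χ y ∙ χ (1ℤ ℤ.- y) *̄))
                     (≡.trans (∙-comm (χ t) _) (x*̄∙x≡I (χ≢O t≢0)))))))) ⟩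
            e (χ y ∙ χ (1ℤ ℤ.- y) *̄)
              ≈⟨ e-∙ _ _ ⟩
            e (χ y) * e (χ (1ℤ ℤ.- y) *̄) ∎

        c₁ : Carrier
        c₁ = at h 1ℤ

        h-shape : ∀ t → at h t ≈ c₁ + at (mono (L - 1# - c₁) 0ℤ) t
        h-shape t with _≋?_ {l} t 0ℤ
        ... | yes t≋0 = trans (h-at-0 t≋0) (solve 2 (λ a b → a := b :+ (a :- b)) refl (L - 1#) c₁)
        ... | no t≢0  = trans (h-const t≢0) (sym (+-identityʳ c₁))

        ∑h≈0 : ∑ h ≈ 0#
        ∑h≈0 = begin
          sum {l} (λ t → sum {l} (λ x → e (χ (+ toℕ x)) * at ḡ (+ toℕ t ℤ.- + toℕ x)))
            ≈⟨ ∑-comm {l} {l} _ ⟩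
          sum {l} (λ x → sum {l} (λ t → e (χ (+ toℕ x)) * at ḡ (+ toℕ t ℤ.- + toℕ x)))
            ≈⟨ sum-cong-≋ {l} (λ x → inner (e (χ (+ toℕ x))) (+ toℕ x)) ⟩
          sum {l} (λ _ → 0#)
            ≈⟨ trans (∑-const l 0#) (zeroʳ L) ⟩
          0# ∎
          where
          inner : ∀ s x → sum {l} (λ t → s * at ḡ (+ toℕ t ℤ.- x)) ≈ 0#
          inner s x = begin
            sum {l} (λ t → s * at ḡ (+ toℕ t ℤ.- x))     ≈⟨ *-distribˡ-sum {l} s _ ⟨
            s * sum {l} (λ t → at ḡ (+ toℕ t ℤ.- x))
              ≈⟨ *-congˡ (sum-cong-≋ {l} λ t → cong ḡ (ℤₙ.reflexive (≡.cong (ℤ._- x) (≡.sym (ℤ.*-identityˡ (+ toℕ t)))))) ⟩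
            s * ∑ (ḡ ∘ₚ affine 1ℤ (ℤ.- x))               ≈⟨ *-congˡ (trans (∑-translate (ℤ.- x) ḡ) ∑χ̄≈0) ⟩
            s * 0#                                       ≈⟨ zeroʳ s ⟩
            0#                                           ∎

        c₁≈-1 : c₁ ≈ - 1#
        c₁≈-1 = begin
          c₁               ≈⟨ solve 1 (λ x → x := (x :+ con 1ℤ) :- con 1ℤ) refl c₁ ⟩
          (c₁ + 1#) - 1#   ≈⟨ +-congʳ (cancel (c₁ + 1#) (begin
            (L - 1#) * (c₁ + 1#)
              ≈⟨ solve 2 (λ L x → (L :- con 1ℤ) :* (x :+ con 1ℤ) := L :* x :+ (L :- con 1ℤ :- x)) refl L c₁ ⟩
            L * c₁ + (L - 1# - c₁)
              ≈⟨ +-cong (∑-const l c₁) (∑-mono0 (L - 1# - c₁)) ⟨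
            sum {l} (λ _ → c₁) + ∑ (mono (L - 1# - c₁) 0ℤ)
              ≈⟨ ∑-distrib-+ {l} (λ _ → c₁) _ ⟨
            sum {l} (λ t → c₁ + at (mono (L - 1# - c₁) 0ℤ) (+ toℕ t))
              ≈⟨ sum-cong-≋ {l} (λ t → h-shape (+ toℕ t)) ⟨
            ∑ h   ≈⟨ ∑h≈0 ⟩
            0# ∎)) ⟩
          0# - 1#          ≈⟨ +-identityˡ _ ⟩
          - 1#             ∎

      gauss-conj : ∀ {t} → ¬ t ≋ 0ℤ [mod l ] → at (gauss isχ ⋆ gauss (conjugate isχ)) t ≈ - 1#
      gauss-conj t≢0 = trans (h-const t≢0) c₁≈-1

      private
        h-shape′ : ∀ t → at h t ≈ at (mono L 0ℤ) t - 1#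
        h-shape′ t with _≋?_ {l} t 0ℤ
        ... | yes t≋0 = h-at-0 t≋0
        ... | no t≢0  = trans (gauss-conj t≢0) (sym (+-identityˡ _))

        1≢0 : ¬ 1ℤ ≋ 0ℤ [mod l ]
        1≢0 eq = PrimeField.0≉1 l-prime (ℤₙ.sym eq)

        h⋆h : at (h ⋆ h) 1ℤ ≈ - L
        h⋆h = begin
          sum {l} (λ x → at h (+ toℕ x) * at h (1ℤ ℤ.- + toℕ x))
            ≈⟨ sum-cong-≋ {l} (λ x → trans (*-congʳ (h-shape′ (+ toℕ x)))
                 (solve 2 (λ a b → (a :- con 1ℤ) :* b := a :* b :+ (:- con 1ℤ) :* b) refl
                   (at (mono L 0ℤ) (+ toℕ x)) (at h (1ℤ ℤ.- + toℕ x)))) ⟩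
          sum {l} (λ x → at (mono L 0ℤ) (+ toℕ x) * at h (1ℤ ℤ.- + toℕ x) + (- 1#) * at h (1ℤ ℤ.- + toℕ x))
            ≈⟨ ∑-distrib-+ {l} _ _ ⟩
          at (mono L 0ℤ ⋆ h) 1ℤ + sum {l} (λ x → (- 1#) * at h (1ℤ ℤ.- + toℕ x))
            ≈⟨ +-cong (mono0-⋆ L h 1ℤ) (sym (*-distribˡ-sum {l} (- 1#) _)) ⟩
          L * at h 1ℤ + (- 1#) * sum {l} (λ x → at h (1ℤ ℤ.- + toℕ x))
            ≈⟨ +-cong (*-congˡ c₁≈-1) (*-congˡ (trans
                 (sum-cong-≋ {l} λ x → cong h (ℤₙ.reflexive (lemma (+ toℕ x))))
                 (trans (∑-reflect 1ℤ h) ∑h≈0))) ⟩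
          L * (- 1#) + (- 1#) * 0#
            ≈⟨ solve 1 (λ L → L :* (:- con 1ℤ) :+ (:- con 1ℤ) :* con 0ℤ := :- L) refl L ⟩
          - L ∎
          where
          lemma : ∀ x → 1ℤ ℤ.- x ≡ ℤ.- 1ℤ ℤ.* x ℤ.+ 1ℤ
          lemma = ℤ-Solver.solve-∀

      jacobi-norm : ∑ g ≈ 0# → jacobi isχ * jacobi (conjugate isχ) ≈ L
      jacobi-norm ∑χ≈0 = begin
        J * J̄              ≈⟨ solve 1 (λ x → x := :- (x :* (:- con 1ℤ))) refl (J * J̄) ⟩
        - (J * J̄ * - 1#)   ≈⟨ -‿cong (*-congˡ c₁≈-1) ⟨
        - (J * J̄ * at h 1ℤ)
          ≈⟨ -‿cong (mono0-⋆ (J * J̄) h 1ℤ) ⟨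
        - at (mono (J * J̄) 0ℤ ⋆ h) 1ℤ
          ≈⟨ -‿cong (G.*-congʳ {h} {mono J 0ℤ ⋆ mono J̄ 0ℤ} {mono (J * J̄) 0ℤ} (mono-* J 0ℤ J̄ 0ℤ) 1ℤ) ⟨
        - at ((mono J 0ℤ ⋆ mono J̄ 0ℤ) ⋆ (g ⋆ ḡ)) 1ℤ
          ≈⟨ -‿cong (GS.solve 4 (λ a b x y → (a GS.:* b) GS.:* (x GS.:* y) GS.:= (a GS.:* y) GS.:* (b GS.:* x)) (λ _ → refl)
               (mono J 0ℤ) (mono J̄ 0ℤ) g ḡ 1ℤ) ⟩
        - at ((mono J 0ℤ ⋆ ḡ) ⋆ (mono J̄ 0ℤ ⋆ g)) 1ℤ
          ≈⟨ -‿cong (G.*-cong {g ⋆ g} {mono J 0ℤ ⋆ ḡ} {ḡ ⋆ ḡ} {mono J̄ 0ℤ ⋆ g} g² ḡ² 1ℤ) ⟨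
        - at ((g ⋆ g) ⋆ (ḡ ⋆ ḡ)) 1ℤ
          ≈⟨ -‿cong (GS.solve 2 (λ x y → (x GS.:* x) GS.:* (y GS.:* y) GS.:= (x GS.:* y) GS.:* (x GS.:* y)) (λ _ → refl) g ḡ 1ℤ) ⟩
        - at (h ⋆ h) 1ℤ    ≈⟨ -‿cong h⋆h ⟩
        - (- L)            ≈⟨ solve 1 (λ x → :- (:- x) := x) refl L ⟩
        L                  ∎
        where
        module GS = IntegerCoefficients ring[ℤ/n]
        J = jacobi isχ
        J̄ = jacobi (conjugate isχ)
        g² : g ⋆ g G.≈ mono J 0ℤ ⋆ ḡ
        g² t = trans (gauss-square isχ ∑χ̄≈0 t) (sym (mono0-⋆ J ḡ t))
        ∑χ̄̄≈0 : ∑ (gauss (conjugate (conjugate isχ))) ≈ 0#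
        ∑χ̄̄≈0 = trans (∑-cong (gauss (conjugate (conjugate isχ))) g
          (λ t → reflexive (≡.cong e (*̄-involutive (χ t))))) ∑χ≈0
        ḡ² : ḡ ⋆ ḡ G.≈ mono J̄ 0ℤ ⋆ g
        ḡ² t = trans (gauss-square (conjugate isχ) ∑χ̄̄≈0 t)
          (trans (*-congˡ (reflexive (≡.cong e (*̄-involutive (χ t))))) (sym (mono0-⋆ J̄ g t)))

module _ (R : CommutativeRing c ℓ) where
  open CommutativeRing R hiding (zero)
  open Exp commutativeSemiring
  open IntegerCoefficients R
  open SetoidReasoning setoid

  module _ {g h j j′ λ′ : Carrier} (g² : g * g ≈ j * h) (h² : h * h ≈ j′ * g) (jj′ : j * j′ ≈ λ′) where

    fourth-power : g ^ 4 ≈ λ′ * j * g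
    fourth-power = begin
      g ^ 4                 ≈⟨ solve 1 (λ g → g :^ 4 := (g :* g) :* (g :* g)) refl g ⟩
      (g * g) * (g * g)     ≈⟨ *-cong g² g² ⟩
      (j * h) * (j * h)     ≈⟨ solve 2 (λ j h → (j :* h) :* (j :* h) := (j :* j) :* (h :* h)) refl j h ⟩
      (j * j) * (h * h)     ≈⟨ *-congˡ h² ⟩
      (j * j) * (j′ * g)    ≈⟨ solve 3 (λ j j′ g → (j :* j) :* (j′ :* g) := ((j :* j′) :* j) :* g) refl j j′ g ⟩
      j * j′ * j * g        ≈⟨ *-congʳ (*-congʳ jj′) ⟩
      λ′ * j * g            ∎

    power-1+3m : ∀ m → g ^ (1 ℕ.+ 3 ℕ.* m) ≈ (λ′ * j) ^ m * g
    power-1+3m zero    = trans (*-identityʳ g) (sym (*-identityˡ g))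
    power-1+3m (suc m) = begin
      g ^ (1 ℕ.+ 3 ℕ.* suc m)          ≡⟨ ≡.cong (λ n → g ^ (1 ℕ.+ n)) (ℕ.*-suc 3 m) ⟩
      g ^ (3 ℕ.+ (1 ℕ.+ 3 ℕ.* m))      ≈⟨ ^-homo-* g 3 (1 ℕ.+ 3 ℕ.* m) ⟩
      g ^ 3 * g ^ (1 ℕ.+ 3 ℕ.* m)      ≈⟨ *-congˡ (power-1+3m m) ⟩
      g ^ 3 * ((λ′ * j) ^ m * g)
        ≈⟨ solve 2 (λ g x → g :^ 3 :* (x :* g) := x :* g :^ 4) refl g ((λ′ * j) ^ m) ⟩
      (λ′ * j) ^ m * g ^ 4             ≈⟨ *-congˡ fourth-power ⟩
      (λ′ * j) ^ m * (λ′ * j * g)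
        ≈⟨ solve 3 (λ g x y → x :* (y :* g) := (y :* x) :* g) refl g ((λ′ * j) ^ m) (λ′ * j) ⟩
      (λ′ * j) ^ suc m * g             ∎

    power-2+3m : ∀ m → g ^ (2 ℕ.+ 3 ℕ.* m) ≈ (λ′ * j) ^ m * j * h
    power-2+3m m = begin
      g * g ^ (1 ℕ.+ 3 ℕ.* m)        ≈⟨ *-congˡ (power-1+3m m) ⟩
      g * ((λ′ * j) ^ m * g)         ≈⟨ solve 2 (λ g x → g :* (x :* g) := x :* (g :* g)) refl g ((λ′ * j) ^ m) ⟩
      (λ′ * j) ^ m * (g * g)         ≈⟨ *-congˡ g² ⟩
      (λ′ * j) ^ m * (j * h)         ≈⟨ *-assoc _ _ _ ⟨
      (λ′ * j) ^ m * j * h           ∎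

  module _ {J J′ J″ L L′ x x̄ : Carrier} (J′≈J″ : J′ ≈ J″) (LL′ : L * L′ ≈ 1#) (xx̄ : x * x̄ ≈ 1#) (x̄x̄ : x̄ * x̄ ≈ x) where

    private
      cancel-L : ∀ m {a b} → (L * J) ^ m * a ≈ (L * J′) ^ m * b → J ^ m * a ≈ J′ ^ m * b
      cancel-L m {a} {b} eq = begin
        J ^ m * a                            ≈⟨ L-out J a ⟩
        L′ ^ m * ((L * J) ^ m * a)           ≈⟨ *-congˡ eq ⟩
        L′ ^ m * ((L * J′) ^ m * b)          ≈⟨ L-out J′ b ⟨
        J′ ^ m * b                           ∎
        where
        L-out : ∀ J a → J ^ m * a ≈ L′ ^ m * ((L * J) ^ m * a)
        L-out J a = begin
          J ^ m * a                            ≈⟨ *-identityˡ _ ⟨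
          1# * (J ^ m * a)                     ≈⟨ *-congʳ (trans (^-congˡ m LL′) (1^≈1 R m)) ⟨
          (L * L′) ^ m * (J ^ m * a)           ≈⟨ *-congʳ (^-distrib-* L L′ m) ⟩
          (L ^ m * L′ ^ m) * (J ^ m * a)
            ≈⟨ solve 4 (λ l k j a → (l :* k) :* (j :* a) := k :* ((l :* j) :* a)) refl (L ^ m) (L′ ^ m) (J ^ m) a ⟩
          L′ ^ m * ((L ^ m * J ^ m) * a)       ≈⟨ *-congˡ (*-congʳ (^-distrib-* L J m)) ⟨
          L′ ^ m * ((L * J) ^ m * a)           ∎

    ratio-1+3m : ∀ m → (L * J) ^ m * x ≈ 1# → (L * J′) ^ m * x̄ ≈ 1# → J ^ m ≈ x * J″ ^ m
    ratio-1+3m m eq eq′ = begin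
      J ^ m                 ≈⟨ *-identityʳ _ ⟨
      J ^ m * 1#            ≈⟨ *-congˡ xx̄ ⟨
      J ^ m * (x * x̄)       ≈⟨ *-assoc _ _ _ ⟨
      J ^ m * x * x̄         ≈⟨ *-congʳ (cancel-L m (trans eq (sym eq′))) ⟩
      J′ ^ m * x̄ * x̄        ≈⟨ *-assoc _ _ _ ⟩
      J′ ^ m * (x̄ * x̄)      ≈⟨ *-congˡ x̄x̄ ⟩
      J′ ^ m * x            ≈⟨ *-comm _ _ ⟩
      x * J′ ^ m            ≈⟨ *-congˡ (^-congˡ m J′≈J″) ⟩
      x * J″ ^ m            ∎

    ratio-2+3m : ∀ m → (L * J) ^ m * J * x̄ ≈ 1# → (L * J′) ^ m * J′ * x ≈ 1# → J″ ^ suc m ≈ x * J ^ suc m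
    ratio-2+3m m eq eq′ = sym (begin
      x * (J * J ^ m)           ≈⟨ *-congʳ x̄x̄ ⟨
      x̄ * x̄ * (J * J ^ m)
        ≈⟨ solve 3 (λ x j k → (x :* x) :* (j :* k) := (k :* (j :* x)) :* x) refl x̄ J (J ^ m) ⟩
      J ^ m * (J * x̄) * x̄
        ≈⟨ *-congʳ (cancel-L m (trans (sym (*-assoc _ _ _)) (trans (trans eq (sym eq′)) (*-assoc _ _ _)))) ⟩
      J′ ^ m * (J′ * x) * x̄
        ≈⟨ solve 4 (λ x x̄ j k → (k :* (j :* x)) :* x̄ := (j :* k) :* (x :* x̄)) refl x x̄ J′ (J′ ^ m) ⟩
      J′ * J′ ^ m * (x * x̄)     ≈⟨ *-congˡ xx̄ ⟩
      J′ * J′ ^ m * 1#          ≈⟨ *-identityʳ _ ⟩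
      J′ ^ suc m                ≈⟨ ^-congˡ (suc m) J′≈J″ ⟩
      J″ ^ suc m                ∎)

module GaussPower (S : CommutativeRing c ℓ) (emb : Embedding S) {l : ℕ} (l-prime : Prime l) where
  open CommutativeRing S hiding (zero)
  open IntegerCoefficients S using (fromℤ)
  open Exp commutativeSemiring using (_^_; ^-congˡ)
  open Embedding emb
  open SetoidReasoning setoid
  open PrimeField l-prime using (p-nonZero)
  open GroupRing S l
  open GaussSum S emb l-prime
  open Exp G.commutativeSemiring using () renaming (_^_ to _^ᴳ_)

  module _ {χ : ℤ → Value} (isχ : IsCubicCharacter l χ)
    (∑χ≈0 : ∑ (gauss isχ) ≈ 0#) (∑χ̄≈0 : ∑ (gauss (conjugate isχ)) ≈ 0#)
    {L : Carrier} (JJ̄≈L : jacobi isχ * jacobi (conjugate isχ) ≈ L)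
    {q : ℕ} (q-prime : Prime q) (char-q : fromℤ (+ q) ≈ 0#)
    (q-cancel : ∀ {i j} → + q ℤ.* i ≋ + q ℤ.* j [mod l ] → i ≋ j [mod l ]) where
    open IsCubicCharacter isχ

    private
      g ḡ : Periodic S l
      g = gauss isχ
      ḡ = gauss (conjugate isχ)
      J J̄ : Carrier
      J = jacobi isχ
      J̄ = jacobi (conjugate isχ)

      g² : g ⋆ g G.≈ mono J 0ℤ ⋆ ḡ
      g² t = trans (gauss-square isχ ∑χ̄≈0 t) (sym (mono0-⋆ J ḡ t))

      ḡ² : ḡ ⋆ ḡ G.≈ mono J̄ 0ℤ ⋆ g
      ḡ² t = trans
        (gauss-square (conjugate isχ) (trans (∑-cong (gauss (conjugate (conjugate isχ))) g
          (λ t → reflexive (≡.cong e (*̄-involutive (χ t))))) ∑χ≈0) t)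
        (trans (*-congˡ (reflexive (≡.cong e (*̄-involutive (χ t))))) (sym (mono0-⋆ J̄ g t)))

      jj̄ : mono J 0ℤ ⋆ mono J̄ 0ℤ G.≈ mono L 0ℤ
      jj̄ t = trans (mono-* J 0ℤ J̄ 0ℤ t) (mono-cong JJ̄≈L ≡.refl t)

      power : ∀ m → (mono L 0ℤ ⋆ mono J 0ℤ) ^ᴳ m G.≈ mono ((L * J) ^ m) 0ℤ
      power m t = trans (^ᴳ-congˡ m {mono L 0ℤ ⋆ mono J 0ℤ} {mono (L * J) 0ℤ} (mono-* L 0ℤ J 0ℤ) t)
        (trans (mono-^ (L * J) 0ℤ m t) (mono-cong refl (ℤ.*-zeroʳ (+ m)) t))
        where open Exp G.commutativeSemiring using () renaming (^-congˡ to ^ᴳ-congˡ)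

      at-q : at (g ^ᴳ q) (+ q ℤ.* 1ℤ) ≈ 1#
      at-q = trans (power-at-q q-prime char-q q-cancel g 1ℤ)
        (trans (^-congˡ q (trans (reflexive (≡.cong e χ-1)) e-I)) (1^≈1 S q))

      χ-q : ∀ {f : Value → Value} → e (f (χ (+ q ℤ.* 1ℤ))) ≈ e (f (χ (+ q)))
      χ-q {f} = reflexive (≡.cong (λ i → e (f (χ i))) (ℤ.*-identityʳ (+ q)))

    jacobi-power-1+3m : ∀ m → q ≡ 1 ℕ.+ 3 ℕ.* m → (L * J) ^ m * e (χ (+ q)) ≈ 1#
    jacobi-power-1+3m m q≡ = begin
      (L * J) ^ m * e (χ (+ q))
        ≈⟨ *-congˡ (χ-q {id}) ⟨
      (L * J) ^ m * at g q′
        ≈⟨ mono0-⋆ ((L * J) ^ m) g q′ ⟨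
      at (mono ((L * J) ^ m) 0ℤ ⋆ g) q′
        ≈⟨ G.*-congʳ {g} {(mono L 0ℤ ⋆ mono J 0ℤ) ^ᴳ m} {mono ((L * J) ^ m) 0ℤ} (power m) q′ ⟨
      at ((mono L 0ℤ ⋆ mono J 0ℤ) ^ᴳ m ⋆ g) q′
        ≈⟨ power-1+3m ring[ℤ/n] {g} {ḡ} {mono J 0ℤ} {mono J̄ 0ℤ} {mono L 0ℤ} g² ḡ² jj̄ m q′ ⟨
      at (g ^ᴳ (1 ℕ.+ 3 ℕ.* m)) q′
        ≡⟨ ≡.cong (λ n → at (g ^ᴳ n) q′) q≡ ⟨
      at (g ^ᴳ q) q′   ≈⟨ at-q ⟩
      1#               ∎
      where q′ = + q ℤ.* 1ℤ

    jacobi-power-2+3m : ∀ m → q ≡ 2 ℕ.+ 3 ℕ.* m → (L * J) ^ m * J * e (χ (+ q) *̄) ≈ 1#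
    jacobi-power-2+3m m q≡ = begin
      (L * J) ^ m * J * e (χ (+ q) *̄)
        ≈⟨ *-congˡ (χ-q {_*̄}) ⟨
      (L * J) ^ m * J * at ḡ q′
        ≈⟨ mono0-⋆ ((L * J) ^ m * J) ḡ q′ ⟨
      at (mono ((L * J) ^ m * J) 0ℤ ⋆ ḡ) q′
        ≈⟨ G.*-congʳ {ḡ} {(mono L 0ℤ ⋆ mono J 0ℤ) ^ᴳ m ⋆ mono J 0ℤ} {mono ((L * J) ^ m * J) 0ℤ} power-j q′ ⟨
      at ((mono L 0ℤ ⋆ mono J 0ℤ) ^ᴳ m ⋆ mono J 0ℤ ⋆ ḡ) q′
        ≈⟨ power-2+3m ring[ℤ/n] {g} {ḡ} {mono J 0ℤ} {mono J̄ 0ℤ} {mono L 0ℤ} g² ḡ² jj̄ m q′ ⟨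
      at (g ^ᴳ (2 ℕ.+ 3 ℕ.* m)) q′
        ≡⟨ ≡.cong (λ n → at (g ^ᴳ n) q′) q≡ ⟨
      at (g ^ᴳ q) q′   ≈⟨ at-q ⟩
      1#               ∎
      where
      q′ = + q ℤ.* 1ℤ
      power-j : (mono L 0ℤ ⋆ mono J 0ℤ) ^ᴳ m ⋆ mono J 0ℤ G.≈ mono ((L * J) ^ m * J) 0ℤ
      power-j t = trans
        (G.*-congʳ {mono J 0ℤ} {(mono L 0ℤ ⋆ mono J 0ℤ) ^ᴳ m} {mono ((L * J) ^ m) 0ℤ} (power m) t)
        (mono-* ((L * J) ^ m) 0ℤ J 0ℤ t)

    jacobi-cube : q ≡ 3 → J * at (g ⋆ ḡ) (+ q ℤ.* 1ℤ) ≈ 1#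
    jacobi-cube q≡3 = begin
      J * at (g ⋆ ḡ) q′                ≈⟨ mono0-⋆ J (g ⋆ ḡ) q′ ⟨
      at (mono J 0ℤ ⋆ (g ⋆ ḡ)) q′
        ≈⟨ GS.solve 3 (λ j g h → j GS.:* (g GS.:* h) GS.:= g GS.:* (j GS.:* h)) (λ _ → refl) (mono J 0ℤ) g ḡ q′ ⟩
      at (g ⋆ (mono J 0ℤ ⋆ ḡ)) q′
        ≈⟨ G.*-congˡ {g} {g ⋆ g} {mono J 0ℤ ⋆ ḡ} g² q′ ⟨
      at (g ⋆ (g ⋆ g)) q′
        ≈⟨ GS.solve 1 (λ g → g GS.:* (g GS.:* g) GS.:= g GS.:^ 3) (λ _ → refl) g q′ ⟩
      at (g ^ᴳ 3) q′
        ≡⟨ ≡.cong (λ n → at (g ^ᴳ n) q′) q≡3 ⟨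
      at (g ^ᴳ q) q′                   ≈⟨ at-q ⟩
      1#                               ∎
      where
      q′ = + q ℤ.* 1ℤ
      module GS = IntegerCoefficients ring[ℤ/n]

module 𝔼/ (q : ℕ) where
  open Eisenstein (ℤ/ q) public
  open CommutativeRing Eis public hiding (zero)
  open Exp commutativeSemiring public using (_^_)

-- 𝔼 and 𝔼/ q have the same carrier and operations, so sums evaluated over ℤ remain valid modulo q.
mod : ∀ q {x y} → x 𝔼.≈ y → 𝔼/._≈_ q x y
mod q (eq , eq′) = CommutativeRing.reflexive (ℤ/ q) eq , CommutativeRing.reflexive (ℤ/ q) eq′

embedding : Embedding 𝔼.Eis
embedding = record { e = emb ; e-O = 𝔼.refl ; e-I = 𝔼.refl ; e-∙ = emb-∙ }

embedding/ : ∀ q → Embedding (𝔼/.Eis q)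
embedding/ q = record
  { e   = emb
  ; e-O = 𝔼/.refl q
  ; e-I = 𝔼/.refl q
  ; e-∙ = λ x y → mod q (emb-∙ x y)
  }

module _ (R : CommutativeRing c ℓ) where
  open Eisenstein R
  open Sum E.semiring using (sum)
  open CommutativeRing R using (0#)
  open IntegerCoefficients R using (fromℤ; 1+×)
  private module ℤE = IntegerCoefficients Eis

  conj-sum : ∀ {n} (f : Fin n → E.Carrier) → (sum f) ̄ E.≈ sum (λ i → (f i) ̄)
  conj-sum {zero}  f = conj-scalar 0#
  conj-sum {suc n} f = E.trans (conj-+ (f zero) _) (E.+-congˡ (conj-sum (f ∘ suc)))

  fromℕ-scalar : ∀ n → ℤE.fromℤ (+ n) E.≈ scalar (fromℤ (+ n))
  fromℕ-scalar zero    = E.refl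
  fromℕ-scalar (suc n) = E.trans (ℤE.1+× n E.1#) (E.trans (E.+-congˡ (fromℕ-scalar n))
    (E.trans (E.sym (scalar-+ _ _)) (scalar-cong (CommutativeRing.sym R (1+× n _)))))

cube-root-fixed⇒0 : ∀ x → x ≢ O → x ≢ I → ∀ s → emb x 𝔼.* s 𝔼.≈ s → s 𝔼.≈ 𝔼.0#
cube-root-fixed⇒0 O  x≢O _   s eq = contradiction ≡.refl x≢O
cube-root-fixed⇒0 I  _   x≢I s eq = contradiction ≡.refl x≢I
cube-root-fixed⇒0 W  _   _   (a , b) (e₁ , e₂) = a≡0 , b≡0
  where
  -b≡a : ℤ.- b ≡ a
  -b≡a = ≡.trans (lemma a b) e₁
    where
    lemma : ∀ a b → ℤ.- b ≡ 0ℤ ℤ.* a ℤ.- 1ℤ ℤ.* b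
    lemma = ℤ-Solver.solve-∀
  3b≡0 : + 3 ℤ.* b ≡ 0ℤ
  3b≡0 = begin
    + 3 ℤ.* b                                             ≡⟨ lemma₁ b ⟩
    b ℤ.- (0ℤ ℤ.* b ℤ.+ 1ℤ ℤ.* (ℤ.- b) ℤ.- 1ℤ ℤ.* b)      ≡⟨ ≡.cong (λ a → b ℤ.- (0ℤ ℤ.* b ℤ.+ 1ℤ ℤ.* a ℤ.- 1ℤ ℤ.* b)) -b≡a ⟩
    b ℤ.- (0ℤ ℤ.* b ℤ.+ 1ℤ ℤ.* a ℤ.- 1ℤ ℤ.* b)            ≡⟨ ≡.cong (ℤ._-_ b) e₂ ⟩
    b ℤ.- b                                               ≡⟨ ℤ.+-inverseʳ b ⟩
    0ℤ                                                    ∎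
    where
    open ≡.≡-Reasoning
    lemma₁ : ∀ b → + 3 ℤ.* b ≡ b ℤ.- (0ℤ ℤ.* b ℤ.+ 1ℤ ℤ.* (ℤ.- b) ℤ.- 1ℤ ℤ.* b)
    lemma₁ = ℤ-Solver.solve-∀
  b≡0 : b ≡ 0ℤ
  b≡0 with ℤ.i*j≡0⇒i≡0∨j≡0 (+ 3) 3b≡0
  ... | inj₂ b≡0 = b≡0
  a≡0 : a ≡ 0ℤ
  a≡0 = ≡.trans (≡.sym -b≡a) (≡.cong ℤ.-_ b≡0)
cube-root-fixed⇒0 W² _   _   s eq = cube-root-fixed⇒0 W (λ ()) (λ ()) s
  (𝔼.trans (𝔼.*-congˡ {emb W} (𝔼.sym eq)) (𝔼.trans (𝔼.sym (𝔼.*-assoc (emb W) (emb W²) s)) (𝔼.*-identityˡ s)))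

-- x is the cubic residue symbol of u modulo the rational prime q ≠ 3.  If q = ππ̄ ≡ 1 (mod 3),
-- then (u/q) = (u/π)(u/π̄) is (u/ū)^((q−1)/3); if q ≡ 2, then u^q ≡ ū, and u^((q²−1)/3) is
-- (ū/u)^((q+1)/3).
Recip : ℕ → ℤ × ℤ → Value → Set
Recip q u x =
  (∀ m → q ≡ 1 ℕ.+ 3 ℕ.* m → u ^ m ≈ emb x * (u ̄) ^ m) ×
  (∀ m → q ≡ 2 ℕ.+ 3 ℕ.* m → (u ̄) ^ suc m ≈ emb x * u ^ suc m)
  where open 𝔼/ q

module Jacobi {l : ℕ} (l-prime : Prime l) where
  open PrimeField l-prime using (p-nonZero; *-cancelˡ)
  private
    module Z = GaussSum 𝔼.Eis embedding l-prime
    module ZG = GroupRing 𝔼.Eis l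
    open ZG using () renaming (_⋆_ to infixl 7 _⋆ᶻ_)

    ∑χ≈0 : ∀ {χ} (isχ : IsCubicCharacter l χ) → ZG.∑ (Z.gauss isχ) 𝔼.≈ 𝔼.0#
    ∑χ≈0 isχ = fixed⇒0 (Z.∑-twist isχ)
      where
      fixed⇒0 : ∀ {s} → ∃[ x ] x ≢ O × x ≢ I × emb x 𝔼.* s 𝔼.≈ s → s 𝔼.≈ 𝔼.0#
      fixed⇒0 {s} (x , x≢O , x≢I , eq) = cube-root-fixed⇒0 x x≢O x≢I s eq

    L≈ : IntegerCoefficients.fromℤ 𝔼.Eis (+ l) 𝔼.≈ 𝔼.scalar (+ l)
    L≈ = 𝔼.trans (fromℕ-scalar ℤ.+-*-commutativeRing l) (𝔼.scalar-cong (ℤ-id l))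
      where
      open IntegerCoefficients ℤ.+-*-commutativeRing using (fromℤ)
      ℤ-id : ∀ n → fromℤ (+ n) ≡ + n
      ℤ-id zero          = ≡.refl
      ℤ-id (suc zero)    = ≡.refl
      ℤ-id (suc (suc n)) = ≡.trans (≡.cong (ℤ._+ 1ℤ) (ℤ-id (suc n))) (≡.cong +_ (ℕ.+-comm (suc n) 1))

    cancel : ∀ x → (IntegerCoefficients.fromℤ 𝔼.Eis (+ l) 𝔼.- 𝔼.1#) 𝔼.* x 𝔼.≈ 𝔼.0# → x 𝔼.≈ 𝔼.0#
    cancel x@(a , b) eq = zero-of a (proj₁ eq′) , zero-of b (proj₂ eq′)
      where
      L-1≈ : 𝔼.scalar (+ l ℤ.- 1ℤ) 𝔼.≈ IntegerCoefficients.fromℤ 𝔼.Eis (+ l) 𝔼.- 𝔼.1#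
      L-1≈ = 𝔼.sym (𝔼.+-congʳ {𝔼.- 𝔼.1#} L≈)
      eq′ : ((+ l ℤ.- 1ℤ) ℤ.* a , (+ l ℤ.- 1ℤ) ℤ.* b) 𝔼.≈ 𝔼.0#
      eq′ = 𝔼.trans (𝔼.sym (𝔼.scalar*-≈ (+ l ℤ.- 1ℤ) x)) (𝔼.trans (𝔼.*-congʳ {x} L-1≈) eq)
      zero-of : ∀ a → (+ l ℤ.- 1ℤ) ℤ.* a ≡ 0ℤ → a ≡ 0ℤ
      zero-of a eq with ℤ.i*j≡0⇒i≡0∨j≡0 (+ l ℤ.- 1ℤ) eq
      ... | inj₂ a≡0   = a≡0
      ... | inj₁ l-1≡0 = contradiction (≡.subst Prime (ℤ.+-injective (ℤ.i-j≡0⇒i≡j (+ l) 1ℤ l-1≡0)) l-prime) ¬prime[1]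

  J : ∀ {χ} → IsCubicCharacter l χ → ℤ × ℤ
  J = Z.jacobi

  private
    conj-emb : ∀ x y → 𝔼._̄ (emb x 𝔼.* emb y) 𝔼.≈ emb (x *̄) 𝔼.* emb (y *̄)
    conj-emb x y = 𝔼.trans {i} {emb x 𝔼.̄ 𝔼.* emb y 𝔼.̄} {k} (𝔼.conj-* (emb x) (emb y))
      (𝔼.sym {k} {emb x 𝔼.̄ 𝔼.* emb y 𝔼.̄}
        (𝔼.*-cong {emb (x *̄)} {emb x 𝔼.̄} {emb (y *̄)} {emb y 𝔼.̄} (emb-*̄ x) (emb-*̄ y)))
      where
      i = 𝔼._̄ (emb x 𝔼.* emb y)
      k = emb (x *̄) 𝔼.* emb (y *̄)

  J̄≈ : ∀ {χ} (isχ : IsCubicCharacter l χ) → J (conjugate isχ) 𝔼.≈ 𝔼._̄ (J isχ)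
  J̄≈ {χ} isχ = 𝔼.sym (𝔼.trans (conj-sum ℤ.+-*-commutativeRing {l} _) (sum-cong-≋ {l} λ i →
      conj-emb (χ (+ toℕ i)) (χ (1ℤ ℤ.- + toℕ i))))
      where open Sum 𝔼.semiring using (sum-cong-≋)

  JJ̄≈L : ∀ {χ} (isχ : IsCubicCharacter l χ) → J isχ 𝔼.* J (conjugate isχ) 𝔼.≈ 𝔼.scalar (+ l)
  JJ̄≈L isχ = 𝔼.trans (Z.jacobi-norm isχ (∑χ≈0 (conjugate isχ)) cancel (∑χ≈0 isχ)) L≈

  J-norm : ∀ {χ} (isχ : IsCubicCharacter l χ) → 𝔼.norm (J isχ) ≡ + l
  J-norm isχ = proj₁ (𝔼.trans (𝔼.sym (𝔼.x*x̄≈norm (J isχ)))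
    (𝔼.trans (𝔼.*-congˡ {J isχ} (𝔼.sym (J̄≈ isχ))) (JJ̄≈L isχ)))

  module _ {q : ℕ} (q-prime : Prime q) (q≢0 : ¬ + q ≋ 0ℤ [mod l ]) where
    private
      module Q = 𝔼/ q
      module P = GaussPower Q.Eis (embedding/ q) l-prime
      module QS = GaussSum Q.Eis (embedding/ q) l-prime
      module QG = GroupRing Q.Eis l

      char-q : IntegerCoefficients.fromℤ Q.Eis (+ q) Q.≈ Q.0#
      char-q = Q.trans (fromℕ-scalar (ℤ/ q) q) (Q.scalar-cong
        (CommutativeRing.trans (ℤ/ q) (CommutativeRing.reflexive (ℤ/ q) (fromℤ≡id (+ q)))
          (PrimeField.p≋0 q-prime)))

      q-cancel : ∀ {i j} → + q ℤ.* i ≋ + q ℤ.* j [mod l ] → i ≋ j [mod l ]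
      q-cancel {i} {j} = *-cancelˡ {+ q} {i} {j} q≢0

      sum-zero : ∀ {χ} (isχ : IsCubicCharacter l χ) → QG.∑ (QS.gauss isχ) Q.≈ Q.0#
      sum-zero isχ = mod q {ZG.∑ (Z.gauss isχ)} {𝔼.0#} (∑χ≈0 isχ)

      JJ̄≈L/ : ∀ {χ} (isχ : IsCubicCharacter l χ) → J isχ Q.* J (conjugate isχ) Q.≈ Q.scalar (+ l)
      JJ̄≈L/ isχ = mod q {J isχ 𝔼.* J (conjugate isχ)} {𝔼.scalar (+ l)} (JJ̄≈L isχ)

    J-recip : ∀ {χ} (isχ : IsCubicCharacter l χ) → ¬ + l ≋ 0ℤ [mod q ] → Recip q (J isχ) (χ (+ q))
    J-recip {χ} isχ l≢0 =
      (λ m q≡ → ratio-1+3m Q.Eis {J isχ} {J (conjugate isχ)} {J̄} {L} {L′} {x} {x̄} J̄≈/ LL′ xx̄ x̄x̄ m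
        (power-1 isχ m q≡) (power-1 (conjugate isχ) m q≡)) ,
      (λ m q≡ → ratio-2+3m Q.Eis {J isχ} {J (conjugate isχ)} {J̄} {L} {L′} {x} {x̄} J̄≈/ LL′ xx̄ x̄x̄ m
        (power-2 isχ m q≡) (≡.subst (λ y → power-2-type (conjugate isχ) m (emb y)) (*̄-involutive (χ (+ q)))
          (power-2 (conjugate isχ) m q≡)))
      where
      open IsCubicCharacter isχ
      J̄ L L′ x x̄ : ℤ × ℤ
      J̄ = 𝔼._̄ (J isχ)
      L = + l , 0ℤ
      L′ = proj₁ (PrimeField.inverse q-prime l≢0) , 0ℤ
      x = emb (χ (+ q))
      x̄ = emb (χ (+ q) *̄)
      J̄≈/ : J (conjugate isχ) Q.≈ J̄
      J̄≈/ = mod q {J (conjugate isχ)} {J̄} (J̄≈ isχ)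
      LL′ : L Q.* L′ Q.≈ Q.1#
      LL′ = Q.trans {L Q.* L′} {Q.scalar (+ l ℤ.* proj₁ (PrimeField.inverse q-prime l≢0))} {Q.1#}
        (Q.sym (Q.scalar-* (+ l) (proj₁ (PrimeField.inverse q-prime l≢0))))
        (Q.scalar-cong (proj₂ (PrimeField.inverse q-prime l≢0)))
      xx̄ : x Q.* x̄ Q.≈ Q.1#
      xx̄ = mod q {x 𝔼.* x̄} {emb I} (𝔼.trans {x 𝔼.* x̄} {emb (χ (+ q) ∙ χ (+ q) *̄)} {emb I}
        (𝔼.sym (emb-∙ (χ (+ q)) (χ (+ q) *̄)))
        (𝔼.reflexive (≡.cong emb (≡.trans (∙-comm (χ (+ q)) _) (x*̄∙x≡I (χ≢O q≢0))))))
      x̄x̄ : x̄ Q.* x̄ Q.≈ x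
      x̄x̄ = mod q {x̄ 𝔼.* x̄} {x} (𝔼.trans {x̄ 𝔼.* x̄} {emb (χ (+ q) *̄ ∙ χ (+ q) *̄)} {x}
        (𝔼.sym (emb-∙ (χ (+ q) *̄) (χ (+ q) *̄)))
        (𝔼.reflexive (≡.cong emb (≡.trans (x∙x≡x*̄ (χ (+ q) *̄)) (*̄-involutive _)))))
      power-1 : ∀ {χ} (isχ : IsCubicCharacter l χ) m → q ≡ 1 ℕ.+ 3 ℕ.* m →
                (L Q.* J isχ) Q.^ m Q.* emb (χ (+ q)) Q.≈ Q.1#
      power-1 isχ = P.jacobi-power-1+3m isχ (sum-zero isχ) (sum-zero (conjugate isχ)) {L} (JJ̄≈L/ isχ) q-prime char-q
        (λ {i} {j} → q-cancel {i} {j})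
      power-2-type : ∀ {χ} (isχ : IsCubicCharacter l χ) → ℕ → ℤ × ℤ → Set
      power-2-type isχ m y = (L Q.* J isχ) Q.^ m Q.* J isχ Q.* y Q.≈ Q.1#
      power-2 : ∀ {χ} (isχ : IsCubicCharacter l χ) m → q ≡ 2 ℕ.+ 3 ℕ.* m →
                power-2-type isχ m (emb (χ (+ q) *̄))
      power-2 isχ = P.jacobi-power-2+3m isχ (sum-zero isχ) (sum-zero (conjugate isχ)) {L} (JJ̄≈L/ isχ) q-prime char-q
        (λ {i} {j} → q-cancel {i} {j})

    J-mod-3 : ∀ {χ} (isχ : IsCubicCharacter l χ) → q ≡ 3 → J isχ Q.* (ℤ.- 1ℤ , 0ℤ) Q.≈ Q.1#
    J-mod-3 isχ q≡3 = Q.trans {J isχ Q.* (ℤ.- 1ℤ , 0ℤ)} {J isχ Q.* gḡ} {Q.1#}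
      (Q.*-congˡ {J isχ} {ℤ.- 1ℤ , 0ℤ} {gḡ} (mod q {ℤ.- 1ℤ , 0ℤ} {gḡ}
        (𝔼.sym {gḡ} {𝔼.- 𝔼.1#} (Z.gauss-conj isχ (∑χ≈0 (conjugate isχ)) cancel
          λ e → q≢0 (≡.subst (_≋ 0ℤ [mod l ]) (ℤ.*-identityʳ (+ q)) e)))))
      (P.jacobi-cube isχ (sum-zero isχ) (sum-zero (conjugate isχ)) {Q.scalar (+ l)} (JJ̄≈L/ isχ) q-prime char-q
        (λ {i} {j} → q-cancel {i} {j}) q≡3)
      where
      gḡ : ℤ × ℤ
      gḡ = at (Z.gauss isχ ⋆ᶻ Z.gauss (conjugate isχ)) (+ q ℤ.* 1ℤ)

-- Cubic reciprocity with a rational modulus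

_∣ℤ_ : ℕ → ℤ → Set
n ∣ℤ i = + n ℤ∣.∣ i

infix 4 _∣ℤ_

prime-factor : ∀ n → 2 ℕ.≤ n → ∃[ p ] Prime p × p ℕ∣.∣ n
prime-factor n@(suc _) 2≤n with factorise n
... | record { factors = []     ; isFactorisation = n≡1 } = contradiction (≡.subst (2 ℕ.≤_) n≡1 2≤n) λ { (ℕ.s≤s ()) }
... | record { factors = p ∷ ps ; isFactorisation = n≡Π ; factorsPrime = p-prime ∷ _ } =
  p , p-prime , ≡.subst (p ℕ∣.∣_) (≡.sym n≡Π) (ℕ∣.m∣m*n _)

primes-divide⇒≡ : ∀ {p q} → Prime p → Prime q → p ℕ∣.∣ q → p ≡ q
primes-divide⇒≡ p-prime q-prime p∣q with prime⇒irreducible q-prime p∣q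
... | inj₁ p≡1 = contradiction (≡.subst Prime p≡1 p-prime) ¬prime[1]
... | inj₂ p≡q = p≡q

module _ (R : CommutativeRing c ℓ) where
  open CommutativeRing R hiding (zero)
  open Exp commutativeSemiring
  open IntegerCoefficients R
  open SetoidReasoning setoid

  power-mod-3 : ∀ {x} → x ^ 3 ≈ 1# → ∀ r m → x ^ (r ℕ.+ 3 ℕ.* m) ≈ x ^ r
  power-mod-3 {x} x³≈1 r m = begin
    x ^ (r ℕ.+ 3 ℕ.* m)    ≈⟨ ^-homo-* x r (3 ℕ.* m) ⟩
    x ^ r * x ^ (3 ℕ.* m)  ≈⟨ *-congˡ (^-assocʳ x 3 m) ⟨
    x ^ r * (x ^ 3) ^ m    ≈⟨ *-congˡ (trans (^-congˡ m x³≈1) (1^≈1 R m)) ⟩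
    x ^ r * 1#             ≈⟨ *-identityʳ _ ⟩
    x ^ r                  ∎

  power-ratio-* : ∀ {u u′ v v′ w′ x y z} → w′ ≈ u′ * v′ → z ≈ x * y → ∀ m →
                  u ^ m ≈ x * u′ ^ m → v ^ m ≈ y * v′ ^ m → (u * v) ^ m ≈ z * w′ ^ m
  power-ratio-* {u} {u′} {v} {v′} {w′} {x} {y} {z} w′≈ z≈ m eq eq′ = begin
    (u * v) ^ m                     ≈⟨ ^-distrib-* u v m ⟩
    u ^ m * v ^ m                   ≈⟨ *-cong eq eq′ ⟩
    (x * u′ ^ m) * (y * v′ ^ m)
      ≈⟨ solve 4 (λ x y s t → (x :* s) :* (y :* t) := (x :* y) :* (s :* t)) refl x y (u′ ^ m) (v′ ^ m) ⟩
    (x * y) * (u′ ^ m * v′ ^ m)     ≈⟨ *-cong z≈ (^-distrib-* u′ v′ m) ⟨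
    z * (u′ * v′) ^ m               ≈⟨ *-congˡ (^-congˡ m w′≈) ⟨
    z * w′ ^ m                      ∎

record Symbol (u : ℤ × ℤ) : Set where
  field
    Χ       : ℤ → Value
    Χ-1     : Χ 1ℤ ≡ I
    Χ-*     : ∀ i j → Χ (i ℤ.* j) ≡ Χ i ∙ Χ j
    Χ-cong  : ∀ {i j} → i ≋ j [mod ℤ.∣ 𝔼.norm u ∣ ] → Χ i ≡ Χ j
    Χ-prime : ∀ {q} → Prime q → ¬ q ∣ℤ 𝔼.norm u → Χ (+ q) ≢ O
    recip   : ∀ {q} → Prime q → q ≢ 3 → ¬ q ∣ℤ 𝔼.norm u → Recip q u (Χ (+ q))

norm-* : ∀ u v → 𝔼.norm (u 𝔼.* v) ≡ 𝔼.norm u ℤ.* 𝔼.norm v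
norm-* (a , b) (c , d) = lemma a b c d
  where
  lemma : ∀ a b c d → (a ℤ.* c ℤ.- b ℤ.* d) ℤ.* (a ℤ.* c ℤ.- b ℤ.* d)
            ℤ.- (a ℤ.* c ℤ.- b ℤ.* d) ℤ.* (a ℤ.* d ℤ.+ b ℤ.* c ℤ.- b ℤ.* d)
            ℤ.+ (a ℤ.* d ℤ.+ b ℤ.* c ℤ.- b ℤ.* d) ℤ.* (a ℤ.* d ℤ.+ b ℤ.* c ℤ.- b ℤ.* d)
          ≡ (a ℤ.* a ℤ.- a ℤ.* b ℤ.+ b ℤ.* b) ℤ.* (c ℤ.* c ℤ.- c ℤ.* d ℤ.+ d ℤ.* d)
  lemma = ℤ-Solver.solve-∀

Recip-* : ∀ q {u v x y} → Recip q u x → Recip q v y → Recip q (u 𝔼.* v) (x ∙ y)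
Recip-* q {u} {v} {x} {y} (r₁ , r₂) (s₁ , s₂) =
  (λ m q≡ → power-ratio-* Q.Eis {u} {u Q.̄} {v} {v Q.̄} {Q._̄ (u Q.* v)} {emb x} {emb y} {emb (x ∙ y)}
    (Q.conj-* u v) e-xy m (r₁ m q≡) (s₁ m q≡)) ,
  (λ m q≡ → Q.trans {Q._̄ (u Q.* v) Q.^ suc m} {(u Q.̄ Q.* v Q.̄) Q.^ suc m} {emb (x ∙ y) Q.* (u Q.* v) Q.^ suc m}
    (^-congˡ (suc m) {Q._̄ (u Q.* v)} {u Q.̄ Q.* v Q.̄} (Q.conj-* u v))
    (power-ratio-* Q.Eis {u Q.̄} {u} {v Q.̄} {v} {u Q.* v} {emb x} {emb y} {emb (x ∙ y)}
      (Q.refl {u Q.* v}) e-xy (suc m) (r₂ m q≡) (s₂ m q≡)))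
  where
  module Q = 𝔼/ q
  open Exp Q.commutativeSemiring using (^-congˡ)
  e-xy : emb (x ∙ y) Q.≈ emb x Q.* emb y
  e-xy = mod q {emb (x ∙ y)} {emb x 𝔼.* emb y} (emb-∙ x y)

Symbol-* : ∀ {u v} → Symbol u → Symbol v → Symbol (u 𝔼.* v)
Symbol-* {u} {v} s t = record
  { Χ       = λ i → S.Χ i ∙ T.Χ i
  ; Χ-1     = ≡.cong₂ _∙_ S.Χ-1 T.Χ-1
  ; Χ-*     = λ i j → ≡.trans (≡.cong₂ _∙_ (S.Χ-* i j) (T.Χ-* i j))
                (∙-interchange (S.Χ i) (S.Χ j) (T.Χ i) (T.Χ j))
  ; Χ-cong  = λ e → ≡.cong₂ _∙_
      (S.Χ-cong (≋-weaken (ℤ∣.∣ᵤ⇒∣ (≡.subst (ℤ.∣ 𝔼.norm u ∣ ℕ∣.∣_) (≡.sym abs-norm) (ℕ∣.m∣m*n _))) e))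
      (T.Χ-cong (≋-weaken (ℤ∣.∣ᵤ⇒∣ (≡.subst (ℤ.∣ 𝔼.norm v ∣ ℕ∣.∣_) (≡.sym abs-norm) (ℕ∣.n∣m*n ℤ.∣ 𝔼.norm u ∣))) e))
  ; Χ-prime = λ q-prime q∤ → ∙-≢O (S.Χ-prime q-prime (∤u q∤)) (T.Χ-prime q-prime (∤v q∤))
  ; recip   = λ {q} q-prime q≢3 q∤ →
      Recip-* q {u} {v} {S.Χ (+ q)} {T.Χ (+ q)} (S.recip q-prime q≢3 (∤u q∤)) (T.recip q-prime q≢3 (∤v q∤))
  }
  where
  module S = Symbol s
  module T = Symbol t
  abs-norm : ℤ.∣ 𝔼.norm (u 𝔼.* v) ∣ ≡ ℤ.∣ 𝔼.norm u ∣ ℕ.* ℤ.∣ 𝔼.norm v ∣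
  abs-norm = ≡.trans (≡.cong ℤ.∣_∣ (norm-* u v)) (ℤ.abs-* (𝔼.norm u) (𝔼.norm v))
  ∤u : ∀ {q} → ¬ q ∣ℤ 𝔼.norm (u 𝔼.* v) → ¬ q ∣ℤ 𝔼.norm u
  ∤u {q} q∤ d = q∤ (≡.subst (q ∣ℤ_) (≡.sym (norm-* u v)) (ℤ∣.∣m⇒∣m*n (𝔼.norm v) d))
  ∤v : ∀ {q} → ¬ q ∣ℤ 𝔼.norm (u 𝔼.* v) → ¬ q ∣ℤ 𝔼.norm v
  ∤v {q} q∤ d = q∤ (≡.subst (q ∣ℤ_) (≡.sym (norm-* u v)) (ℤ∣.∣n⇒∣m*n (𝔼.norm u) d))

Symbol-scalar : ∀ r → Symbol (r , 0ℤ)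
Symbol-scalar r = record
  { Χ       = λ _ → I
  ; Χ-1     = ≡.refl
  ; Χ-*     = λ _ _ → ≡.refl
  ; Χ-cong  = λ _ → ≡.refl
  ; Χ-prime = λ _ _ ()
  ; recip   = λ {q} _ _ _ → rational q
  }
  where
  rational : ∀ q → Recip q (r , 0ℤ) I
  rational q =
    (λ m _ → Q.trans {u Q.^ m} {u Q.̄ Q.^ m} {Q.1# Q.* u Q.̄ Q.^ m}
      (^-congˡ m {u} {u Q.̄} (Q.sym {u Q.̄} {u} (Q.conj-scalar r))) (Q.sym {Q.1# Q.* u Q.̄ Q.^ m} (Q.*-identityˡ _))) ,
    (λ m _ → Q.trans {u Q.̄ Q.^ suc m} {u Q.^ suc m} {Q.1# Q.* u Q.^ suc m}
      (^-congˡ (suc m) {u Q.̄} {u} (Q.conj-scalar r)) (Q.sym {Q.1# Q.* u Q.^ suc m} (Q.*-identityˡ _)))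
    where
    module Q = 𝔼/ q
    open Exp Q.commutativeSemiring using (^-congˡ)
    u : ℤ × ℤ
    u = r , 0ℤ

Symbol-J : ∀ {l χ} (l-prime : Prime l) (isχ : IsCubicCharacter l χ) → Symbol (Jacobi.J l-prime isχ)
Symbol-J {l} {χ} l-prime isχ = record
  { Χ       = χ
  ; Χ-1     = χ-1
  ; Χ-*     = χ-*
  ; Χ-cong  = λ e → χ-cong (≡.subst (λ n → _ ≋ _ [mod n ]) (≡.cong ℤ.∣_∣ (J-norm isχ)) e)
  ; Χ-prime = λ q-prime q∤ → χ≢O (λ e → q≢l q-prime q∤ e)
  ; recip   = λ q-prime q≢3 q∤ → J-recip q-prime (q≢l q-prime q∤) isχ
      (λ e → q∤ (≡.subst (_ ∣ℤ_) (≡.sym (J-norm isχ)) (≋0⇒∣ e)))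
  }
  where
  open Jacobi l-prime
  open IsCubicCharacter isχ
  q≢l : ∀ {q} → Prime q → ¬ q ∣ℤ 𝔼.norm (J isχ) → ¬ + q ≋ 0ℤ [mod l ]
  q≢l {q} q-prime q∤ e with primes-divide⇒≡ l-prime q-prime (ℤ∣.∣⇒∣ᵤ (≋0⇒∣ e))
  ... | ≡.refl = q∤ (ℤ∣.∣-reflexive (≡.sym (J-norm isχ)))

Primary : ℤ × ℤ → Set
Primary (a , b) = ¬ 3 ∣ℤ a × 3 ∣ℤ b

3-prime : Prime 3
3-prime = from-yes (prime? 3)

module _ {p : ℕ} (p-prime : Prime p) where

  prime∣square : ∀ {i} → p ∣ℤ i ℤ.* i → p ∣ℤ i
  prime∣square {i} d = [ id , id ]′ (prime∣* p-prime {i} {i} d)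

∣-norm⇒∣-a² : ∀ {n} a {b} → n ∣ℤ b → n ∣ℤ 𝔼.norm (a , b) → n ∣ℤ a ℤ.* a
∣-norm⇒∣-a² {n} a {b} d e = ≡.subst (n ∣ℤ_) (lemma a b)
  (ℤ∣.∣m∣n⇒∣m-n e (ℤ∣.∣n⇒∣m*n (b ℤ.- a) d))
  where
  lemma : ∀ a b → a ℤ.* a ℤ.- a ℤ.* b ℤ.+ b ℤ.* b ℤ.- (b ℤ.- a) ℤ.* b ≡ a ℤ.* a
  lemma = ℤ-Solver.solve-∀

3∤norm : ∀ {u} → Primary u → ¬ 3 ∣ℤ 𝔼.norm u
3∤norm {a , b} (3∤a , 3∣b) d = 3∤a (prime∣square 3-prime (∣-norm⇒∣-a² a 3∣b d))

Primary-quotient : ∀ u v → Primary (u 𝔼.* v) → Primary v → Primary u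
Primary-quotient (s , t) (c , d) (3∤a , 3∣b) (3∤c , 3∣d) = 3∤s , 3∣t
  where
  lemma₁ : ∀ s t c d → s ℤ.* d ℤ.+ t ℤ.* c ℤ.- t ℤ.* d ℤ.- (s ℤ.- t) ℤ.* d ≡ t ℤ.* c
  lemma₁ = ℤ-Solver.solve-∀
  3∣t : 3 ∣ℤ t
  3∣t = [ id , (λ 3∣c → contradiction 3∣c 3∤c) ]′ (prime∣* 3-prime {t} {c}
    (≡.subst (3 ∣ℤ_) (lemma₁ s t c d) (ℤ∣.∣m∣n⇒∣m-n 3∣b (ℤ∣.∣n⇒∣m*n (s ℤ.- t) 3∣d))))
  3∤s : ¬ 3 ∣ℤ s
  3∤s 3∣s = 3∤a (ℤ∣.∣m∣n⇒∣m-n (ℤ∣.∣m⇒∣m*n c 3∣s) (ℤ∣.∣m⇒∣m*n d 3∣t))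

-- u and v lie in the prime ideal (l , ω - w), of which v is a generator.
divide-by-generator : ∀ {l} → Prime l → ∀ w → l ∣ℤ w ℤ.* w ℤ.+ w ℤ.+ 1ℤ → ∀ u v →
  l ∣ℤ proj₁ u ℤ.+ proj₂ u ℤ.* w → l ∣ℤ proj₁ v ℤ.+ proj₂ v ℤ.* w → 𝔼.norm v ≡ + l →
  ∃[ u′ ] u ≡ u′ 𝔼.* v
divide-by-generator {l} l-prime w w-root (a , b) (c , d) u∈ v∈ Nv≡l =
  (s , t) , ≡.cong₂ _,_ (cancel a _ a-eq) (cancel b _ b-eq)
  where
  instance
    l-nonZero : ℤ.NonZero (+ l)
    l-nonZero = ℕ.≢-nonZero λ { ≡.refl → ¬prime[0] l-prime }
  first : l ∣ℤ a ℤ.* (c ℤ.- d) ℤ.+ b ℤ.* d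
  first = ≡.subst (l ∣ℤ_) (lemma a b c d w)
    (ℤ∣.∣m∣n⇒∣m+n (ℤ∣.∣m∣n⇒∣m+n (ℤ∣.∣m⇒∣m*n (c ℤ.- d) u∈) (ℤ∣.∣n⇒∣m*n (ℤ.- (b ℤ.* w)) v∈))
      (ℤ∣.∣n⇒∣m*n (b ℤ.* d) w-root))
    where
    lemma : ∀ a b c d w → (a ℤ.+ b ℤ.* w) ℤ.* (c ℤ.- d) ℤ.+ ℤ.- (b ℤ.* w) ℤ.* (c ℤ.+ d ℤ.* w)
              ℤ.+ b ℤ.* d ℤ.* (w ℤ.* w ℤ.+ w ℤ.+ 1ℤ) ≡ a ℤ.* (c ℤ.- d) ℤ.+ b ℤ.* d
    lemma = ℤ-Solver.solve-∀
  second : l ∣ℤ b ℤ.* c ℤ.- a ℤ.* d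
  second = ≡.subst (l ∣ℤ_) (lemma a b c d w)
    (ℤ∣.∣m∣n⇒∣m-n (ℤ∣.∣n⇒∣m*n b v∈) (ℤ∣.∣m⇒∣m*n d u∈))
    where
    lemma : ∀ a b c d w → b ℤ.* (c ℤ.+ d ℤ.* w) ℤ.- (a ℤ.+ b ℤ.* w) ℤ.* d ≡ b ℤ.* c ℤ.- a ℤ.* d
    lemma = ℤ-Solver.solve-∀
  s = ℤ∣._∣_.quotient first
  t = ℤ∣._∣_.quotient second
  cancel : ∀ i j → i ℤ.* + l ≡ j ℤ.* + l → i ≡ j
  cancel i j eq = ℤ.*-cancelʳ-≡ i j (+ l) eq
  a-eq : a ℤ.* + l ≡ (s ℤ.* c ℤ.- t ℤ.* d) ℤ.* + l
  a-eq = begin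
    a ℤ.* + l                                   ≡⟨ ≡.cong (a ℤ.*_) Nv≡l ⟨
    a ℤ.* (c ℤ.* c ℤ.- c ℤ.* d ℤ.+ d ℤ.* d)     ≡⟨ lemma₁ a b c d ⟩
    (a ℤ.* (c ℤ.- d) ℤ.+ b ℤ.* d) ℤ.* c ℤ.- (b ℤ.* c ℤ.- a ℤ.* d) ℤ.* d
      ≡⟨ ≡.cong₂ (λ x y → x ℤ.* c ℤ.- y ℤ.* d) (ℤ∣._∣_.equality first) (ℤ∣._∣_.equality second) ⟩
    (s ℤ.* + l) ℤ.* c ℤ.- (t ℤ.* + l) ℤ.* d     ≡⟨ lemma₂ s t c d (+ l) ⟩
    (s ℤ.* c ℤ.- t ℤ.* d) ℤ.* + l               ∎
    where
    open ≡.≡-Reasoning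
    lemma₁ : ∀ a b c d → a ℤ.* (c ℤ.* c ℤ.- c ℤ.* d ℤ.+ d ℤ.* d) ≡
             (a ℤ.* (c ℤ.- d) ℤ.+ b ℤ.* d) ℤ.* c ℤ.- (b ℤ.* c ℤ.- a ℤ.* d) ℤ.* d
    lemma₁ = ℤ-Solver.solve-∀
    lemma₂ : ∀ s t c d l → (s ℤ.* l) ℤ.* c ℤ.- (t ℤ.* l) ℤ.* d ≡ (s ℤ.* c ℤ.- t ℤ.* d) ℤ.* l
    lemma₂ = ℤ-Solver.solve-∀
  b-eq : b ℤ.* + l ≡ (s ℤ.* d ℤ.+ t ℤ.* c ℤ.- t ℤ.* d) ℤ.* + l
  b-eq = begin
    b ℤ.* + l                                   ≡⟨ ≡.cong (b ℤ.*_) Nv≡l ⟨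
    b ℤ.* (c ℤ.* c ℤ.- c ℤ.* d ℤ.+ d ℤ.* d)     ≡⟨ lemma₁ a b c d ⟩
    (a ℤ.* (c ℤ.- d) ℤ.+ b ℤ.* d) ℤ.* d ℤ.+ (b ℤ.* c ℤ.- a ℤ.* d) ℤ.* c ℤ.- (b ℤ.* c ℤ.- a ℤ.* d) ℤ.* d
      ≡⟨ ≡.cong₂ (λ x y → x ℤ.* d ℤ.+ y ℤ.* c ℤ.- y ℤ.* d) (ℤ∣._∣_.equality first) (ℤ∣._∣_.equality second) ⟩
    (s ℤ.* + l) ℤ.* d ℤ.+ (t ℤ.* + l) ℤ.* c ℤ.- (t ℤ.* + l) ℤ.* d     ≡⟨ lemma₂ s t c d (+ l) ⟩
    (s ℤ.* d ℤ.+ t ℤ.* c ℤ.- t ℤ.* d) ℤ.* + l   ∎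
    where
    open ≡.≡-Reasoning
    lemma₁ : ∀ a b c d → b ℤ.* (c ℤ.* c ℤ.- c ℤ.* d ℤ.+ d ℤ.* d) ≡
             (a ℤ.* (c ℤ.- d) ℤ.+ b ℤ.* d) ℤ.* d ℤ.+ (b ℤ.* c ℤ.- a ℤ.* d) ℤ.* c ℤ.- (b ℤ.* c ℤ.- a ℤ.* d) ℤ.* d
    lemma₁ = ℤ-Solver.solve-∀
    lemma₂ : ∀ s t c d l → (s ℤ.* l) ℤ.* d ℤ.+ (t ℤ.* l) ℤ.* c ℤ.- (t ℤ.* l) ℤ.* d ≡
             (s ℤ.* d ℤ.+ t ℤ.* c ℤ.- t ℤ.* d) ℤ.* l
    lemma₂ = ℤ-Solver.solve-∀

Primary-J : ∀ {l χ} (l-prime : Prime l) (isχ : IsCubicCharacter l χ) → l ≢ 3 → Primary (Jacobi.J l-prime isχ)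
Primary-J {l} l-prime isχ l≢3 = 3∤c J-mod , 3∣d J-mod
  where
  open Jacobi l-prime
  J₁ = proj₁ (J isχ)
  J₂ = proj₂ (J isχ)
  J-mod = J-mod-3 3-prime (λ e → l≢3 (primes-divide⇒≡ l-prime 3-prime (ℤ∣.∣⇒∣ᵤ (≋0⇒∣ e)))) isχ ≡.refl
  3∣d : 𝔼/._≈_ 3 (𝔼/._*_ 3 (J isχ) (ℤ.- 1ℤ , 0ℤ)) (1ℤ , 0ℤ) → 3 ∣ℤ J₂
  3∣d (_ , e) = ≡.subst (3 ∣ℤ_) (lemma J₁ J₂) (ℤ∣.∣m⇒∣-m (≋0⇒∣ e))
    where
    lemma : ∀ c d → ℤ.- (c ℤ.* 0ℤ ℤ.+ d ℤ.* (ℤ.- 1ℤ) ℤ.- d ℤ.* 0ℤ) ≡ d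
    lemma = ℤ-Solver.solve-∀
  3∤c : 𝔼/._≈_ 3 (𝔼/._*_ 3 (J isχ) (ℤ.- 1ℤ , 0ℤ)) (1ℤ , 0ℤ) → ¬ 3 ∣ℤ J₁
  3∤c (congruent e , _) 3∣c = contradiction
    (ℤ∣.∣⇒∣ᵤ (≡.subst (3 ∣ℤ_) (lemma J₁ J₂) (ℤ∣.∣m∣n⇒∣m+n e 3∣c)))
    (ℕ∣.>⇒∤ (ℕ.s≤s (ℕ.s≤s ℕ.z≤n)))
    where
    lemma : ∀ c d → (c ℤ.* (ℤ.- 1ℤ) ℤ.- d ℤ.* 0ℤ ℤ.- 1ℤ) ℤ.+ c ≡ ℤ.- 1ℤ
    lemma = ℤ-Solver.solve-∀

cube-root-of-unity⇒ : ∀ {l} → Prime l → l ≢ 3 → ∀ w → w ℤ.* w ℤ.+ w ℤ.+ 1ℤ ≋ 0ℤ [mod l ] →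
                      ∃[ k ] l ≡ suc (3 ℕ.* suc k)
cube-root-of-unity⇒ {l} l-prime l≢3 w (congruent w-root) = by-cases (prime⇒suc l-prime)
  where
  open CommutativeRing (ℤ/ l) using (commutativeSemiring; trans; sym)
  open Exp commutativeSemiring using (_^_)
  root : l ∣ℤ w ℤ.* w ℤ.+ w ℤ.+ 1ℤ
  root = ≋0⇒∣ (congruent w-root)
  w³ : w ^ 3 ≋ 1ℤ [mod l ]
  w³ = congruent (≡.subst (l ∣ℤ_) (lemma w) (ℤ∣.∣n⇒∣m*n (w ℤ.- 1ℤ) root))
    where
    lemma : ∀ w → (w ℤ.- 1ℤ) ℤ.* (w ℤ.* w ℤ.+ w ℤ.+ 1ℤ) ≡ w ℤ.* (w ℤ.* (w ℤ.* 1ℤ)) ℤ.- 1ℤ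
    lemma = ℤ-Solver.solve-∀
  w≢1 : ¬ w ^ 1 ≋ 1ℤ [mod l ]
  w≢1 (congruent d) = l≢3 (primes-divide⇒≡ l-prime 3-prime (ℤ∣.∣⇒∣ᵤ (≡.subst (l ∣ℤ_) (lemma w)
    (ℤ∣.∣m∣n⇒∣m-n root (ℤ∣.∣n⇒∣m*n (w ℤ.+ + 2) d)))))
    where
    lemma : ∀ w → (w ℤ.* w ℤ.+ w ℤ.+ 1ℤ) ℤ.- (w ℤ.+ + 2) ℤ.* (w ℤ.* 1ℤ ℤ.- 1ℤ) ≡ + 3
    lemma = ℤ-Solver.solve-∀
  w²≢1 : ¬ w ^ 2 ≋ 1ℤ [mod l ]
  w²≢1 (congruent d) = w≢1 (congruent (≡.subst (l ∣ℤ_) (lemma w)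
    (ℤ∣.∣m∣n⇒∣m-n (_≋_[mod_].divides-difference w³) (ℤ∣.∣n⇒∣m*n w d))))
    where
    lemma : ∀ w → (w ℤ.* (w ℤ.* (w ℤ.* 1ℤ)) ℤ.- 1ℤ) ℤ.- w ℤ.* (w ℤ.* (w ℤ.* 1ℤ) ℤ.- 1ℤ) ≡ w ℤ.* 1ℤ ℤ.- 1ℤ
    lemma = ℤ-Solver.solve-∀
  w≢0 : ¬ w ≋ 0ℤ [mod l ]
  w≢0 e = ¬prime[1] (≡.subst Prime (ℕ∣.∣1⇒≡1 (ℤ∣.∣⇒∣ᵤ (≡.subst (l ∣ℤ_) (lemma w)
    (ℤ∣.∣m∣n⇒∣m-n root (ℤ∣.∣n⇒∣m*n (w ℤ.+ 1ℤ) (≋0⇒∣ e)))))) l-prime)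
    where
    lemma : ∀ w → (w ℤ.* w ℤ.+ w ℤ.+ 1ℤ) ℤ.- (w ℤ.+ 1ℤ) ℤ.* w ≡ 1ℤ
    lemma = ℤ-Solver.solve-∀
  by-cases : ∃[ q ] l ≡ suc q → ∃[ k ] l ≡ suc (3 ℕ.* suc k)
  by-cases (q , l≡) = by-residue (q ℕ.% 3) (q ℕ./ 3) (ℕ.m%n<n q 3)
    (≡.trans (ℕ.m≡m%n+[m/n]*n q 3) (≡.cong (q ℕ.% 3 ℕ.+_) (ℕ.*-comm (q ℕ./ 3) 3)))
    where
    power : ∀ r m → q ≡ r ℕ.+ 3 ℕ.* m → w ^ r ≋ 1ℤ [mod l ]
    power r m q≡ = trans (sym (power-mod-3 (ℤ/ l) w³ r m))
      (≡.subst (λ n → w ^ n ≋ 1ℤ [mod l ]) q≡ (PrimeField.fermat′ l-prime l≡ w≢0))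
    by-residue : ∀ r m → r ℕ.< 3 → q ≡ r ℕ.+ 3 ℕ.* m → ∃[ k ] l ≡ suc (3 ℕ.* suc k)
    by-residue 0 zero    _ q≡0 = contradiction (≡.subst Prime (≡.trans l≡ (≡.cong suc q≡0)) l-prime) ¬prime[1]
    by-residue 0 (suc k) _ q≡  = k , ≡.trans l≡ (≡.cong suc q≡)
    by-residue 1 m       _ q≡  = contradiction (power 1 m q≡) w≢1
    by-residue 2 m       _ q≡  = contradiction (power 2 m q≡) w²≢1
    by-residue (suc (suc (suc _))) _ (ℕ.s≤s (ℕ.s≤s (ℕ.s≤s ()))) _

square-abs : ∀ i → i ℤ.* i ≡ + (ℤ.∣ i ∣ ℕ.* ℤ.∣ i ∣)
square-abs (+ n)    = ≡.sym (ℤ.pos-* n n)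
square-abs -[1+ n ] = ≡.refl

norm≡±1⇒ : ∀ {a b} → 3 ∣ℤ b → ℤ.∣ 𝔼.norm (a , b) ∣ ≡ 1 → b ≡ 0ℤ
norm≡±1⇒ {a} {b} (ℤ∣.divides k b≡3k) N≡1 = b≡0 (ℤ.∣ k ∣ ℕ.≟ 0)
  where
  s = + 2 ℤ.* a ℤ.- k ℤ.* + 3
  4N : + 4 ℤ.* 𝔼.norm (a , b) ≡ + (ℤ.∣ s ∣ ℕ.* ℤ.∣ s ∣ ℕ.+ 27 ℕ.* (ℤ.∣ k ∣ ℕ.* ℤ.∣ k ∣))
  4N = begin
    + 4 ℤ.* 𝔼.norm (a , b)                            ≡⟨ ≡.cong (λ b → + 4 ℤ.* 𝔼.norm (a , b)) b≡3k ⟩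
    + 4 ℤ.* 𝔼.norm (a , k ℤ.* + 3)                    ≡⟨ lemma a k ⟩
    s ℤ.* s ℤ.+ + 27 ℤ.* (k ℤ.* k)                    ≡⟨ ≡.cong₂ (λ x y → x ℤ.+ + 27 ℤ.* y) (square-abs s) (square-abs k) ⟩
    + (ℤ.∣ s ∣ ℕ.* ℤ.∣ s ∣) ℤ.+ + 27 ℤ.* + (ℤ.∣ k ∣ ℕ.* ℤ.∣ k ∣)
      ≡⟨ ≡.cong (λ x → + (ℤ.∣ s ∣ ℕ.* ℤ.∣ s ∣) ℤ.+ x) (≡.sym (ℤ.pos-* 27 (ℤ.∣ k ∣ ℕ.* ℤ.∣ k ∣))) ⟩
    + (ℤ.∣ s ∣ ℕ.* ℤ.∣ s ∣ ℕ.+ 27 ℕ.* (ℤ.∣ k ∣ ℕ.* ℤ.∣ k ∣)) ∎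
    where
    open ≡.≡-Reasoning
    lemma : ∀ a k → + 4 ℤ.* (a ℤ.* a ℤ.- a ℤ.* (k ℤ.* + 3) ℤ.+ (k ℤ.* + 3) ℤ.* (k ℤ.* + 3)) ≡
            (+ 2 ℤ.* a ℤ.- k ℤ.* + 3) ℤ.* (+ 2 ℤ.* a ℤ.- k ℤ.* + 3) ℤ.+ + 27 ℤ.* (k ℤ.* k)
    lemma = ℤ-Solver.solve-∀
  abs-4N : ℤ.∣ s ∣ ℕ.* ℤ.∣ s ∣ ℕ.+ 27 ℕ.* (ℤ.∣ k ∣ ℕ.* ℤ.∣ k ∣) ≡ 4
  abs-4N = ≡.trans (≡.sym (≡.cong ℤ.∣_∣ 4N))
    (≡.trans (ℤ.abs-* (+ 4) (𝔼.norm (a , b))) (≡.cong (4 ℕ.*_) N≡1))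
  b≡0 : Dec (ℤ.∣ k ∣ ≡ 0) → b ≡ 0ℤ
  b≡0 (yes k≡0) = ≡.trans b≡3k (≡.trans (≡.cong (ℤ._* + 3) (ℤ.∣i∣≡0⇒i≡0 {k} k≡0)) (ℤ.*-zeroˡ (+ 3)))
  b≡0 (no k≢0)  = contradiction
    (ℕ.≤-trans (ℕ.*-monoʳ-≤ 27 (ℕ.*-mono-≤ 1≤k 1≤k)) (≡.subst (27 ℕ.* (ℤ.∣ k ∣ ℕ.* ℤ.∣ k ∣) ℕ.≤_) abs-4N (ℕ.m≤n+m _ (ℤ.∣ s ∣ ℕ.* ℤ.∣ s ∣))))
    (ℕ.<⇒≱ (from-yes (4 ℕ.<? 27)))
    where
    1≤k = ℕ.n≢0⇒n>0 k≢0

private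
  Smaller : ℤ × ℤ → Set
  Smaller u = ∀ v → ℤ.∣ 𝔼.norm v ∣ ℕ.< ℤ.∣ 𝔼.norm u ∣ → Primary v → Symbol v

  factor-symbol : ∀ {u} u′ v → u ≡ u′ 𝔼.* v → 2 ℕ.≤ ℤ.∣ 𝔼.norm v ∣ → Primary u → Primary v →
                  Smaller u → Symbol v → Symbol u
  factor-symbol u′ v ≡.refl 2≤N u-primary v-primary rec sym-v = Symbol-* {u′} {v} (rec u′ smaller u′-primary) sym-v
    where
    u′-primary : Primary u′
    u′-primary = Primary-quotient u′ v u-primary v-primary
    nonzero : 1 ℕ.≤ ℤ.∣ 𝔼.norm u′ ∣
    nonzero = ℕ.n≢0⇒n>0 λ N≡0 → 3∤norm {u′} u′-primary
      (≡.subst (3 ∣ℤ_) (≡.sym (ℤ.∣i∣≡0⇒i≡0 N≡0)) (ℤ∣.divides 0ℤ ≡.refl))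
    smaller : ℤ.∣ 𝔼.norm u′ ∣ ℕ.< ℤ.∣ 𝔼.norm (u′ 𝔼.* v) ∣
    smaller = ≡.subst (ℤ.∣ 𝔼.norm u′ ∣ ℕ.<_)
      (≡.sym (≡.trans (≡.cong ℤ.∣_∣ (norm-* u′ v)) (ℤ.abs-* (𝔼.norm u′) (𝔼.norm v))))
      (ℕ.m<m*n ℤ.∣ 𝔼.norm u′ ∣ ℤ.∣ 𝔼.norm v ∣ {{ℕ.>-nonZero nonzero}} 2≤N)

  rational-step : ∀ {l} → Prime l → l ≢ 3 → ∀ {a b} → l ∣ℤ b → l ∣ℤ 𝔼.norm (a , b) →
                  Primary (a , b) → Smaller (a , b) → Symbol (a , b)
  rational-step {l} l-prime l≢3 {a} {b} l∣b l∣N primary rec =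
    factor-symbol (s , t) (+ l , 0ℤ) split 2≤N primary (3∤l , ℤ∣.divides 0ℤ ≡.refl) rec (Symbol-scalar (+ l))
    where
    l∣a : l ∣ℤ a
    l∣a = prime∣square l-prime (∣-norm⇒∣-a² a l∣b l∣N)
    s = ℤ∣._∣_.quotient l∣a
    t = ℤ∣._∣_.quotient l∣b
    split : (a , b) ≡ (s , t) 𝔼.* (+ l , 0ℤ)
    split = ≡.cong₂ _,_ (≡.trans (ℤ∣._∣_.equality l∣a) (lemma₁ s t (+ l)))
                        (≡.trans (ℤ∣._∣_.equality l∣b) (lemma₂ s t (+ l)))
      where
      lemma₁ : ∀ s t l → s ℤ.* l ≡ s ℤ.* l ℤ.- t ℤ.* 0ℤ
      lemma₁ = ℤ-Solver.solve-∀
      lemma₂ : ∀ s t l → t ℤ.* l ≡ s ℤ.* 0ℤ ℤ.+ t ℤ.* l ℤ.- t ℤ.* 0ℤ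
      lemma₂ = ℤ-Solver.solve-∀
    3∤l : ¬ 3 ∣ℤ + l
    3∤l d = l≢3 (≡.sym (primes-divide⇒≡ 3-prime l-prime (ℤ∣.∣⇒∣ᵤ d)))
    2≤l = ℕ.nonTrivial⇒n>1 l {{prime⇒nonTrivial l-prime}}
    2≤N : 2 ℕ.≤ ℤ.∣ 𝔼.norm (+ l , 0ℤ) ∣
    2≤N = ≡.subst (2 ℕ.≤_) (≡.sym (≡.trans (≡.cong ℤ.∣_∣ (lemma (+ l))) (ℤ.abs-* (+ l) (+ l))))
      (ℕ.≤-trans 2≤l (ℕ.m≤m*n l l {{ℕ.>-nonZero (ℕ.≤-trans (ℕ.s≤s ℕ.z≤n) 2≤l)}}))
      where
      lemma : ∀ l → l ℤ.* l ℤ.- l ℤ.* 0ℤ ℤ.+ 0ℤ ℤ.* 0ℤ ≡ l ℤ.* l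
      lemma = ℤ-Solver.solve-∀

  split-step : ∀ {l} → Prime l → l ≢ 3 → ∀ {a b} → ¬ l ∣ℤ b → l ∣ℤ 𝔼.norm (a , b) →
               Primary (a , b) → Smaller (a , b) → Symbol (a , b)
  split-step {l} l-prime l≢3 {a} {b} l∤b l∣N primary rec = by-cases (cube-root-of-unity⇒ l-prime l≢3 w (∣⇒≋0 w-root))
    where
    bb′ = PrimeField.inverse l-prime {b} (λ e → l∤b (≋0⇒∣ e))
    b′ = proj₁ bb′
    w = ℤ.- (a ℤ.* b′)
    u∈ : l ∣ℤ a ℤ.+ b ℤ.* w
    u∈ = ≡.subst (l ∣ℤ_) (lemma a b b′) (ℤ∣.∣n⇒∣m*n (ℤ.- a) (_≋_[mod_].divides-difference (proj₂ bb′)))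
      where
      lemma : ∀ a b b′ → ℤ.- a ℤ.* (b ℤ.* b′ ℤ.- 1ℤ) ≡ a ℤ.+ b ℤ.* (ℤ.- (a ℤ.* b′))
      lemma = ℤ-Solver.solve-∀
    w-root : l ∣ℤ w ℤ.* w ℤ.+ w ℤ.+ 1ℤ
    w-root = [ (λ d → contradiction (prime∣square l-prime d) l∤b) , id ]′
      (prime∣* l-prime {b ℤ.* b} {w ℤ.* w ℤ.+ w ℤ.+ 1ℤ} (≡.subst (l ∣ℤ_) (lemma a b w)
        (ℤ∣.∣m∣n⇒∣m+n l∣N (ℤ∣.∣m⇒∣m*n (b ℤ.* w ℤ.- a ℤ.+ b) u∈))))
      where
      lemma : ∀ a b w → (a ℤ.* a ℤ.- a ℤ.* b ℤ.+ b ℤ.* b) ℤ.+ (a ℤ.+ b ℤ.* w) ℤ.* (b ℤ.* w ℤ.- a ℤ.+ b) ≡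
              b ℤ.* b ℤ.* (w ℤ.* w ℤ.+ w ℤ.+ 1ℤ)
      lemma = ℤ-Solver.solve-∀
    by-cases : ∃[ k ] l ≡ suc (3 ℕ.* suc k) → Symbol (a , b)
    by-cases (k , l≡) = [ via isχ , via (conjugate isχ) ]′ J∈⊎J̄∈
      where
      open CubicCharacter l-prime k l≡ w (∣⇒≋0 w-root)
      isχ : IsCubicCharacter l χ
      isχ = record
        { χ-cong = χ-cong
        ; χ-*    = χ-*
        ; χ-0    = χ-0
        ; χ≢O    = χ≢O
        ; χ-1    = χ-1
        ; χ-neg  = χ-neg
        ; χ-nontrivial = χ-nontrivial
        }
      open Jacobi l-prime
      generates : ∀ {χ} → IsCubicCharacter l χ → Set
      generates isχ = l ∣ℤ proj₁ (J isχ) ℤ.+ proj₂ (J isχ) ℤ.* w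
      J∈⊎J̄∈ : generates isχ ⊎ generates (conjugate isχ)
      J∈⊎J̄∈ = prime∣* l-prime (≡.subst (l ∣ℤ_)
        (≡.sym (evaluate (proj₁ (J isχ)) (proj₂ (J isχ)) (proj₁ (J (conjugate isχ))) (proj₂ (J (conjugate isχ))) (JJ̄≈L isχ)))
        (ℤ∣.∣m∣n⇒∣m+n ℤ∣.∣-refl (ℤ∣.∣n⇒∣m*n (proj₂ (J isχ) ℤ.* proj₂ (J (conjugate isχ))) w-root)))
        where
        lemma : ∀ x y z v w → (x ℤ.+ y ℤ.* w) ℤ.* (z ℤ.+ v ℤ.* w) ≡
          (x ℤ.* z ℤ.- y ℤ.* v) ℤ.+ (x ℤ.* v ℤ.+ y ℤ.* z ℤ.- y ℤ.* v) ℤ.* w ℤ.+ (y ℤ.* v) ℤ.* (w ℤ.* w ℤ.+ w ℤ.+ 1ℤ)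
        lemma = ℤ-Solver.solve-∀
        evaluate : ∀ x y z v → (x , y) 𝔼.* (z , v) 𝔼.≈ (+ l , 0ℤ) →
          (x ℤ.+ y ℤ.* w) ℤ.* (z ℤ.+ v ℤ.* w) ≡ + l ℤ.+ (y ℤ.* v) ℤ.* (w ℤ.* w ℤ.+ w ℤ.+ 1ℤ)
        evaluate x y z v (e₁ , e₂) = ≡.trans (lemma x y z v w)
          (≡.cong (ℤ._+ (y ℤ.* v) ℤ.* (w ℤ.* w ℤ.+ w ℤ.+ 1ℤ))
            (≡.trans (≡.cong₂ (λ s t → s ℤ.+ t ℤ.* w) e₁ e₂) (ℤ.+-identityʳ (+ l))))
      via : ∀ {χ} (isχ : IsCubicCharacter l χ) → generates isχ → Symbol (a , b)
      via isχ J∈ = finish (divide-by-generator l-prime w w-root (a , b) (J isχ) u∈ J∈ (J-norm isχ))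
        where
        finish : ∃[ u′ ] (a , b) ≡ u′ 𝔼.* J isχ → Symbol (a , b)
        finish (u′ , u≡) = factor-symbol u′ (J isχ) u≡
          (≡.subst (2 ℕ.≤_) (≡.sym (≡.cong ℤ.∣_∣ (J-norm isχ))) (ℕ.nonTrivial⇒n>1 l {{prime⇒nonTrivial l-prime}}))
          primary (Primary-J l-prime isχ l≢3) rec (Symbol-J l-prime isχ)

  symbol-step : ∀ u → Primary u → Smaller u → Symbol u
  symbol-step (a , b) primary@(3∤a , 3∣b) rec = by-size ℤ.∣ 𝔼.norm (a , b) ∣ ≡.refl
    where
    by-prime : ∃[ l ] Prime l × l ℕ∣.∣ ℤ.∣ 𝔼.norm (a , b) ∣ → Symbol (a , b)
    by-prime (l , l-prime , l∣N) = by-case (+ l ℤ∣.∣? b)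
      where
      l∣N′ : l ∣ℤ 𝔼.norm (a , b)
      l∣N′ = ℤ∣.∣ᵤ⇒∣ l∣N
      l≢3 : l ≢ 3
      l≢3 l≡3 = 3∤norm {a , b} primary (≡.subst (_∣ℤ 𝔼.norm (a , b)) l≡3 l∣N′)
      by-case : Dec (l ∣ℤ b) → Symbol (a , b)
      by-case (yes l∣b) = rational-step l-prime l≢3 {a} {b} l∣b l∣N′ primary rec
      by-case (no l∤b)  = split-step l-prime l≢3 {a} {b} l∤b l∣N′ primary rec
    by-size : ∀ n → ℤ.∣ 𝔼.norm (a , b) ∣ ≡ n → Symbol (a , b)
    by-size 0 N≡0 = contradiction
      (≡.subst (3 ∣ℤ_) (≡.sym (ℤ.∣i∣≡0⇒i≡0 N≡0)) (ℤ∣.divides 0ℤ ≡.refl)) (3∤norm {a , b} primary)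
    by-size 1 N≡1 = ≡.subst (λ b → Symbol (a , b)) (≡.sym (norm≡±1⇒ {a} 3∣b N≡1)) (Symbol-scalar a)
    by-size n@(suc (suc _)) N≡n = by-prime (prime-factor _ (≡.subst (2 ℕ.≤_) (≡.sym N≡n) (ℕ.s≤s (ℕ.s≤s ℕ.z≤n))))

symbol : ∀ u → Primary u → Symbol u
symbol u = ℕ.<-rec (λ n → ∀ u → ℤ.∣ 𝔼.norm u ∣ ≡ n → Primary u → Symbol u)
  (λ n rec u N≡n primary → symbol-step u primary
    λ v smaller → rec (≡.subst (ℤ.∣ 𝔼.norm v ∣ ℕ.<_) N≡n smaller) v ≡.refl)
  ℤ.∣ 𝔼.norm u ∣ u ≡.refl

-- Forms of discriminant −23

module _ (R : CommutativeRing c ℓ) where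
  open CommutativeRing R hiding (zero)
  open Exp commutativeSemiring
  open IntegerCoefficients R
  open SetoidReasoning setoid

  ratio-squared≈1 : ∀ {u u′ v x} → u * v ≈ 1# → u′ ≈ - u → ∀ m → u ^ m ≈ x * u′ ^ m → x * x ≈ 1#
  ratio-squared≈1 {u} {u′} {v} {x} uv≈1 u′≈-u m eq = begin
    x * x                                     ≈⟨ *-identityʳ _ ⟨
    x * x * 1#                                ≈⟨ *-congˡ unit ⟨
    x * x * ((u ^ m * u ^ m) * (v ^ m * v ^ m)) ≈⟨ *-congˡ (*-congʳ u²ᵐ≈u′²ᵐ) ⟩
    x * x * ((u′ ^ m * u′ ^ m) * (v ^ m * v ^ m))
      ≈⟨ solve 3 (λ x s t → (x :* x) :* ((s :* s) :* t) := ((x :* s) :* (x :* s)) :* t) refl x (u′ ^ m) (v ^ m * v ^ m) ⟩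
    (x * u′ ^ m) * (x * u′ ^ m) * (v ^ m * v ^ m)   ≈⟨ *-congʳ (*-cong eq eq) ⟨
    (u ^ m * u ^ m) * (v ^ m * v ^ m)         ≈⟨ unit ⟩
    1#                                        ∎
    where
    unit : (u ^ m * u ^ m) * (v ^ m * v ^ m) ≈ 1#
    unit = begin
      (u ^ m * u ^ m) * (v ^ m * v ^ m)
        ≈⟨ solve 2 (λ s t → (s :* s) :* (t :* t) := (s :* t) :* (s :* t)) refl (u ^ m) (v ^ m) ⟩
      (u ^ m * v ^ m) * (u ^ m * v ^ m)   ≈⟨ *-cong uvᵐ uvᵐ ⟩
      1# * 1#                             ≈⟨ *-identityˡ 1# ⟩
      1#                                  ∎
      where
      uvᵐ : u ^ m * v ^ m ≈ 1#
      uvᵐ = trans (sym (^-distrib-* u v m)) (trans (^-congˡ m uv≈1) (1^≈1 R m))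
    u²ᵐ≈u′²ᵐ : u ^ m * u ^ m ≈ u′ ^ m * u′ ^ m
    u²ᵐ≈u′²ᵐ = begin
      u ^ m * u ^ m     ≈⟨ ^-distrib-* u u m ⟨
      (u * u) ^ m       ≈⟨ ^-congˡ m (trans (solve 1 (λ u → u :* u := (:- u) :* (:- u)) refl u) (*-cong (sym u′≈-u) (sym u′≈-u))) ⟩
      (u′ * u′) ^ m     ≈⟨ ^-distrib-* u′ u′ m ⟩
      u′ ^ m * u′ ^ m   ∎

emb≈1⇒I : ∀ {q} → Prime q → ∀ x → 𝔼/._≈_ q (emb x) (𝔼/.1# q) → x ≡ I
emb≈1⇒I q-prime O  (e , _) = contradiction e (PrimeField.0≉1 q-prime)
emb≈1⇒I q-prime I  _       = ≡.refl
emb≈1⇒I {q} q-prime W  (_ , e) = contradiction (CommutativeRing.sym (ℤ/ q) e) (PrimeField.0≉1 q-prime)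
emb≈1⇒I {q} q-prime W² (_ , congruent d) =
  contradiction (CommutativeRing.sym (ℤ/ q) (congruent (ℤ∣.∣m⇒∣-m d))) (PrimeField.0≉1 q-prime)

Recip⇒I : ∀ {q} → Prime q → q ≢ 3 → ∀ u x → ¬ q ∣ℤ 𝔼.norm u →
          𝔼/._≈_ q (𝔼/._̄ q u) (𝔼/.-_ q u) → Recip q u x → x ≡ I
Recip⇒I {q} q-prime q≢3 u x q∤N ū≈-u (r₁ , r₂) =
  x∙x≡I⇒ (emb≈1⇒I q-prime (x ∙ x)
    (Q.trans {emb (x ∙ x)} {emb x Q.* emb x} {Q.1#} (mod q {emb (x ∙ x)} {emb x 𝔼.* emb x} (emb-∙ x x))
      (by-residue (q ℕ.% 3) (q ℕ./ 3) (ℕ.m%n<n q 3)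
        (≡.trans (ℕ.m≡m%n+[m/n]*n q 3) (≡.cong (q ℕ.% 3 ℕ.+_) (ℕ.*-comm (q ℕ./ 3) 3))))))
  where
  module Q = 𝔼/ q
  N′ = PrimeField.inverse q-prime {𝔼.norm u} (λ e → q∤N (≋0⇒∣ e))
  v : ℤ × ℤ
  v = u Q.̄ Q.* Q.scalar (proj₁ N′)
  uv≈1 : u Q.* v Q.≈ Q.1#
  uv≈1 = Q.trans {u Q.* v} {(u Q.* u Q.̄) Q.* Q.scalar (proj₁ N′)} {Q.1#} (Q.sym (Q.*-assoc u (u Q.̄) (Q.scalar (proj₁ N′))))
    (Q.trans {(u Q.* u Q.̄) Q.* Q.scalar (proj₁ N′)} {Q.scalar (𝔼.norm u) Q.* Q.scalar (proj₁ N′)} {Q.1#}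
      (Q.*-congʳ {Q.scalar (proj₁ N′)} {u Q.* u Q.̄} {Q.scalar (𝔼.norm u)} (Q.x*x̄≈norm u))
      (Q.trans {Q.scalar (𝔼.norm u) Q.* Q.scalar (proj₁ N′)} {Q.scalar (𝔼.norm u ℤ.* proj₁ N′)} {Q.1#}
        (Q.sym (Q.scalar-* (𝔼.norm u) (proj₁ N′))) (Q.scalar-cong (proj₂ N′))))
  v̄ : ℤ × ℤ
  v̄ = Q.- v
  u≈-ū : u Q.≈ Q.- (u Q.̄)
  u≈-ū = Q.trans {u} {Q.- (Q.- u)} {Q.- (u Q.̄)}
    (Q.sym {Q.- (Q.- u)} {u} (RingProperties.-‿involutive Q.ring u)) (Q.-‿cong {Q.- u} {u Q.̄} (Q.sym ū≈-u))
  ūv̄≈1 : u Q.̄ Q.* v̄ Q.≈ Q.1#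
  ūv̄≈1 = Q.trans {u Q.̄ Q.* v̄} {(Q.- u) Q.* (Q.- v)} {Q.1#} (Q.*-congʳ {Q.- v} {u Q.̄} {Q.- u} ū≈-u)
    (Q.trans {(Q.- u) Q.* (Q.- v)} {u Q.* v} {Q.1#}
      (IntegerCoefficients.solve Q.Eis 2 (λ x y → (S.:- x) S.:* (S.:- y) S.:= x S.:* y) Q.refl u v) uv≈1)
    where module S = IntegerCoefficients Q.Eis
  by-residue : ∀ r m → r ℕ.< 3 → q ≡ r ℕ.+ 3 ℕ.* m → emb x Q.* emb x Q.≈ Q.1#
  by-residue 0 m _ q≡ = contradiction (≡.sym (primes-divide⇒≡ 3-prime q-prime (ℕ∣.divides m (≡.trans q≡ (ℕ.*-comm 3 m))))) q≢3
  by-residue 1 m _ q≡ = ratio-squared≈1 Q.Eis {u} {u Q.̄} {v} {emb x} uv≈1 ū≈-u m (r₁ m q≡)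
  by-residue 2 m _ q≡ = ratio-squared≈1 Q.Eis {u Q.̄} {u} {v̄} {emb x} ūv̄≈1 u≈-ū (suc m) (r₂ m q≡)
  by-residue (suc (suc (suc _))) _ (ℕ.s≤s (ℕ.s≤s (ℕ.s≤s ()))) _

-- For p ∤ Y, the class of X/Y is a square root of -23 modulo p; u = (25Y + 3X√-3)/2 is Y times
-- the unit (25 + 3√69)/2 of ℚ(√69).
record Resolvent (p : ℕ) : Set where
  field
    X Y a    : ℤ
    a-half   : + 2 ℤ.* a ≡ + 25 ℤ.* Y ℤ.+ + 3 ℤ.* X
    -23≋     : p ∣ℤ X ℤ.* X ℤ.+ + 23 ℤ.* (Y ℤ.* Y)
    p∤Y      : ¬ p ∣ℤ Y
    value    : Value
    recip    : Recip p (a , + 3 ℤ.* X) value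

-- The norm of u is 27Mp + Y², so Χ(27Mp) = Χ(−Y²); modulo a prime q ∣ Y, the conjugate
-- of u is −u, and hence Χ(q) = 1.
module Evaluate {p : ℕ} (p-prime : Prime p) (p≢3 : p ≢ 3) (X Y a M : ℤ)
  (X²+23Y² : X ℤ.* X ℤ.+ + 23 ℤ.* (Y ℤ.* Y) ≡ + 4 ℤ.* M ℤ.* + p)
  (a-half : + 2 ℤ.* a ≡ + 25 ℤ.* Y ℤ.+ + 3 ℤ.* X)
  (3∤Y : ¬ 3 ∣ℤ Y) (p∤4M : ¬ p ∣ℤ + 4 ℤ.* M)
  (coprime : ∀ {q} → Prime q → q ∣ℤ M → ¬ q ∣ℤ Y) where

  u : ℤ × ℤ
  u = a , + 3 ℤ.* X

  primary : Primary u
  primary = 3∤a , ℤ∣.∣m⇒∣m*n X ℤ∣.∣-refl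
    where
    lemma : ∀ a X Y → + 2 ℤ.* a ≡ + 25 ℤ.* Y ℤ.+ + 3 ℤ.* X → Y ≡ + 2 ℤ.* a ℤ.- + 3 ℤ.* (X ℤ.+ + 8 ℤ.* Y)
    lemma a X Y eq = ≡.trans (lemma′ X Y) (≡.cong (λ x → x ℤ.- + 3 ℤ.* (X ℤ.+ + 8 ℤ.* Y)) (≡.sym eq))
      where
      lemma′ : ∀ X Y → Y ≡ (+ 25 ℤ.* Y ℤ.+ + 3 ℤ.* X) ℤ.- + 3 ℤ.* (X ℤ.+ + 8 ℤ.* Y)
      lemma′ = ℤ-Solver.solve-∀
    3∤a : ¬ 3 ∣ℤ a
    3∤a d = 3∤Y (≡.subst (3 ∣ℤ_) (≡.sym (lemma a X Y a-half))
      (ℤ∣.∣m∣n⇒∣m-n (ℤ∣.∣n⇒∣m*n (+ 2) d) (ℤ∣.∣m⇒∣m*n (X ℤ.+ + 8 ℤ.* Y) ℤ∣.∣-refl)))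

  open Symbol (symbol u primary) public

  N≡ : 𝔼.norm u ≡ + 27 ℤ.* M ℤ.* + p ℤ.+ Y ℤ.* Y
  N≡ = ℤ.*-cancelˡ-≡ (+ 4) _ _ (begin
    + 4 ℤ.* 𝔼.norm u                                        ≡⟨ lemma₁ a X ⟩
    (+ 2 ℤ.* a ℤ.- + 3 ℤ.* X) ℤ.* (+ 2 ℤ.* a ℤ.- + 3 ℤ.* X) ℤ.+ + 27 ℤ.* (X ℤ.* X)
      ≡⟨ ≡.cong (λ z → (z ℤ.- + 3 ℤ.* X) ℤ.* (z ℤ.- + 3 ℤ.* X) ℤ.+ + 27 ℤ.* (X ℤ.* X)) a-half ⟩
    (+ 25 ℤ.* Y ℤ.+ + 3 ℤ.* X ℤ.- + 3 ℤ.* X) ℤ.* (+ 25 ℤ.* Y ℤ.+ + 3 ℤ.* X ℤ.- + 3 ℤ.* X) ℤ.+ + 27 ℤ.* (X ℤ.* X)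
      ≡⟨ lemma₂ X Y ⟩
    + 27 ℤ.* (X ℤ.* X ℤ.+ + 23 ℤ.* (Y ℤ.* Y)) ℤ.+ + 4 ℤ.* (Y ℤ.* Y)
      ≡⟨ ≡.cong (λ z → + 27 ℤ.* z ℤ.+ + 4 ℤ.* (Y ℤ.* Y)) X²+23Y² ⟩
    + 27 ℤ.* (+ 4 ℤ.* M ℤ.* + p) ℤ.+ + 4 ℤ.* (Y ℤ.* Y)     ≡⟨ lemma₃ M (+ p) Y ⟩
    + 4 ℤ.* (+ 27 ℤ.* M ℤ.* + p ℤ.+ Y ℤ.* Y)               ∎)
    where
    open ≡.≡-Reasoning
    lemma₁ : ∀ a X → + 4 ℤ.* (a ℤ.* a ℤ.- a ℤ.* (+ 3 ℤ.* X) ℤ.+ (+ 3 ℤ.* X) ℤ.* (+ 3 ℤ.* X)) ≡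
      (+ 2 ℤ.* a ℤ.- + 3 ℤ.* X) ℤ.* (+ 2 ℤ.* a ℤ.- + 3 ℤ.* X) ℤ.+ + 27 ℤ.* (X ℤ.* X)
    lemma₁ = ℤ-Solver.solve-∀
    lemma₂ : ∀ X Y → (+ 25 ℤ.* Y ℤ.+ + 3 ℤ.* X ℤ.- + 3 ℤ.* X) ℤ.* (+ 25 ℤ.* Y ℤ.+ + 3 ℤ.* X ℤ.- + 3 ℤ.* X) ℤ.+ + 27 ℤ.* (X ℤ.* X) ≡
      + 27 ℤ.* (X ℤ.* X ℤ.+ + 23 ℤ.* (Y ℤ.* Y)) ℤ.+ + 4 ℤ.* (Y ℤ.* Y)
    lemma₂ = ℤ-Solver.solve-∀
    lemma₃ : ∀ M p Y → + 27 ℤ.* (+ 4 ℤ.* M ℤ.* p) ℤ.+ + 4 ℤ.* (Y ℤ.* Y) ≡ + 4 ℤ.* (+ 27 ℤ.* M ℤ.* p ℤ.+ Y ℤ.* Y)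
    lemma₃ = ℤ-Solver.solve-∀

  ∣N∧∣Mp⇒∣Y : ∀ {q} → Prime q → q ∣ℤ 𝔼.norm u → q ∣ℤ + 27 ℤ.* M ℤ.* + p → q ∣ℤ Y
  ∣N∧∣Mp⇒∣Y {q} q-prime d e = prime∣square q-prime
    (ℤ∣.∣m+n∣m⇒∣n (≡.subst (q ∣ℤ_) N≡ d) e)

  p∣Y⇒ : ¬ p ∣ℤ Y
  p∣Y⇒ p∣Y = p∤4M (ℤ∣.*-cancelʳ-∣ (+ p) {{p-nonZero}} (≡.subst (+ p ℤ.* + p ℤ∣.∣_) X²+23Y²
    (ℤ∣.∣m∣n⇒∣m+n (square∣ p∣X) (ℤ∣.∣n⇒∣m*n (+ 23) (square∣ p∣Y)))))
    where
    p-nonZero : ℤ.NonZero (+ p)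
    p-nonZero = prime⇒nonZero p-prime
    square∣ : ∀ {i} → p ∣ℤ i → + p ℤ.* + p ℤ∣.∣ i ℤ.* i
    square∣ (ℤ∣.divides k ≡.refl) = ℤ∣.divides (k ℤ.* k) (lemma k (+ p))
      where
      lemma : ∀ k p → k ℤ.* p ℤ.* (k ℤ.* p) ≡ k ℤ.* k ℤ.* (p ℤ.* p)
      lemma = ℤ-Solver.solve-∀
    p∣X : p ∣ℤ X
    p∣X = prime∣square p-prime (ℤ∣.∣m+n∣n⇒∣m
      (≡.subst (p ∣ℤ_) (≡.sym X²+23Y²) (ℤ∣.∣n⇒∣m*n (+ 4 ℤ.* M) ℤ∣.∣-refl))
      (ℤ∣.∣n⇒∣m*n (+ 23) (ℤ∣.∣m⇒∣m*n Y p∣Y)))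

  p∤N : ¬ p ∣ℤ 𝔼.norm u
  p∤N d = p∣Y⇒ (∣N∧∣Mp⇒∣Y p-prime d (ℤ∣.∣n⇒∣m*n (+ 27 ℤ.* M) ℤ∣.∣-refl))

  Χ-prime-of-Y : ∀ {q} → Prime q → q ∣ℤ Y → Χ (+ q) ≡ I
  Χ-prime-of-Y {q} q-prime q∣Y =
    Recip⇒I q-prime q≢3 u (Χ (+ q)) q∤N ū≈-u (recip q-prime q≢3 q∤N)
    where
    q≢3 : q ≢ 3
    q≢3 ≡.refl = 3∤Y q∣Y
    q∤N : ¬ q ∣ℤ 𝔼.norm u
    q∤N d = [ (λ e → [ (λ q∣27 → q≢3 (divides-27 q∣27)) , (λ q∣M → coprime q-prime q∣M q∣Y) ]′ (prime∣* q-prime {+ 27} {M} e))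
            , (λ e → p∣Y⇒ (≡.subst (_∣ℤ Y) (primes-divide⇒≡ q-prime p-prime (ℤ∣.∣⇒∣ᵤ e)) q∣Y)) ]′
      (prime∣* q-prime {+ 27 ℤ.* M} {+ p} (ℤ∣.∣m+n∣n⇒∣m (≡.subst (q ∣ℤ_) N≡ d) (ℤ∣.∣m⇒∣m*n Y q∣Y)))
      where
      divides-27 : q ∣ℤ + 27 → q ≡ 3
      divides-27 e = primes-divide⇒≡ q-prime 3-prime (ℤ∣.∣⇒∣ᵤ
        ([ id , prime∣square q-prime {+ 3} ]′ (prime∣* q-prime {+ 3} {+ 3 ℤ.* + 3} e)))
    ū≈-u : 𝔼/._≈_ q (𝔼/._̄ q u) (𝔼/.-_ q u)
    ū≈-u = congruent (≡.subst (q ∣ℤ_) eq (ℤ∣.∣n⇒∣m*n (+ 25) q∣Y)) , CommutativeRing.refl (ℤ/ q)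
      where
      lemma₁ : ∀ X Y → + 25 ℤ.* Y ≡ (+ 25 ℤ.* Y ℤ.+ + 3 ℤ.* X) ℤ.- + 3 ℤ.* X
      lemma₁ = ℤ-Solver.solve-∀
      lemma₂ : ∀ a b → + 2 ℤ.* a ℤ.- b ≡ a ℤ.- b ℤ.- (ℤ.- a)
      lemma₂ = ℤ-Solver.solve-∀
      eq : + 25 ℤ.* Y ≡ a ℤ.- + 3 ℤ.* X ℤ.- (ℤ.- a)
      eq = ≡.trans (lemma₁ X Y) (≡.trans (≡.cong (ℤ._- + 3 ℤ.* X) (≡.sym a-half)) (lemma₂ a (+ 3 ℤ.* X)))

  Χ-product : ∀ ps → All Prime ps → (∀ {q} → q ∈ₗ ps → q ∣ℤ Y) → Χ (+ product ps) ≡ I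
  Χ-product []       _               _   = Χ-1
  Χ-product (q ∷ qs) (q-prime ∷ prs) q∣Y = ≡.trans (≡.cong Χ (ℤ.pos-* q (product qs)))
    (≡.trans (Χ-* (+ q) (+ product qs))
      (≡.cong₂ _∙_ (Χ-prime-of-Y q-prime (q∣Y (here ≡.refl))) (Χ-product qs prs (q∣Y ∘ there))))

  Χ-[-1] : Χ (ℤ.- 1ℤ) ≡ I
  Χ-[-1] = x∙x≡I⇒ (≡.trans (≡.sym (Χ-* (ℤ.- 1ℤ) (ℤ.- 1ℤ))) Χ-1)

  Χ-neg : ∀ i → Χ (ℤ.- i) ≡ Χ i
  Χ-neg i = ≡.trans (≡.cong Χ (≡.sym (ℤ.-1*i≡-i i)))
    (≡.trans (Χ-* (ℤ.- 1ℤ) i) (≡.cong (_∙ Χ i) Χ-[-1]))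

  Χ-∣∣ : ∀ i → Χ i ≡ Χ (+ ℤ.∣ i ∣)
  Χ-∣∣ (+ n)    = ≡.refl
  Χ-∣∣ -[1+ n ] = Χ-neg (+ suc n)

  Χ-Y : Χ Y ≡ I
  Χ-Y = ≡.trans (Χ-∣∣ Y) (≡.trans (≡.cong (λ n → Χ (+ n)) isFactorisation)
    (Χ-product factors factorsPrime λ {q} q∈ → ℤ∣.∣ᵤ⇒∣
      (≡.subst (q ℕ∣.∣_) (≡.sym isFactorisation) (∈⇒∣product q∈))))
    where
    open PrimeFactorisation (factorise ℤ.∣ Y ∣
      {{ℕ.≢-nonZero λ Y≡0 → 3∤Y (≡.subst (3 ∣ℤ_) (≡.sym (ℤ.∣i∣≡0⇒i≡0 Y≡0)) (ℤ∣.divides 0ℤ ≡.refl))}})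

  cube≡I : ∀ {q} → Prime q → ¬ q ∣ℤ 𝔼.norm u → Χ (+ q ℤ.* (+ q ℤ.* + q)) ≡ I
  cube≡I {q} q-prime q∤N = ≡.trans (Χ-* (+ q) (+ q ℤ.* + q)) (≡.trans
    (≡.cong (Χ (+ q) ∙_) (≡.trans (Χ-* (+ q) (+ q)) (x∙x≡x*̄ (Χ (+ q)))))
    (≡.trans (∙-comm (Χ (+ q)) _) (x*̄∙x≡I (Χ-prime q-prime q∤N))))

  Χ[M]∙Χ[p]≡I : Χ M ∙ Χ (+ p) ≡ I
  Χ[M]∙Χ[p]≡I = begin
    Χ M ∙ Χ (+ p)                          ≡⟨ ≡.cong (λ x → x ∙ (Χ M ∙ Χ (+ p))) (cube≡I 3-prime (3∤norm {u} primary)) ⟨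
    Χ (+ 27) ∙ (Χ M ∙ Χ (+ p))             ≡⟨ ∙-assoc (Χ (+ 27)) (Χ M) (Χ (+ p)) ⟨
    Χ (+ 27) ∙ Χ M ∙ Χ (+ p)               ≡⟨ ≡.cong (_∙ Χ (+ p)) (Χ-* (+ 27) M) ⟨
    Χ (+ 27 ℤ.* M) ∙ Χ (+ p)               ≡⟨ Χ-* (+ 27 ℤ.* M) (+ p) ⟨
    Χ (+ 27 ℤ.* M ℤ.* + p)                 ≡⟨ Χ-cong (congruent (ℤ∣.∣-trans ℤ∣.∣m∣∣m (ℤ∣.∣-reflexive (≡.trans N≡ (lemma (+ 27 ℤ.* M ℤ.* + p) Y))))) ⟩
    Χ (ℤ.- (Y ℤ.* Y))                      ≡⟨ Χ-neg (Y ℤ.* Y) ⟩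
    Χ (Y ℤ.* Y)                            ≡⟨ Χ-* Y Y ⟩
    Χ Y ∙ Χ Y                              ≡⟨ ≡.cong₂ _∙_ Χ-Y Χ-Y ⟩
    I                                      ∎
    where
    open ≡.≡-Reasoning
    lemma : ∀ z Y → z ℤ.+ Y ℤ.* Y ≡ z ℤ.- (ℤ.- (Y ℤ.* Y))
    lemma = ℤ-Solver.solve-∀

  resolvent : Resolvent p
  resolvent = record
    { X      = X
    ; Y      = Y
    ; a      = a
    ; a-half = a-half
    ; -23≋   = ≡.subst (p ∣ℤ_) (≡.sym X²+23Y²) (ℤ∣.∣n⇒∣m*n (+ 4 ℤ.* M) ℤ∣.∣-refl)
    ; p∤Y    = p∣Y⇒
    ; value  = Χ (+ p)
    ; recip  = recip p-prime p≢3 p∤N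
    }

2-prime : Prime 2
2-prime = from-yes (prime? 2)

∣1⇒⊥ : ∀ {q} → Prime q → ¬ q ∣ℤ 1ℤ
∣1⇒⊥ q-prime d = ¬prime[1] (≡.subst Prime (ℕ∣.∣1⇒≡1 (ℤ∣.∣⇒∣ᵤ d)) q-prime)

q∣2*⇒ : ∀ {q} → Prime q → ∀ M → q ∣ℤ + 2 ℤ.* M → q ≡ 2 ⊎ q ∣ℤ M
q∣2*⇒ q-prime M d = [ inj₁ ∘ primes-divide⇒≡ q-prime 2-prime ∘ ℤ∣.∣⇒∣ᵤ , inj₂ ]′ (prime∣* q-prime {+ 2} {M} d)

q∣2⇒ : ∀ {q} → Prime q → q ∣ℤ + 2 → q ≡ 2
q∣2⇒ q-prime d = primes-divide⇒≡ q-prime 2-prime (ℤ∣.∣⇒∣ᵤ d)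

q∣8⇒ : ∀ {q} → Prime q → q ∣ℤ + 8 → q ≡ 2
q∣8⇒ q-prime d = [ id , [ id , q∣2⇒ q-prime ]′ ∘ q∣2*⇒ q-prime (+ 2) ]′ (q∣2*⇒ q-prime (+ 4) d)

q∣16⇒ : ∀ {q} → Prime q → q ∣ℤ + 16 → q ≡ 2
q∣16⇒ q-prime d = [ id , q∣8⇒ q-prime ]′ (q∣2*⇒ q-prime (+ 8) d)

q∣64⇒ : ∀ {q} → Prime q → q ∣ℤ + 64 → q ≡ 2
q∣64⇒ q-prime d = [ id , [ id , q∣16⇒ q-prime ]′ ∘ q∣2*⇒ q-prime (+ 16) ]′ (q∣2*⇒ q-prime (+ 32) d)

coprime-8 : ∀ {Y} → ¬ 2 ∣ℤ Y → ∀ {q} → Prime q → q ∣ℤ + 8 → ¬ q ∣ℤ Y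
coprime-8 2∤Y q-prime d e = 2∤Y (≡.subst (_∣ℤ _) (q∣8⇒ q-prime d) e)

coprime-16 : ∀ {Y} → ¬ 2 ∣ℤ Y → ∀ {q} → Prime q → q ∣ℤ + 16 → ¬ q ∣ℤ Y
coprime-16 2∤Y q-prime d e = 2∤Y (≡.subst (_∣ℤ _) (q∣16⇒ q-prime d) e)

2∣⇒ : ∀ {x y z} → 2 ∣ℤ x → x ℤ.+ + 2 ℤ.* y ≡ z → 2 ∣ℤ z
2∣⇒ {y = y} d eq = ≡.subst (2 ∣ℤ_) eq (ℤ∣.∣m∣n⇒∣m+n d (ℤ∣.∣m⇒∣m*n y ℤ∣.∣-refl))

module _ {p : ℕ} (p-prime : Prime p) (p≢2 : p ≢ 2) (p≢3 : p ≢ 3) where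

  private
    2∤p : ¬ 2 ∣ℤ + p
    2∤p d = p≢2 (≡.sym (primes-divide⇒≡ 2-prime p-prime (ℤ∣.∣⇒∣ᵤ d)))

    3∤p : ¬ 3 ∣ℤ + p
    3∤p d = p≢3 (≡.sym (primes-divide⇒≡ 3-prime p-prime (ℤ∣.∣⇒∣ᵤ d)))

  principal⇒resolvent : ∀ x y → + p ≡ x ℤ.* x ℤ.+ + 23 ℤ.* (y ℤ.* y) →
                        ∃[ ρ ] Resolvent.value {p} ρ ≡ I
  principal⇒resolvent x y p≡ = by-cases (+ 3 ℤ∣.∣? y)
    where
    by-cases : Dec (3 ∣ℤ y) → ∃[ ρ ] Resolvent.value {p} ρ ≡ I
    by-cases (no 3∤y) = resolvent , ≡.trans (≡.cong (_∙ Χ (+ p)) (≡.sym Χ-1)) Χ[M]∙Χ[p]≡I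
      where
      lemma₁ : ∀ x y → (+ 2 ℤ.* x) ℤ.* (+ 2 ℤ.* x) ℤ.+ + 23 ℤ.* ((+ 2 ℤ.* y) ℤ.* (+ 2 ℤ.* y)) ≡
                       + 4 ℤ.* 1ℤ ℤ.* (x ℤ.* x ℤ.+ + 23 ℤ.* (y ℤ.* y))
      lemma₁ = ℤ-Solver.solve-∀
      lemma₂ : ∀ x y → + 2 ℤ.* (+ 25 ℤ.* y ℤ.+ + 3 ℤ.* x) ≡ + 25 ℤ.* (+ 2 ℤ.* y) ℤ.+ + 3 ℤ.* (+ 2 ℤ.* x)
      lemma₂ = ℤ-Solver.solve-∀
      open Evaluate p-prime p≢3 (+ 2 ℤ.* x) (+ 2 ℤ.* y) (+ 25 ℤ.* y ℤ.+ + 3 ℤ.* x) 1ℤ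
        (≡.trans (lemma₁ x y) (≡.cong (+ 4 ℤ.* 1ℤ ℤ.*_) (≡.sym p≡))) (lemma₂ x y)
        (λ d → [ (λ e → contradiction (ℤ∣.∣⇒∣ᵤ e) (ℕ∣.>⇒∤ (ℕ.n<1+n 2))) , 3∤y ]′ (prime∣* 3-prime {+ 2} {y} d))
        (λ d → p≢2 (q∣8⇒ p-prime (ℤ∣.∣m⇒∣m*n (+ 2) d)))
        (λ q-prime d _ → ∣1⇒⊥ q-prime d)
    by-cases (yes 3∣y) = resolvent , ≡.trans (≡.cong (_∙ Χ (+ p)) (≡.sym (cube≡I 2-prime 2∤N))) Χ[M]∙Χ[p]≡I
      where
      lemma₁ : ∀ x y → (+ 3 ℤ.* x ℤ.- + 23 ℤ.* y) ℤ.* (+ 3 ℤ.* x ℤ.- + 23 ℤ.* y)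
                         ℤ.+ + 23 ℤ.* ((x ℤ.+ + 3 ℤ.* y) ℤ.* (x ℤ.+ + 3 ℤ.* y)) ≡
                       + 4 ℤ.* + 8 ℤ.* (x ℤ.* x ℤ.+ + 23 ℤ.* (y ℤ.* y))
      lemma₁ = ℤ-Solver.solve-∀
      lemma₂ : ∀ x y → + 2 ℤ.* (+ 17 ℤ.* x ℤ.+ + 3 ℤ.* y) ≡
                       + 25 ℤ.* (x ℤ.+ + 3 ℤ.* y) ℤ.+ + 3 ℤ.* (+ 3 ℤ.* x ℤ.- + 23 ℤ.* y)
      lemma₂ = ℤ-Solver.solve-∀
      lemma₃ : ∀ x y → x ℤ.* (x ℤ.+ + 3 ℤ.* y) ℤ.- (x ℤ.* + 3) ℤ.* y ℤ.+ (+ 23 ℤ.* y) ℤ.* y ≡ x ℤ.* x ℤ.+ + 23 ℤ.* (y ℤ.* y)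
      lemma₃ = ℤ-Solver.solve-∀
      lemma₄ : ∀ x y → (x ℤ.+ + 3 ℤ.* y) ℤ.* (x ℤ.+ + 3 ℤ.* y) ℤ.+ + 2 ℤ.* (+ 7 ℤ.* (y ℤ.* y) ℤ.- + 3 ℤ.* (x ℤ.* y)) ≡
                       x ℤ.* x ℤ.+ + 23 ℤ.* (y ℤ.* y)
      lemma₄ = ℤ-Solver.solve-∀
      3∤x+3y : ¬ 3 ∣ℤ x ℤ.+ + 3 ℤ.* y
      3∤x+3y d = 3∤p (≡.subst (3 ∣ℤ_) (≡.trans (lemma₃ x y) (≡.sym p≡))
        (ℤ∣.∣m∣n⇒∣m+n (ℤ∣.∣m∣n⇒∣m-n (ℤ∣.∣n⇒∣m*n x d) (ℤ∣.∣n⇒∣m*n (x ℤ.* + 3) 3∣y)) (ℤ∣.∣n⇒∣m*n (+ 23 ℤ.* y) 3∣y)))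
      2∤x+3y : ¬ 2 ∣ℤ x ℤ.+ + 3 ℤ.* y
      2∤x+3y d = 2∤p (≡.subst (2 ∣ℤ_) (≡.sym p≡) (2∣⇒ (ℤ∣.∣m⇒∣m*n (x ℤ.+ + 3 ℤ.* y) d) (lemma₄ x y)))
      open Evaluate p-prime p≢3 (+ 3 ℤ.* x ℤ.- + 23 ℤ.* y) (x ℤ.+ + 3 ℤ.* y) (+ 17 ℤ.* x ℤ.+ + 3 ℤ.* y) (+ 8)
        (≡.trans (lemma₁ x y) (≡.cong (+ 4 ℤ.* + 8 ℤ.*_) (≡.sym p≡))) (lemma₂ x y)
        3∤x+3y (λ d → p≢2 (q∣64⇒ p-prime (ℤ∣.∣m⇒∣m*n (+ 2) d)))
        (coprime-8 2∤x+3y)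
      2∤N : ¬ 2 ∣ℤ 𝔼.norm u
      2∤N d = 2∤x+3y (∣N∧∣Mp⇒∣Y 2-prime d (ℤ∣.∣m⇒∣m*n (+ p) (ℤ∣.divides (+ 108) ≡.refl)))

  private
    -- At q = 2 the symbol is trivial only if u is congruent to its conjugate.
    Χ[2]≢I : ∀ {a X x} → ¬ 2 ∣ℤ X → Recip 2 (a , + 3 ℤ.* X) x → x ≢ I
    Χ[2]≢I {a} {X} 2∤X (_ , r) ≡.refl = 2∤X (≡.subst (2 ∣ℤ_) (lemma a X)
      (ℤ∣.∣m∣n⇒∣m-n (_≋_[mod_].divides-difference (proj₁ (r 0 ≡.refl)))
        (ℤ∣.∣m⇒∣m*n (ℤ.- (+ 2 ℤ.* X)) (ℤ∣.∣-refl {+ 2}))))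
      where
      lemma : ∀ a X → ((a ℤ.- + 3 ℤ.* X) ℤ.* 1ℤ ℤ.- (ℤ.- (+ 3 ℤ.* X)) ℤ.* 0ℤ ℤ.-
                (1ℤ ℤ.* (a ℤ.* 1ℤ ℤ.- (+ 3 ℤ.* X) ℤ.* 0ℤ) ℤ.- 0ℤ ℤ.* (a ℤ.* 0ℤ ℤ.+ (+ 3 ℤ.* X) ℤ.* 1ℤ ℤ.- (+ 3 ℤ.* X) ℤ.* 0ℤ)))
                ℤ.- + 2 ℤ.* (ℤ.- (+ 2 ℤ.* X)) ≡ X
      lemma = ℤ-Solver.solve-∀

  non-principal⇒resolvent : ∀ x y → + p ≡ + 2 ℤ.* (x ℤ.* x) ℤ.+ x ℤ.* y ℤ.+ + 3 ℤ.* (y ℤ.* y) →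
                            ∃[ ρ ] Resolvent.value {p} ρ ≢ I
  non-principal⇒resolvent x y p≡ = by-cases (+ 3 ℤ∣.∣? y)
    where
    2∤y : ¬ 2 ∣ℤ y
    2∤y d = 2∤p (≡.subst (2 ∣ℤ_) (≡.trans (lemma x y) (≡.sym p≡))
      (ℤ∣.∣m∣n⇒∣m+n (ℤ∣.∣m⇒∣m*n (x ℤ.* x) (ℤ∣.∣-refl {+ 2})) (ℤ∣.∣n⇒∣m*n (x ℤ.+ + 3 ℤ.* y) d)))
      where
      lemma : ∀ x y → + 2 ℤ.* (x ℤ.* x) ℤ.+ (x ℤ.+ + 3 ℤ.* y) ℤ.* y ≡ + 2 ℤ.* (x ℤ.* x) ℤ.+ x ℤ.* y ℤ.+ + 3 ℤ.* (y ℤ.* y)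
      lemma = ℤ-Solver.solve-∀
    by-cases : Dec (3 ∣ℤ y) → ∃[ ρ ] Resolvent.value {p} ρ ≢ I
    by-cases (no 3∤y) = resolvent , λ Χp≡I → Χ[2]≢I {a = + 14 ℤ.* y ℤ.+ + 6 ℤ.* x} 2∤X (recip 2-prime (λ ()) 2∤N)
      (≡.trans (≡.sym (∙-identityʳ (Χ (+ 2)))) (≡.trans (≡.cong (Χ (+ 2) ∙_) (≡.sym Χp≡I)) Χ[M]∙Χ[p]≡I))
      where
      lemma₁ : ∀ x y → (+ 4 ℤ.* x ℤ.+ y) ℤ.* (+ 4 ℤ.* x ℤ.+ y) ℤ.+ + 23 ℤ.* (y ℤ.* y) ≡
                       + 4 ℤ.* + 2 ℤ.* (+ 2 ℤ.* (x ℤ.* x) ℤ.+ x ℤ.* y ℤ.+ + 3 ℤ.* (y ℤ.* y))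
      lemma₁ = ℤ-Solver.solve-∀
      lemma₂ : ∀ x y → + 2 ℤ.* (+ 14 ℤ.* y ℤ.+ + 6 ℤ.* x) ≡ + 25 ℤ.* y ℤ.+ + 3 ℤ.* (+ 4 ℤ.* x ℤ.+ y)
      lemma₂ = ℤ-Solver.solve-∀
      lemma₃ : ∀ x y → + 4 ℤ.* x ℤ.+ y ℤ.+ + 2 ℤ.* (ℤ.- (+ 2 ℤ.* x)) ≡ y
      lemma₃ = ℤ-Solver.solve-∀
      2∤X : ¬ 2 ∣ℤ + 4 ℤ.* x ℤ.+ y
      2∤X d = 2∤y (2∣⇒ d (lemma₃ x y))
      open Evaluate p-prime p≢3 (+ 4 ℤ.* x ℤ.+ y) y (+ 14 ℤ.* y ℤ.+ + 6 ℤ.* x) (+ 2)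
        (≡.trans (lemma₁ x y) (≡.cong (+ 4 ℤ.* + 2 ℤ.*_) (≡.sym p≡))) (lemma₂ x y)
        3∤y (λ d → p≢2 (q∣8⇒ p-prime d))
        (λ q-prime d → coprime-8 2∤y q-prime (ℤ∣.∣m⇒∣m*n (+ 4) d))
      2∤N : ¬ 2 ∣ℤ 𝔼.norm u
      2∤N d = 2∤y (∣N∧∣Mp⇒∣Y 2-prime d (ℤ∣.∣m⇒∣m*n (+ p) (ℤ∣.divides (+ 27) ≡.refl)))
    by-cases (yes 3∣y) = resolvent , λ Χp≡I → Χ[2]≢I {a = + 34 ℤ.* x ℤ.+ + 7 ℤ.* y} 2∤X (recip 2-prime (λ ()) 2∤N)
      (begin
        Χ (+ 2)                        ≡⟨ ∙-identityʳ (Χ (+ 2)) ⟨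
        Χ (+ 2) ∙ I                    ≡⟨ ≡.cong (Χ (+ 2) ∙_) (cube≡I 2-prime 2∤N) ⟨
        Χ (+ 2) ∙ Χ (+ 8)              ≡⟨ Χ-* (+ 2) (+ 8) ⟨
        Χ (+ 16)                       ≡⟨ ∙-identityʳ (Χ (+ 16)) ⟨
        Χ (+ 16) ∙ I                   ≡⟨ ≡.cong (Χ (+ 16) ∙_) Χp≡I ⟨
        Χ (+ 16) ∙ Χ (+ p)             ≡⟨ Χ[M]∙Χ[p]≡I ⟩
        I                              ∎)
      where
      open ≡.≡-Reasoning
      lemma₁ : ∀ x y → (+ 6 ℤ.* x ℤ.+ + 13 ℤ.* y) ℤ.* (+ 6 ℤ.* x ℤ.+ + 13 ℤ.* y)
                         ℤ.+ + 23 ℤ.* ((+ 2 ℤ.* x ℤ.- y) ℤ.* (+ 2 ℤ.* x ℤ.- y)) ≡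
                       + 4 ℤ.* + 16 ℤ.* (+ 2 ℤ.* (x ℤ.* x) ℤ.+ x ℤ.* y ℤ.+ + 3 ℤ.* (y ℤ.* y))
      lemma₁ = ℤ-Solver.solve-∀
      lemma₂ : ∀ x y → + 2 ℤ.* (+ 34 ℤ.* x ℤ.+ + 7 ℤ.* y) ≡ + 25 ℤ.* (+ 2 ℤ.* x ℤ.- y) ℤ.+ + 3 ℤ.* (+ 6 ℤ.* x ℤ.+ + 13 ℤ.* y)
      lemma₂ = ℤ-Solver.solve-∀
      lemma₃ : ∀ x y → + 2 ℤ.* x ℤ.- y ℤ.+ + 2 ℤ.* (y ℤ.- x) ≡ y
      lemma₃ = ℤ-Solver.solve-∀
      lemma₄ : ∀ x y → + 6 ℤ.* x ℤ.+ + 13 ℤ.* y ℤ.+ + 2 ℤ.* (ℤ.- (+ 3 ℤ.* x ℤ.+ + 6 ℤ.* y)) ≡ y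
      lemma₄ = ℤ-Solver.solve-∀
      lemma₅ : ∀ x y → x ℤ.* (+ 2 ℤ.* x ℤ.- y) ℤ.+ (+ 2 ℤ.* x ℤ.+ + 3 ℤ.* y) ℤ.* y ≡
                       + 2 ℤ.* (x ℤ.* x) ℤ.+ x ℤ.* y ℤ.+ + 3 ℤ.* (y ℤ.* y)
      lemma₅ = ℤ-Solver.solve-∀
      2∤X : ¬ 2 ∣ℤ + 6 ℤ.* x ℤ.+ + 13 ℤ.* y
      2∤X d = 2∤y (2∣⇒ d (lemma₄ x y))
      2∤Y : ¬ 2 ∣ℤ + 2 ℤ.* x ℤ.- y
      2∤Y d = 2∤y (2∣⇒ d (lemma₃ x y))
      3∤Y : ¬ 3 ∣ℤ + 2 ℤ.* x ℤ.- y
      3∤Y d = 3∤p (≡.subst (3 ∣ℤ_) (≡.trans (lemma₅ x y) (≡.sym p≡))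
        (ℤ∣.∣m∣n⇒∣m+n (ℤ∣.∣n⇒∣m*n x d) (ℤ∣.∣n⇒∣m*n (+ 2 ℤ.* x ℤ.+ + 3 ℤ.* y) 3∣y)))
      open Evaluate p-prime p≢3 (+ 6 ℤ.* x ℤ.+ + 13 ℤ.* y) (+ 2 ℤ.* x ℤ.- y) (+ 34 ℤ.* x ℤ.+ + 7 ℤ.* y) (+ 16)
        (≡.trans (lemma₁ x y) (≡.cong (+ 4 ℤ.* + 16 ℤ.*_) (≡.sym p≡))) (lemma₂ x y)
        3∤Y (λ d → p≢2 (q∣64⇒ p-prime d))
        (coprime-16 2∤Y)
      2∤N : ¬ 2 ∣ℤ 𝔼.norm u
      2∤N d = 2∤Y (∣N∧∣Mp⇒∣Y 2-prime d (ℤ∣.∣m⇒∣m*n (+ p) (ℤ∣.divides (+ 216) ≡.refl)))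

Principal NonPrincipal : ℤ → Set
Principal    n = ∃[ x ] ∃[ y ] n ≡ x ℤ.* x ℤ.+ x ℤ.* y ℤ.+ + 6 ℤ.* (y ℤ.* y)
NonPrincipal n = ∃[ x ] ∃[ y ] n ≡ + 2 ℤ.* (x ℤ.* x) ℤ.+ x ℤ.* y ℤ.+ + 3 ℤ.* (y ℤ.* y)

private
  Reduces : ℕ → Set
  Reduces A = ∀ B C x y → B ℤ.* B ℤ.+ + 23 ≡ + 4 ℤ.* + A ℤ.* C →
    Principal (+ A ℤ.* (x ℤ.* x) ℤ.+ B ℤ.* (x ℤ.* y) ℤ.+ C ℤ.* (y ℤ.* y)) ⊎
    NonPrincipal (+ A ℤ.* (x ℤ.* x) ℤ.+ B ℤ.* (x ℤ.* y) ℤ.+ C ℤ.* (y ℤ.* y))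

  centre : ∀ A .{{_ : ℕ.NonZero A}} B → ∃[ k ] ℤ.∣ B ℤ.- + 2 ℤ.* + A ℤ.* k ∣ ℕ.≤ A
  centre A B = by-size (r ℕ.≤? A)
    where
    instance
      2A-nonZero : ℕ.NonZero (2 ℕ.* A)
      2A-nonZero = ℕ.m*n≢0 2 A
    r = B ℤ.%ℕ (2 ℕ.* A)
    k = B ℤ./ℕ (2 ℕ.* A)
    B≡ : B ≡ + r ℤ.+ k ℤ.* + (2 ℕ.* A)
    B≡ = ℤ.a≡a%ℕn+[a/ℕn]*n B (2 ℕ.* A)
    lemma₁ : ∀ r k A → r ℤ.+ k ℤ.* (+ 2 ℤ.* A) ℤ.- + 2 ℤ.* A ℤ.* k ≡ r
    lemma₁ = ℤ-Solver.solve-∀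
    lemma₂ : ∀ r k A → r ℤ.+ k ℤ.* (+ 2 ℤ.* A) ℤ.- + 2 ℤ.* A ℤ.* (k ℤ.+ 1ℤ) ≡ r ℤ.- + 2 ℤ.* A
    lemma₂ = ℤ-Solver.solve-∀
    B′≡ : B ≡ + r ℤ.+ k ℤ.* (+ 2 ℤ.* + A)
    B′≡ = ≡.trans B≡ (≡.cong (λ z → + r ℤ.+ k ℤ.* z) (ℤ.pos-* 2 A))
    by-size : Dec (r ℕ.≤ A) → ∃[ k ] ℤ.∣ B ℤ.- + 2 ℤ.* + A ℤ.* k ∣ ℕ.≤ A
    by-size (yes r≤A) = k , ≡.subst (λ z → ℤ.∣ z ∣ ℕ.≤ A)
      (≡.sym (≡.trans (≡.cong (ℤ._- + 2 ℤ.* + A ℤ.* k) B′≡) (lemma₁ (+ r) k (+ A)))) r≤A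
    by-size (no r≰A) = k ℤ.+ 1ℤ , ≡.subst (ℕ._≤ A) (≡.sym abs-eq)
      (ℕ.m≤n+o⇒m∸n≤o (2 ℕ.* A) r (≡.subst (ℕ._≤ r ℕ.+ A) (≡.sym (≡.cong (A ℕ.+_) (ℕ.+-identityʳ A))) (ℕ.+-monoˡ-≤ A (ℕ.<⇒≤ (ℕ.≰⇒> r≰A)))))
      where
      abs-eq : ℤ.∣ B ℤ.- + 2 ℤ.* + A ℤ.* (k ℤ.+ 1ℤ) ∣ ≡ 2 ℕ.* A ℕ.∸ r
      abs-eq = begin
        ℤ.∣ B ℤ.- + 2 ℤ.* + A ℤ.* (k ℤ.+ 1ℤ) ∣
          ≡⟨ ≡.cong ℤ.∣_∣ (≡.trans (≡.cong (ℤ._- + 2 ℤ.* + A ℤ.* (k ℤ.+ 1ℤ)) B′≡) (lemma₂ (+ r) k (+ A))) ⟩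
        ℤ.∣ + r ℤ.- + 2 ℤ.* + A ∣      ≡⟨ ≡.cong (λ z → ℤ.∣ + r ℤ.- z ∣) (ℤ.pos-* 2 A) ⟨
        ℤ.∣ + r ℤ.- + (2 ℕ.* A) ∣      ≡⟨ ≡.cong ℤ.∣_∣ (ℤ.m-n≡m⊖n r (2 ℕ.* A)) ⟩
        ℤ.∣ r ℤ.⊖ (2 ℕ.* A) ∣          ≡⟨ ℤ.∣⊖∣-≤ (ℕ.<⇒≤ (ℤ.n%ℕd<d B (2 ℕ.* A))) ⟩
        2 ℕ.* A ℕ.∸ r                  ∎
        where open ≡.≡-Reasoning

  base : ∀ A B c x y → 1 ℕ.≤ A → A ℕ.≤ 2 → ℤ.∣ B ∣ ℕ.≤ A → ℤ.∣ B ∣ ℕ.* ℤ.∣ B ∣ ℕ.+ 23 ≡ 4 ℕ.* A ℕ.* c →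
    Principal (+ A ℤ.* (x ℤ.* x) ℤ.+ B ℤ.* (x ℤ.* y) ℤ.+ + c ℤ.* (y ℤ.* y)) ⊎
    NonPrincipal (+ A ℤ.* (x ℤ.* x) ℤ.+ B ℤ.* (x ℤ.* y) ℤ.+ + c ℤ.* (y ℤ.* y))
  base 1 (+ 0)    c x y _ _ _ eq = contradiction (ℕ∣.divides c (≡.trans eq (ℕ.*-comm 4 c))) (from-no (4 ℕ∣.∣? 23))
  base 1 (+ 1)    c x y _ _ _ eq with ℕ.*-cancelˡ-≡ 6 c 4 eq
  ... | ≡.refl = inj₁ (x , y , lemma x y)
    where
    lemma : ∀ x y → 1ℤ ℤ.* (x ℤ.* x) ℤ.+ 1ℤ ℤ.* (x ℤ.* y) ℤ.+ + 6 ℤ.* (y ℤ.* y) ≡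
                    x ℤ.* x ℤ.+ x ℤ.* y ℤ.+ + 6 ℤ.* (y ℤ.* y)
    lemma = ℤ-Solver.solve-∀
  base 1 -[1+ 0 ] c x y _ _ _ eq with ℕ.*-cancelˡ-≡ 6 c 4 eq
  ... | ≡.refl = inj₁ (x , ℤ.- y , lemma x y)
    where
    lemma : ∀ x y → 1ℤ ℤ.* (x ℤ.* x) ℤ.+ ℤ.- 1ℤ ℤ.* (x ℤ.* y) ℤ.+ + 6 ℤ.* (y ℤ.* y) ≡
                    x ℤ.* x ℤ.+ x ℤ.* (ℤ.- y) ℤ.+ + 6 ℤ.* (ℤ.- y ℤ.* (ℤ.- y))
    lemma = ℤ-Solver.solve-∀
  base 2 (+ 0)    c x y _ _ _ eq = contradiction (ℕ∣.divides c (≡.trans eq (ℕ.*-comm 8 c))) (from-no (8 ℕ∣.∣? 23))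
  base 2 (+ 1)    c x y _ _ _ eq with ℕ.*-cancelˡ-≡ 3 c 8 eq
  ... | ≡.refl = inj₂ (x , y , lemma x y)
    where
    lemma : ∀ x y → + 2 ℤ.* (x ℤ.* x) ℤ.+ 1ℤ ℤ.* (x ℤ.* y) ℤ.+ + 3 ℤ.* (y ℤ.* y) ≡
                    + 2 ℤ.* (x ℤ.* x) ℤ.+ x ℤ.* y ℤ.+ + 3 ℤ.* (y ℤ.* y)
    lemma = ℤ-Solver.solve-∀
  base 2 -[1+ 0 ] c x y _ _ _ eq with ℕ.*-cancelˡ-≡ 3 c 8 eq
  ... | ≡.refl = inj₂ (x , ℤ.- y , lemma x y)
    where
    lemma : ∀ x y → + 2 ℤ.* (x ℤ.* x) ℤ.+ ℤ.- 1ℤ ℤ.* (x ℤ.* y) ℤ.+ + 3 ℤ.* (y ℤ.* y) ≡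
                    + 2 ℤ.* (x ℤ.* x) ℤ.+ x ℤ.* (ℤ.- y) ℤ.+ + 3 ℤ.* (ℤ.- y ℤ.* (ℤ.- y))
    lemma = ℤ-Solver.solve-∀
  base 2 (+ 2)    c x y _ _ _ eq = contradiction (ℕ∣.divides c (≡.trans eq (ℕ.*-comm 8 c))) (from-no (8 ℕ∣.∣? 27))
  base 2 -[1+ 1 ] c x y _ _ _ eq = contradiction (ℕ∣.divides c (≡.trans eq (ℕ.*-comm 8 c))) (from-no (8 ℕ∣.∣? 27))
  base 1 (+ (suc (suc _)))          c x y _ _ (ℕ.s≤s ()) _
  base 1 -[1+ suc _ ]               c x y _ _ (ℕ.s≤s ()) _
  base 2 (+ (suc (suc (suc _))))    c x y _ _ (ℕ.s≤s (ℕ.s≤s ())) _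
  base 2 -[1+ suc (suc _) ]         c x y _ _ (ℕ.s≤s (ℕ.s≤s ())) _
  base (suc (suc (suc _))) _        c x y _ (ℕ.s≤s (ℕ.s≤s ())) _ _

  module _ {A : ℕ} (1≤A : 1 ℕ.≤ A) (rec : ∀ {c} → c ℕ.< A → 1 ℕ.≤ c → Reduces c) where

    reduce-centred : ∀ B C → ℤ.∣ B ∣ ℕ.≤ A → ∀ x y → B ℤ.* B ℤ.+ + 23 ≡ + 4 ℤ.* + A ℤ.* C →
      Principal (+ A ℤ.* (x ℤ.* x) ℤ.+ B ℤ.* (x ℤ.* y) ℤ.+ C ℤ.* (y ℤ.* y)) ⊎
      NonPrincipal (+ A ℤ.* (x ℤ.* x) ℤ.+ B ℤ.* (x ℤ.* y) ℤ.+ C ℤ.* (y ℤ.* y))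
    reduce-centred B C ∣B∣≤A x y disc = by-sign C disc
      where
      Goal : ℤ → Set
      Goal C = Principal (+ A ℤ.* (x ℤ.* x) ℤ.+ B ℤ.* (x ℤ.* y) ℤ.+ C ℤ.* (y ℤ.* y)) ⊎
               NonPrincipal (+ A ℤ.* (x ℤ.* x) ℤ.+ B ℤ.* (x ℤ.* y) ℤ.+ C ℤ.* (y ℤ.* y))
      s = ℤ.∣ B ∣ ℕ.* ℤ.∣ B ∣
      positive : ∀ c → B ℤ.* B ℤ.+ + 23 ≡ + 4 ℤ.* + A ℤ.* + c → s ℕ.+ 23 ≡ 4 ℕ.* A ℕ.* c
      positive c eq = ℤ.+-injective (begin
        + (s ℕ.+ 23)               ≡⟨ ≡.cong (ℤ._+ + 23) (square-abs B) ⟨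
        B ℤ.* B ℤ.+ + 23           ≡⟨ eq ⟩
        + 4 ℤ.* + A ℤ.* + c        ≡⟨ ≡.cong (ℤ._* + c) (ℤ.pos-* 4 A) ⟨
        + (4 ℕ.* A) ℤ.* + c        ≡⟨ ℤ.pos-* (4 ℕ.* A) c ⟨
        + (4 ℕ.* A ℕ.* c)          ∎)
        where open ≡.≡-Reasoning
      small : ∀ c → B ℤ.* B ℤ.+ + 23 ≡ + 4 ℤ.* + A ℤ.* + c → c ℕ.< A → 1 ℕ.≤ c → Goal (+ c)
      small c eq c<A 1≤c = ≡.subst (λ n → Principal n ⊎ NonPrincipal n) (lemma₁ (+ A) B (+ c) x y)
        (rec c<A 1≤c B (+ A) y x (≡.trans eq (lemma₂ (+ A) (+ c))))
        where
        lemma₁ : ∀ A B c x y → c ℤ.* (y ℤ.* y) ℤ.+ B ℤ.* (y ℤ.* x) ℤ.+ A ℤ.* (x ℤ.* x) ≡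
                               A ℤ.* (x ℤ.* x) ℤ.+ B ℤ.* (x ℤ.* y) ℤ.+ c ℤ.* (y ℤ.* y)
        lemma₁ = ℤ-Solver.solve-∀
        lemma₂ : ∀ A c → + 4 ℤ.* A ℤ.* c ≡ + 4 ℤ.* c ℤ.* A
        lemma₂ = ℤ-Solver.solve-∀
      1≤c : ∀ c → s ℕ.+ 23 ≡ 4 ℕ.* A ℕ.* c → 1 ℕ.≤ c
      1≤c zero    eq = contradiction (≡.trans (≡.sym (ℕ.*-zeroʳ (4 ℕ.* A))) (≡.sym eq)) λ 0≡ →
        ℕ.<⇒≢ (ℕ.<-≤-trans (from-yes (0 ℕ.<? 23)) (ℕ.m≤n+m 23 s)) 0≡
      1≤c (suc c) _  = ℕ.s≤s ℕ.z≤n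
      c<A : ∀ c → 3 ℕ.≤ A → s ℕ.+ 23 ≡ 4 ℕ.* A ℕ.* c → c ℕ.< A
      c<A c 3≤A eq = ℕ.≰⇒> λ A≤c → contradiction (bound A≤c) (ℕ.<⇒≱ (ℕ.<-≤-trans (from-yes (23 ℕ.<? 27)) (ℕ.*-monoʳ-≤ 3 (ℕ.*-mono-≤ 3≤A 3≤A))))
        where
        open ℕ.≤-Reasoning
        bound : A ℕ.≤ c → 3 ℕ.* (A ℕ.* A) ℕ.≤ 23
        bound A≤c = ℕ.+-cancelˡ-≤ (A ℕ.* A) _ _ (begin
          A ℕ.* A ℕ.+ 3 ℕ.* (A ℕ.* A)   ≡⟨⟩
          4 ℕ.* (A ℕ.* A)               ≡⟨ ℕ.*-assoc 4 A A ⟨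
          4 ℕ.* A ℕ.* A                 ≤⟨ ℕ.*-monoʳ-≤ (4 ℕ.* A) A≤c ⟩
          4 ℕ.* A ℕ.* c                 ≡⟨ eq ⟨
          s ℕ.+ 23                      ≤⟨ ℕ.+-monoˡ-≤ 23 (ℕ.*-mono-≤ ∣B∣≤A ∣B∣≤A) ⟩
          A ℕ.* A ℕ.+ 23                ∎)
      by-sign : ∀ C → B ℤ.* B ℤ.+ + 23 ≡ + 4 ℤ.* + A ℤ.* C → Goal C
      by-sign (+ c) eq = by-size (3 ℕ.≤? A)
        where
        by-size : Dec (3 ℕ.≤ A) → Goal (+ c)
        by-size (yes 3≤A) = small c eq (c<A c 3≤A (positive c eq)) (1≤c c (positive c eq))
        by-size (no 3≰A)  = base A B c x y 1≤A (ℕ.s≤s⁻¹ (ℕ.≰⇒> 3≰A)) ∣B∣≤A (positive c eq)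
      by-sign -[1+ c ] eq = contradiction
        (≡.trans (≡.cong (ℤ._+ + 23) (≡.sym (square-abs B))) (≡.trans eq (≡.trans (≡.cong (ℤ._* -[1+ c ]) (≡.sym (ℤ.pos-* 4 A)))
          (≡.cong (λ n → + n ℤ.* -[1+ c ]) (≡.sym (ℕ.suc-pred (4 ℕ.* A) {{4A-nonZero}}))))))
        λ ()
        where
        4A-nonZero : ℕ.NonZero (4 ℕ.* A)
        4A-nonZero = ℕ.m*n≢0 4 A {{_}} {{ℕ.>-nonZero 1≤A}}

  reduces : ∀ A → 1 ℕ.≤ A → Reduces A
  reduces = ℕ.<-rec (λ A → 1 ℕ.≤ A → Reduces A) λ A rec 1≤A B C x y disc →
    step A 1≤A (λ c<A 1≤c → rec c<A 1≤c) B C x y disc (centre A {{ℕ.>-nonZero 1≤A}} B)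
    where
    step : ∀ A (1≤A : 1 ℕ.≤ A) → (∀ {c} → c ℕ.< A → 1 ℕ.≤ c → Reduces c) → ∀ B C x y →
      B ℤ.* B ℤ.+ + 23 ≡ + 4 ℤ.* + A ℤ.* C → ∃[ k ] ℤ.∣ B ℤ.- + 2 ℤ.* + A ℤ.* k ∣ ℕ.≤ A →
      Principal (+ A ℤ.* (x ℤ.* x) ℤ.+ B ℤ.* (x ℤ.* y) ℤ.+ C ℤ.* (y ℤ.* y)) ⊎
      NonPrincipal (+ A ℤ.* (x ℤ.* x) ℤ.+ B ℤ.* (x ℤ.* y) ℤ.+ C ℤ.* (y ℤ.* y))
    step A 1≤A rec B C x y disc (k , ∣B′∣≤A) =
      ≡.subst (λ n → Principal n ⊎ NonPrincipal n) (lemma₁ (+ A) B C x y k)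
        (reduce-centred 1≤A rec (B ℤ.- + 2 ℤ.* + A ℤ.* k) (C ℤ.- B ℤ.* k ℤ.+ + A ℤ.* (k ℤ.* k)) ∣B′∣≤A (x ℤ.+ k ℤ.* y) y
          (≡.trans (lemma₂ (+ A) B k) (≡.trans (≡.cong (ℤ._+ + 4 ℤ.* + A ℤ.* (+ A ℤ.* (k ℤ.* k) ℤ.- B ℤ.* k)) disc)
            (lemma₃ (+ A) B C k))))
      where
      lemma₁ : ∀ A B C x y k →
        A ℤ.* ((x ℤ.+ k ℤ.* y) ℤ.* (x ℤ.+ k ℤ.* y)) ℤ.+ (B ℤ.- + 2 ℤ.* A ℤ.* k) ℤ.* ((x ℤ.+ k ℤ.* y) ℤ.* y)
          ℤ.+ (C ℤ.- B ℤ.* k ℤ.+ A ℤ.* (k ℤ.* k)) ℤ.* (y ℤ.* y) ≡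
        A ℤ.* (x ℤ.* x) ℤ.+ B ℤ.* (x ℤ.* y) ℤ.+ C ℤ.* (y ℤ.* y)
      lemma₁ = ℤ-Solver.solve-∀
      lemma₂ : ∀ A B k → (B ℤ.- + 2 ℤ.* A ℤ.* k) ℤ.* (B ℤ.- + 2 ℤ.* A ℤ.* k) ℤ.+ + 23 ≡
        B ℤ.* B ℤ.+ + 23 ℤ.+ + 4 ℤ.* A ℤ.* (A ℤ.* (k ℤ.* k) ℤ.- B ℤ.* k)
      lemma₂ = ℤ-Solver.solve-∀
      lemma₃ : ∀ A B C k → + 4 ℤ.* A ℤ.* C ℤ.+ + 4 ℤ.* A ℤ.* (A ℤ.* (k ℤ.* k) ℤ.- B ℤ.* k) ≡
        + 4 ℤ.* A ℤ.* (C ℤ.- B ℤ.* k ℤ.+ A ℤ.* (k ℤ.* k))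
      lemma₃ = ℤ-Solver.solve-∀

odd-form : ∀ {p} → Prime p → p ≢ 2 → ∀ d → p ∣ℤ d ℤ.* d ℤ.+ + 23 → Principal (+ p) ⊎ NonPrincipal (+ p)
odd-form {p} p-prime p≢2 d p∣ = ≡.subst (λ n → Principal n ⊎ NonPrincipal n) (lemma₁ (+ p) B C)
  (reduces p (ℕ.≤-trans (ℕ.s≤s ℕ.z≤n) (ℕ.nonTrivial⇒n>1 p {{prime⇒nonTrivial p-prime}})) B C 1ℤ 0ℤ disc)
  where
  p∤2 : ¬ + 2 ≋ 0ℤ [mod p ]
  p∤2 e = p≢2 (primes-divide⇒≡ p-prime 2-prime (ℤ∣.∣⇒∣ᵤ (≋0⇒∣ e)))
  h = PrimeField.inverse p-prime {+ 2} p∤2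
  e = (d ℤ.- 1ℤ) ℤ.* proj₁ h
  B = + 2 ℤ.* e ℤ.+ 1ℤ
  p∣4* : p ∣ℤ + 4 ℤ.* (e ℤ.* e ℤ.+ e ℤ.+ + 6)
  p∣4* = ≡.subst (p ∣ℤ_) (lemma d (proj₁ h))
    (ℤ∣.∣m∣n⇒∣m+n p∣ (ℤ∣.∣n⇒∣m*n ((d ℤ.- 1ℤ) ℤ.* (d ℤ.+ + 2 ℤ.* e ℤ.+ 1ℤ)) (_≋_[mod_].divides-difference (proj₂ h))))
    where
    lemma : ∀ d h → d ℤ.* d ℤ.+ + 23 ℤ.+ (d ℤ.- 1ℤ) ℤ.* (d ℤ.+ + 2 ℤ.* ((d ℤ.- 1ℤ) ℤ.* h) ℤ.+ 1ℤ) ℤ.* (+ 2 ℤ.* h ℤ.- 1ℤ) ≡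
            + 4 ℤ.* ((d ℤ.- 1ℤ) ℤ.* h ℤ.* ((d ℤ.- 1ℤ) ℤ.* h) ℤ.+ (d ℤ.- 1ℤ) ℤ.* h ℤ.+ + 6)
    lemma = ℤ-Solver.solve-∀
  p∣e²+e+6 : p ∣ℤ e ℤ.* e ℤ.+ e ℤ.+ + 6
  p∣e²+e+6 = [ (λ z → contradiction (q∣8⇒ p-prime (ℤ∣.∣m⇒∣m*n (+ 2) z)) p≢2) , id ]′
    (prime∣* p-prime {+ 4} {e ℤ.* e ℤ.+ e ℤ.+ + 6} p∣4*)
  C = ℤ∣._∣_.quotient p∣e²+e+6
  disc : B ℤ.* B ℤ.+ + 23 ≡ + 4 ℤ.* + p ℤ.* C
  disc = ≡.trans (lemma₂ e) (≡.trans (≡.cong (+ 4 ℤ.*_) (ℤ∣._∣_.equality p∣e²+e+6)) (lemma₃ (+ p) C))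
    where
    lemma₂ : ∀ e → (+ 2 ℤ.* e ℤ.+ 1ℤ) ℤ.* (+ 2 ℤ.* e ℤ.+ 1ℤ) ℤ.+ + 23 ≡ + 4 ℤ.* (e ℤ.* e ℤ.+ e ℤ.+ + 6)
    lemma₂ = ℤ-Solver.solve-∀
    lemma₃ : ∀ p C → + 4 ℤ.* (C ℤ.* p) ≡ + 4 ℤ.* p ℤ.* C
    lemma₃ = ℤ-Solver.solve-∀
  lemma₁ : ∀ p B C → p ℤ.* (1ℤ ℤ.* 1ℤ) ℤ.+ B ℤ.* (1ℤ ℤ.* 0ℤ) ℤ.+ C ℤ.* (0ℤ ℤ.* 0ℤ) ≡ p
  lemma₁ = ℤ-Solver.solve-∀

Principal⇒x²+23y² : ∀ {n} → ¬ 2 ∣ℤ n → Principal n → ∃[ x ] ∃[ y ] n ≡ x ℤ.* x ℤ.+ + 23 ℤ.* (y ℤ.* y)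
Principal⇒x²+23y² {n} 2∤n (x , y , n≡) = from-even 2∣y
  where
  2∣i*i+i : ∀ i → 2 ∣ℤ i ℤ.* i ℤ.+ i
  2∣i*i+i i = even (i ℤ.%ℕ 2) (ℤ.n%ℕd<d i 2) (ℤ.a≡a%ℕn+[a/ℕn]*n i 2)
    where
    k = i ℤ./ℕ 2
    even : ∀ r → r ℕ.< 2 → i ≡ + r ℤ.+ k ℤ.* + 2 → 2 ∣ℤ i ℤ.* i ℤ.+ i
    even 0 _ eq = ℤ∣.divides ((k ℤ.* + 2 ℤ.+ 1ℤ) ℤ.* k) (≡.trans (≡.cong (λ i → i ℤ.* i ℤ.+ i) eq) (lemma k))
      where
      lemma : ∀ k → (0ℤ ℤ.+ k ℤ.* + 2) ℤ.* (0ℤ ℤ.+ k ℤ.* + 2) ℤ.+ (0ℤ ℤ.+ k ℤ.* + 2) ≡ (k ℤ.* + 2 ℤ.+ 1ℤ) ℤ.* k ℤ.* + 2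
      lemma = ℤ-Solver.solve-∀
    even 1 _ eq = ℤ∣.divides ((k ℤ.* + 2 ℤ.+ 1ℤ) ℤ.* (k ℤ.+ 1ℤ)) (≡.trans (≡.cong (λ i → i ℤ.* i ℤ.+ i) eq) (lemma k))
      where
      lemma : ∀ k → (1ℤ ℤ.+ k ℤ.* + 2) ℤ.* (1ℤ ℤ.+ k ℤ.* + 2) ℤ.+ (1ℤ ℤ.+ k ℤ.* + 2) ≡ (k ℤ.* + 2 ℤ.+ 1ℤ) ℤ.* (k ℤ.+ 1ℤ) ℤ.* + 2
      lemma = ℤ-Solver.solve-∀
    even (suc (suc _)) (ℕ.s≤s (ℕ.s≤s ())) _
  -- n = x (x + 1) + x (y − 1) + 6y², so y − 1 is odd if n is.
  2∣y : 2 ∣ℤ y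
  2∣y = [ id , (λ 2∣y+1 → contradiction (≡.subst (2 ∣ℤ_) (≡.trans (lemma₂ x y) (≡.sym n≡))
      (ℤ∣.∣m∣n⇒∣m+n (ℤ∣.∣m∣n⇒∣m+n (2∣i*i+i x) (ℤ∣.∣n⇒∣m*n x 2∣y+1)) (ℤ∣.∣m⇒∣m*n (+ 3 ℤ.* (y ℤ.* y) ℤ.- x) (ℤ∣.∣-refl {+ 2})))) 2∤n) ]′
    (prime∣* 2-prime {y} {y ℤ.+ 1ℤ} (≡.subst (2 ∣ℤ_) (lemma₁ y) (2∣i*i+i y)))
    where
    lemma₁ : ∀ y → y ℤ.* y ℤ.+ y ≡ y ℤ.* (y ℤ.+ 1ℤ)
    lemma₁ = ℤ-Solver.solve-∀
    lemma₂ : ∀ x y → x ℤ.* x ℤ.+ x ℤ.+ x ℤ.* (y ℤ.+ 1ℤ) ℤ.+ + 2 ℤ.* (+ 3 ℤ.* (y ℤ.* y) ℤ.- x) ≡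
             x ℤ.* x ℤ.+ x ℤ.* y ℤ.+ + 6 ℤ.* (y ℤ.* y)
    lemma₂ = ℤ-Solver.solve-∀
  from-even : 2 ∣ℤ y → ∃[ x ] ∃[ y ] n ≡ x ℤ.* x ℤ.+ + 23 ℤ.* (y ℤ.* y)
  from-even (ℤ∣.divides z ≡.refl) = x ℤ.+ z , z , ≡.trans n≡ (lemma x z)
    where
    lemma : ∀ x z → x ℤ.* x ℤ.+ x ℤ.* (z ℤ.* + 2) ℤ.+ + 6 ℤ.* (z ℤ.* + 2 ℤ.* (z ℤ.* + 2)) ≡
                    (x ℤ.+ z) ℤ.* (x ℤ.+ z) ℤ.+ + 23 ℤ.* (z ℤ.* z)
    lemma = ℤ-Solver.solve-∀

-- The Lagrange resolvent of X³ − X − 1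

module _ (R : CommutativeRing c ℓ) where
  open CommutativeRing R hiding (zero)
  open Exp commutativeSemiring
  open IntegerCoefficients R
  open SetoidReasoning setoid

  transfer-ratio : ∀ {k y y′ u ū a b x} → k * u ≈ y * a → k * ū ≈ y * b → y * y′ ≈ 1# →
                   ∀ m → u ^ m ≈ x * ū ^ m → a ^ m ≈ x * b ^ m
  transfer-ratio {k} {y} {y′} {u} {ū} {a} {b} {x} ku kū yy′ m eq = begin
    a ^ m                           ≈⟨ isolate ku ⟩
    y′ ^ m * (k ^ m * u ^ m)        ≈⟨ *-congˡ (*-congˡ eq) ⟩
    y′ ^ m * (k ^ m * (x * ū ^ m))
      ≈⟨ solve 4 (λ y k x u → y :* (k :* (x :* u)) := x :* (y :* (k :* u))) refl (y′ ^ m) (k ^ m) x (ū ^ m) ⟩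
    x * (y′ ^ m * (k ^ m * ū ^ m))  ≈⟨ *-congˡ (isolate kū) ⟨
    x * b ^ m                       ∎
    where
    isolate : ∀ {u a} → k * u ≈ y * a → a ^ m ≈ y′ ^ m * (k ^ m * u ^ m)
    isolate {u} {a} ku = begin
      a ^ m                       ≈⟨ *-identityˡ _ ⟨
      1# * a ^ m                  ≈⟨ *-congʳ (trans (^-congˡ m (trans (*-comm y′ y) yy′)) (1^≈1 R m)) ⟨
      (y′ * y) ^ m * a ^ m        ≈⟨ *-congʳ (^-distrib-* y′ y m) ⟩
      y′ ^ m * y ^ m * a ^ m      ≈⟨ *-assoc _ _ _ ⟩
      y′ ^ m * (y ^ m * a ^ m)    ≈⟨ *-congˡ (^-distrib-* y a m) ⟨
      y′ ^ m * (y * a) ^ m        ≈⟨ *-congˡ (^-congˡ m ku) ⟨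
      y′ ^ m * (k * u) ^ m        ≈⟨ *-congˡ (^-distrib-* k u m) ⟩
      y′ ^ m * (k ^ m * u ^ m)    ∎

  sixth-power : ∀ x m → (x ^ 6) ^ m ≈ x ^ (3 ℕ.* m) * x ^ (3 ℕ.* m)
  sixth-power x m = begin
    (x ^ 6) ^ m                    ≈⟨ ^-congˡ m (^-homo-* x 3 3) ⟩
    (x ^ 3 * x ^ 3) ^ m            ≈⟨ ^-distrib-* (x ^ 3) (x ^ 3) m ⟩
    (x ^ 3) ^ m * (x ^ 3) ^ m      ≈⟨ *-cong (^-assocʳ x 3 m) (^-assocʳ x 3 m) ⟩
    x ^ (3 ℕ.* m) * x ^ (3 ℕ.* m)  ∎

  module _ {x y z : Carrier} where

    complete-1+3m : ∀ m → (x ^ 6) ^ m ≈ z * (y ^ 6) ^ m →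
      (x ^ (1 ℕ.+ 3 ℕ.* m) * x ^ (1 ℕ.+ 3 ℕ.* m)) * (y * y) ≈ z * ((y ^ (1 ℕ.+ 3 ℕ.* m) * y ^ (1 ℕ.+ 3 ℕ.* m)) * (x * x))
    complete-1+3m m eq = begin
      (x * s * (x * s)) * (y * y)
        ≈⟨ solve 3 (λ x y s → (x :* s :* (x :* s)) :* (y :* y) := (s :* s) :* (x :* x :* (y :* y))) refl x y s ⟩
      (s * s) * (x * x * (y * y))          ≈⟨ *-congʳ (trans (sym (sixth-power x m)) eq) ⟩
      z * (y ^ 6) ^ m * (x * x * (y * y))  ≈⟨ *-congʳ (*-congˡ (sixth-power y m)) ⟩
      z * (t * t) * (x * x * (y * y))
        ≈⟨ solve 4 (λ x y z t → (z :* (t :* t)) :* (x :* x :* (y :* y)) := z :* ((y :* t :* (y :* t)) :* (x :* x))) refl x y z t ⟩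
      z * ((y * t * (y * t)) * (x * x))    ∎
      where
      s = x ^ (3 ℕ.* m)
      t = y ^ (3 ℕ.* m)

    complete-2+3m : ∀ m → (y ^ 6) ^ suc m ≈ z * (x ^ 6) ^ suc m →
      (y ^ (2 ℕ.+ 3 ℕ.* m) * y ^ (2 ℕ.+ 3 ℕ.* m)) * (y * y) ≈ z * ((x ^ (2 ℕ.+ 3 ℕ.* m) * x ^ (2 ℕ.+ 3 ℕ.* m)) * (x * x))
    complete-2+3m m eq = begin
      (y * (y * t) * (y * (y * t))) * (y * y)
        ≈⟨ solve 2 (λ y t → (y :* (y :* t) :* (y :* (y :* t))) :* (y :* y) := y :^ 6 :* (t :* t)) refl y t ⟩
      y ^ 6 * (t * t)          ≈⟨ *-congˡ (sixth-power y m) ⟨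
      (y ^ 6) ^ suc m          ≈⟨ eq ⟩
      z * (x ^ 6) ^ suc m      ≈⟨ *-congˡ (*-congˡ (sixth-power x m)) ⟩
      z * (x ^ 6 * (s * s))
        ≈⟨ *-congˡ (solve 2 (λ x s → (x :* (x :* s) :* (x :* (x :* s))) :* (x :* x) := x :^ 6 :* (s :* s)) refl x s) ⟨
      z * ((x * (x * s) * (x * (x * s))) * (x * x))   ∎
      where
      s = x ^ (3 ℕ.* m)
      t = y ^ (3 ℕ.* m)

  cancel-product : ∀ {x y s t z k k′} → x * y ≈ k → k * k′ ≈ 1# →
    (s * x) * (s * x) * (y * y) ≈ z * ((t * y) * (t * y) * (x * x)) → s * s ≈ z * (t * t)
  cancel-product {x} {y} {s} {t} {z} {k} {k′} xy≈k kk′ eq = begin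
    s * s                                  ≈⟨ *-identityʳ _ ⟨
    s * s * 1#                             ≈⟨ *-congˡ unit ⟨
    s * s * ((x * y) * (x * y) * (k′ * k′))
      ≈⟨ solve 4 (λ x y s k → s :* s :* ((x :* y) :* (x :* y) :* (k :* k)) := (s :* x) :* (s :* x) :* (y :* y) :* (k :* k)) refl x y s k′ ⟩
    (s * x) * (s * x) * (y * y) * (k′ * k′)          ≈⟨ *-congʳ eq ⟩
    z * ((t * y) * (t * y) * (x * x)) * (k′ * k′)
      ≈⟨ solve 5 (λ x y t z k → z :* ((t :* y) :* (t :* y) :* (x :* x)) :* (k :* k) := z :* (t :* t) :* ((x :* y) :* (x :* y) :* (k :* k))) refl x y t z k′ ⟩
    z * (t * t) * ((x * y) * (x * y) * (k′ * k′))    ≈⟨ *-congˡ unit ⟩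
    z * (t * t) * 1#                                 ≈⟨ *-identityʳ _ ⟩
    z * (t * t)                                      ∎
    where
    unit : (x * y) * (x * y) * (k′ * k′) ≈ 1#
    unit = begin
      (x * y) * (x * y) * (k′ * k′)  ≈⟨ *-congʳ (*-cong xy≈k xy≈k) ⟩
      k * k * (k′ * k′)              ≈⟨ solve 2 (λ k l → k :* k :* (l :* l) := (k :* l) :* (k :* l)) refl k k′ ⟩
      (k * k′) * (k * k′)            ≈⟨ *-cong kk′ kk′ ⟩
      1# * 1#                        ≈⟨ *-identityˡ 1# ⟩
      1#                             ∎

record Roots (R : CommutativeRing c ℓ) : Set (c ⊔ ℓ) where
  open CommutativeRing R
  field
    α β γ : Carrier
    e₁ : α + β + γ ≈ 0#
    e₂ : α * β + β * γ + γ * α ≈ - 1#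
    e₃ : α * β * γ ≈ 1#

module LagrangeResolvent (R : CommutativeRing c ℓ) (roots : Roots R) where
  open CommutativeRing R hiding (zero)
  open IntegerCoefficients R
  open Eisenstein R
  open Roots roots
  open SetoidReasoning setoid

  δ : Carrier
  δ = (α - β) * (β - γ) * (γ - α)

  δ² : δ * δ ≈ fromℤ (ℤ.- + 23)
  δ² = begin
    δ * δ
      ≈⟨ solve 3 (λ a b c →
           let s = a :+ b :+ c
               q = a :* b :+ b :* c :+ c :* a
               r = a :* b :* c
               d = (a :- b) :* (b :- c) :* (c :- a) in
           d :* d := s :* s :* (q :* q) :- con (+ 4) :* (q :* q :* q) :- con (+ 4) :* (s :* s :* s :* r)
                     :+ con (+ 18) :* (s :* q :* r) :- con (+ 27) :* (r :* r)) refl α β γ ⟩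
    disc (α + β + γ) (α * β + β * γ + γ * α) (α * β * γ)
      ≈⟨ disc-cong e₁ e₂ e₃ ⟩
    disc 0# (- 1#) 1#
      ≈⟨ solve 0 (let s = con 0ℤ ; q = :- con 1ℤ ; r = con 1ℤ in
           s :* s :* (q :* q) :- con (+ 4) :* (q :* q :* q) :- con (+ 4) :* (s :* s :* s :* r)
           :+ con (+ 18) :* (s :* q :* r) :- con (+ 27) :* (r :* r) := con (ℤ.- + 23)) refl ⟩
    fromℤ (ℤ.- + 23) ∎
    where
    disc : Carrier → Carrier → Carrier → Carrier
    disc s q r = s * s * (q * q) - fromℤ (+ 4) * (q * q * q) - fromℤ (+ 4) * (s * s * s * r)
                 + fromℤ (+ 18) * (s * q * r) - fromℤ (+ 27) * (r * r)
    disc-cong : ∀ {s s′ q q′ r r′} → s ≈ s′ → q ≈ q′ → r ≈ r′ → disc s q r ≈ disc s′ q′ r′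
    disc-cong es eq er = +-cong (+-cong (+-cong (+-cong
      (*-cong (*-cong es es) (*-cong eq eq))
      (-‿cong (*-congˡ (*-cong (*-cong eq eq) eq))))
      (-‿cong (*-congˡ (*-cong (*-cong (*-cong es es) es) er))))
      (*-congˡ (*-cong (*-cong es eq) er)))
      (-‿cong (*-congˡ (*-cong er er)))

  -- L = α + ωβ + ω²γ
  L : Carrier × Carrier
  L = α - γ , β - γ

  L*L̄ : L E.* L ̄ E.≈ scalar (fromℤ (+ 3))
  L*L̄ = E.trans (x*x̄≈norm L) (scalar-cong (begin
    norm L
      ≈⟨ solve 3 (λ a b c → (a :- c) :* (a :- c) :- (a :- c) :* (b :- c) :+ (b :- c) :* (b :- c) :=
           (a :+ b :+ c) :* (a :+ b :+ c) :- con (+ 3) :* (a :* b :+ b :* c :+ c :* a)) refl α β γ ⟩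
    (α + β + γ) * (α + β + γ) - fromℤ (+ 3) * (α * β + β * γ + γ * α)
      ≈⟨ +-cong (*-cong e₁ e₁) (-‿cong (*-congˡ e₂)) ⟩
    0# * 0# - fromℤ (+ 3) * - 1#
      ≈⟨ solve 0 (con 0ℤ :* con 0ℤ :- con (+ 3) :* (:- con 1ℤ) := con (+ 3)) refl ⟩
    fromℤ (+ 3) ∎))

  2L³ : scalar (fromℤ (+ 2)) E.* (L E.* (L E.* L)) E.≈ (fromℤ (+ 27) - fromℤ (+ 3) * δ , - (fromℤ (+ 6) * δ))
  2L³ = E.trans (scalar*-≈ (fromℤ (+ 2)) (L E.* (L E.* L)))
    ((begin
      fromℤ (+ 2) * proj₁ (L E.* (L E.* L))
        ≈⟨ solve 3 (λ a b c →
             let x = a :- c ; y = b :- c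
                 x² = x :* x :- y :* y ; y² = x :* y :+ y :* x :- y :* y
                 s = a :+ b :+ c ; q = a :* b :+ b :* c :+ c :* a ; r = a :* b :* c
                 d = (a :- b) :* (b :- c) :* (c :- a) in
             con (+ 2) :* (x :* x² :- y :* y²) :=
             (con (+ 2) :* (s :* s :* s) :- con (+ 9) :* (s :* q) :+ con (+ 27) :* r) :- con (+ 3) :* d) refl α β γ ⟩
      sym-part (α + β + γ) (α * β + β * γ + γ * α) (α * β * γ) - fromℤ (+ 3) * δ
        ≈⟨ +-congʳ (+-cong (+-cong (*-congˡ (*-cong (*-cong e₁ e₁) e₁)) (-‿cong (*-congˡ (*-cong e₁ e₂)))) (*-congˡ e₃)) ⟩
      sym-part 0# (- 1#) 1# - fromℤ (+ 3) * δ
        ≈⟨ solve 1 (λ d → let s = con 0ℤ ; q = :- con 1ℤ ; r = con 1ℤ in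
             (con (+ 2) :* (s :* s :* s) :- con (+ 9) :* (s :* q) :+ con (+ 27) :* r) :- con (+ 3) :* d := con (+ 27) :- con (+ 3) :* d) refl δ ⟩
      fromℤ (+ 27) - fromℤ (+ 3) * δ ∎) ,
     solve 3 (λ a b c →
       let x = a :- c ; y = b :- c
           x² = x :* x :- y :* y ; y² = x :* y :+ y :* x :- y :* y
           d = (a :- b) :* (b :- c) :* (c :- a) in
       con (+ 2) :* (x :* y² :+ y :* x² :- y :* y²) := :- (con (+ 6) :* d)) refl α β γ)
    where
    sym-part : Carrier → Carrier → Carrier → Carrier
    sym-part s q r = fromℤ (+ 2) * (s * s * s) - fromℤ (+ 9) * (s * q) + fromℤ (+ 27) * r

module SixthPower (R : CommutativeRing c ℓ) (roots : Roots R) where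
  open CommutativeRing R hiding (zero)
  open IntegerCoefficients R
  open Eisenstein R
  open Roots roots
  open LagrangeResolvent R roots
  open Exp E.commutativeSemiring using () renaming (_^_ to _^ₑ_)

  private
    P Q : Carrier
    P = fromℤ (+ 27) - fromℤ (+ 3) * δ
    Q = - (fromℤ (+ 6) * δ)

  module _ {x y a 2⁻¹ : Carrier} (2*2⁻¹ : fromℤ (+ 2) * 2⁻¹ ≈ 1#)
    (a-half : fromℤ (+ 2) * a ≈ fromℤ (+ 25) * y + fromℤ (+ 3) * x) (x≈-δy : x ≈ - (δ * y)) where

    private
      first : y * (P * P - Q * Q) ≈ fromℤ (+ 2) * (fromℤ (+ 2) * (fromℤ (+ 27) * a))
      first = begin
        y * (P * P - Q * Q)
          ≈⟨ solve 2 (λ y d → let p = con (+ 27) :- con (+ 3) :* d ; q = :- (con (+ 6) :* d) in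
               y :* (p :* p :- q :* q) := con (+ 54) :* (con (+ 25) :* y :+ con (+ 3) :* (:- (d :* y)))
                                          :- con (+ 27) :* y :* (d :* d :- con (ℤ.- + 23))) refl y δ ⟩
        fromℤ (+ 54) * (fromℤ (+ 25) * y + fromℤ (+ 3) * (- (δ * y))) - fromℤ (+ 27) * y * (δ * δ - fromℤ (ℤ.- + 23))
          ≈⟨ +-cong (*-congˡ (+-congˡ (*-congˡ (sym x≈-δy)))) (-‿cong (*-congˡ (trans (+-congʳ δ²) (-‿inverseʳ _)))) ⟩
        fromℤ (+ 54) * (fromℤ (+ 25) * y + fromℤ (+ 3) * x) - fromℤ (+ 27) * y * 0#
          ≈⟨ +-congʳ (*-congˡ (sym a-half)) ⟩
        fromℤ (+ 54) * (fromℤ (+ 2) * a) - fromℤ (+ 27) * y * 0#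
          ≈⟨ solve 2 (λ a y → con (+ 54) :* (con (+ 2) :* a) :- con (+ 27) :* y :* con 0ℤ :=
               con (+ 2) :* (con (+ 2) :* (con (+ 27) :* a))) refl a y ⟩
        fromℤ (+ 2) * (fromℤ (+ 2) * (fromℤ (+ 27) * a)) ∎
        where open SetoidReasoning setoid

      second : y * (P * Q + Q * P - Q * Q) ≈ fromℤ (+ 2) * (fromℤ (+ 2) * (fromℤ (+ 27) * (fromℤ (+ 3) * x)))
      second = begin
        y * (P * Q + Q * P - Q * Q)
          ≈⟨ solve 2 (λ y d → let p = con (+ 27) :- con (+ 3) :* d ; q = :- (con (+ 6) :* d) in
               y :* (p :* q :+ q :* p :- q :* q) := con (+ 2) :* (con (+ 2) :* (con (+ 27) :* (con (+ 3) :* (:- (d :* y)))))) refl y δ ⟩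
        fromℤ (+ 2) * (fromℤ (+ 2) * (fromℤ (+ 27) * (fromℤ (+ 3) * (- (δ * y)))))
          ≈⟨ *-congˡ (*-congˡ (*-congˡ (*-congˡ x≈-δy))) ⟨
        fromℤ (+ 2) * (fromℤ (+ 2) * (fromℤ (+ 27) * (fromℤ (+ 3) * x))) ∎
        where open SetoidReasoning setoid

      2ₑ 27ₑ yₑ u : Carrier × Carrier
      2ₑ = scalar (fromℤ (+ 2))
      27ₑ = scalar (fromℤ (+ 27))
      yₑ = scalar y
      u = a , fromℤ (+ 3) * x

      quadrupled : 2ₑ E.* (2ₑ E.* (27ₑ E.* u)) E.≈ 2ₑ E.* (2ₑ E.* (yₑ E.* L ^ₑ 6))
      quadrupled = E.sym (begin
        2ₑ E.* (2ₑ E.* (yₑ E.* L ^ₑ 6))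
          ≈⟨ S.solve 3 (λ t y l → t S.:* (t S.:* (y S.:* l S.:^ 6)) S.:= y S.:* ((t S.:* (l S.:* (l S.:* l))) S.:* (t S.:* (l S.:* (l S.:* l))))) E.refl 2ₑ yₑ L ⟩
        yₑ E.* ((2ₑ E.* (L E.* (L E.* L))) E.* (2ₑ E.* (L E.* (L E.* L))))
          ≈⟨ E.*-congˡ {yₑ} (E.*-cong 2L³ 2L³) ⟩
        yₑ E.* ((P , Q) E.* (P , Q))
          ≈⟨ scalar*-≈ y ((P , Q) E.* (P , Q)) ⟩
        (y * (P * P - Q * Q) , y * (P * Q + Q * P - Q * Q))
          ≈⟨ first , second ⟩
        (fromℤ (+ 2) * (fromℤ (+ 2) * (fromℤ (+ 27) * a)) , fromℤ (+ 2) * (fromℤ (+ 2) * (fromℤ (+ 27) * (fromℤ (+ 3) * x))))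
          ≈⟨ scalar*-≈ (fromℤ (+ 2)) _ ⟨
        2ₑ E.* (fromℤ (+ 2) * (fromℤ (+ 27) * a) , fromℤ (+ 2) * (fromℤ (+ 27) * (fromℤ (+ 3) * x)))
          ≈⟨ E.*-congˡ {2ₑ} (E.trans (E.*-congˡ {2ₑ} (scalar*-≈ (fromℤ (+ 27)) u)) (scalar*-≈ (fromℤ (+ 2)) _)) ⟨
        2ₑ E.* (2ₑ E.* (27ₑ E.* u)) ∎)
        where
        module S = IntegerCoefficients Eis
        open SetoidReasoning E.setoid

      halve : ∀ {v w} → 2ₑ E.* v E.≈ 2ₑ E.* w → v E.≈ w
      halve {v} {w} eq = E.trans (E.sym (undo v)) (E.trans (E.*-congˡ {scalar 2⁻¹} eq) (undo w))
        where
        undo : ∀ v → scalar 2⁻¹ E.* (2ₑ E.* v) E.≈ v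
        undo v = E.trans (E.sym (E.*-assoc (scalar 2⁻¹) 2ₑ v)) (E.trans
          (E.*-congʳ {v} (E.trans (E.sym (scalar-* 2⁻¹ (fromℤ (+ 2)))) (scalar-cong (trans (*-comm _ _) 2*2⁻¹)))) (E.*-identityˡ v))

    27u≈yL⁶ : 27ₑ E.* u E.≈ yₑ E.* L ^ₑ 6
    27u≈yL⁶ = halve (halve quadrupled)

    27ū≈yL̄⁶ : 27ₑ E.* u ̄ E.≈ yₑ E.* (L ̄) ^ₑ 6
    27ū≈yL̄⁶ = E.trans (E.sym (conj-scalar* (fromℤ (+ 27)) u)) (E.trans (conj-cong 27u≈yL⁶)
      (E.trans (conj-scalar* y (L ^ₑ 6)) (E.*-congˡ {yₑ} (conj-^ L 6))))
      where
      conj-scalar* : ∀ s v → (scalar s E.* v) ̄ E.≈ scalar s E.* v ̄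
      conj-scalar* s v = E.trans (conj-* (scalar s) v) (E.*-congʳ {v ̄} (conj-scalar s))

module ResidueMap (R : CommutativeRing c ℓ) {p : ℕ} (p-prime : Prime p)
  (char-p : CommutativeRing._≈_ R (IntegerCoefficients.fromℤ R (+ p)) (CommutativeRing.0# R))
  (0≉1 : ¬ CommutativeRing._≈_ R (CommutativeRing.0# R) (CommutativeRing.1# R)) where
  open CommutativeRing R hiding (zero)
  open IntegerCoefficients R
  open Eisenstein R
  open Exp E.commutativeSemiring using () renaming (_^_ to _^ₑ_)
  private module Q = 𝔼/ p

  fromℤ-mod : ∀ {i j} → i ≋ j [mod p ] → fromℤ i ≈ fromℤ j
  fromℤ-mod {i} {j} (congruent (ℤ∣.divides k i-j≡)) = begin
    fromℤ i                             ≡⟨ ≡.cong fromℤ (≡.trans (lemma i j) (≡.cong (ℤ._+ j) i-j≡)) ⟩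
    fromℤ (k ℤ.* + p ℤ.+ j)             ≈⟨ fromℤ-+ (k ℤ.* + p) j ⟩
    fromℤ (k ℤ.* + p) + fromℤ j         ≈⟨ +-congʳ (trans (fromℤ-* k (+ p)) (*-congˡ char-p)) ⟩
    fromℤ k * 0# + fromℤ j              ≈⟨ +-congʳ (zeroʳ _) ⟩
    0# + fromℤ j                        ≈⟨ +-identityˡ _ ⟩
    fromℤ j                             ∎
    where
    open SetoidReasoning setoid
    lemma : ∀ i j → i ≡ i ℤ.- j ℤ.+ j
    lemma = ℤ-Solver.solve-∀

  fromℤ-unit : ∀ {i} → ¬ i ≋ 0ℤ [mod p ] → ∃[ j ] fromℤ i * fromℤ j ≈ 1#
  fromℤ-unit {i} i≢0 = proj₁ ij≋1 , trans (sym (fromℤ-* i (proj₁ ij≋1))) (fromℤ-mod (proj₂ ij≋1))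
    where ij≋1 = PrimeField.inverse p-prime {i} i≢0

  fromℤ≈0⇒ : ∀ {i} → fromℤ i ≈ 0# → i ≋ 0ℤ [mod p ]
  fromℤ≈0⇒ {i} i≈0 = decidable-stable (i ≋? 0ℤ) λ i≢0 → 0≉1
    (trans (sym (zeroˡ _)) (trans (*-congʳ (sym i≈0)) (proj₂ (fromℤ-unit i≢0))))

  fromℤ-injective : ∀ {i j} → fromℤ i ≈ fromℤ j → i ≋ j [mod p ]
  fromℤ-injective {i} {j} eq = congruent (≋0⇒∣ (fromℤ≈0⇒
    (trans (fromℤ-+ i (ℤ.- j)) (trans (+-cong eq (fromℤ-neg j)) (-‿inverseʳ _)))))

  φ : ℤ × ℤ → Carrier × Carrier
  φ (a , b) = fromℤ a , fromℤ b

  φ-cong : ∀ {u v} → u Q.≈ v → φ u E.≈ φ v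
  φ-cong (eq , eq′) = fromℤ-mod eq , fromℤ-mod eq′

  private
    fromℤ-minus : ∀ i j → fromℤ (i ℤ.- j) ≈ fromℤ i - fromℤ j
    fromℤ-minus i j = trans (fromℤ-+ i (ℤ.- j)) (+-congˡ (fromℤ-neg j))

  φ-* : ∀ u v → φ (u Q.* v) E.≈ φ u E.* φ v
  φ-* (a , b) (s , t) =
    trans (fromℤ-minus (a ℤ.* s) (b ℤ.* t)) (+-cong (fromℤ-* a s) (-‿cong (fromℤ-* b t))) ,
    trans (fromℤ-minus (a ℤ.* t ℤ.+ b ℤ.* s) (b ℤ.* t))
      (+-cong (trans (fromℤ-+ (a ℤ.* t) (b ℤ.* s)) (+-cong (fromℤ-* a t) (fromℤ-* b s))) (-‿cong (fromℤ-* b t)))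

  φ-̄ : ∀ u → φ (u Q.̄) E.≈ (φ u) ̄
  φ-̄ (a , b) = fromℤ-minus a b , fromℤ-neg b

  φ-^ : ∀ u m → φ (u Q.^ m) E.≈ φ u ^ₑ m
  φ-^ u zero    = E.refl
  φ-^ u (suc m) = E.trans (φ-* u (u Q.^ m)) (E.*-congˡ {φ u} (φ-^ u m))

  e : Value → Carrier × Carrier
  e x = φ (emb x)

  e-∙ : ∀ x y → e (x ∙ y) E.≈ e x E.* e y
  e-∙ x y = E.trans (φ-cong {emb (x ∙ y)} {emb x Q.* emb y} (mod p {emb (x ∙ y)} {emb x 𝔼.* emb y} (emb-∙ x y)))
    (φ-* (emb x) (emb y))

  e-*̄ : ∀ x → e (x *̄) E.≈ (e x) ̄
  e-*̄ x = E.trans (φ-cong {emb (x *̄)} {emb x Q.̄} (mod p {emb (x *̄)} {emb x 𝔼.̄} (emb-*̄ x))) (φ-̄ (emb x))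

  private
    0≉-1 : ¬ 0# ≈ - 1#
    0≉-1 eq = 0≉1 (trans (solve 0 (con 0ℤ := :- con 0ℤ) refl) (trans (-‿cong eq) (solve 0 (:- (:- con 1ℤ) := con 1ℤ) refl)))

  e-injective : ∀ x y → e x E.≈ e y → x ≡ y
  e-injective O  O  _       = ≡.refl
  e-injective O  I  (a , _) = contradiction a 0≉1
  e-injective O  W  (_ , b) = contradiction b 0≉1
  e-injective O  W² (_ , b) = contradiction b 0≉-1
  e-injective I  O  (a , _) = contradiction (sym a) 0≉1
  e-injective I  I  _       = ≡.refl
  e-injective I  W  (_ , b) = contradiction b 0≉1
  e-injective I  W² (_ , b) = contradiction b 0≉-1
  e-injective W  O  (_ , b) = contradiction (sym b) 0≉1
  e-injective W  I  (_ , b) = contradiction (sym b) 0≉1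
  e-injective W  W  _       = ≡.refl
  e-injective W  W² (a , _) = contradiction a 0≉-1
  e-injective W² O  (_ , b) = contradiction (sym b) 0≉-1
  e-injective W² I  (_ , b) = contradiction (sym b) 0≉-1
  e-injective W² W  (a , _) = contradiction (sym a) 0≉-1
  e-injective W² W² _       = ≡.refl

  module F = Frobenius R p-prime char-p
  module FE = Frobenius Eis p-prime (E.trans (fromℕ-scalar R p) (scalar-cong char-p))
  open Exp commutativeSemiring using (_^_)

  private
    ω : Carrier × Carrier
    ω = 0# , 1#

    ω³ : ω ^ₑ 3 E.≈ E.1#
    ω³ = solve 0 (let z = con 0ℤ ; o = con 1ℤ ; s = z :* o :- o :* z ; t = z :* z :+ o :* o :- o :* z
                      s² = z :* s :- o :* t ; t² = z :* t :+ o :* s :- o :* t in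
                  z :* s² :- o :* t² := o) refl ,
         solve 0 (let z = con 0ℤ ; o = con 1ℤ
                      s = z :* o :- o :* z ; t = z :* z :+ o :* o :- o :* z
                      s² = z :* s :- o :* t ; t² = z :* t :+ o :* s :- o :* t in
                  z :* t² :+ o :* s² :- o :* t² := z) refl

    scalar-^ : ∀ x m → scalar x ^ₑ m E.≈ scalar (x ^ m)
    scalar-^ x zero    = E.refl
    scalar-^ x (suc m) = E.trans (E.*-congˡ {scalar x} (scalar-^ x m)) (E.sym (scalar-* x (x ^ m)))

    power : ∀ a b → (a , b) ^ₑ p E.≈ scalar (a ^ p) E.+ scalar (b ^ p) E.* ω ^ₑ p
    power a b = E.trans (^ₑ-congˡ p split) (E.trans (FE.frobenius-+ (scalar a) (scalar b E.* ω))
      (E.+-cong (scalar-^ a p) (E.trans (^ₑ-distrib-* (scalar b) ω p) (E.*-congʳ {ω ^ₑ p} (scalar-^ b p)))))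
      where
      open Exp E.commutativeSemiring using () renaming (^-congˡ to ^ₑ-congˡ; ^-distrib-* to ^ₑ-distrib-*)
      split : (a , b) E.≈ scalar a E.+ scalar b E.* ω
      split = solve 2 (λ a b → a := a :+ (b :* con 0ℤ :- con 0ℤ :* con 1ℤ)) refl a b ,
              solve 2 (λ a b → b := con 0ℤ :+ (b :* con 1ℤ :+ con 0ℤ :* con 0ℤ :- con 0ℤ :* con 1ℤ)) refl a b

  frobenius-1+3m : ∀ m → p ≡ 1 ℕ.+ 3 ℕ.* m → ∀ a b → (a , b) ^ₑ p E.≈ (a ^ p , b ^ p)
  frobenius-1+3m m p≡ a b = E.trans (power a b) (E.trans
    (E.+-congˡ {scalar (a ^ p)} (E.*-congˡ {scalar (b ^ p)}
      (E.trans (E.reflexive (≡.cong (ω ^ₑ_) p≡)) (power-mod-3 Eis ω³ 1 m))))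
    (solve 2 (λ a b → let z = con 0ℤ ; o = con 1ℤ ; s = z :* o :- o :* z ; t = z :* z :+ o :* o :- o :* z in
       a :+ (b :* s :- z :* t) := a) refl (a ^ p) (b ^ p) ,
     solve 2 (λ a b → let z = con 0ℤ ; o = con 1ℤ ; s = z :* o :- o :* z ; t = z :* z :+ o :* o :- o :* z in
       z :+ (b :* t :+ z :* s :- z :* t) := b) refl (a ^ p) (b ^ p)))

  frobenius-2+3m : ∀ m → p ≡ 2 ℕ.+ 3 ℕ.* m → ∀ a b → (a , b) ^ₑ p E.≈ (a ^ p , b ^ p) ̄
  frobenius-2+3m m p≡ a b = E.trans (power a b) (E.trans
    (E.+-congˡ {scalar (a ^ p)} (E.*-congˡ {scalar (b ^ p)}
      (E.trans (E.reflexive (≡.cong (ω ^ₑ_) p≡)) (power-mod-3 Eis ω³ 2 m))))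
    (solve 2 (λ a b → let z = con 0ℤ ; o = con 1ℤ ; s = z :* o :- o :* z ; t = z :* z :+ o :* o :- o :* z
                          s² = z :* s :- o :* t ; t² = z :* t :+ o :* s :- o :* t in
       a :+ (b :* s² :- z :* t²) := a :- b) refl (a ^ p) (b ^ p) ,
     solve 2 (λ a b → let z = con 0ℤ ; o = con 1ℤ ; s = z :* o :- o :* z ; t = z :* z :+ o :* o :- o :* z
                          s² = z :* s :- o :* t ; t² = z :* t :+ o :* s :- o :* t in
       z :+ (b :* t² :+ z :* s² :- z :* t²) := :- b) refl (a ^ p) (b ^ p)))

module ResolventValue (R : CommutativeRing c ℓ) {p : ℕ} (p-prime : Prime p) (p≢2 : p ≢ 2) (p≢3 : p ≢ 3)
  (char-p : CommutativeRing._≈_ R (IntegerCoefficients.fromℤ R (+ p)) (CommutativeRing.0# R))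
  (0≉1 : ¬ CommutativeRing._≈_ R (CommutativeRing.0# R) (CommutativeRing.1# R))
  (roots : Roots R) (ρ : Resolvent p) where
  open CommutativeRing R hiding (zero)
  open IntegerCoefficients R
  open Eisenstein R
  open Roots roots
  open LagrangeResolvent R roots
  open ResidueMap R p-prime char-p 0≉1
  open Resolvent ρ
  open Exp commutativeSemiring using (_^_)
  open Exp E.commutativeSemiring using () renaming (_^_ to _^ₑ_)
  private
    module Q = 𝔼/ p

    x y : Carrier
    x = fromℤ X
    y = fromℤ Y

    u : ℤ × ℤ
    u = a , + 3 ℤ.* X

    unit : ∀ q → Prime q → p ≢ q → ∃[ j ] fromℤ (+ q) * fromℤ j ≈ 1#
    unit q q-prime p≢q = fromℤ-unit {+ q} λ e → p≢q (primes-divide⇒≡ p-prime q-prime (ℤ∣.∣⇒∣ᵤ (≋0⇒∣ e)))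

    2⁻¹ = unit 2 2-prime p≢2
    3⁻¹ = unit 3 3-prime p≢3
    y⁻¹ = fromℤ-unit {Y} λ e → p∤Y (≋0⇒∣ e)

    scalar-unit : ∀ {a b} → a * b ≈ 1# → scalar a E.* scalar b E.≈ E.1#
    scalar-unit ab≈1 = E.trans (E.sym (scalar-* _ _)) (scalar-cong ab≈1)

    a-half′ : fromℤ (+ 2) * fromℤ a ≈ fromℤ (+ 25) * y + fromℤ (+ 3) * x
    a-half′ = trans (sym (fromℤ-* (+ 2) a)) (trans (reflexive (≡.cong fromℤ a-half))
      (trans (fromℤ-+ (+ 25 ℤ.* Y) (+ 3 ℤ.* X)) (+-cong (fromℤ-* (+ 25) Y) (fromℤ-* (+ 3) X))))

    φu≈ : φ u E.≈ (fromℤ a , fromℤ (+ 3) * x)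
    φu≈ = refl , fromℤ-* (+ 3) X

  module _ (x≈-δy : x ≈ - (δ * y)) (s : Value)
    (permuted : (α ^ p - γ ^ p , β ^ p - γ ^ p) E.≈ e s E.* L) where

    private
      27u : scalar (fromℤ (+ 27)) E.* φ u E.≈ scalar y E.* L ^ₑ 6
      27u = E.trans (E.*-congˡ {scalar (fromℤ (+ 27))} φu≈)
        (SixthPower.27u≈yL⁶ R roots (proj₂ 2⁻¹) a-half′ x≈-δy)

      27ū : scalar (fromℤ (+ 27)) E.* φ (u Q.̄) E.≈ scalar y E.* (L ̄) ^ₑ 6
      27ū = E.trans (E.*-congˡ {scalar (fromℤ (+ 27))} (E.trans (φ-̄ u) (conj-cong φu≈)))
        (SixthPower.27ū≈yL̄⁶ R roots (proj₂ 2⁻¹) a-half′ x≈-δy)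

      recip-φ : ∀ {v w} m → v Q.^ m Q.≈ emb value Q.* w Q.^ m → φ v ^ₑ m E.≈ e value E.* φ w ^ₑ m
      recip-φ {v} {w} m eq = E.trans (E.sym (φ-^ v m)) (E.trans (φ-cong {v Q.^ m} {emb value Q.* w Q.^ m} eq)
        (E.trans (φ-* (emb value) (w Q.^ m)) (E.*-congˡ {e value} (φ-^ w m))))

      -^p : ∀ a b → (a - b) ^ p ≈ a ^ p - b ^ p
      -^p a b = trans (F.frobenius-+ a (- b)) (+-congˡ (F.frobenius-neg b))

      L^p-components : ((α - γ) ^ p , (β - γ) ^ p) E.≈ e s E.* L
      L^p-components = E.trans (-^p α γ , -^p β γ) permuted

      conj-eL : (e s E.* L) ̄ E.≈ e (s *̄) E.* L ̄
      conj-eL = E.trans (conj-* (e s) L) (E.*-congʳ {L ̄} (E.sym (e-*̄ s)))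

      conclude : (e s E.* L) E.* (e s E.* L) E.* (L ̄ E.* L ̄) E.≈
                 e value E.* ((e (s *̄) E.* L ̄) E.* (e (s *̄) E.* L ̄) E.* (L E.* L)) →
                 s ∙ s ≡ value ∙ (s *̄ ∙ s *̄)
      conclude eq = e-injective (s ∙ s) (value ∙ (s *̄ ∙ s *̄)) (E.trans (e-∙ s s) (E.trans
        (cancel-product Eis L*L̄ (scalar-unit (proj₂ 3⁻¹)) eq)
        (E.sym (E.trans (e-∙ value (s *̄ ∙ s *̄)) (E.*-congˡ {e value} (e-∙ (s *̄) (s *̄)))))))

      squares : ∀ {a b c d} → a E.≈ b → c E.≈ d → a E.* a E.* (L ̄ E.* L ̄) E.≈ e value E.* (c E.* c E.* (L E.* L)) →
                b E.* b E.* (L ̄ E.* L ̄) E.≈ e value E.* (d E.* d E.* (L E.* L))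
      squares {a} {b} {c} {d} a≈b c≈d eq = E.trans (E.*-congʳ {L ̄ E.* L ̄} (E.*-cong (E.sym a≈b) (E.sym a≈b)))
        (E.trans eq (E.*-congˡ {e value} (E.*-congʳ {L E.* L} (E.*-cong c≈d c≈d))))

      at-exponent : ∀ {n} → p ≡ n → ∀ v {w} → v ^ₑ p E.≈ w → v ^ₑ n E.≈ w
      at-exponent ≡.refl _ eq = eq

      by-residue : ∀ r m → r ℕ.< 3 → p ≡ r ℕ.+ 3 ℕ.* m → s ∙ s ≡ value ∙ (s *̄ ∙ s *̄)
      by-residue 0 m _ p≡ = contradiction
        (≡.sym (primes-divide⇒≡ 3-prime p-prime (ℕ∣.divides m (≡.trans p≡ (ℕ.*-comm 3 m))))) p≢3
      by-residue 1 m _ p≡ = conclude (squares (at-exponent p≡ L L^p) (at-exponent p≡ (L ̄) L̄^p)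
        (complete-1+3m Eis m (transfer-ratio Eis 27u 27ū (scalar-unit (proj₂ y⁻¹)) m
          (recip-φ {u} {u Q.̄} m (proj₁ recip m p≡)))))
        where
        L^p : L ^ₑ p E.≈ e s E.* L
        L^p = E.trans (frobenius-1+3m m p≡ (α - γ) (β - γ)) L^p-components
        L̄^p : (L ̄) ^ₑ p E.≈ e (s *̄) E.* L ̄
        L̄^p = E.trans (E.sym (conj-^ L p)) (E.trans (conj-cong L^p) conj-eL)
      by-residue 2 m _ p≡ = conclude (squares (at-exponent p≡ (L ̄) L̄^p) (at-exponent p≡ L L^p)
        (complete-2+3m Eis m (transfer-ratio Eis 27ū 27u (scalar-unit (proj₂ y⁻¹)) (suc m)
          (recip-φ {u Q.̄} {u} (suc m) (proj₂ recip m p≡)))))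
        where
        L^p′ : L ^ₑ p E.≈ (e s E.* L) ̄
        L^p′ = E.trans (frobenius-2+3m m p≡ (α - γ) (β - γ)) (conj-cong L^p-components)
        L^p : L ^ₑ p E.≈ e (s *̄) E.* L ̄
        L^p = E.trans L^p′ conj-eL
        L̄^p : (L ̄) ^ₑ p E.≈ e s E.* L
        L̄^p = E.trans (E.sym (conj-^ L p)) (E.trans (conj-cong L^p′) (conj-involutive (e s E.* L)))
      by-residue (suc (suc (suc _))) _ (ℕ.s≤s (ℕ.s≤s (ℕ.s≤s ()))) _

    value-equation : s ∙ s ≡ value ∙ (s *̄ ∙ s *̄)
    value-equation = by-residue (p ℕ.% 3) (p ℕ./ 3) (ℕ.m%n<n p 3)
      (≡.trans (ℕ.m≡m%n+[m/n]*n p 3) (≡.cong (p ℕ.% 3 ℕ.+_) (ℕ.*-comm (p ℕ./ 3) 3)))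

-- Frobenius on the roots

record IsDiscreteField (R : CommutativeRing c ℓ) : Set (c ⊔ ℓ) where
  open CommutativeRing R
  field
    0≉1     : ¬ 0# ≈ 1#
    _≟_     : ∀ x y → Dec (x ≈ y)
    inverse : ∀ {x} → ¬ x ≈ 0# → ∃[ y ] x * y ≈ 1#

  x*y≈0⇒ : ∀ {x y} → x * y ≈ 0# → x ≈ 0# ⊎ y ≈ 0#
  x*y≈0⇒ {x} {y} xy≈0 with x ≟ 0#
  ... | yes x≈0 = inj₁ x≈0
  ... | no x≉0 with inverse x≉0
  ...   | x⁻¹ , xx⁻¹≈1 = inj₂ (begin
    y                 ≈⟨ *-identityʳ y ⟨
    y * 1#            ≈⟨ *-congˡ xx⁻¹≈1 ⟨
    y * (x * x⁻¹)     ≈⟨ *-assoc _ _ _ ⟨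
    y * x * x⁻¹       ≈⟨ *-congʳ (trans (*-comm y x) xy≈0) ⟩
    0# * x⁻¹          ≈⟨ zeroˡ _ ⟩
    0#                ∎)
    where open SetoidReasoning setoid

  x-y≈0⇒ : ∀ {x y} → x - y ≈ 0# → x ≈ y
  x-y≈0⇒ = AbelianGroupProperties.x∙y⁻¹≈ε⇒x≈y +-abelianGroup _ _

  difference-cancel : ∀ {x y z} → ¬ x ≈ y → (x - y) * z ≈ 0# → z ≈ 0#
  difference-cancel x≉y eq = [ (λ x-y≈0 → contradiction (x-y≈0⇒ x-y≈0) x≉y) , id ]′ (x*y≈0⇒ eq)

module PrimeSubfield (R : CommutativeRing c ℓ) (isField : IsDiscreteField R) {p : ℕ} (p-prime : Prime p)
  (char-p : CommutativeRing._≈_ R (IntegerCoefficients.fromℤ R (+ p)) (CommutativeRing.0# R)) where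
  open CommutativeRing R hiding (zero)
  open IntegerCoefficients R
  open IsDiscreteField isField
  open ResidueMap R p-prime char-p 0≉1 public
    using (fromℤ-mod; fromℤ-unit; fromℤ≈0⇒; fromℤ-injective)
  open Frobenius R p-prime char-p public using (frobenius-+; frobenius-neg; frobenius-ℤ; 0^p≈0)
  open Exp commutativeSemiring using (_^_; ^-congˡ)
  open SetoidReasoning setoid

  Fixed : Carrier → Set ℓ
  Fixed x = x ^ p ≈ x

  frobenius-- : ∀ x y → (x - y) ^ p ≈ x ^ p - y ^ p
  frobenius-- x y = trans (frobenius-+ x (- y)) (+-congˡ (frobenius-neg y))

  ^≈0⇒ : ∀ n {x} → x ^ n ≈ 0# → x ≈ 0#
  ^≈0⇒ zero    eq = contradiction (sym eq) 0≉1
  ^≈0⇒ (suc n) eq = [ id , ^≈0⇒ n ]′ (x*y≈0⇒ eq)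

  frobenius-injective : ∀ {x y} → x ^ p ≈ y ^ p → x ≈ y
  frobenius-injective {x} {y} eq = x-y≈0⇒ (^≈0⇒ p (begin
    (x - y) ^ p       ≈⟨ frobenius-- x y ⟩
    x ^ p - y ^ p     ≈⟨ +-congʳ eq ⟩
    y ^ p - y ^ p     ≈⟨ -‿inverseʳ _ ⟩
    0#                ∎))

  -- Otherwise x and the p residues would be p + 1 roots of X^p − X.
  Fixed⇒fromℤ : ∀ {x} → Fixed x → ∃[ k ] fromℤ k ≈ x
  Fixed⇒fromℤ {x} fixed with Fin.any? {n = p} (λ i → fromℤ (+ toℕ i) ≟ x)
  ... | yes (i , eq) = + toℕ i , eq
  ... | no ¬∃ = contradiction bound (ℕ.<⇒≱ (ℕ.n<1+n p))
    where
    r : Fin (suc p) → Carrier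
    r zero    = x
    r (suc i) = fromℤ (+ toℕ i)
    r-injective : ∀ {i j} → r i ≈ r j → i ≡ j
    r-injective {zero}  {zero}  _  = ≡.refl
    r-injective {zero}  {suc j} eq = contradiction (j , sym eq) ¬∃
    r-injective {suc i} {zero}  eq = contradiction (i , eq) ¬∃
    r-injective {suc i} {suc j} eq = ≡.cong suc (≋⇒≡Fin (fromℤ-injective eq))
    r-fixed : ∀ i → r i ^ p ≈ r i
    r-fixed zero    = fixed
    r-fixed (suc i) = frobenius-ℤ (+ toℕ i)
    bound : suc p ℕ.≤ p
    bound = from-suc (prime⇒suc p-prime)
      where
      open RootBound R 0≉1 x*y≈0⇒
      from-suc : ∃[ q ] p ≡ suc q → suc p ℕ.≤ p
      from-suc (zero  , p≡1) = contradiction (≡.subst Prime p≡1 p-prime) ¬prime[1]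
      from-suc (suc k , p≡)  = ≡.subst (suc p ℕ.≤_) (≡.sym p≡)
        (fixed-by-power≤ k r r-injective λ i → ≡.subst (λ n → r i ^ n ≈ r i) p≡ (r-fixed i))

  fromℤ⇒Fixed : ∀ {x} → ∃[ k ] fromℤ k ≈ x → Fixed x
  fromℤ⇒Fixed (k , eq) = trans (^-congˡ p (sym eq)) (trans (frobenius-ℤ k) eq)

module RootAction (R : CommutativeRing c ℓ) (isField : IsDiscreteField R) {p : ℕ} (p-prime : Prime p)
  (char-p : CommutativeRing._≈_ R (IntegerCoefficients.fromℤ R (+ p)) (CommutativeRing.0# R)) (roots : Roots R) where
  open CommutativeRing R hiding (zero)
  open IntegerCoefficients R
  open IsDiscreteField isField
  open PrimeSubfield R isField p-prime char-p
  open Roots roots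
  open Exp commutativeSemiring using (_^_; ^-congˡ; ^-distrib-*)
  open SetoidReasoning setoid

  cubic : ∀ x → (x - α) * ((x - β) * (x - γ)) ≈ x * (x * x) - x - 1#
  cubic x = begin
    (x - α) * ((x - β) * (x - γ))
      ≈⟨ solve 4 (λ x a b c → (x :- a) :* ((x :- b) :* (x :- c)) :=
           x :* (x :* x) :- (a :+ b :+ c) :* (x :* x) :+ (a :* b :+ b :* c :+ c :* a) :* x :- a :* b :* c) refl x α β γ ⟩
    x * (x * x) - (α + β + γ) * (x * x) + (α * β + β * γ + γ * α) * x - α * β * γ
      ≈⟨ +-cong (+-cong (+-congˡ (-‿cong (*-congʳ e₁))) (*-congʳ e₂)) (-‿cong e₃) ⟩
    x * (x * x) - 0# * (x * x) + - 1# * x - 1#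
      ≈⟨ solve 1 (λ x → x :* (x :* x) :- con 0ℤ :* (x :* x) :+ (:- con 1ℤ) :* x :- con 1ℤ := x :* (x :* x) :- x :- con 1ℤ) refl x ⟩
    x * (x * x) - x - 1# ∎

  IsRoot : Carrier → Set ℓ
  IsRoot x = x * (x * x) ≈ x + 1#

  private
    zero⇒IsRoot : ∀ {x} → (x - α) * ((x - β) * (x - γ)) ≈ 0# → IsRoot x
    zero⇒IsRoot {x} eq = x-y≈0⇒ (trans (solve 1 (λ x → x :* (x :* x) :- (x :+ con 1ℤ) := x :* (x :* x) :- x :- con 1ℤ) refl x)
      (trans (sym (cubic x)) eq))

  IsRoot⇒ : ∀ {x} → IsRoot x → x ≈ α ⊎ x ≈ β ⊎ x ≈ γ
  IsRoot⇒ {x} root = map x-y≈0⇒ (map x-y≈0⇒ x-y≈0⇒ ∘ x*y≈0⇒) (x*y≈0⇒ product≈0)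
    where
    product≈0 : (x - α) * ((x - β) * (x - γ)) ≈ 0#
    product≈0 = trans (cubic x) (trans (+-congʳ (+-congʳ root))
      (solve 1 (λ x → x :+ con 1ℤ :- x :- con 1ℤ := con 0ℤ) refl x))

  α-root : IsRoot α
  α-root = zero⇒IsRoot (trans (*-congʳ (-‿inverseʳ α)) (zeroˡ _))

  β-root : IsRoot β
  β-root = zero⇒IsRoot (trans (*-congˡ (trans (*-congʳ (-‿inverseʳ β)) (zeroˡ _))) (zeroʳ _))

  γ-root : IsRoot γ
  γ-root = zero⇒IsRoot (trans (*-congˡ (trans (*-congˡ (-‿inverseʳ γ)) (zeroʳ _))) (zeroʳ _))

  frobenius-root : ∀ {x} → IsRoot x → IsRoot (x ^ p)
  frobenius-root {x} root = begin
    x ^ p * (x ^ p * x ^ p)     ≈⟨ trans (^-distrib-* x (x * x) p) (*-congˡ (^-distrib-* x x p)) ⟨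
    (x * (x * x)) ^ p           ≈⟨ ^-congˡ p root ⟩
    (x + 1#) ^ p                ≈⟨ frobenius-+ x 1# ⟩
    x ^ p + 1# ^ p              ≈⟨ +-congˡ (1^≈1 R p) ⟩
    x ^ p + 1#                  ∎

  third : ∀ {a b c} → a + b + c ≈ 0# → c ≈ - (a + b)
  third {a} {b} {c} eq = trans (solve 3 (λ a b c → c := a :+ b :+ c :- (a :+ b)) refl a b c)
    (trans (+-congʳ eq) (+-identityˡ _))

  γ^p≈ : γ ^ p ≈ - (α ^ p + β ^ p)
  γ^p≈ = trans (^-congˡ p (third e₁)) (trans (frobenius-neg _) (-‿cong (frobenius-+ α β)))

  data Action : Set ℓ where
    identity : α ^ p ≈ α → β ^ p ≈ β → γ ^ p ≈ γ → Action
    swap-βγ  : α ^ p ≈ α → β ^ p ≈ γ → γ ^ p ≈ β → Action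
    swap-γα  : α ^ p ≈ γ → β ^ p ≈ β → γ ^ p ≈ α → Action
    swap-αβ  : α ^ p ≈ β → β ^ p ≈ α → γ ^ p ≈ γ → Action
    cycle    : α ^ p ≈ β → β ^ p ≈ γ → γ ^ p ≈ α → Action
    cycle⁻¹  : α ^ p ≈ γ → β ^ p ≈ α → γ ^ p ≈ β → Action

  private
    γ^p : ∀ {a b c} → a + b + c ≈ 0# → α ^ p ≈ a → β ^ p ≈ b → γ ^ p ≈ c
    γ^p eq a b = trans γ^p≈ (trans (-‿cong (+-cong a b)) (sym (third eq)))

    e₁-perm : ∀ {x y z} → x + y + z ≈ α + β + γ → x + y + z ≈ 0#
    e₁-perm eq = trans eq e₁

  action : ¬ α ≈ β → Action
  action α≉β = from-images (IsRoot⇒ (frobenius-root α-root)) (IsRoot⇒ (frobenius-root β-root))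
    where
    distinct : ∀ {x} → α ^ p ≈ x → β ^ p ≈ x → Action
    distinct a b = contradiction (frobenius-injective (trans a (sym b))) α≉β
    from-images : α ^ p ≈ α ⊎ α ^ p ≈ β ⊎ α ^ p ≈ γ → β ^ p ≈ α ⊎ β ^ p ≈ β ⊎ β ^ p ≈ γ → Action
    from-images (inj₁ a)        (inj₁ b)        = distinct a b
    from-images (inj₁ a)        (inj₂ (inj₁ b)) = identity a b (γ^p e₁ a b)
    from-images (inj₁ a)        (inj₂ (inj₂ b)) =
      swap-βγ a b (γ^p (e₁-perm (solve 3 (λ a b c → a :+ c :+ b := a :+ b :+ c) refl α β γ)) a b)
    from-images (inj₂ (inj₁ a)) (inj₁ b)        =
      swap-αβ a b (γ^p (e₁-perm (solve 3 (λ a b c → b :+ a :+ c := a :+ b :+ c) refl α β γ)) a b)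
    from-images (inj₂ (inj₁ a)) (inj₂ (inj₁ b)) = distinct a b
    from-images (inj₂ (inj₁ a)) (inj₂ (inj₂ b)) =
      cycle a b (γ^p (e₁-perm (solve 3 (λ a b c → b :+ c :+ a := a :+ b :+ c) refl α β γ)) a b)
    from-images (inj₂ (inj₂ a)) (inj₁ b)        =
      cycle⁻¹ a b (γ^p (e₁-perm (solve 3 (λ a b c → c :+ a :+ b := a :+ b :+ c) refl α β γ)) a b)
    from-images (inj₂ (inj₂ a)) (inj₂ (inj₁ b)) =
      swap-γα a b (γ^p (e₁-perm (solve 3 (λ a b c → c :+ b :+ a := a :+ b :+ c) refl α β γ)) a b)
    from-images (inj₂ (inj₂ a)) (inj₂ (inj₂ b)) = distinct a b

  open LagrangeResolvent R roots using (δ; δ²)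

  23≉0⇒δ≉0 : p ≢ 23 → ¬ δ ≈ 0#
  23≉0⇒δ≉0 p≢23 δ≈0 = p≢23 (primes-divide⇒≡ p-prime (from-yes (prime? 23)) (ℤ∣.∣⇒∣ᵤ (≋0⇒∣ (fromℤ≈0⇒ {ℤ.- + 23}
    (trans (sym δ²) (trans (*-congʳ δ≈0) (zeroˡ δ)))))))

  module Distinct (p≢23 : p ≢ 23) where

    α≉β : ¬ α ≈ β
    α≉β eq = 23≉0⇒δ≉0 p≢23 (trans (*-congʳ (*-congʳ (trans (+-congˡ (-‿cong (sym eq))) (-‿inverseʳ α))))
      (trans (*-congʳ (zeroˡ _)) (zeroˡ _)))

    β≉γ : ¬ β ≈ γ
    β≉γ eq = 23≉0⇒δ≉0 p≢23 (trans (*-congʳ (*-congˡ (trans (+-congˡ (-‿cong (sym eq))) (-‿inverseʳ β))))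
      (trans (*-congʳ (zeroʳ _)) (zeroˡ _)))

    γ≉α : ¬ γ ≈ α
    γ≉α eq = 23≉0⇒δ≉0 p≢23 (trans (*-congˡ (trans (+-congˡ (-‿cong (sym eq))) (-‿inverseʳ γ))) (zeroʳ _))

    quadratic-vanishes : ∀ {s t v} → (∀ {x} → IsRoot x → s + t * x + v * (x * x) ≈ 0#) →
                         s ≈ 0# × t ≈ 0# × v ≈ 0#
    quadratic-vanishes {s} {t} {v} vanishes = s≈0 , t≈0 , v≈0
      where
      difference : ∀ {x y} → IsRoot x → IsRoot y → ¬ x ≈ y → t + v * (x + y) ≈ 0#
      difference {x} {y} x-root y-root x≉y = difference-cancel x≉y (begin
        (x - y) * (t + v * (x + y))
          ≈⟨ solve 5 (λ s t v x y → (x :- y) :* (t :+ v :* (x :+ y)) :=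
               (s :+ t :* x :+ v :* (x :* x)) :- (s :+ t :* y :+ v :* (y :* y))) refl s t v x y ⟩
        (s + t * x + v * (x * x)) - (s + t * y + v * (y * y))
          ≈⟨ +-cong (vanishes x-root) (-‿cong (vanishes y-root)) ⟩
        0# - 0#   ≈⟨ -‿inverseʳ 0# ⟩
        0#        ∎)
      v≈0 : v ≈ 0#
      v≈0 = difference-cancel β≉γ (begin
        (β - γ) * v
          ≈⟨ solve 5 (λ t v a b c → (b :- c) :* v := (t :+ v :* (a :+ b)) :- (t :+ v :* (c :+ a))) refl t v α β γ ⟩
        (t + v * (α + β)) - (t + v * (γ + α))
          ≈⟨ +-cong (difference α-root β-root α≉β) (-‿cong (difference γ-root α-root γ≉α)) ⟩
        0# - 0#   ≈⟨ -‿inverseʳ 0# ⟩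
        0#        ∎)
      t≈0 : t ≈ 0#
      t≈0 = begin
        t                               ≈⟨ solve 3 (λ t v x → t := (t :+ v :* x) :- v :* x) refl t v (α + β) ⟩
        (t + v * (α + β)) - v * (α + β) ≈⟨ +-cong (difference α-root β-root α≉β) (-‿cong (trans (*-congʳ v≈0) (zeroˡ _))) ⟩
        0# - 0#                         ≈⟨ -‿inverseʳ 0# ⟩
        0#                              ∎
      s≈0 : s ≈ 0#
      s≈0 = begin
        s
          ≈⟨ solve 4 (λ s t v x → s := (s :+ t :* x :+ v :* (x :* x)) :- (t :* x :+ v :* (x :* x))) refl s t v α ⟩
        (s + t * α + v * (α * α)) - (t * α + v * (α * α))
          ≈⟨ +-cong (vanishes α-root) (-‿cong (+-cong (trans (*-congʳ t≈0) (zeroˡ _)) (trans (*-congʳ v≈0) (zeroˡ _)))) ⟩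
        0# - (0# + 0#)
          ≈⟨ solve 0 (con 0ℤ :- (con 0ℤ :+ con 0ℤ) := con 0ℤ) refl ⟩
        0# ∎

funToFin-cong : ∀ {m n} {f g : Fin m → Fin n} → (∀ i → f i ≡ g i) → Fin.funToFin f ≡ Fin.funToFin g
funToFin-cong {zero}  _   = ≡.refl
funToFin-cong {suc m} f≡g = ≡.cong₂ Fin.combine (f≡g zero) (funToFin-cong (f≡g ∘ suc))

finToFun-injective : ∀ {m n} {i j : Fin (n ℕ.^ m)} →
                     (∀ k → Fin.finToFun {n} {m} i k ≡ Fin.finToFun j k) → i ≡ j
finToFun-injective {m} {n} {i} {j} eq =
  ≡.trans (≡.sym (Fin.funToFin-finToFin {m} i)) (≡.trans (funToFin-cong eq) (Fin.funToFin-finToFin {m} j))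

module ExtensionField {p : ℕ} (p-prime : Prime p) {ℓ₁ ℓ₂ : Level} (E : Extension p c ℓ₁ ℓ₂) where
  open Extension E hiding (zero)
  open HeytingField heytingField using (tight; #-irrefl; #⇒invertible; invertible⇒#)
  open IntegerCoefficients commutativeRing
  open RingMorphisms.IsRingHomomorphism ι-isRingHomomorphism
    using (+-homo; -‿homo; 0#-homo; 1#-homo; ⟦⟧-cong)
  open SetoidReasoning setoid

  ι≈fromℤ : ∀ i → ι i ≈ fromℤ i
  ι≈fromℤ (+ n)    = ι-ℕ n
    where
    ι-ℕ : ∀ n → ι (+ n) ≈ fromℤ (+ n)
    ι-ℕ zero    = 0#-homo
    ι-ℕ (suc n) = trans (+-homo 1ℤ (+ n)) (trans (+-cong 1#-homo (ι-ℕ n)) (sym (1+× n 1#)))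
  ι≈fromℤ -[1+ n ] = trans (-‿homo (+ suc n)) (-‿cong (ι≈fromℤ (+ suc n)))

  char-p : fromℤ (+ p) ≈ 0#
  char-p = trans (sym (ι≈fromℤ (+ p))) (trans (⟦⟧-cong (PrimeField.p≋0 p-prime)) 0#-homo)

  isField : IsDiscreteField commutativeRing
  isField = record { 0≉1 = 0≉1 ; _≟_ = _≟_ ; inverse = inverse }
    where
    x-0 : ∀ x → x - 0# ≈ x
    x-0 = solve 1 (λ x → x :- con 0ℤ := x) refl
    0≉1 : ¬ 0# ≈ 1#
    0≉1 0≈1 = #-irrefl (sym 0≈1) (invertible⇒# (1# ,
      trans (*-identityˡ _) (x-0 1#) , trans (*-identityʳ _) (x-0 1#)))
    _≟_ : ∀ x y → Dec (x ≈ y)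
    x ≟ y with x #? y
    ... | yes x#y = no λ x≈y → #-irrefl x≈y x#y
    ... | no ¬x#y = yes (proj₁ (tight x y) ¬x#y)
    inverse : ∀ {x} → ¬ x ≈ 0# → ∃[ y ] x * y ≈ 1#
    inverse {x} x≉0 with x #? 0#
    ... | no ¬x#0 = contradiction (proj₁ (tight x 0#) ¬x#0) x≉0
    ... | yes x#0 = proj₁ (#⇒invertible x#0) , trans (*-congʳ (sym (x-0 x))) (proj₂ (proj₂ (#⇒invertible x#0)))

  open IsDiscreteField isField
  open PrimeSubfield commutativeRing isField p-prime char-p
  open PrimeField p-prime using (p-nonZero)
  open Sum semiring using (sum-cong-≋; ∑-distrib-+)

  ι-cong : ∀ {i j} → i ≋ j [mod p ] → ι i ≈ ι j
  ι-cong = ⟦⟧-cong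

  ι≈0⇒ : ∀ {i} → ι i ≈ 0# → i ≋ 0ℤ [mod p ]
  ι≈0⇒ {i} eq = fromℤ≈0⇒ (trans (sym (ι≈fromℤ i)) eq)

  combination : ∀ {r} → (Fin r → ℤ) → (Fin r → Carrier) → Carrier
  combination k e = sum (λ i → ι (k i) * e i)

  combination-cong : ∀ {r} {k k′ : Fin r → ℤ} e → (∀ i → k i ≋ k′ i [mod p ]) → combination k e ≈ combination k′ e
  combination-cong {r} e k≋k′ = sum-cong-≋ {r} λ i → *-congʳ (ι-cong (k≋k′ i))

  combination-injective : ∀ {r} {e : Fin r → Carrier} →
    (∀ k → combination k e ≈ 0# → ∀ i → k i ≋ 0ℤ [mod p ]) →
    ∀ k k′ → combination k e ≈ combination k′ e → ∀ i → k i ≋ k′ i [mod p ]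
  combination-injective {r} {e} independent k k′ eq i = congruent (≋0⇒∣ (independent (λ i → k i ℤ.- k′ i) (begin
    combination (λ i → k i ℤ.- k′ i) e
      ≈⟨ solve 2 (λ x y → x := (x :+ y) :- y) refl _ (combination k′ e) ⟩
    (combination (λ i → k i ℤ.- k′ i) e + combination k′ e) - combination k′ e
      ≈⟨ +-congʳ (sym (∑-distrib-+ {r} _ _)) ⟩
    sum (λ i → ι (k i ℤ.- k′ i) * e i + ι (k′ i) * e i) - combination k′ e
      ≈⟨ +-congʳ (sum-cong-≋ {r} λ i → trans (sym (distribʳ (e i) _ _))
           (*-congʳ (trans (sym (+-homo _ _)) (reflexive (≡.cong ι (lemma (k i) (k′ i))))))) ⟩
    combination k e - combination k′ e
      ≈⟨ +-congʳ eq ⟩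
    combination k′ e - combination k′ e
      ≈⟨ -‿inverseʳ _ ⟩
    0# ∎) i))
    where
    lemma : ∀ x y → x ℤ.- y ℤ.+ y ≡ x
    lemma = ℤ-Solver.solve-∀

  -- An r-dimensional space has pʳ elements.
  HasDegree⇒≤ : ∀ {r s} → HasDegree r → HasDegree s → r ℕ.≤ s
  HasDegree⇒≤ {r} {s} (e , _ , independent) (f , spans , _) = ℕ.≮⇒≥ λ s<r →
    ℕ.<⇒≱ (ℕ.^-monoʳ-< p (ℕ.nonTrivial⇒n>1 p {{prime⇒nonTrivial p-prime}}) s<r) (Fin.injective⇒≤ {f = encode} encode-injective)
    where
    digits : ∀ {n} → Fin (p ℕ.^ n) → Fin n → ℤ
    digits i j = + toℕ (Fin.finToFun {p} i j)
    element : Fin (p ℕ.^ r) → Carrier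
    element i = combination (digits i) e
    coordinates : Fin (p ℕ.^ r) → Fin s → ℤ
    coordinates i = proj₁ (spans (element i))
    encode : Fin (p ℕ.^ r) → Fin (p ℕ.^ s)
    encode i = Fin.funToFin (residue ∘ coordinates i)
    encode-injective : ∀ {i j} → encode i ≡ encode j → i ≡ j
    encode-injective {i} {j} eq = finToFun-injective {r} λ k → ≋⇒≡Fin
      (combination-injective independent (digits i) (digits j) elements≈ k)
      where
      residues≡ : ∀ k → residue {p} (coordinates i k) ≡ residue (coordinates j k)
      residues≡ k = ≡.trans (≡.sym (Fin.finToFun-funToFin (residue ∘ coordinates i) k))
        (≡.trans (≡.cong (λ n → Fin.finToFun {p} {s} n k) eq) (Fin.finToFun-funToFin (residue ∘ coordinates j) k))
      coordinates≋ : ∀ k → coordinates i k ≋ coordinates j k [mod p ]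
      coordinates≋ k = CommutativeRing.trans (ℤ/ p) (CommutativeRing.sym (ℤ/ p) (residue-≋ (coordinates i k)))
        (≡.subst (λ n → + toℕ n ≋ coordinates j k [mod p ]) (≡.sym (residues≡ k)) (residue-≋ (coordinates j k)))
      elements≈ : element i ≈ element j
      elements≈ = trans (sym (proj₂ (spans (element i))))
        (trans (combination-cong f coordinates≋) (proj₂ (spans (element j))))

  degree-unique : ∀ {r s} → HasDegree r → HasDegree s → r ≡ s
  degree-unique d d′ = ℕ.≤-antisym (HasDegree⇒≤ d d′) (HasDegree⇒≤ d′ d)

module Degrees {p : ℕ} (p-prime : Prime p) {ℓ₁ ℓ₂ : Level} (E : Extension p c ℓ₁ ℓ₂) where
  open Extension E hiding (zero)
  open IntegerCoefficients commutativeRing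
  open RingMorphisms.IsRingHomomorphism ι-isRingHomomorphism using (1#-homo)
  open ExtensionField p-prime E
  open IsDiscreteField isField
  open PrimeSubfield commutativeRing isField p-prime char-p
  open Exp commutativeSemiring using (^-congˡ; ^-distrib-*)
  open SetoidReasoning setoid

  Fixed⇒ι : ∀ {x} → Fixed x → ∃[ k ] ι k ≈ x
  Fixed⇒ι fixed = proj₁ k , trans (ι≈fromℤ (proj₁ k)) (proj₂ k)
    where k = Fixed⇒fromℤ fixed

  ι-Fixed : ∀ k → Fixed (ι k)
  ι-Fixed k = fromℤ⇒Fixed (k , sym (ι≈fromℤ k))

  ι⇒Fixed : ∀ {x} → In𝔽ₚ x → Fixed x
  ι⇒Fixed (k , eq) = trans (^-congˡ p (sym eq)) (trans (ι-Fixed k) eq)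

  record IsEndomorphism (φ : Carrier → Carrier) : Set (c ⊔ ℓ₁) where
    field
      φ-cong : ∀ {x y} → x ≈ y → φ x ≈ φ y
      φ-+    : ∀ x y → φ (x + y) ≈ φ x + φ y
      φ-neg  : ∀ x → φ (- x) ≈ - φ x
      φ-*    : ∀ x y → φ (x * y) ≈ φ x * φ y
      φ-ι    : ∀ k → φ (ι k) ≈ ι k

  frobenius-endomorphism : IsEndomorphism (_^ p)
  frobenius-endomorphism = record
    { φ-cong = ^-congˡ p
    ; φ-+    = frobenius-+
    ; φ-neg  = frobenius-neg
    ; φ-*    = λ x y → ^-distrib-* x y p
    ; φ-ι    = ι-Fixed
    }

  ∘-endomorphism : ∀ {φ ψ} → IsEndomorphism φ → IsEndomorphism ψ → IsEndomorphism (φ ∘ ψ)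
  ∘-endomorphism φ-endo ψ-endo = record
    { φ-cong = Φ.φ-cong ∘ Ψ.φ-cong
    ; φ-+    = λ x y → trans (Φ.φ-cong (Ψ.φ-+ x y)) (Φ.φ-+ _ _)
    ; φ-neg  = λ x → trans (Φ.φ-cong (Ψ.φ-neg x)) (Φ.φ-neg _)
    ; φ-*    = λ x y → trans (Φ.φ-cong (Ψ.φ-* x y)) (Φ.φ-* _ _)
    ; φ-ι    = λ k → trans (Φ.φ-cong (Ψ.φ-ι k)) (Φ.φ-ι k)
    }
    where
    module Φ = IsEndomorphism φ-endo
    module Ψ = IsEndomorphism ψ-endo

  endomorphism-fixes : ∀ {φ} → IsEndomorphism φ → ∀ {s} {S : Pred Carrier s} → (∀ {x} → S x → φ x ≈ x) →
                       ∀ {x} → 𝔽ₚ⟮_⟯ E S x → φ x ≈ x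
  endomorphism-fixes {φ} endo fixes = go
    where
    open IsEndomorphism endo
    go : ∀ {x} → 𝔽ₚ⟮_⟯ E _ x → φ x ≈ x
    go (gen∈ x∈S)       = fixes x∈S
    go (base∈ k)        = φ-ι k
    go (add∈ x∈ y∈)     = trans (φ-+ _ _) (+-cong (go x∈) (go y∈))
    go (neg∈ x∈)        = trans (φ-neg _) (-‿cong (go x∈))
    go (mul∈ x∈ y∈)     = trans (φ-* _ _) (*-cong (go x∈) (go y∈))
    go (resp∈ x≈y x∈)   = trans (φ-cong (sym x≈y)) (trans (go x∈) x≈y)
    go (inv∈ {x} {y} x∈ xy≈1) = begin
      φ y               ≈⟨ *-identityʳ _ ⟨
      φ y * 1#          ≈⟨ *-congˡ xy≈1 ⟨
      φ y * (x * y)     ≈⟨ *-assoc _ _ _ ⟨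
      φ y * x * y       ≈⟨ *-congʳ (trans (*-comm _ _) (*-congʳ (sym (go x∈)))) ⟩
      φ x * φ y * y     ≈⟨ *-congʳ (trans (sym (φ-* x y)) (trans (φ-cong (trans xy≈1 (sym 1#-homo))) (φ-ι 1ℤ))) ⟩
      ι 1ℤ * y          ≈⟨ trans (*-congʳ 1#-homo) (*-identityˡ y) ⟩
      y                 ∎

  degree-1 : (∀ x → Fixed x) → HasDegree 1
  degree-1 fixed = (λ _ → 1#) ,
    (λ x → (λ _ → proj₁ (Fixed⇒ι (fixed x))) , trans (simplify _) (proj₂ (Fixed⇒ι (fixed x)))) ,
    λ { k eq zero → ι≈0⇒ (trans (sym (simplify _)) eq) }
    where
    simplify : ∀ x → x * 1# + 0# ≈ x
    simplify x = trans (+-identityʳ _) (*-identityʳ x)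

  module _ {β β′ : Carrier} (β^p : β ^ p ≈ β′) (β′^p : β′ ^ p ≈ β) (β≉β′ : ¬ β ≈ β′)
           (frobenius² : ∀ x → (x ^ p) ^ p ≈ x) where

    private
      d = β - β′
      d⁻¹ = inverse {d} λ d≈0 → β≉β′ (x-y≈0⇒ d≈0)
      d′ = proj₁ d⁻¹

      d^p : d ^ p ≈ - d
      d^p = trans (frobenius-- β β′) (trans (+-cong β^p (-‿cong β′^p)) (solve 2 (λ a b → b :- a := :- (a :- b)) refl β β′))

      d′^p : d′ ^ p ≈ - d′
      d′^p = begin
        d′ ^ p                        ≈⟨ *-identityʳ _ ⟨
        d′ ^ p * 1#                   ≈⟨ *-congˡ (proj₂ d⁻¹) ⟨
        d′ ^ p * (d * d′)             ≈⟨ solve 3 (λ x d e → x :* (d :* e) := :- (((:- d) :* x) :* e)) refl (d′ ^ p) d d′ ⟩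
        - ((- d) * d′ ^ p * d′)       ≈⟨ -‿cong (*-congʳ (*-congʳ d^p)) ⟨
        - (d ^ p * d′ ^ p * d′)       ≈⟨ -‿cong (*-congʳ (trans (sym (^-distrib-* d d′ p)) (trans (^-congˡ p (proj₂ d⁻¹)) (1^≈1 commutativeRing p)))) ⟩
        - (1# * d′)                   ≈⟨ -‿cong (*-identityˡ d′) ⟩
        - d′                          ∎

      basis : Fin 2 → Carrier
      basis zero       = 1#
      basis (suc zero) = β

      combination₂ : ∀ k → combination k basis ≈ ι (k zero) + ι (k (suc zero)) * β
      combination₂ k = +-cong (*-identityʳ _) (+-identityʳ _)

      slope intercept : Carrier → Carrier
      slope x = (x - x ^ p) * d′
      intercept x = x - slope x * β

      slope-fixed : ∀ x → Fixed (slope x)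
      slope-fixed x = begin
        ((x - x ^ p) * d′) ^ p         ≈⟨ ^-distrib-* (x - x ^ p) d′ p ⟩
        (x - x ^ p) ^ p * d′ ^ p       ≈⟨ *-cong (trans (frobenius-- x (x ^ p)) (+-congˡ (-‿cong (frobenius² x)))) d′^p ⟩
        (x ^ p - x) * - d′             ≈⟨ solve 3 (λ x y d → (y :- x) :* (:- d) := (x :- y) :* d) refl x (x ^ p) d′ ⟩
        (x - x ^ p) * d′               ∎

      slope*d : ∀ x → slope x * d ≈ x - x ^ p
      slope*d x = trans (*-assoc _ _ _) (trans (*-congˡ (trans (*-comm d′ d) (proj₂ d⁻¹))) (*-identityʳ _))

      intercept-fixed : ∀ x → Fixed (intercept x)
      intercept-fixed x = begin
        (x - slope x * β) ^ p          ≈⟨ frobenius-- x (slope x * β) ⟩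
        x ^ p - (slope x * β) ^ p      ≈⟨ +-congˡ (-‿cong (trans (^-distrib-* (slope x) β p) (*-cong (slope-fixed x) β^p))) ⟩
        x ^ p - slope x * β′
          ≈⟨ solve 4 (λ y s b b′ → y :- s :* b′ := y :+ s :* (b :- b′) :- s :* b) refl (x ^ p) (slope x) β β′ ⟩
        x ^ p + slope x * d - slope x * β   ≈⟨ +-congʳ (trans (+-congˡ (slope*d x))
                                                 (solve 2 (λ x y → y :+ (x :- y) := x) refl x (x ^ p))) ⟩
        x - slope x * β                ∎

    degree-2 : HasDegree 2
    degree-2 = basis , spans , independent
      where
      spans : ∀ x → ∃[ k ] combination k basis ≈ x
      spans x = k , trans (combination₂ k) (trans (+-cong (proj₂ k₀) (*-congʳ (proj₂ k₁)))
        (solve 2 (λ x y → x :- y :+ y := x) refl x (slope x * β)))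
        where
        k₀ = Fixed⇒ι (intercept-fixed x)
        k₁ = Fixed⇒ι (slope-fixed x)
        k : Fin 2 → ℤ
        k zero       = proj₁ k₀
        k (suc zero) = proj₁ k₁
      independent : ∀ k → combination k basis ≈ 0# → ∀ i → k i ≋ 0ℤ [mod p ]
      independent k eq = λ { zero → ι≈0⇒ k₀≈0 ; (suc zero) → ι≈0⇒ k₁≈0 }
        where
        s = ι (k zero)
        t = ι (k (suc zero))
        at-β : s + t * β ≈ 0#
        at-β = trans (sym (combination₂ k)) eq
        at-β′ : s + t * β′ ≈ 0#
        at-β′ = begin
          s + t * β′              ≈⟨ +-cong (ι-Fixed (k zero)) (*-cong (ι-Fixed (k (suc zero))) β^p) ⟨
          s ^ p + t ^ p * β ^ p   ≈⟨ +-congˡ (^-distrib-* t β p) ⟨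
          s ^ p + (t * β) ^ p     ≈⟨ frobenius-+ s (t * β) ⟨
          (s + t * β) ^ p         ≈⟨ trans (^-congˡ p at-β) 0^p≈0 ⟩
          0#                      ∎
        k₁≈0 : t ≈ 0#
        k₁≈0 = difference-cancel β≉β′ (begin
          (β - β′) * t                       ≈⟨ solve 4 (λ s t b b′ → (b :- b′) :* t := (s :+ t :* b) :- (s :+ t :* b′)) refl s t β β′ ⟩
          (s + t * β) - (s + t * β′)         ≈⟨ +-cong at-β (-‿cong at-β′) ⟩
          0# - 0#                            ≈⟨ -‿inverseʳ 0# ⟩
          0#                                 ∎)
        k₀≈0 : s ≈ 0#
        k₀≈0 = trans (sym (trans (+-congˡ (trans (*-congʳ k₁≈0) (zeroˡ β))) (+-identityʳ s))) at-β

  module _ (roots : Roots commutativeRing) (p≢23 : p ≢ 23) where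
    open Roots roots
    open RootAction commutativeRing isField p-prime char-p roots
    open Distinct p≢23

    module _ (α^p : α ^ p ≈ β) (β^p : β ^ p ≈ γ) (γ^p : γ ^ p ≈ α)
             (frobenius³ : ∀ x → ((x ^ p) ^ p) ^ p ≈ x) where

      private
        tr : Carrier → Carrier
        tr x = x + x ^ p + (x ^ p) ^ p

        tr-fixed : ∀ x → Fixed (tr x)
        tr-fixed x = begin
          (x + x ^ p + (x ^ p) ^ p) ^ p            ≈⟨ trans (frobenius-+ _ _) (+-congʳ (frobenius-+ _ _)) ⟩
          x ^ p + (x ^ p) ^ p + ((x ^ p) ^ p) ^ p  ≈⟨ +-congˡ (frobenius³ x) ⟩
          x ^ p + (x ^ p) ^ p + x                  ≈⟨ solve 3 (λ x y z → y :+ z :+ x := x :+ y :+ z) refl x (x ^ p) ((x ^ p) ^ p) ⟩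
          tr x                                     ∎

        tr-* : ∀ x {a b c} → a ^ p ≈ b → b ^ p ≈ c → tr (x * a) ≈ x * a + x ^ p * b + (x ^ p) ^ p * c
        tr-* x {a} {b} {c} a^p b^p = +-cong (+-congˡ xa^p)
          (trans (^-congˡ p xa^p) (trans (^-distrib-* (x ^ p) b p) (*-congˡ b^p)))
          where
          xa^p : (x * a) ^ p ≈ x ^ p * b
          xa^p = trans (^-distrib-* x a p) (*-congˡ a^p)

        basis : Fin 3 → Carrier
        basis zero             = 1#
        basis (suc zero)       = α
        basis (suc (suc zero)) = α * α

        combination₃ : ∀ k → combination k basis ≈ ι (k zero) + ι (k (suc zero)) * α + ι (k (suc (suc zero))) * (α * α)
        combination₃ k = trans (+-cong (*-identityʳ _) (+-congˡ (+-identityʳ _))) (sym (+-assoc _ _ _))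

        l⁻¹ = inverse {(α - β) * (α - γ)} λ eq →
          [ (λ eq → α≉β (x-y≈0⇒ eq)) , (λ eq → γ≉α (sym (x-y≈0⇒ eq))) ]′ (x*y≈0⇒ eq)
        l = proj₁ l⁻¹

        -- Lagrange interpolation at α, β, γ of the conjugates of x.
        interpolate : ∀ x → let y = x * l in tr (y * (β * γ)) + tr (y * α) * α + tr y * (α * α) ≈ x
        interpolate x = begin
          tr (y * (β * γ)) + tr (y * α) * α + tr y * (α * α)
            ≈⟨ +-congʳ (+-cong (tr-* y (trans (^-distrib-* β γ p) (*-cong β^p γ^p)) (trans (^-distrib-* γ α p) (*-cong γ^p α^p)))
                 (*-congʳ (tr-* y α^p β^p))) ⟩
          (y * (β * γ) + y′ * (γ * α) + y″ * (α * β)) + (y * α + y′ * β + y″ * γ) * α + (y + y′ + y″) * (α * α)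
            ≈⟨ solve 6 (λ y y′ y″ a b c →
                 (y :* (b :* c) :+ y′ :* (c :* a) :+ y″ :* (a :* b)) :+ (y :* a :+ y′ :* b :+ y″ :* c) :* a :+ (y :+ y′ :+ y″) :* (a :* a) :=
                 y :* ((a :- b) :* (a :- c)) :+ (a :+ b :+ c) :* (a :* (y :+ y′ :+ y″))) refl y y′ y″ α β γ ⟩
          y * ((α - β) * (α - γ)) + (α + β + γ) * (α * (y + y′ + y″))
            ≈⟨ +-cong (trans (*-assoc x l _) (trans (*-congˡ (trans (*-comm l _) (proj₂ l⁻¹))) (*-identityʳ x)))
                 (trans (*-congʳ e₁) (zeroˡ _)) ⟩
          x + 0#   ≈⟨ +-identityʳ x ⟩
          x        ∎
          where
          y = x * l
          y′ = y ^ p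
          y″ = y′ ^ p

      degree-3 : HasDegree 3
      degree-3 = basis , spans , independent
        where
        spans : ∀ x → ∃[ k ] combination k basis ≈ x
        spans x = k , trans (combination₃ k)
          (trans (+-cong (+-cong (proj₂ k₀) (*-congʳ (proj₂ k₁))) (*-congʳ (proj₂ k₂))) (interpolate x))
          where
          k₀ = Fixed⇒ι (tr-fixed (x * l * (β * γ)))
          k₁ = Fixed⇒ι (tr-fixed (x * l * α))
          k₂ = Fixed⇒ι (tr-fixed (x * l))
          k : Fin 3 → ℤ
          k zero             = proj₁ k₀
          k (suc zero)       = proj₁ k₁
          k (suc (suc zero)) = proj₁ k₂
        independent : ∀ k → combination k basis ≈ 0# → ∀ i → k i ≋ 0ℤ [mod p ]
        independent k eq = λ { zero → ι≈0⇒ (proj₁ zeros)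
                             ; (suc zero) → ι≈0⇒ (proj₁ (proj₂ zeros))
                             ; (suc (suc zero)) → ι≈0⇒ (proj₂ (proj₂ zeros)) }
          where
          s = ι (k zero)
          t = ι (k (suc zero))
          v = ι (k (suc (suc zero)))
          Vanishes : Carrier → Set ℓ₁
          Vanishes x = s + t * x + v * (x * x) ≈ 0#
          frobenius-vanishes : ∀ {x y} → x ^ p ≈ y → Vanishes x → Vanishes y
          frobenius-vanishes {x} {y} x^p vanishes = begin
            s + t * y + v * (y * y)
              ≈⟨ +-cong (+-cong (ι-Fixed _) (*-cong (ι-Fixed _) x^p)) (*-cong (ι-Fixed _) (*-cong x^p x^p)) ⟨
            s ^ p + t ^ p * x ^ p + v ^ p * (x ^ p * x ^ p)
              ≈⟨ +-cong (+-congˡ (^-distrib-* t x p)) (trans (^-distrib-* v (x * x) p) (*-congˡ (^-distrib-* x x p))) ⟨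
            s ^ p + (t * x) ^ p + (v * (x * x)) ^ p
              ≈⟨ trans (frobenius-+ _ _) (+-congʳ (frobenius-+ _ _)) ⟨
            (s + t * x + v * (x * x)) ^ p
              ≈⟨ trans (^-congˡ p vanishes) 0^p≈0 ⟩
            0# ∎
          at-α : Vanishes α
          at-α = trans (sym (combination₃ k)) eq
          at-β : Vanishes β
          at-β = frobenius-vanishes α^p at-α
          at-γ : Vanishes γ
          at-γ = frobenius-vanishes β^p at-β
          respects : ∀ {x y} → x ≈ y → Vanishes y → Vanishes x
          respects x≈y = trans (+-cong (+-congˡ (*-congˡ x≈y)) (*-congˡ (*-cong x≈y x≈y)))
          zeros : s ≈ 0# × t ≈ 0# × v ≈ 0#
          zeros = quadratic-vanishes λ root →
            [ (λ eq → respects eq at-α) , [ (λ eq → respects eq at-β) , (λ eq → respects eq at-γ) ]′ ]′ (IsRoot⇒ root)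

swapRoots : ∀ {R : CommutativeRing c ℓ} → Roots R → Roots R
swapRoots {R = R} roots = record
  { α = α ; β = γ ; γ = β
  ; e₁ = trans (solve 3 (λ a b c → a :+ c :+ b := a :+ b :+ c) refl α β γ) e₁
  ; e₂ = trans (solve 3 (λ a b c → a :* c :+ c :* b :+ b :* a := a :* b :+ b :* c :+ c :* a) refl α β γ) e₂
  ; e₃ = trans (solve 3 (λ a b c → a :* c :* b := a :* b :* c) refl α β γ) e₃
  }
  where
  open CommutativeRing R
  open Roots roots
  open IntegerCoefficients R

module ResolventAction (R : CommutativeRing c ℓ) (isField : IsDiscreteField R)
  {p : ℕ} (p-prime : Prime p) (p≢2 : p ≢ 2) (p≢3 : p ≢ 3)
  (char-p : CommutativeRing._≈_ R (IntegerCoefficients.fromℤ R (+ p)) (CommutativeRing.0# R))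
  (ρ : Resolvent p) where
  open CommutativeRing R hiding (zero)
  open IntegerCoefficients R
  open IsDiscreteField isField
  open ResidueMap R p-prime char-p 0≉1
  open Resolvent ρ
  open SetoidReasoning setoid

  private
    x y : Carrier
    x = fromℤ X
    y = fromℤ Y

  x²+23y² : x * x + fromℤ (+ 23) * (y * y) ≈ 0#
  x²+23y² = begin
    x * x + fromℤ (+ 23) * (y * y)
      ≈⟨ +-cong (fromℤ-* X X) (trans (fromℤ-* (+ 23) (Y ℤ.* Y)) (*-congˡ (fromℤ-* Y Y))) ⟨
    fromℤ (X ℤ.* X) + fromℤ (+ 23 ℤ.* (Y ℤ.* Y))
      ≈⟨ fromℤ-+ (X ℤ.* X) (+ 23 ℤ.* (Y ℤ.* Y)) ⟨
    fromℤ (X ℤ.* X ℤ.+ + 23 ℤ.* (Y ℤ.* Y))   ≈⟨ fromℤ-mod (∣⇒≋0 -23≋) ⟩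
    0#                                       ∎

  module _ (roots : Roots R) where
    open Roots roots
    open LagrangeResolvent R roots using (δ; δ²; L)
    open RootAction R isField p-prime char-p roots
    open Eisenstein R
    open Exp commutativeSemiring using (_^_)

    x≈±δy : x ≈ - (δ * y) ⊎ x ≈ δ * y
    x≈±δy = map (λ eq → trans (solve 2 (λ x z → x := (x :+ z) :- z) refl x (δ * y)) (trans (+-congʳ eq) (+-identityˡ _))) x-y≈0⇒
      (x*y≈0⇒ {x + δ * y} {x - δ * y} (begin
        (x + δ * y) * (x - δ * y)
          ≈⟨ solve 3 (λ x y d → (x :+ d :* y) :* (x :- d :* y) :=
               (x :* x :+ con (+ 23) :* (y :* y)) :- (d :* d :- con (ℤ.- + 23)) :* (y :* y)) refl x y δ ⟩
        (x * x + fromℤ (+ 23) * (y * y)) - (δ * δ - fromℤ (ℤ.- + 23)) * (y * y)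
          ≈⟨ +-cong x²+23y² (-‿cong (trans (*-congʳ (trans (+-congʳ δ²) (-‿inverseʳ _))) (zeroˡ _))) ⟩
        0# - 0#   ≈⟨ -‿inverseʳ 0# ⟩
        0#        ∎))

    private
      Twist : Value → Set ℓ
      Twist s = (α ^ p - γ ^ p , β ^ p - γ ^ p) E.≈ e s E.* L

      sub : ∀ {a b c d} → a ≈ b → c ≈ d → a - c ≈ b - d
      sub a c = +-cong a (-‿cong c)

    twist-identity : α ^ p ≈ α → β ^ p ≈ β → γ ^ p ≈ γ → Twist I
    twist-identity a b g =
      trans (sub a g) (solve 2 (λ x y → x := con 1ℤ :* x :- con 0ℤ :* y) refl (α - γ) (β - γ)) ,
      trans (sub b g) (solve 2 (λ x y → y := con 1ℤ :* y :+ con 0ℤ :* x :- con 0ℤ :* y) refl (α - γ) (β - γ))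

    twist-cycle : α ^ p ≈ β → β ^ p ≈ γ → γ ^ p ≈ α → Twist W²
    twist-cycle a b g =
      trans (sub a g) (solve 3 (λ a b c → b :- a := (:- con 1ℤ) :* (a :- c) :- (:- con 1ℤ) :* (b :- c)) refl α β γ) ,
      trans (sub b g) (solve 3 (λ a b c → c :- a := (:- con 1ℤ) :* (b :- c) :+ (:- con 1ℤ) :* (a :- c) :- (:- con 1ℤ) :* (b :- c)) refl α β γ)

    twist-cycle⁻¹ : α ^ p ≈ γ → β ^ p ≈ α → γ ^ p ≈ β → Twist W
    twist-cycle⁻¹ a b g =
      trans (sub a g) (solve 3 (λ a b c → c :- b := con 0ℤ :* (a :- c) :- con 1ℤ :* (b :- c)) refl α β γ) ,
      trans (sub b g) (solve 3 (λ a b c → a :- b := con 0ℤ :* (b :- c) :+ con 1ℤ :* (a :- c) :- con 1ℤ :* (b :- c)) refl α β γ)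

    module _ (x≈-δy : x ≈ - (δ * y)) where
      open ResolventValue R p-prime p≢2 p≢3 char-p 0≉1 roots ρ using (value-equation)

      identity⇒I′ : α ^ p ≈ α → β ^ p ≈ β → γ ^ p ≈ γ → value ≡ I
      identity⇒I′ a b g = ≡.trans (≡.sym (∙-identityʳ value)) (≡.sym (value-equation x≈-δy I (twist-identity a b g)))

      cycle⇒≢I′ : α ^ p ≈ β → β ^ p ≈ γ → γ ^ p ≈ α → value ≢ I
      cycle⇒≢I′ a b g v≡I with ≡.trans (value-equation x≈-δy W² (twist-cycle a b g)) (≡.cong (_∙ W²) v≡I)
      ... | ()

      cycle⁻¹⇒≢I′ : α ^ p ≈ γ → β ^ p ≈ α → γ ^ p ≈ β → value ≢ I
      cycle⁻¹⇒≢I′ a b g v≡I with ≡.trans (value-equation x≈-δy W (twist-cycle⁻¹ a b g)) (≡.cong (_∙ W) v≡I)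
      ... | ()

  module _ (roots : Roots R) where
    open Roots roots
    open LagrangeResolvent R roots using (δ)
    open Exp commutativeSemiring using (_^_)

    private
      swap-δ : x ≈ δ * y → x ≈ - (LagrangeResolvent.δ R (swapRoots roots) * y)
      swap-δ eq = trans eq (solve 4 (λ a b c y → ((a :- b) :* (b :- c) :* (c :- a)) :* y :=
        :- (((a :- c) :* (c :- b) :* (b :- a)) :* y)) refl α β γ y)

    identity⇒I : α ^ p ≈ α → β ^ p ≈ β → γ ^ p ≈ γ → value ≡ I
    identity⇒I a b g = [ (λ eq → identity⇒I′ roots eq a b g)
                       , (λ eq → identity⇒I′ (swapRoots roots) (swap-δ eq) a g b) ]′ (x≈±δy roots)

    cycle⇒≢I : α ^ p ≈ β → β ^ p ≈ γ → γ ^ p ≈ α → value ≢ I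
    cycle⇒≢I a b g = [ (λ eq → cycle⇒≢I′ roots eq a b g)
                     , (λ eq → cycle⁻¹⇒≢I′ (swapRoots roots) (swap-δ eq) a g b) ]′ (x≈±δy roots)

    cycle⁻¹⇒≢I : α ^ p ≈ γ → β ^ p ≈ α → γ ^ p ≈ β → value ≢ I
    cycle⁻¹⇒≢I a b g = [ (λ eq → cycle⁻¹⇒≢I′ roots eq a b g)
                       , (λ eq → cycle⇒≢I′ (swapRoots roots) (swap-δ eq) a g b) ]′ (x≈±δy roots)

module Splitting {p : ℕ} (p-prime : Prime p) {ℓ₁ ℓ₂ : Level} (S : SplittingField p c ℓ₁ ℓ₂) where
  open SplittingField S hiding (zero)
  open IntegerCoefficients commutativeRing
  open RingMorphisms.IsRingHomomorphism ι-isRingHomomorphism using (-‿homo; 0#-homo; 1#-homo)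
  open ExtensionField p-prime extension
  open IsDiscreteField isField
  open PrimeSubfield commutativeRing isField p-prime char-p
  open Degrees p-prime extension
  open Exp commutativeSemiring using (^-congˡ; ^-distrib-*)
  open SetoidReasoning setoid

  roots : Roots commutativeRing
  roots = record
    { α = α ; β = β ; γ = γ
    ; e₁ = trans (solve 3 (λ a b c → a :+ b :+ c := :- (((:- a) :* con 1ℤ :+ (con 1ℤ :* (:- b) :+ con 0ℤ)) :* con 1ℤ
             :+ (con 1ℤ :* con 1ℤ :* (:- c) :+ con 0ℤ))) refl α β γ)
             (trans (-‿cong (trans (sym (splits 2)) 0#-homo)) (solve 0 (:- con 0ℤ := con 0ℤ) refl))
    ; e₂ = trans (solve 3 (λ a b c → a :* b :+ b :* c :+ c :* a := ((:- a) :* (:- b) :+ con 0ℤ) :* con 1ℤ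
             :+ (((:- a) :* con 1ℤ :+ (con 1ℤ :* (:- b) :+ con 0ℤ)) :* (:- c) :+ con 0ℤ)) refl α β γ)
             (trans (sym (splits 1)) ι-1)
    ; e₃ = trans (solve 3 (λ a b c → a :* b :* c := :- (((:- a) :* (:- b) :+ con 0ℤ) :* (:- c) :+ con 0ℤ)) refl α β γ)
             (trans (-‿cong (trans (sym (splits 0)) ι-1)) (solve 0 (:- (:- con 1ℤ) := con 1ℤ) refl))
    }
    where
    ι-1 : ι (ℤ.- 1ℤ) ≈ - 1#
    ι-1 = trans (-‿homo 1ℤ) (-‿cong 1#-homo)

  open RootAction commutativeRing isField p-prime char-p roots
  open LagrangeResolvent commutativeRing roots using (δ; δ²)

  private
    fixed-everywhere : ∀ {φ} → IsEndomorphism φ → φ α ≈ α → φ β ≈ β → φ γ ≈ γ → ∀ x → φ x ≈ x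
    fixed-everywhere {φ} endo a b g x = endomorphism-fixes endo
      [ respects a , [ respects b , respects g ]′ ]′ (generated x)
      where
      open IsEndomorphism endo
      respects : ∀ {x y} → φ y ≈ y → x ≈ y → φ x ≈ x
      respects φy≈y x≈y = trans (φ-cong x≈y) (trans φy≈y (sym x≈y))

    φ² = ∘-endomorphism frobenius-endomorphism frobenius-endomorphism
    φ³ = ∘-endomorphism frobenius-endomorphism φ²

    steps : ∀ {x y z} → x ^ p ≈ y → y ^ p ≈ z → (x ^ p) ^ p ≈ z
    steps x y = trans (^-congˡ p x) y

  identity⇒degree-1 : α ^ p ≈ α → β ^ p ≈ β → γ ^ p ≈ γ → HasDegree 1
  identity⇒degree-1 a b g = degree-1 (fixed-everywhere frobenius-endomorphism a b g)

  module NotRamified (p≢23 : p ≢ 23) where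
    open Distinct p≢23 public

    data Degree : Set (c ⊔ ℓ₁) where
      one   : HasDegree 1 → α ^ p ≈ α → β ^ p ≈ β → γ ^ p ≈ γ → Degree
      two   : HasDegree 2 → (α ^ p ≈ α × β ^ p ≈ γ × γ ^ p ≈ β) ⊎
                            (α ^ p ≈ γ × β ^ p ≈ β × γ ^ p ≈ α) ⊎
                            (α ^ p ≈ β × β ^ p ≈ α × γ ^ p ≈ γ) → Degree
      three : HasDegree 3 → (α ^ p ≈ β × β ^ p ≈ γ × γ ^ p ≈ α) ⊎
                            (α ^ p ≈ γ × β ^ p ≈ α × γ ^ p ≈ β) → Degree

    degree : Degree
    degree = from-action (action α≉β)
      where
      from-action : Action → Degree
      from-action (identity a b g) = one (identity⇒degree-1 a b g) a b g
      from-action (swap-βγ a b g)  = two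
        (degree-2 b g β≉γ (fixed-everywhere φ² (steps a a) (steps b g) (steps g b))) (inj₁ (a , b , g))
      from-action (swap-γα a b g)  = two
        (degree-2 g a γ≉α (fixed-everywhere φ² (steps a g) (steps b b) (steps g a))) (inj₂ (inj₁ (a , b , g)))
      from-action (swap-αβ a b g)  = two
        (degree-2 a b α≉β (fixed-everywhere φ² (steps a b) (steps b a) (steps g g))) (inj₂ (inj₂ (a , b , g)))
      from-action (cycle a b g)    = three
        (degree-3 roots p≢23 a b g (fixed-everywhere φ³ (steps (steps a b) g) (steps (steps b g) a) (steps (steps g a) b)))
        (inj₁ (a , b , g))
      from-action (cycle⁻¹ a b g)  = three
        (degree-3 (swapRoots roots) p≢23 a g b
          (fixed-everywhere φ³ (steps (steps a g) b) (steps (steps b a) g) (steps (steps g b) a)))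
        (inj₂ (a , b , g))

  -- X³ − X − 1 = (X − 3)(X − 10)² modulo 23.
  module _ (p≡23 : p ≡ 23) where

    private
      23≈0 : fromℤ (+ 23) ≈ 0#
      23≈0 = ≡.subst (λ n → fromℤ (+ n) ≈ 0#) p≡23 char-p

      fixed : ∀ {x} → IsRoot x → Fixed x
      fixed {x} root = [ from-difference (+ 3) , [ from-difference (+ 10) , from-difference (+ 10) ]′ ∘ x*y≈0⇒ ]′ (x*y≈0⇒ (begin
        (x - fromℤ (+ 3)) * ((x - fromℤ (+ 10)) * (x - fromℤ (+ 10)))
          ≈⟨ solve 1 (λ x → (x :- con (+ 3)) :* ((x :- con (+ 10)) :* (x :- con (+ 10))) :=
               (x :* (x :* x) :- (x :+ con 1ℤ)) :- con (+ 23) :* (x :* x :- con (+ 7) :* x :+ con (+ 13))) refl x ⟩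
        (x * (x * x) - (x + 1#)) - fromℤ (+ 23) * (x * x - fromℤ (+ 7) * x + fromℤ (+ 13))
          ≈⟨ +-cong (trans (+-congʳ root) (-‿inverseʳ _)) (-‿cong (trans (*-congʳ 23≈0) (zeroˡ _))) ⟩
        0# - 0#   ≈⟨ -‿inverseʳ 0# ⟩
        0#        ∎))
        where
        from-difference : ∀ k → x - fromℤ k ≈ 0# → Fixed x
        from-difference k eq = fromℤ⇒Fixed (k , sym (x-y≈0⇒ eq))

    ramified-degree : HasDegree 1
    ramified-degree = identity⇒degree-1 (fixed α-root) (fixed β-root) (fixed γ-root)

  private
    no-fixed-root⇒p≢ : ∀ q → (∀ x → x ^ q ≈ x → ¬ IsRoot x) → Fixed α → p ≢ q
    no-fixed-root⇒p≢ q no-root fixed ≡.refl = no-root α fixed α-root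

    no-fixed-root : ∀ {x} → x * (x * x) ≈ x → ¬ IsRoot x
    no-fixed-root {x} x³≈x root = 0≉1 (begin
      0#             ≈⟨ -‿inverseʳ x ⟨
      x - x          ≈⟨ +-congʳ (trans (sym x³≈x) root) ⟩
      x + 1# - x     ≈⟨ solve 1 (λ x → x :+ con 1ℤ :- x := con 1ℤ) refl x ⟩
      1#             ∎)

  fixed⇒p≢2 : Fixed α → p ≢ 2
  fixed⇒p≢2 = no-fixed-root⇒p≢ 2 λ x eq → let xx≈x = trans (*-congˡ (sym (*-identityʳ x))) eq in
    no-fixed-root (trans (*-congˡ xx≈x) xx≈x)

  fixed⇒p≢3 : Fixed α → p ≢ 3
  fixed⇒p≢3 = no-fixed-root⇒p≢ 3 λ x eq → no-fixed-root (trans (*-congˡ (*-congˡ (sym (*-identityʳ x)))) eq)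

  δ-fixed⇒-23-square : Fixed δ → ∃[ d ] p ∣ℤ d ℤ.* d ℤ.+ + 23
  δ-fixed⇒-23-square fixed = from-integer (Fixed⇒fromℤ fixed)
    where
    from-integer : ∃[ d ] fromℤ d ≈ δ → ∃[ d ] p ∣ℤ d ℤ.* d ℤ.+ + 23
    from-integer (d , d≈δ) = d , ≋0⇒∣ (fromℤ≈0⇒ (begin
      fromℤ (d ℤ.* d ℤ.+ + 23)        ≈⟨ trans (fromℤ-+ (d ℤ.* d) (+ 23)) (+-congʳ (trans (fromℤ-* d d) (*-cong d≈δ d≈δ))) ⟩
      δ * δ + fromℤ (+ 23)            ≈⟨ +-congʳ δ² ⟩
      fromℤ (ℤ.- + 23) + fromℤ (+ 23) ≈⟨ -‿inverseˡ _ ⟩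
      0#                              ∎))

  split⇒represented : α ^ p ≈ α → β ^ p ≈ β → γ ^ p ≈ γ → ∃[ x ] ∃[ y ] + p ≡ x ℤ.* x ℤ.+ + 23 ℤ.* (y ℤ.* y)
  split⇒represented a b g = from-square (δ-fixed⇒-23-square δ-fixed)
    where
    p≢2 = fixed⇒p≢2 a
    p≢3 = fixed⇒p≢3 a
    δ-fixed : Fixed δ
    δ-fixed = trans (trans (^-distrib-* _ (γ - α) p) (*-congʳ (^-distrib-* (α - β) (β - γ) p)))
      (*-cong (*-cong (difference a b) (difference b g)) (difference g a))
      where
      difference : ∀ {x y} → Fixed x → Fixed y → Fixed (x - y)
      difference {x} {y} fx fy = trans (frobenius-- x y) (+-cong fx (-‿cong fy))
    2∤p : ¬ 2 ∣ℤ + p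
    2∤p d = p≢2 (≡.sym (primes-divide⇒≡ 2-prime p-prime (ℤ∣.∣⇒∣ᵤ d)))
    non-principal : NonPrincipal (+ p) → ⊥
    non-principal (x , y , p≡) = absurd (non-principal⇒resolvent p-prime p≢2 p≢3 x y p≡)
      where
      absurd : ∃[ ρ ] Resolvent.value {p} ρ ≢ I → ⊥
      absurd (ρ , v≢I) = v≢I (ResolventAction.identity⇒I commutativeRing isField p-prime p≢2 p≢3 char-p ρ roots a b g)
    from-square : ∃[ d ] p ∣ℤ d ℤ.* d ℤ.+ + 23 → ∃[ x ] ∃[ y ] + p ≡ x ℤ.* x ℤ.+ + 23 ℤ.* (y ℤ.* y)
    from-square (d , p∣) = [ Principal⇒x²+23y² 2∤p , ⊥-elim ∘ non-principal ]′ (odd-form p-prime p≢2 d p∣)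

  module _ (p≢2 : p ≢ 2) (p≢23 : p ≢ 23) where

    private
      odd-permutation : ∀ {x} → x ^ p ≈ - x → Fixed x → x ≈ 0#
      odd-permutation {x} -x fixed = [ (λ 2≈0 → contradiction (fromℤ≈0⇒ {+ 2} 2≈0)
          λ e → p≢2 (primes-divide⇒≡ p-prime 2-prime (ℤ∣.∣⇒∣ᵤ (≋0⇒∣ e)))) , id ]′
        (x*y≈0⇒ (trans (solve 1 (λ x → con (+ 2) :* x := x :+ x) refl x)
          (trans (+-congˡ (trans (sym fixed) -x)) (-‿inverseʳ x))))

      δ^p : ∀ {a b c} → α ^ p ≈ a → β ^ p ≈ b → γ ^ p ≈ c → δ ^ p ≈ (a - b) * (b - c) * (c - a)
      δ^p a b g = trans (trans (^-distrib-* _ (γ - α) p) (*-congʳ (^-distrib-* (α - β) (β - γ) p)))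
        (*-cong (*-cong (difference a b) (difference b g)) (difference g a))
        where
        difference : ∀ {x y x′ y′} → x ^ p ≈ x′ → y ^ p ≈ y′ → (x - y) ^ p ≈ x′ - y′
        difference {x} {y} ex ey = trans (frobenius-- x y) (+-cong ex (-‿cong ey))

    represented⇒degree-1 : ∀ x y → + p ≡ x ℤ.* x ℤ.+ + 23 ℤ.* (y ℤ.* y) → p ≢ 3 → HasDegree 1
    represented⇒degree-1 x y p≡ p≢3 = from-resolvent (principal⇒resolvent p-prime p≢2 p≢3 x y p≡)
      where
      open NotRamified p≢23
      from-resolvent : ∃[ ρ ] Resolvent.value {p} ρ ≡ I → HasDegree 1
      from-resolvent (ρ , v≡I) = from-degree (action α≉β)
        where
        open ResolventAction commutativeRing isField p-prime p≢2 p≢3 char-p ρ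
        open Resolvent ρ using (Y; X; p∤Y)
        y⁻¹ = fromℤ-unit {Y} λ e → p∤Y (≋0⇒∣ e)
        δ-fixed : Fixed δ
        δ-fixed = [ (λ x≈-δy → fromℤ⇒Fixed (ℤ.- X ℤ.* proj₁ y⁻¹ , trans (fromℤ-* (ℤ.- X) (proj₁ y⁻¹)) (divide (begin
                      fromℤ (ℤ.- X)          ≈⟨ fromℤ-neg X ⟩
                      - fromℤ X              ≈⟨ -‿cong x≈-δy ⟩
                      - - (δ * fromℤ Y)      ≈⟨ solve 1 (λ x → :- (:- x) := x) refl _ ⟩
                      δ * fromℤ Y            ∎))))
                  , (λ x≈δy → fromℤ⇒Fixed (X ℤ.* proj₁ y⁻¹ , trans (fromℤ-* X (proj₁ y⁻¹)) (divide x≈δy))) ]′ (x≈±δy roots)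
          where
          divide : ∀ {z} → z ≈ δ * fromℤ Y → z * fromℤ (proj₁ y⁻¹) ≈ δ
          divide eq = trans (*-congʳ eq) (trans (*-assoc _ _ _) (trans (*-congˡ (proj₂ y⁻¹)) (*-identityʳ δ)))
        odd : δ ^ p ≈ - δ → HasDegree 1
        odd -δ = contradiction (odd-permutation -δ δ-fixed) (23≉0⇒δ≉0 p≢23)
        from-degree : Action → HasDegree 1
        from-degree (identity a b g) = identity⇒degree-1 a b g
        from-degree (swap-βγ a b g)  = odd (trans (δ^p a b g)
          (solve 3 (λ a b c → (a :- c) :* (c :- b) :* (b :- a) := :- ((a :- b) :* (b :- c) :* (c :- a))) refl α β γ))
        from-degree (swap-γα a b g)  = odd (trans (δ^p a b g)
          (solve 3 (λ a b c → (c :- b) :* (b :- a) :* (a :- c) := :- ((a :- b) :* (b :- c) :* (c :- a))) refl α β γ))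
        from-degree (swap-αβ a b g)  = odd (trans (δ^p a b g)
          (solve 3 (λ a b c → (b :- a) :* (a :- c) :* (c :- b) := :- ((a :- b) :* (b :- c) :* (c :- a))) refl α β γ))
        from-degree (cycle a b g)    = contradiction v≡I (cycle⇒≢I roots a b g)
        from-degree (cycle⁻¹ a b g)  = contradiction v≡I (cycle⁻¹⇒≢I roots a b g)

-- The Padovan sequence modulo p

module _ {p t : ℕ} (period : Period p t) where
  open CommutativeRing (ℤ/ p) using () renaming (trans to ≋-trans; sym to ≋-sym; refl to ≋-refl; +-cong to ≋-+-cong)

  private
    T : ℕ → ℤ
    T = padovan

    cancelʳ : ∀ {x y z w} → y ≋ w [mod p ] → x ℤ.+ y ≋ z ℤ.+ w [mod p ] → x ≋ z [mod p ]
    cancelʳ {x} {y} {z} {w} (congruent d) (congruent e) =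
      congruent (≡.subst (+ p ℤ∣.∣_) (lemma x y z w) (ℤ∣.∣m∣n⇒∣m-n e d))
      where
      lemma : ∀ x y z w → x ℤ.+ y ℤ.- (z ℤ.+ w) ℤ.- (y ℤ.- w) ≡ x ℤ.- z
      lemma = ℤ-Solver.solve-∀

    cancelˡ : ∀ {x y z w} → x ≋ z [mod p ] → x ℤ.+ y ≋ z ℤ.+ w [mod p ] → y ≋ w [mod p ]
    cancelˡ {x} {y} {z} {w} d e = cancelʳ {y} {x} {w} {z} d
      (≡.subst₂ (_≋_[mod p ]) (ℤ.+-comm x y) (ℤ.+-comm z w) e)

  early-zeros : ∀ n → t ≡ suc (suc (suc n)) → T n ≋ 0ℤ [mod p ] × T (suc n) ≋ 0ℤ [mod p ]
  early-zeros n ≡.refl = T[n] , T[1+n]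
    where
    T[3+n] = proj₁ (proj₂ period)
    T[4+n] = proj₁ (proj₂ (proj₂ period))
    T[5+n] = proj₂ (proj₂ (proj₂ period))
    T[2+n] : T (2 ℕ.+ n) ≋ 1ℤ [mod p ]
    T[2+n] = cancelˡ {T (3 ℕ.+ n)} {T (2 ℕ.+ n)} {0ℤ} {1ℤ} T[3+n] T[5+n]
    T[1+n] : T (1 ℕ.+ n) ≋ 0ℤ [mod p ]
    T[1+n] = cancelˡ {T (2 ℕ.+ n)} {T (1 ℕ.+ n)} {1ℤ} {0ℤ} T[2+n] T[4+n]
    T[n] : T n ≋ 0ℤ [mod p ]
    T[n] = cancelˡ {T (1 ℕ.+ n)} {T n} {0ℤ} {0ℤ} T[1+n] T[3+n]

  period≥4 : Prime p → ∃[ n ] t ≡ suc (suc (suc (suc n)))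
  period≥4 p-prime = by-cases t ≡.refl (proj₁ period) (proj₁ (proj₂ period))
    where
    1≢0 : ¬ 1ℤ ≋ 0ℤ [mod p ]
    1≢0 e = PrimeField.0≉1 p-prime (≋-sym e)
    by-cases : ∀ s → t ≡ s → 1 ℕ.≤ t → T t ≋ 0ℤ [mod p ] → ∃[ n ] t ≡ suc (suc (suc (suc n)))
    by-cases 0 ≡.refl () _
    by-cases 1 ≡.refl _ e = contradiction e 1≢0
    by-cases 2 ≡.refl _ e = contradiction e 1≢0
    by-cases 3 ≡.refl _ e = contradiction e 1≢0
    by-cases (suc (suc (suc (suc n)))) eq _ _ = n , eq

  periodic-mod : ∀ n → T (n ℕ.+ t) ≋ T n [mod p ]
  periodic-mod 0 = proj₁ (proj₂ period)
  periodic-mod 1 = proj₁ (proj₂ (proj₂ period))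
  periodic-mod 2 = proj₂ (proj₂ (proj₂ period))
  periodic-mod (suc (suc (suc n))) = ≋-+-cong (periodic-mod (suc n)) (periodic-mod n)

  periodic-multiple : ∀ k n → T (n ℕ.+ k ℕ.* t) ≋ T n [mod p ]
  periodic-multiple zero    n = ≡.subst (λ m → T m ≋ T n [mod p ]) (≡.sym (ℕ.+-identityʳ n)) ≋-refl
  periodic-multiple (suc k) n = ≡.subst (λ m → T m ≋ T n [mod p ])
    (≡.trans (ℕ.+-assoc n (k ℕ.* t) t) (≡.cong (n ℕ.+_) (ℕ.+-comm (k ℕ.* t) t)))
    (≋-trans (periodic-mod (n ℕ.+ k ℕ.* t)) (periodic-multiple k n))

  Ω⊆A+ℕt : ∀ n → Ω p n → (A p t +ℕ· t) n
  Ω⊆A+ℕt = ℕ.<-rec (λ n → Ω p n → (A p t +ℕ· t) n) λ n rec n∈Ω → by-size n rec n∈Ω (n ℕ.≤? t)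
    where
    by-size : ∀ n → (∀ {m} → m ℕ.< n → Ω p m → (A p t +ℕ· t) m) → Ω p n → Dec (n ℕ.≤ t) → (A p t +ℕ· t) n
    by-size n rec n∈Ω (yes n≤t) = n , 0 , (n∈Ω , n≤t) , ≡.sym (ℕ.+-identityʳ n)
    by-size n rec (1≤n , p∣Tn) (no n≰t) = extend (rec (ℕ.∸-monoʳ-< (proj₁ period) t≤n) smaller)
      where
      t<n = ℕ.≰⇒> n≰t
      t≤n = ℕ.<⇒≤ t<n
      smaller : Ω p (n ℕ.∸ t)
      smaller = ℕ.m<n⇒0<n∸m t<n , ≋0⇒∣ (≋-trans (≋-sym (periodic-mod (n ℕ.∸ t)))
        (≡.subst (λ m → T m ≋ 0ℤ [mod p ]) (≡.sym (ℕ.m∸n+n≡m t≤n)) (∣⇒≋0 p∣Tn)))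
      extend : (A p t +ℕ· t) (n ℕ.∸ t) → (A p t +ℕ· t) n
      extend (x , k , x∈A , n∸t≡) = x , suc k , x∈A , (begin
        n                          ≡⟨ ℕ.m∸n+n≡m t≤n ⟨
        n ℕ.∸ t ℕ.+ t              ≡⟨ ≡.cong (ℕ._+ t) n∸t≡ ⟩
        x ℕ.+ k ℕ.* t ℕ.+ t        ≡⟨ ℕ.+-assoc x (k ℕ.* t) t ⟩
        x ℕ.+ (k ℕ.* t ℕ.+ t)      ≡⟨ ≡.cong (x ℕ.+_) (ℕ.+-comm (k ℕ.* t) t) ⟩
        x ℕ.+ suc k ℕ.* t          ∎)
        where open ≡.≡-Reasoning

  A+ℕt⊆Ω : ∀ n → (A p t +ℕ· t) n → Ω p n
  A+ℕt⊆Ω n (x , k , ((1≤x , p∣Tx) , _) , ≡.refl) =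
    ℕ.≤-trans 1≤x (ℕ.m≤m+n x _) , ≋0⇒∣ (≋-trans (periodic-multiple k x) (∣⇒≋0 p∣Tx))

module Ramified where
  open CommutativeRing (ℤ/ 23) using () renaming (trans to ≋-trans; +-cong to ≋-+-cong; refl to ≋-refl; sym to ≋-sym)

  State : Set
  State = ℕ × ℕ × ℕ

  next : State → State
  next (x , y , z) = y , z , (x ℕ.+ y) ℕ.% 23

  state : ℕ → State
  state zero    = 0 , 1 , 1
  state (suc n) = next (state n)

  Represents : ℕ → State → Set
  Represents n (x , y , z) = (padovan n ≋ + x [mod 23 ] × x ℕ.< 23) ×
    (padovan (1 ℕ.+ n) ≋ + y [mod 23 ] × y ℕ.< 23) × (padovan (2 ℕ.+ n) ≋ + z [mod 23 ] × z ℕ.< 23)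

  next-represents : ∀ n s → Represents n s → Represents (suc n) (next s)
  next-represents n (x , y , z) ((ex , x<) , (ey , y<) , ez , z<) = (ey , y<) , (ez , z<) ,
    ≋-trans (≋-+-cong ey ex) (≡.subst (λ m → + m ≋ + ((x ℕ.+ y) ℕ.% 23) [mod 23 ]) (ℕ.+-comm x y) (≋-% (+ (x ℕ.+ y)))) ,
    ℕ.m%n<n (x ℕ.+ y) 23

  state-represents : ∀ n → Represents n (state n)
  state-represents zero    = (≋-refl , from-yes (0 ℕ.<? 23)) , (≋-refl , from-yes (1 ℕ.<? 23)) , ≋-refl , from-yes (1 ℕ.<? 23)
  state-represents (suc n) = next-represents n (state n) (state-represents n)

  avoids : ℕ → State → Bool
  avoids zero    _ = true
  avoids (suc f) (x , y , z) = not ((x ℕ.≡ᵇ 0) ∧ (y ℕ.≡ᵇ 1) ∧ (z ℕ.≡ᵇ 1)) ∧ avoids f (next (x , y , z))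

  period⇒start : ∀ n s → Represents n s → Period 23 n → s ≡ (0 , 1 , 1)
  period⇒start n (x , y , z) ((ex , x<) , (ey , y<) , ez , z<) (_ , t₀ , t₁ , t₂) =
    ≡.cong₂ _,_ (≋⇒≡ℕ x< (from-yes (0 ℕ.<? 23)) (≋-trans (≋-sym ex) t₀))
      (≡.cong₂ _,_ (≋⇒≡ℕ y< (from-yes (1 ℕ.<? 23)) (≋-trans (≋-sym ey) t₁))
                   (≋⇒≡ℕ z< (from-yes (1 ℕ.<? 23)) (≋-trans (≋-sym ez) t₂)))

  avoids-sound : ∀ f n s → Represents n s → avoids f s ≡ true → ∀ k → k ℕ.< f → ¬ Period 23 (k ℕ.+ n)
  avoids-sound (suc f) n s rep ok zero _ period with period⇒start n s rep period
  ... | ≡.refl = contradiction ok λ ()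
  avoids-sound (suc f) n (x , y , z) rep ok (suc k) (ℕ.s≤s k<f) period =
    avoids-sound f (suc n) (next (x , y , z)) (next-represents n (x , y , z) rep) (∧-true ok) k k<f
      (≡.subst (Period 23) (≡.sym (ℕ.+-suc k n)) period)
    where
    ∧-true : ∀ {a b} → a ∧ b ≡ true → b ≡ true
    ∧-true {true} eq = eq

  start⇒period : ∀ n s → 1 ℕ.≤ n → Represents n s → s ≡ (0 , 1 , 1) → Period 23 n
  start⇒period n _ 1≤n ((e₀ , _) , (e₁ , _) , e₂ , _) ≡.refl = 1≤n , e₀ , e₁ , e₂

  period-506 : Period 23 506
  period-506 = start⇒period 506 (state 506) (ℕ.s≤s ℕ.z≤n) (state-represents 506) ≡.refl

  period≥506 : ∀ n → Period 23 n → 506 ℕ.≤ n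
  period≥506 (suc k) period = ℕ.≮⇒≥ λ n<506 → avoids-sound 505 1 (1 , 1 , 1) (state-represents 1) ≡.refl k (ℕ.s≤s⁻¹ n<506)
    (≡.subst (Period 23) (ℕ.+-comm 1 k) period)

module Orders (R : CommutativeRing c ℓ) where
  open CommutativeRing R hiding (zero)
  open Exp commutativeSemiring

  IsOrder : Carrier → ℕ → Set ℓ
  IsOrder x = IsLeast (λ n → 1 ℕ.≤ n × x ^ n ≈ 1#)

  power-multiple : ∀ {x a} → x ^ a ≈ 1# → ∀ {m} → a ℕ∣.∣ m → x ^ m ≈ 1#
  power-multiple {x} {a} x^a (ℕ∣.divides k ≡.refl) =
    trans (^-congʳ x (ℕ.*-comm k a)) (trans (sym (^-assocʳ x a k)) (trans (^-congˡ k x^a) (1^≈1 R k)))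

  order-divides : ∀ {x a} → IsOrder x a → ∀ {m} → x ^ m ≈ 1# → a ℕ∣.∣ m
  order-divides {x} {a} ((1≤a , x^a) , least) {m} x^m =
    ℕ∣.m%n≡0⇒n∣m m a (by-remainder (m ℕ.% a) ≡.refl)
    where
    instance
      a-nonZero : ℕ.NonZero a
      a-nonZero = ℕ.>-nonZero 1≤a
    remainder : x ^ (m ℕ.% a) ≈ 1#
    remainder = begin
      x ^ (m ℕ.% a)                            ≈⟨ *-identityʳ _ ⟨
      x ^ (m ℕ.% a) * 1#                       ≈⟨ *-congˡ (power-multiple x^a (ℕ∣.n∣m*n (m ℕ./ a))) ⟨
      x ^ (m ℕ.% a) * x ^ (m ℕ./ a ℕ.* a)      ≈⟨ ^-homo-* x (m ℕ.% a) (m ℕ./ a ℕ.* a) ⟨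
      x ^ (m ℕ.% a ℕ.+ m ℕ./ a ℕ.* a)          ≡⟨ ≡.cong (x ^_) (ℕ.m≡m%n+[m/n]*n m a) ⟨
      x ^ m                                    ≈⟨ x^m ⟩
      1#                                       ∎
      where open SetoidReasoning setoid
    by-remainder : ∀ r → m ℕ.% a ≡ r → m ℕ.% a ≡ 0
    by-remainder zero    eq = eq
    by-remainder (suc r) eq = contradiction
      (least (suc r) (ℕ.s≤s ℕ.z≤n , ≡.subst (λ n → x ^ n ≈ 1#) eq remainder))
      (ℕ.<⇒≱ (≡.subst (ℕ._< a) eq (ℕ.m%n<n m a)))

module PadovanRoots (R : CommutativeRing c ℓ) where
  open CommutativeRing R hiding (zero)
  open IntegerCoefficients R
  open Exp commutativeSemiring
  open SetoidReasoning setoid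

  private
    T : ℕ → Carrier
    T n = fromℤ (padovan n)

  root-power : ∀ {x} → x * (x * x) ≈ x + 1# → ∀ n →
               x ^ (3 ℕ.+ n) ≈ (T (2 ℕ.+ n) - T n) + T (1 ℕ.+ n) * x + T n * (x * x)
  root-power {x} root zero = begin
    x ^ 3             ≈⟨ *-congˡ (*-congˡ (*-identityʳ x)) ⟩
    x * (x * x)       ≈⟨ root ⟩
    x + 1#            ≈⟨ solve 1 (λ x → x :+ con 1ℤ := (con 1ℤ :- con 0ℤ) :+ con 1ℤ :* x :+ con 0ℤ :* (x :* x)) refl x ⟩
    (T 2 - T 0) + T 1 * x + T 0 * (x * x) ∎
  root-power {x} root (suc n) = begin
    x * x ^ (3 ℕ.+ n)
      ≈⟨ *-congˡ (root-power root n) ⟩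
    x * ((T (2 ℕ.+ n) - T n) + T (1 ℕ.+ n) * x + T n * (x * x))
      ≈⟨ solve 4 (λ x a b d → x :* ((d :- a) :+ b :* x :+ a :* (x :* x)) := (d :- a) :* x :+ b :* (x :* x) :+ a :* (x :* (x :* x)))
           refl x (T n) (T (1 ℕ.+ n)) (T (2 ℕ.+ n)) ⟩
    (T (2 ℕ.+ n) - T n) * x + T (1 ℕ.+ n) * (x * x) + T n * (x * (x * x))
      ≈⟨ +-congˡ (*-congˡ root) ⟩
    (T (2 ℕ.+ n) - T n) * x + T (1 ℕ.+ n) * (x * x) + T n * (x + 1#)
      ≈⟨ solve 4 (λ x a b d → (d :- a) :* x :+ b :* (x :* x) :+ a :* (x :+ con 1ℤ) := ((b :+ a) :- b) :+ d :* x :+ b :* (x :* x))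
           refl x (T n) (T (1 ℕ.+ n)) (T (2 ℕ.+ n)) ⟩
    (T (1 ℕ.+ n) + T n - T (1 ℕ.+ n)) + T (2 ℕ.+ n) * x + T (1 ℕ.+ n) * (x * x)
      ≈⟨ +-congʳ (+-congʳ (+-congʳ (fromℤ-+ (padovan (1 ℕ.+ n)) (padovan n)))) ⟨
    (T (3 ℕ.+ n) - T (1 ℕ.+ n)) + T (2 ℕ.+ n) * x + T (1 ℕ.+ n) * (x * x) ∎

module SplittingPeriod {p : ℕ} (p-prime : Prime p) {ℓ₁ ℓ₂ : Level} (S : SplittingField p c ℓ₁ ℓ₂) where
  open SplittingField S hiding (zero)
  open IntegerCoefficients commutativeRing
  open ExtensionField p-prime extension
  open IsDiscreteField isField
  open PrimeSubfield commutativeRing isField p-prime char-p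
  open Splitting p-prime S
  open RootAction commutativeRing isField p-prime char-p roots
  open Orders commutativeRing
  open PadovanRoots commutativeRing
  open Exp commutativeSemiring using (^-congˡ; ^-assocʳ; ^-homo-*)
  open SetoidReasoning setoid

  cancel-nonzero : ∀ {x y z} → ¬ x ≈ 0# → x * y ≈ x * z → y ≈ z
  cancel-nonzero {x} {y} {z} x≉0 eq = x-y≈0⇒ ([ (λ x≈0 → contradiction x≈0 x≉0) , id ]′ (x*y≈0⇒ (begin
    x * (y - z)      ≈⟨ solve 3 (λ x y z → x :* (y :- z) := x :* y :- x :* z) refl x y z ⟩
    x * y - x * z    ≈⟨ trans (+-congʳ eq) (-‿inverseʳ _) ⟩
    0#               ∎)))

  root≉0 : ∀ {x} → IsRoot x → ¬ x ≈ 0#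
  root≉0 {x} root x≈0 = 0≉1 (begin
    0#               ≈⟨ trans (*-congʳ x≈0) (zeroˡ _) ⟨
    x * (x * x)      ≈⟨ root ⟩
    x + 1#           ≈⟨ trans (+-congʳ x≈0) (+-identityˡ 1#) ⟩
    1#               ∎)

  period⇒power : ∀ {t} → Period p t → ∀ {x} → IsRoot x → x ^ t ≈ 1#
  period⇒power {t} (_ , t₀ , t₁ , t₂) {x} root = cancel-nonzero (root≉0 root ∘ ^≈0⇒ 3) (begin
    x ^ 3 * x ^ t
      ≈⟨ ^-homo-* x 3 t ⟨
    x ^ (3 ℕ.+ t)
      ≈⟨ root-power root t ⟩
    (fromℤ (padovan (2 ℕ.+ t)) - fromℤ (padovan t)) + fromℤ (padovan (1 ℕ.+ t)) * x + fromℤ (padovan t) * (x * x)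
      ≈⟨ +-cong (+-cong (+-cong (fromℤ-mod t₂) (-‿cong (fromℤ-mod t₀))) (*-congʳ (fromℤ-mod t₁))) (*-congʳ (fromℤ-mod t₀)) ⟩
    (1# - 0#) + 1# * x + 0# * (x * x)
      ≈⟨ solve 1 (λ x → (con 1ℤ :- con 0ℤ) :+ con 1ℤ :* x :+ con 0ℤ :* (x :* x) := x :+ con 1ℤ) refl x ⟩
    x + 1#           ≈⟨ root ⟨
    x * (x * x)      ≈⟨ trans (*-congˡ (*-congˡ (sym (*-identityʳ x)))) (sym (*-identityʳ _)) ⟩
    x ^ 3 * 1#       ∎)

  module _ (p≢23 : p ≢ 23) where
    open Distinct p≢23

    powers-determine : ∀ {n s t v} → (∀ {x} → IsRoot x → x ^ (3 ℕ.+ n) ≈ s + t * x + v * (x * x)) →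
      fromℤ (padovan (2 ℕ.+ n)) - fromℤ (padovan n) ≈ s × fromℤ (padovan (1 ℕ.+ n)) ≈ t × fromℤ (padovan n) ≈ v
    powers-determine {n} {s} {t} {v} eq = x-y≈0⇒ (proj₁ zeros) , x-y≈0⇒ (proj₁ (proj₂ zeros)) , x-y≈0⇒ (proj₂ (proj₂ zeros))
      where
      s′ = fromℤ (padovan (2 ℕ.+ n)) - fromℤ (padovan n)
      t′ = fromℤ (padovan (1 ℕ.+ n))
      v′ = fromℤ (padovan n)
      zeros : s′ - s ≈ 0# × t′ - t ≈ 0# × v′ - v ≈ 0#
      zeros = quadratic-vanishes λ {x} root → begin
        (s′ - s) + (t′ - t) * x + (v′ - v) * (x * x)
          ≈⟨ solve 7 (λ s t v s′ t′ v′ x → (s′ :- s) :+ (t′ :- t) :* x :+ (v′ :- v) :* (x :* x) :=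
               (s′ :+ t′ :* x :+ v′ :* (x :* x)) :- (s :+ t :* x :+ v :* (x :* x))) refl s t v s′ t′ v′ x ⟩
        (s′ + t′ * x + v′ * (x * x)) - (s + t * x + v * (x * x))
          ≈⟨ +-cong (sym (root-power root n)) (-‿cong (sym (eq root))) ⟩
        x ^ (3 ℕ.+ n) - x ^ (3 ℕ.+ n)   ≈⟨ -‿inverseʳ _ ⟩
        0# ∎

    power⇒period : ∀ {n} → 1 ℕ.≤ n → (∀ {x} → IsRoot x → x ^ n ≈ 1#) → Period p n
    power⇒period {n} 1≤n powers = 1≤n , T₀ , T₁ , T₂
      where
      determined = powers-determine {n} {1#} {1#} {0#} λ {x} root → begin
        x ^ (3 ℕ.+ n)                ≈⟨ ^-homo-* x 3 n ⟩
        x ^ 3 * x ^ n                ≈⟨ *-cong (*-congˡ (*-congˡ (*-identityʳ x))) (powers root) ⟩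
        x * (x * x) * 1#             ≈⟨ trans (*-identityʳ _) root ⟩
        x + 1#                       ≈⟨ solve 1 (λ x → x :+ con 1ℤ := con 1ℤ :+ con 1ℤ :* x :+ con 0ℤ :* (x :* x)) refl x ⟩
        1# + 1# * x + 0# * (x * x)   ∎
      T₀ : padovan n ≋ 0ℤ [mod p ]
      T₀ = fromℤ-injective (proj₂ (proj₂ determined))
      T₁ : padovan (1 ℕ.+ n) ≋ 1ℤ [mod p ]
      T₁ = fromℤ-injective (proj₁ (proj₂ determined))
      T₂ : padovan (2 ℕ.+ n) ≋ 1ℤ [mod p ]
      T₂ = fromℤ-injective (begin
        fromℤ (padovan (2 ℕ.+ n))
          ≈⟨ solve 2 (λ x y → x := (x :- y) :+ y) refl _ (fromℤ (padovan n)) ⟩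
        fromℤ (padovan (2 ℕ.+ n)) - fromℤ (padovan n) + fromℤ (padovan n)
          ≈⟨ +-cong (proj₁ determined) (proj₂ (proj₂ determined)) ⟩
        1# + 0#   ≈⟨ +-identityʳ 1# ⟩
        1#        ∎)

    root-cases : ∀ {n} → α ^ n ≈ 1# → β ^ n ≈ 1# → γ ^ n ≈ 1# → ∀ {x} → IsRoot x → x ^ n ≈ 1#
    root-cases {n} a b g root = [ via a , [ via b , via g ]′ ]′ (IsRoot⇒ root)
      where
      via : ∀ {x y} → y ^ n ≈ 1# → x ≈ y → x ^ n ≈ 1#
      via y^n x≈y = trans (^-congˡ n x≈y) y^n

  module _ {a b d : ℕ} (a-order : HasOrder α a) (b-order : HasOrder β b) (d-order : HasOrder γ d) where

    lcm-divides : ∀ {m} → α ^ m ≈ 1# → β ^ m ≈ 1# → γ ^ m ≈ 1# → lcm a (lcm b d) ℕ∣.∣ m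
    lcm-divides eα eβ eγ = lcm-least (order-divides a-order eα)
      (lcm-least (order-divides b-order eβ) (order-divides d-order eγ))

    period≡lcm : p ≢ 23 → ∀ {t} → IsLeast (Period p) t → t ≡ lcm a (lcm b d)
    period≡lcm p≢23 {t} (period , least) = ℕ.≤-antisym
      (least L (power⇒period p≢23 1≤L (root-cases p≢23 {L}
        (power-multiple (proj₂ (proj₁ a-order)) (m∣lcm[m,n] a (lcm b d)))
        (power-multiple (proj₂ (proj₁ b-order)) (ℕ∣.∣-trans (m∣lcm[m,n] b d) (n∣lcm[m,n] a (lcm b d))))
        (power-multiple (proj₂ (proj₁ d-order)) (ℕ∣.∣-trans (n∣lcm[m,n] b d) (n∣lcm[m,n] a (lcm b d)))))))
      (ℕ∣.∣⇒≤ {{ℕ.>-nonZero (proj₁ period)}} L∣t)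
      where
      L = lcm a (lcm b d)
      L∣t : L ℕ∣.∣ t
      L∣t = lcm-divides (period⇒power period α-root) (period⇒power period β-root) (period⇒power period γ-root)
      1≤L : 1 ℕ.≤ L
      1≤L = ℕ.n≢0⇒n>0 λ L≡0 → ℕ.<⇒≢ (proj₁ period) (≡.sym (ℕ∣.0∣⇒≡0 (≡.subst (ℕ∣._∣ t) L≡0 L∣t)))

  frobenius-power : ∀ {x y} → x ^ p ≈ y → ∀ r {z} → y ^ (p ℕ.^ r) ≈ z → x ^ (p ℕ.^ suc r) ≈ z
  frobenius-power {x} x^p r eq = trans (sym (^-assocʳ x p (p ℕ.^ r))) (trans (^-congˡ (p ℕ.^ r) x^p) eq)

  power-pred : ∀ {x} n → 1 ℕ.≤ n → ¬ x ≈ 0# → x ^ n ≈ x → x ^ (n ℕ.∸ 1) ≈ 1#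
  power-pred {x} (suc n) _ x≉0 eq = cancel-nonzero x≉0 (trans eq (sym (*-identityʳ x)))

represented⇒≥4 : ∀ {p} → Prime p → ∀ {x y} → + p ≡ x ℤ.* x ℤ.+ + 23 ℤ.* (y ℤ.* y) → 4 ℕ.≤ p
represented⇒≥4 {p} p-prime {x} {y} p≡ = by-y (ℤ.∣ y ∣ ℕ.≟ 0)
  where
  m = ℤ.∣ x ∣
  n = ℤ.∣ y ∣
  sum≡ : p ≡ m ℕ.* m ℕ.+ 23 ℕ.* (n ℕ.* n)
  sum≡ = ℤ.+-injective (≡.trans p≡ (≡.trans
    (≡.cong₂ (λ s t → s ℤ.+ + 23 ℤ.* t) (square-abs x) (square-abs y))
    (≡.cong (λ z → + (m ℕ.* m) ℤ.+ z) (≡.sym (ℤ.pos-* 23 (n ℕ.* n))))))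
  by-x : ∀ m → p ≡ m ℕ.* m → 4 ℕ.≤ p
  by-x 0 p≡0 = contradiction (≡.subst Prime p≡0 p-prime) ¬prime[0]
  by-x 1 p≡1 = contradiction (≡.subst Prime p≡1 p-prime) ¬prime[1]
  by-x (suc (suc m)) p≡ = ≡.subst (4 ℕ.≤_) (≡.sym p≡) (ℕ.*-mono-≤ {2} {suc (suc m)} (ℕ.s≤s (ℕ.s≤s ℕ.z≤n)) (ℕ.s≤s (ℕ.s≤s ℕ.z≤n)))
  by-y : Dec (n ≡ 0) → 4 ℕ.≤ p
  by-y (yes n≡0) = by-x m (≡.trans sum≡ (≡.trans (≡.cong (λ n → m ℕ.* m ℕ.+ 23 ℕ.* (n ℕ.* n)) n≡0) (ℕ.+-identityʳ _)))
  by-y (no n≢0)  = ≡.subst (4 ℕ.≤_) (≡.sym sum≡) (ℕ.≤-trans (ℕ.≤-trans (from-yes (4 ℕ.≤? 23))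
    (ℕ.*-monoʳ-≤ 23 (ℕ.*-mono-≤ (ℕ.n≢0⇒n>0 n≢0) (ℕ.n≢0⇒n>0 n≢0)))) (ℕ.m≤n+m _ (m ℕ.* m)))

module Conclusions {p : ℕ} (p-prime : Prime p) {ℓ₁ ℓ₂ : Level} (S : SplittingField p c ℓ₁ ℓ₂) where
  open SplittingField S hiding (zero)
  open IntegerCoefficients commutativeRing
  open ExtensionField p-prime extension
  open IsDiscreteField isField
  open PrimeSubfield commutativeRing isField p-prime char-p
  open Degrees p-prime extension
  open Splitting p-prime S
  open RootAction commutativeRing isField p-prime char-p roots
  open SplittingPeriod p-prime S
  open Orders commutativeRing
  open Roots roots using (e₃)
  open Exp commutativeSemiring using (^-congˡ; ^-distrib-*; ^-assocʳ; ^-homo-*)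
  open SetoidReasoning setoid

  degree-cases : ∀ {r} → HasDegree r → r ≡ 1 ⊎ r ≡ 2 ⊎ r ≡ 3
  degree-cases {r} d = by-ramification (p ℕ.≟ 23)
    where
    by-ramification : Dec (p ≡ 23) → r ≡ 1 ⊎ r ≡ 2 ⊎ r ≡ 3
    by-ramification (yes p≡23) = inj₁ (degree-unique d (ramified-degree p≡23))
    by-ramification (no p≢23)  = from-degree degree
      where
      open NotRamified p≢23
      from-degree : Degree → r ≡ 1 ⊎ r ≡ 2 ⊎ r ≡ 3
      from-degree (one d′ _ _ _) = inj₁ (degree-unique d d′)
      from-degree (two d′ _)     = inj₂ (inj₁ (degree-unique d d′))
      from-degree (three d′ _)   = inj₂ (inj₂ (degree-unique d d′))

  unramified : ∀ {r} → HasDegree r → r ≢ 1 → p ≢ 23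
  unramified d r≢1 p≡23 = r≢1 (degree-unique d (ramified-degree p≡23))

  degree-1⇒split : p ≢ 23 → HasDegree 1 → α ^ p ≈ α × β ^ p ≈ β × γ ^ p ≈ γ
  degree-1⇒split p≢23 d = from-degree degree
    where
    open NotRamified p≢23
    from-degree : Degree → α ^ p ≈ α × β ^ p ≈ β × γ ^ p ≈ γ
    from-degree (one _ a b g) = a , b , g
    from-degree (two d′ _)    = contradiction (degree-unique d d′) λ ()
    from-degree (three d′ _)  = contradiction (degree-unique d d′) λ ()

  degree-1⇔represented : HasDegree 1 ⇔ (∃[ x ] ∃[ y ] + p ≡ x ℤ.* x ℤ.+ + 23 ℤ.* (y ℤ.* y))
  degree-1⇔represented = mk⇔ to from
    where
    to : HasDegree 1 → ∃[ x ] ∃[ y ] + p ≡ x ℤ.* x ℤ.+ + 23 ℤ.* (y ℤ.* y)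
    to d = by-ramification (p ℕ.≟ 23)
      where
      from-split : α ^ p ≈ α × β ^ p ≈ β × γ ^ p ≈ γ → ∃[ x ] ∃[ y ] + p ≡ x ℤ.* x ℤ.+ + 23 ℤ.* (y ℤ.* y)
      from-split (a , b , g) = split⇒represented a b g
      by-ramification : Dec (p ≡ 23) → ∃[ x ] ∃[ y ] + p ≡ x ℤ.* x ℤ.+ + 23 ℤ.* (y ℤ.* y)
      by-ramification (yes p≡23) = 0ℤ , 1ℤ , ≡.cong +_ p≡23
      by-ramification (no p≢23)  = from-split (degree-1⇒split p≢23 d)
    from : ∃[ x ] ∃[ y ] + p ≡ x ℤ.* x ℤ.+ + 23 ℤ.* (y ℤ.* y) → HasDegree 1
    from (x , y , p≡) = by-ramification (p ℕ.≟ 23)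
      where
      4≤p = represented⇒≥4 p-prime {x} {y} p≡
      small : ∀ {n} → n ℕ.< 4 → p ≢ n
      small n<4 ≡.refl = ℕ.<⇒≱ n<4 4≤p
      by-ramification : Dec (p ≡ 23) → HasDegree 1
      by-ramification (yes p≡23) = ramified-degree p≡23
      by-ramification (no p≢23)  =
        represented⇒degree-1 (small (from-yes (2 ℕ.<? 4))) p≢23 x y p≡ (small (from-yes (3 ℕ.<? 4)))

  root-fixed-by-p^r : p ≢ 23 → ∀ {r} → HasDegree r → ∀ {x} → IsRoot x → x ^ (p ℕ.^ r) ≈ x
  root-fixed-by-p^r p≢23 {r} d = from-degree degree
    where
    open NotRamified p≢23
    iterated : ∀ {s} → r ≡ s → α ^ (p ℕ.^ s) ≈ α → β ^ (p ℕ.^ s) ≈ β → γ ^ (p ℕ.^ s) ≈ γ →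
               ∀ {x} → IsRoot x → x ^ (p ℕ.^ r) ≈ x
    iterated ≡.refl a b g root = [ via a , [ via b , via g ]′ ]′ (IsRoot⇒ root)
      where
      via : ∀ {x y} → y ^ (p ℕ.^ r) ≈ y → x ≈ y → x ^ (p ℕ.^ r) ≈ x
      via y^ x≈y = trans (^-congˡ (p ℕ.^ r) x≈y) (trans y^ (sym x≈y))
    once : ∀ {x y} → x ^ p ≈ y → x ^ (p ℕ.^ 1) ≈ y
    once x = frobenius-power x 0 (*-identityʳ _)
    twice : ∀ {x y z} → x ^ p ≈ y → y ^ p ≈ z → x ^ (p ℕ.^ 2) ≈ z
    twice x y = frobenius-power x 1 (once y)
    thrice : ∀ {x y z w} → x ^ p ≈ y → y ^ p ≈ z → z ^ p ≈ w → x ^ (p ℕ.^ 3) ≈ w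
    thrice x y z = frobenius-power x 2 (twice y z)
    from-degree : Degree → ∀ {x} → IsRoot x → x ^ (p ℕ.^ r) ≈ x
    from-degree (one d′ a b g) = iterated (degree-unique d d′) (once a) (once b) (once g)
    from-degree (two d′ (inj₁ (a , b , g))) = iterated (degree-unique d d′) (twice a a) (twice b g) (twice g b)
    from-degree (two d′ (inj₂ (inj₁ (a , b , g)))) = iterated (degree-unique d d′) (twice a g) (twice b b) (twice g a)
    from-degree (two d′ (inj₂ (inj₂ (a , b , g)))) = iterated (degree-unique d d′) (twice a b) (twice b a) (twice g g)
    from-degree (three d′ (inj₁ (a , b , g))) = iterated (degree-unique d d′) (thrice a b g) (thrice b g a) (thrice g a b)
    from-degree (three d′ (inj₂ (a , b , g))) = iterated (degree-unique d d′) (thrice a g b) (thrice b a g) (thrice g b a)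

  frobenius-order-divides : ∀ {x y m n} → x ^ p ≈ y → HasOrder x m → HasOrder y n → n ℕ∣.∣ m
  frobenius-order-divides {x} {y} {m} x^p ((_ , x^m) , _) y-order = order-divides y-order (begin
    y ^ m            ≈⟨ ^-congˡ m x^p ⟨
    (x ^ p) ^ m      ≈⟨ ^-assocʳ x p m ⟩
    x ^ (p ℕ.* m)    ≈⟨ power-multiple x^m (ℕ∣.n∣m*n p) ⟩
    1#               ∎)

  fixed-root⇒root-mod-p : ∀ {x} → IsRoot x → Fixed x →
    let module 𝔽ₚ[X] = Polynomial (ℤ/ p) in ∃[ k ] 𝔽ₚ[X].eval 𝔽ₚ[X].X³-X-1 k ≋ 0ℤ [mod p ]
  fixed-root⇒root-mod-p {x} root fixed = from-integer (Fixed⇒fromℤ fixed)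
    where
    module 𝔽ₚ[X] = Polynomial (ℤ/ p)
    from-integer : ∃[ k ] fromℤ k ≈ x → ∃[ k ] 𝔽ₚ[X].eval 𝔽ₚ[X].X³-X-1 k ≋ 0ℤ [mod p ]
    from-integer (k , k≈x) = k , ≡.subst (_≋ 0ℤ [mod p ]) (lemma k) (fromℤ≈0⇒ (begin
      fromℤ (k ℤ.* (k ℤ.* k) ℤ.- (k ℤ.+ 1ℤ))
        ≈⟨ trans (fromℤ-+ (k ℤ.* (k ℤ.* k)) (ℤ.- (k ℤ.+ 1ℤ))) (+-congˡ (fromℤ-neg (k ℤ.+ 1ℤ))) ⟩
      fromℤ (k ℤ.* (k ℤ.* k)) - fromℤ (k ℤ.+ 1ℤ)
        ≈⟨ +-cong (trans (fromℤ-* k (k ℤ.* k)) (*-cong k≈x (trans (fromℤ-* k k) (*-cong k≈x k≈x))))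
                  (-‿cong (trans (fromℤ-+ k 1ℤ) (+-congʳ k≈x))) ⟩
      x * (x * x) - (x + 1#)   ≈⟨ trans (+-congʳ root) (-‿inverseʳ _) ⟩
      0#                       ∎))
      where
      lemma : ∀ k → k ℤ.* (k ℤ.* k) ℤ.- (k ℤ.+ 1ℤ) ≡
              ℤ.- 1ℤ ℤ.+ k ℤ.* (ℤ.- 1ℤ ℤ.+ k ℤ.* (0ℤ ℤ.+ k ℤ.* (1ℤ ℤ.+ k ℤ.* 0ℤ)))
      lemma = ℤ-Solver.solve-∀

  degree-2⇒root-mod-p : HasDegree 2 →
    let module 𝔽ₚ[X] = Polynomial (ℤ/ p) in ∃[ k ] 𝔽ₚ[X].eval 𝔽ₚ[X].X³-X-1 k ≋ 0ℤ [mod p ]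
  degree-2⇒root-mod-p d = from-degree degree
    where
    open NotRamified (unramified d λ ())
    module 𝔽ₚ[X] = Polynomial (ℤ/ p)
    from-degree : Degree → ∃[ k ] 𝔽ₚ[X].eval 𝔽ₚ[X].X³-X-1 k ≋ 0ℤ [mod p ]
    from-degree (two _ (inj₁ (a , _)))            = fixed-root⇒root-mod-p α-root a
    from-degree (two _ (inj₂ (inj₁ (_ , b , _)))) = fixed-root⇒root-mod-p β-root b
    from-degree (two _ (inj₂ (inj₂ (_ , _ , g)))) = fixed-root⇒root-mod-p γ-root g
    from-degree (one d′ _ _ _) = contradiction (degree-unique d d′) λ ()
    from-degree (three d′ _)   = contradiction (degree-unique d d′) λ ()

  degree-2⇒swap : HasDegree 2 → Fixed α → β ^ p ≈ γ × γ ^ p ≈ β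
  degree-2⇒swap d α-fixed = from-degree degree
    where
    open NotRamified (unramified d λ ())
    from-degree : Degree → β ^ p ≈ γ × γ ^ p ≈ β
    from-degree (two _ (inj₁ (_ , b , g)))        = b , g
    from-degree (two _ (inj₂ (inj₁ (a , _))))     = contradiction (trans (sym a) α-fixed) γ≉α
    from-degree (two _ (inj₂ (inj₂ (a , _))))     = contradiction (trans (sym α-fixed) a) α≉β
    from-degree (one d′ _ _ _) = contradiction (degree-unique d d′) λ ()
    from-degree (three d′ _)   = contradiction (degree-unique d d′) λ ()

  product-power : ∀ n → α ^ n * β ^ n * γ ^ n ≈ 1#
  product-power n = trans (*-congʳ (sym (^-distrib-* α β n))) (trans (sym (^-distrib-* (α * β) γ n))
    (trans (^-congˡ n e₃) (1^≈1 commutativeRing n)))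

  module _ {t ω a b d : ℕ} (least-period : IsLeast (Period p) t) (least-ω : IsLeast (Ω p) ω)
    (a-order : HasOrder α a) (b-order : HasOrder β b) (d-order : HasOrder γ d) where

    period-divides-p^r-1 : p ≢ 23 → ∀ {r} → HasDegree r → t ℕ∣.∣ p ℕ.^ r ℕ.∸ 1
    period-divides-p^r-1 p≢23 {r} degree = ≡.subst (ℕ∣._∣ p ℕ.^ r ℕ.∸ 1)
      (≡.sym (period≡lcm a-order b-order d-order p≢23 least-period))
      (lcm-divides a-order b-order d-order (power α-root) (power β-root) (power γ-root))
      where
      power : ∀ {x} → IsRoot x → x ^ (p ℕ.^ r ℕ.∸ 1) ≈ 1#
      power root = power-pred (p ℕ.^ r) (ℕ.m^n>0 p {{prime⇒nonZero p-prime}} r) (root≉0 root)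
        (root-fixed-by-p^r p≢23 degree root)

    module _ (degree : HasDegree 2) (α-fixed : Fixed α) where

      private
        swap = degree-2⇒swap degree α-fixed
        p≢23 = unramified degree λ ()

      b≡d : b ≡ d
      b≡d = ℕ∣.∣-antisym (frobenius-order-divides (proj₂ swap) d-order b-order)
                         (frobenius-order-divides (proj₁ swap) b-order d-order)

      a∣b : a ℕ∣.∣ b
      a∣b = order-divides a-order (begin
        α ^ b                      ≈⟨ solve 1 (λ x → x := x :* con 1ℤ :* con 1ℤ) refl (α ^ b) ⟩
        α ^ b * 1# * 1#            ≈⟨ *-cong (*-congˡ (sym (proj₂ (proj₁ b-order))))
                                        (sym (≡.subst (λ n → γ ^ n ≈ 1#) (≡.sym b≡d) (proj₂ (proj₁ d-order)))) ⟩
        α ^ b * β ^ b * γ ^ b      ≈⟨ product-power b ⟩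
        1#                         ∎)

      t≡b : t ≡ b
      t≡b = ≡.trans (period≡lcm a-order b-order d-order p≢23 least-period) (ℕ∣.∣-antisym
        (lcm-least a∣b (lcm-least ℕ∣.∣-refl (ℕ∣.∣-reflexive (≡.sym b≡d))))
        (ℕ∣.∣-trans (m∣lcm[m,n] b d) (n∣lcm[m,n] a (lcm b d))))

      private
        norm-power : ∀ {x y} → x ^ p ≈ y → ∀ n → x ^ ((p ℕ.+ 1) ℕ.* n) ≈ (y * x) ^ n
        norm-power {x} {y} x^p n = begin
          x ^ ((p ℕ.+ 1) ℕ.* n)     ≈⟨ ^-assocʳ x (p ℕ.+ 1) n ⟨
          (x ^ (p ℕ.+ 1)) ^ n       ≈⟨ ^-congˡ n (trans (^-homo-* x p 1) (*-cong x^p (*-identityʳ x))) ⟩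
          (y * x) ^ n               ∎

      b∣[p+1]a : b ℕ∣.∣ (p ℕ.+ 1) ℕ.* a
      b∣[p+1]a = order-divides b-order (begin
        β ^ ((p ℕ.+ 1) ℕ.* a)        ≈⟨ norm-power (proj₁ swap) a ⟩
        (γ * β) ^ a                  ≈⟨ ^-distrib-* γ β a ⟩
        γ ^ a * β ^ a                ≈⟨ solve 2 (λ x y → y :* x := con 1ℤ :* x :* y) refl (β ^ a) (γ ^ a) ⟩
        1# * β ^ a * γ ^ a           ≈⟨ *-congʳ (*-congʳ (sym (proj₂ (proj₁ a-order)))) ⟩
        α ^ a * β ^ a * γ ^ a        ≈⟨ product-power a ⟩
        1#                           ∎)

      ω≤ : ∀ o → HasOrder (α ^ 3) o → ω ℕ.≤ (p ℕ.+ 1) ℕ.* o ℕ.∸ 3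
      ω≤ o ((1≤o , α³ᵒ) , _) = proj₂ least-ω n (1≤n , ≋0⇒∣ (fromℤ≈0⇒ (proj₂ (proj₂ (powers-determine p≢23 {n} {l} {0#} {0#}
        λ {x} root → trans (≡.subst (λ m → x ^ m ≈ l) (≡.sym 3+n≡) (by-root root))
          (solve 2 (λ l x → l := l :+ con 0ℤ :* x :+ con 0ℤ :* (x :* x)) refl l x))))))
        where
        N = (p ℕ.+ 1) ℕ.* o
        n = N ℕ.∸ 3
        l = (γ * β) ^ o
        3≤p : 3 ℕ.≤ p
        3≤p = ℕ.≤∧≢⇒< (ℕ.nonTrivial⇒n>1 p {{prime⇒nonTrivial p-prime}}) (fixed⇒p≢2 α-fixed ∘ ≡.sym)
        4≤N : 4 ℕ.≤ N
        4≤N = ℕ.*-mono-≤ {4} {p ℕ.+ 1} {1} {o} (ℕ.+-monoˡ-≤ 1 3≤p) 1≤o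
        1≤n : 1 ℕ.≤ n
        1≤n = ℕ.m<n⇒0<n∸m 4≤N
        3+n≡ : 3 ℕ.+ n ≡ N
        3+n≡ = ℕ.m+[n∸m]≡n (ℕ.≤-trans (ℕ.n≤1+n 3) 4≤N)
        α²ᵒ≈l : (α * α) ^ o ≈ l
        α²ᵒ≈l = cancel-nonzero (root≉0 α-root ∘ ^≈0⇒ o) (begin
          α ^ o * (α * α) ^ o
            ≈⟨ *-congˡ (^-congˡ o (*-congˡ (sym (*-identityʳ α)))) ⟩
          α ^ o * (α ^ 2) ^ o           ≈⟨ ^-distrib-* α (α ^ 2) o ⟨
          (α ^ 3) ^ o                   ≈⟨ α³ᵒ ⟩
          1#                            ≈⟨ product-power o ⟨
          α ^ o * β ^ o * γ ^ o         ≈⟨ solve 3 (λ x y z → x :* y :* z := x :* (z :* y)) refl (α ^ o) (β ^ o) (γ ^ o) ⟩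
          α ^ o * (γ ^ o * β ^ o)       ≈⟨ *-congˡ (^-distrib-* γ β o) ⟨
          α ^ o * l                     ∎)
        by-root : ∀ {x} → IsRoot x → x ^ N ≈ l
        by-root = root-cases-at (trans (norm-power α-fixed o) α²ᵒ≈l)
          (norm-power (proj₁ swap) o)
          (trans (norm-power (proj₂ swap) o) (^-congˡ o (*-comm β γ)))
          where
          root-cases-at : α ^ N ≈ l → β ^ N ≈ l → γ ^ N ≈ l → ∀ {x} → IsRoot x → x ^ N ≈ l
          root-cases-at a b g root = [ via a , [ via b , via g ]′ ]′ (IsRoot⇒ root)
            where
            via : ∀ {x y} → y ^ N ≈ l → x ≈ y → x ^ N ≈ l
            via y^N x≈y = trans (^-congˡ N x≈y) y^N

    module _ (degree : HasDegree 3) where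

      private
        p≢23 = unramified degree λ ()

        FrobeniusCycle : Set ℓ₁
        FrobeniusCycle = (α ^ p ≈ β × β ^ p ≈ γ × γ ^ p ≈ α) ⊎ (α ^ p ≈ γ × β ^ p ≈ α × γ ^ p ≈ β)

      cycle-or-inverse : FrobeniusCycle
      cycle-or-inverse = from-degree (NotRamified.degree p≢23)
        where
        open NotRamified p≢23 using (Degree; one; two; three)
        from-degree : Degree → FrobeniusCycle
        from-degree (three _ cycles) = cycles
        from-degree (one d′ _ _ _) = contradiction (degree-unique degree d′) λ ()
        from-degree (two d′ _)     = contradiction (degree-unique degree d′) λ ()

      orders-equal : a ≡ b × b ≡ d
      orders-equal = from-cycle cycle-or-inverse
        where
        from-cycle : FrobeniusCycle → a ≡ b × b ≡ d
        from-cycle (inj₁ (x , y , z)) =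
          ℕ∣.∣-antisym (ℕ∣.∣-trans (frobenius-order-divides z d-order a-order) d∣b) b∣a ,
          ℕ∣.∣-antisym (ℕ∣.∣-trans b∣a (frobenius-order-divides z d-order a-order)) d∣b
          where
          b∣a = frobenius-order-divides x a-order b-order
          d∣b = frobenius-order-divides y b-order d-order
        from-cycle (inj₂ (x , y , z)) =
          ℕ∣.∣-antisym a∣b′ (ℕ∣.∣-trans (frobenius-order-divides z d-order b-order) d∣a) ,
          ℕ∣.∣-antisym (frobenius-order-divides z d-order b-order) (ℕ∣.∣-trans d∣a a∣b′)
          where
          d∣a = frobenius-order-divides x a-order d-order
          a∣b′ = frobenius-order-divides y b-order a-order

      t≡a : t ≡ a
      t≡a = ≡.trans (period≡lcm a-order b-order d-order p≢23 least-period) (ℕ∣.∣-antisym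
        (lcm-least ℕ∣.∣-refl (lcm-least (ℕ∣.∣-reflexive (≡.sym (proj₁ orders-equal)))
          (ℕ∣.∣-reflexive (≡.sym (≡.trans (proj₁ orders-equal) (proj₂ orders-equal))))))
        (m∣lcm[m,n] a (lcm b d)))

      t∣p²+p+1 : t ℕ∣.∣ p ℕ.^ 2 ℕ.+ p ℕ.+ 1
      t∣p²+p+1 = ≡.subst (ℕ∣._∣ p ℕ.^ 2 ℕ.+ p ℕ.+ 1) (≡.sym t≡a) (order-divides a-order (from-cycle cycle-or-inverse))
        where
        norm : ∀ {y z} → α ^ p ≈ y → y ^ p ≈ z → z * y * α ≈ 1# → α ^ (p ℕ.^ 2 ℕ.+ p ℕ.+ 1) ≈ 1#
        norm {y} {z} α^p y^p zyα = begin
          α ^ (p ℕ.^ 2 ℕ.+ p ℕ.+ 1)            ≈⟨ ^-homo-* α (p ℕ.^ 2 ℕ.+ p) 1 ⟩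
          α ^ (p ℕ.^ 2 ℕ.+ p) * α ^ 1          ≈⟨ *-cong (^-homo-* α (p ℕ.^ 2) p) (*-identityʳ α) ⟩
          α ^ (p ℕ.^ 2) * α ^ p * α
            ≈⟨ *-congʳ (*-cong (frobenius-power α^p 1 (frobenius-power y^p 0 (*-identityʳ z))) α^p) ⟩
          z * y * α                            ≈⟨ zyα ⟩
          1#                                   ∎
        from-cycle : FrobeniusCycle → α ^ (p ℕ.^ 2 ℕ.+ p ℕ.+ 1) ≈ 1#
        from-cycle (inj₁ (x , y , z)) = norm x y (trans (solve 3 (λ a b c → c :* b :* a := a :* b :* c) refl α β γ) e₃)
        from-cycle (inj₂ (x , y , z)) = norm x z (trans (solve 3 (λ a b c → b :* c :* a := a :* b :* c) refl α β γ) e₃)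

p³-1≡ : ∀ p → 1 ℕ.≤ p → p ℕ.^ 3 ℕ.∸ 1 ≡ (p ℕ.^ 2 ℕ.+ p ℕ.+ 1) ℕ.* (p ℕ.∸ 1)
p³-1≡ (suc q) _ = ≡.cong (ℕ._∸ 1) (lemma q)
  where
  lemma : ∀ q → (suc q) ℕ.* ((suc q) ℕ.* ((suc q) ℕ.* 1)) ≡ suc (((suc q) ℕ.* ((suc q) ℕ.* 1) ℕ.+ suc q ℕ.+ 1) ℕ.* q)
  lemma = ℕ-Solver.solve-∀

open import Data.Nat.Base using (_+_; _*_; _^_; _∸_; _≤_)
open import Data.Nat.Divisibility using (_∣_)
open import Relation.Unary using (_∈_; _≐_)

theorem5p1 :
  ∀ {ℓ ℓ₁ ℓ₂} (p : ℕ) → Prime p →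
  ∀ (t ω : ℕ) → IsLeast (Period p) t → IsLeast (Ω p) ω →
    (t ∸ 3 ∈ A p t × t ∸ 2 ∈ A p t × t ∈ A p t × ω ≤ t ∸ 3)
  × (Ω p ≐ A p t +ℕ· t)
  × (∀ (R : SplittingField p ℓ ℓ₁ ℓ₂) →
     let module R = SplittingField R
         module 𝔽ₚ = CommutativeRing (ℤ/ p)
         module 𝔽ₚ[X] = Polynomial (ℤ/ p)
     in
     ∀ (r a b c : ℕ) →
     R.HasDegree r → R.HasOrder R.α a → R.HasOrder R.β b → R.HasOrder R.γ c →
       (r ≡ 1 ⊎ r ≡ 2 ⊎ r ≡ 3)
     × (p ≢ 23 → t ≡ lcm a (lcm b c) × t ∣ p ^ r ∸ 1)
     × (p ≡ 23 → t ≡ 506 × 506 ≡ p * (p ∸ 1) × r ≡ 1)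
     × (r ≡ 1 ⇔ (∃[ x ] ∃[ y ] + p ≡ x ℤ.* x ℤ.+ + 23 ℤ.* (y ℤ.* y)))
     × (r ≡ 2 →
          (∃[ x ] 𝔽ₚ[X].eval 𝔽ₚ[X].X³-X-1 x 𝔽ₚ.≈ 𝔽ₚ.0#)
        × (R.In𝔽ₚ R.α →
             (t ≡ b × b ≡ c)
           × b ∣ (p + 1) * a
           × (∀ o → R.HasOrder (R.α R.^ 3) o → ω ≤ (p + 1) * o ∸ 3)))
     × (r ≡ 3 →
          (t ≡ a × a ≡ b × b ≡ c)
        × t ∣ p ^ 2 + p + 1
        × p ^ 3 ∸ 1 ≡ (p ^ 2 + p + 1) * (p ∸ 1)))
theorem5p1 p p-prime t ω least-period least-ω = part-1 , (Ω⊆ , ⊆Ω) , parts-3-5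
  where
  period = proj₁ least-period
  part-1 : t ∸ 3 ∈ A p t × t ∸ 2 ∈ A p t × t ∈ A p t × ω ≤ t ∸ 3
  part-1 = from-size (period≥4 period p-prime)
    where
    from-size : ∃[ n ] t ≡ suc (suc (suc (suc n))) → t ∸ 3 ∈ A p t × t ∸ 2 ∈ A p t × t ∈ A p t × ω ≤ t ∸ 3
    from-size (n , ≡.refl) =
      (t-3∈Ω , ℕ.m∸n≤m t 3) ,
      ((ℕ.s≤s ℕ.z≤n , ≋0⇒∣ (proj₂ (early-zeros period (suc n) ≡.refl))) , ℕ.m∸n≤m t 2) ,
      ((ℕ.s≤s ℕ.z≤n , ≋0⇒∣ (proj₁ (proj₂ period))) , ℕ.≤-refl) ,
      proj₂ least-ω (suc n) t-3∈Ω
      where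
      t-3∈Ω : suc n ∈ Ω p
      t-3∈Ω = ℕ.s≤s ℕ.z≤n , ≋0⇒∣ (proj₁ (early-zeros period (suc n) ≡.refl))
  Ω⊆ : ∀ {n} → n ∈ Ω p → n ∈ A p t +ℕ· t
  Ω⊆ {n} = Ω⊆A+ℕt period n
  ⊆Ω : ∀ {n} → n ∈ A p t +ℕ· t → n ∈ Ω p
  ⊆Ω {n} = A+ℕt⊆Ω period n
  ramified : p ≡ 23 → t ≡ 506 × 506 ≡ p * (p ∸ 1)
  ramified ≡.refl = ℕ.≤-antisym (proj₂ least-period 506 Ramified.period-506) (Ramified.period≥506 t period) , ≡.refl
  parts-3-5 : _
  parts-3-5 R r a b c degree a-order b-order c-order =
    degree-cases degree ,
    (λ p≢23 → period≡lcm a-order b-order c-order p≢23 least-period ,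
              period-divides-p^r-1 least-period least-ω a-order b-order c-order p≢23 degree) ,
    (λ p≡23 → proj₁ (ramified p≡23) , proj₂ (ramified p≡23) , degree-unique degree (ramified-degree p≡23)) ,
    mk⇔ (λ r≡1 → Equivalence.to degree-1⇔represented (≡.subst HasDegree r≡1 degree))
        (λ represented → degree-unique degree (Equivalence.from degree-1⇔represented represented)) ,
    (λ r≡2 → let degree₂ = ≡.subst HasDegree r≡2 degree in
      degree-2⇒root-mod-p degree₂ ,
      λ α∈𝔽ₚ → let α-fixed = ι⇒Fixed α∈𝔽ₚ in
        (t≡b least-period least-ω a-order b-order c-order degree₂ α-fixed ,
         b≡d least-period least-ω a-order b-order c-order degree₂ α-fixed) ,
        b∣[p+1]a least-period least-ω a-order b-order c-order degree₂ α-fixed ,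
        ω≤ least-period least-ω a-order b-order c-order degree₂ α-fixed) ,
    (λ r≡3 → let degree₃ = ≡.subst HasDegree r≡3 degree in
      (t≡a least-period least-ω a-order b-order c-order degree₃ ,
       orders-equal least-period least-ω a-order b-order c-order degree₃) ,
      t∣p²+p+1 least-period least-ω a-order b-order c-order degree₃ ,
      p³-1≡ p (ℕ.≤-trans (ℕ.s≤s ℕ.z≤n) (ℕ.nonTrivial⇒n>1 p {{prime⇒nonTrivial p-prime}})))
    where
    open SplittingField R using (HasDegree; extension)
    open ExtensionField p-prime extension using (degree-unique)
    open Degrees p-prime extension using (ι⇒Fixed)
    open Splitting p-prime R using (ramified-degree)
    open SplittingPeriod p-prime R using (period≡lcm)
    open Conclusions p-prime R
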